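{- For each of the following four choices of coefficients $(a,b)$: (1) Pascal: $a(n,k)=1$, $b(n,k)=1$; (2) Stirling numbers of the second kind: $a(n,k)=1$, $b(n,k)=k$; (3) (unsigned) Stirling numbers of the first kind: $a(n,k)=1$, $b(n,k)=n-1$; (4) Euler: $a(n,k)=n-k$, $b(n,k)=k+1$; let $(T(n,k))_{0\le k\le n}$ be the corresponding combinatorial triangle and let $p_1(n,k)=\dfrac{a(n,k)\,T(n-1,k-1)}{T(n,k)}$. Then, in each of the four cases, there exists a function $\varphi:(0,+\infty)\to[0,1]$ such that, for any real number $\lambda_\infty>0$, when $m$ and $\ell$ tend to $+\infty$ with $\lim m/\ell=1+\lambda_\infty$, $$\lim p_1(m,\ell)=\varphi(\lambda_\infty).$$
   Context: The triangle $(T(n,k))_{0\le k\le n}$ of nonnegative integers associated with $(a,b)$ is determined by $T(0,0)=1$, the convention $T(n,k)=0$ unless $0\le k\le n$, and the recursion $$T(n,k)=a(n,k)T(n-1,k-1)+b(n,k)T(n-1,k),\qquad 0\le k\le n,\ (n,k)\neq(0,0).$$ In the four cases $T(n,k)$ is, respectively, the binomial coefficient $\binom nk$, the number of partitions of an $n$-set into $k$ nonempty blocks, the number of permutations of $n$ elements with $k$ cycles, and the Eulerian number counting permutations of $n$ elements with $k$ descents. The ratio $p_1(n,k)$ is considered where $T(n,k)\neq 0$; in particular it is defined whenever $0<k<n$. The limit is taken along pairs of integers $(m,\ell)$ with both $m\to+\infty$ and $\ell\to+\infty$ (so that, eventually, $0<\ell<m$). -}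

module Defs where

open import Data.Nat.Base as ℕ using (ℕ; zero; suc; NonZero; z≤n; s≤s)
import Data.Nat.Properties as ℕ
open import Data.Integer.Base as ℤ using (+_)
open import Data.Rational.Base as ℚ using (ℚ; 0ℚ; 1ℚ; ½)
import Data.Rational.Properties as ℚ
open import Data.Rational.Solver using (module +-*-Solver)
open import Data.Product using (Σ-syntax; ∃-syntax; _×_; _,_; proj₁)
open import Data.Sum using (inj₁; inj₂)
open import Level using (0ℓ)
open import Relation.Binary.Bundles using (Setoid)
import Relation.Binary.Construct.On as On
open import Relation.Binary.PropositionalEquality
  using (_≡_; refl; sym; trans; cong; cong₂; subst; subst₂)

data Triangle : Set where
  pascal stirling₂ stirling₁ euler : Triangle

-- Outside 0 ≤ k ≤ n, (n , k) ≢ (0 , 0) these values never contribute to T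
-- (see T-outside); inside, the truncated subtractions are exact.

a b : Triangle → ℕ → ℕ → ℕ

a pascal    n k = 1
a stirling₂ n k = 1
a stirling₁ n k = 1
a euler     n k = n ℕ.∸ k

b pascal    n k = 1
b stirling₂ n k = k
b stirling₁ n k = n ℕ.∸ 1
b euler     n k = k ℕ.+ 1

-- The terms T (n - 1 , -1) of the recursion vanish; the vanishing of
-- T (n , k) for k > n need not be imposed, see T-outside.

T : Triangle → ℕ → ℕ → ℕ
T t zero    zero    = 1
T t zero    (suc k) = 0
T t (suc n) zero    = b t (suc n) zero ℕ.* T t n zero
T t (suc n) (suc k) =
  a t (suc n) (suc k) ℕ.* T t n k ℕ.+ b t (suc n) (suc k) ℕ.* T t n (suc k)

-- T (n - 1 , k - 1), which is 0 when n = 0 or k = 0.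

T↖ : Triangle → ℕ → ℕ → ℕ
T↖ t (suc n) (suc k) = T t n k
T↖ t zero    _       = 0
T↖ t (suc n) zero    = 0

p₁ : ∀ t n k .{{_ : NonZero (T t n k)}} → ℚ
p₁ t n k = + (a t n k ℕ.* T↖ t n k) ℚ./ T t n k

T-outside : ∀ t {n k} → n ℕ.< k → T t n k ≡ 0
T-outside t {zero}  {suc k} _         = refl
T-outside t {suc n} {suc k} (s≤s n<k)
  rewrite T-outside t n<k
        | T-outside t (ℕ.m<n⇒m<1+n n<k)
        | ℕ.*-zeroʳ (a t (suc n) (suc k)) = ℕ.*-zeroʳ (b t (suc n) (suc k))

private
  *-pos : ∀ {m n} → 0 ℕ.< m → 0 ℕ.< n → 0 ℕ.< m ℕ.* n
  *-pos = ℕ.*-mono-<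

  +-posˡ : ∀ {m} n → 0 ℕ.< m → 0 ℕ.< m ℕ.+ n
  +-posˡ {m} n 0<m = ℕ.<-≤-trans 0<m (ℕ.m≤m+n m n)

  +-posʳ : ∀ m {n} → 0 ℕ.< n → 0 ℕ.< m ℕ.+ n
  +-posʳ m {n} 0<n = ℕ.<-≤-trans 0<n (ℕ.m≤n+m n m)

  a≡1⇒T-pos : ∀ t → (∀ n k → a t n k ≡ 1) →
              (∀ n → 0 ℕ.< b t (suc (suc n)) 1) →
              ∀ {n k} → k ℕ.< n → 0 ℕ.< T t n (suc k)
  a≡1⇒T-pos t a≡1 0<b {suc zero} {zero} _
    rewrite a≡1 1 1 = s≤s z≤n
  a≡1⇒T-pos t a≡1 0<b {suc (suc n)} {zero} _ =
    +-posʳ (a t (suc (suc n)) 1 ℕ.* T t (suc n) zero)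
           (*-pos (0<b n) (a≡1⇒T-pos t a≡1 0<b {suc n} (s≤s z≤n)))
  a≡1⇒T-pos t a≡1 0<b {suc n} {suc k} (s≤s k<n)
    rewrite a≡1 (suc n) (suc (suc k)) =
    +-posˡ _ (+-posˡ 0 (a≡1⇒T-pos t a≡1 0<b k<n))

  euler-pos : ∀ {n k} → k ℕ.≤ n → 0 ℕ.< T euler (suc n) k
  euler-pos {zero}  {zero}  _ = s≤s z≤n
  euler-pos {suc n} {zero}  _ = +-posˡ 0 (euler-pos {n} z≤n)
  euler-pos {suc n} {suc k} (s≤s k≤n) =
    +-posˡ _ (*-pos (ℕ.m<n⇒0<n∸m (s≤s k≤n)) (euler-pos k≤n))

-- Thus p₁ t n k is defined whenever 0 < k < n.

T-positive : ∀ t {n k} → 0 ℕ.< k → k ℕ.< n → 0 ℕ.< T t n k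
T-positive pascal    {k = suc k} _ k<n =
  a≡1⇒T-pos pascal (λ _ _ → refl) (λ _ → s≤s z≤n) (ℕ.<-trans (ℕ.n<1+n k) k<n)
T-positive stirling₂ {k = suc k} _ k<n =
  a≡1⇒T-pos stirling₂ (λ _ _ → refl) (λ _ → s≤s z≤n) (ℕ.<-trans (ℕ.n<1+n k) k<n)
T-positive stirling₁ {k = suc k} _ k<n =
  a≡1⇒T-pos stirling₁ (λ _ _ → refl) (λ _ → s≤s z≤n) (ℕ.<-trans (ℕ.n<1+n k) k<n)
T-positive euler     {suc n} _ (s≤s k≤n) = euler-pos k≤n

-- Constructive Cauchy reals: the sequences carry a modulus of convergence,
-- and equality of reals is _≃_.

record ℝ : Set where
  field
    seq    : ℕ → ℚ
    cauchy : ∀ ε → 0ℚ ℚ.< ε →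
             ∃[ N ] ∀ m n → N ℕ.≤ m → N ℕ.≤ n → ℚ.∣ seq m ℚ.- seq n ∣ ℚ.< ε

open ℝ public

infix  4 _≃_ _<_ _≤_
infixl 6 _+_ _-_
infix  8 -_

_≃_ _<_ _≤_ : ℝ → ℝ → Set

x ≃ y = ∀ ε → 0ℚ ℚ.< ε →
        ∃[ N ] ∀ n → N ℕ.≤ n → ℚ.∣ seq x n ℚ.- seq y n ∣ ℚ.< ε

x < y = Σ[ ε ∈ ℚ ] 0ℚ ℚ.< ε ×
        ∃[ N ] ∀ n → N ℕ.≤ n → seq x n ℚ.+ ε ℚ.< seq y n

x ≤ y = ∀ ε → 0ℚ ℚ.< ε →
        ∃[ N ] ∀ n → N ℕ.≤ n → seq x n ℚ.< seq y n ℚ.+ ε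

private
  half-pos : ∀ {ε} → 0ℚ ℚ.< ε → 0ℚ ℚ.< ½ ℚ.* ε
  half-pos 0<ε = ℚ.*-monoʳ-<-pos ½ 0<ε

  half+half : ∀ ε → ½ ℚ.* ε ℚ.+ ½ ℚ.* ε ≡ ε
  half+half ε = trans (sym (ℚ.*-distribʳ-+ ε ½ ½)) (ℚ.*-identityˡ ε)

  ∣p-p∣≡0 : ∀ p → ℚ.∣ p ℚ.- p ∣ ≡ 0ℚ
  ∣p-p∣≡0 p = cong ℚ.∣_∣ (ℚ.+-inverseʳ p)

  -‿swap : ∀ p q → ℚ.- (p ℚ.- q) ≡ q ℚ.- p
  -‿swap = solve 2 (λ p q → :- (p :- q) := q :- p) refl
    where open +-*-Solver

  ∣-∣-swap : ∀ p q → ℚ.∣ p ℚ.- q ∣ ≡ ℚ.∣ q ℚ.- p ∣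
  ∣-∣-swap p q = trans (sym (ℚ.∣-p∣≡∣p∣ (p ℚ.- q))) (cong ℚ.∣_∣ (-‿swap p q))

  sum-< : ∀ {ε p q r} → r ≡ p ℚ.+ q →
          ℚ.∣ p ∣ ℚ.< ½ ℚ.* ε → ℚ.∣ q ∣ ℚ.< ½ ℚ.* ε → ℚ.∣ r ∣ ℚ.< ε
  sum-< {ε} {p} {q} refl p< q< =
    ℚ.≤-<-trans (ℚ.∣p+q∣≤∣p∣+∣q∣ p q)
      (subst (ℚ.∣ p ∣ ℚ.+ ℚ.∣ q ∣ ℚ.<_) (half+half ε) (ℚ.+-mono-< p< q<))

  ∣p∣-∣q∣≤∣p-q∣ : ∀ p q → ℚ.∣ p ∣ ℚ.- ℚ.∣ q ∣ ℚ.≤ ℚ.∣ p ℚ.- q ∣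
  ∣p∣-∣q∣≤∣p-q∣ p q =
    subst (ℚ.∣ p ∣ ℚ.- ℚ.∣ q ∣ ℚ.≤_) (+-cancel ℚ.∣ p ℚ.- q ∣ ℚ.∣ q ∣)
      (ℚ.+-monoˡ-≤ (ℚ.- ℚ.∣ q ∣)
        (subst (λ r → ℚ.∣ r ∣ ℚ.≤ ℚ.∣ p ℚ.- q ∣ ℚ.+ ℚ.∣ q ∣) (cancel p q)
          (ℚ.∣p+q∣≤∣p∣+∣q∣ (p ℚ.- q) q)))
    where
    open +-*-Solver
    cancel : ∀ p q → p ℚ.- q ℚ.+ q ≡ p
    cancel = solve 2 (λ p q → p :- q :+ q := p) refl
    +-cancel : ∀ p q → p ℚ.+ q ℚ.- q ≡ p
    +-cancel = solve 2 (λ p q → p :+ q :- q := p) refl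

  ∣∣-contraction : ∀ p q → ℚ.∣ ℚ.∣ p ∣ ℚ.- ℚ.∣ q ∣ ∣ ℚ.≤ ℚ.∣ p ℚ.- q ∣
  ∣∣-contraction p q with ℚ.∣p∣≡p∨∣p∣≡-p (ℚ.∣ p ∣ ℚ.- ℚ.∣ q ∣)
  ... | inj₁ eq = subst (ℚ._≤ ℚ.∣ p ℚ.- q ∣) (sym eq) (∣p∣-∣q∣≤∣p-q∣ p q)
  ... | inj₂ eq = subst₂ ℚ._≤_
    (sym (trans eq (-‿swap ℚ.∣ p ∣ ℚ.∣ q ∣))) (∣-∣-swap q p) (∣p∣-∣q∣≤∣p-q∣ q p)

fromℚ : ℚ → ℝ
fromℚ q .seq _        = q
fromℚ q .cauchy ε 0<ε = 0 , λ _ _ _ _ → subst (ℚ._< ε) (sym (∣p-p∣≡0 q)) 0<ε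

0ℝ 1ℝ : ℝ
0ℝ = fromℚ 0ℚ
1ℝ = fromℚ 1ℚ

_+_ : ℝ → ℝ → ℝ
(x + y) .seq n = seq x n ℚ.+ seq y n
(x + y) .cauchy ε 0<ε with cauchy x (½ ℚ.* ε) (half-pos 0<ε) | cauchy y (½ ℚ.* ε) (half-pos 0<ε)
... | M , x-close | N , y-close = M ℕ.⊔ N , λ m n m≥ n≥ →
  sum-< {ε} (interchange (seq x m) (seq y m) (seq x n) (seq y n))
    (x-close m n (ℕ.m⊔n≤o⇒m≤o M N m≥) (ℕ.m⊔n≤o⇒m≤o M N n≥))
    (y-close m n (ℕ.m⊔n≤o⇒n≤o M N m≥) (ℕ.m⊔n≤o⇒n≤o M N n≥))
  where
  open +-*-Solver
  interchange : ∀ p q r s → p ℚ.+ q ℚ.- (r ℚ.+ s) ≡ (p ℚ.- r) ℚ.+ (q ℚ.- s)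
  interchange = solve 4 (λ p q r s → p :+ q :- (r :+ s) := (p :- r) :+ (q :- s)) refl

-_ : ℝ → ℝ
(- x) .seq n = ℚ.- seq x n
(- x) .cauchy ε 0<ε with cauchy x ε 0<ε
... | N , close = N , λ m n m≥ n≥ →
  subst (ℚ._< ε) (trans (∣-∣-swap (seq x m) (seq x n)) (cong ℚ.∣_∣ (neg (seq x m) (seq x n))))
    (close m n m≥ n≥)
  where
  open +-*-Solver
  neg : ∀ p q → q ℚ.- p ≡ ℚ.- p ℚ.- ℚ.- q
  neg = solve 2 (λ p q → q :- p := :- p :- :- q) refl

_-_ : ℝ → ℝ → ℝ
x - y = x + (- y)

∣_∣ : ℝ → ℝ
∣ x ∣ .seq n = ℚ.∣ seq x n ∣
∣ x ∣ .cauchy ε 0<ε with cauchy x ε 0<ε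
... | N , close = N , λ m n m≥ n≥ →
  ℚ.≤-<-trans (∣∣-contraction (seq x m) (seq x n)) (close m n m≥ n≥)

ℝ-setoid : Setoid 0ℓ 0ℓ
ℝ-setoid = record
  { Carrier       = ℝ
  ; _≈_           = _≃_
  ; isEquivalence = record
    { refl  = λ {x} ε 0<ε → 0 , λ n _ → subst (ℚ._< ε) (sym (∣p-p∣≡0 (seq x n))) 0<ε
    ; sym   = λ {x} {y} → ≃-sym {x} {y}
    ; trans = λ {x} {y} {z} → ≃-trans {x} {y} {z}
    }
  }
  where
  ≃-sym : ∀ {x y} → x ≃ y → y ≃ x
  ≃-sym {x} {y} x≃y ε 0<ε with x≃y ε 0<ε
  ... | N , close = N , λ n n≥ →
    subst (ℚ._< ε) (∣-∣-swap (seq x n) (seq y n)) (close n n≥)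

  ≃-trans : ∀ {x y z} → x ≃ y → y ≃ z → x ≃ z
  ≃-trans {x} {y} {z} x≃y y≃z ε 0<ε
    with x≃y (½ ℚ.* ε) (half-pos 0<ε) | y≃z (½ ℚ.* ε) (half-pos 0<ε)
  ... | M , xy | N , yz = M ℕ.⊔ N , λ n n≥ →
    sum-< {ε} (insert (seq x n) (seq y n) (seq z n))
      (xy n (ℕ.m⊔n≤o⇒m≤o M N n≥)) (yz n (ℕ.m⊔n≤o⇒n≤o M N n≥))
    where
    open +-*-Solver
    insert : ∀ p q r → p ℚ.- r ≡ (p ℚ.- q) ℚ.+ (q ℚ.- r)
    insert = solve 3 (λ p q r → p :- r := (p :- q) :+ (q :- r)) refl

]0,+∞[ : Setoid 0ℓ 0ℓ
]0,+∞[ = On.setoid {B = Σ[ x ∈ ℝ ] 0ℝ < x} ℝ-setoid proj₁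

[0,1] : Setoid 0ℓ 0ℓ
[0,1] = On.setoid {B = Σ[ x ∈ ℝ ] 0ℝ ≤ x × x ≤ 1ℝ} ℝ-setoid proj₁

-- Multiply row n of T by weights with closed-form total: M(M-1)⋯(M-k+1) for Stirling₂ (total M^n), X^k
-- for Stirling₁ (total X(X+1)⋯(X+n-1)), C(M+k , n) for Euler (Worpitzky, total M^n). Comparing the totals
-- at M and M - 1 gives the exact mean of an explicit monotone function of k, for Stirling₂ the mean
-- (1 - 1/M)^n of 1 - k/M. The weighted row is log-concave, hence concentrated at its mode, and choosing
-- M so that the mode is k yields (1 - 1/M)^n ≈ 1 - k/M, while the mode condition reads p₁ ≈ 1 - k/M.
-- With κ = k/n and θ = n/M this is e^{-θ} ≈ 1 - κθ, which determines θ from κ because (1 - e^{-θ})/θ is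
-- strictly monotone; quantitatively, pairs (n , k) and (n′ , k′) with close κ have close θ, hence close
-- p₁. Of the exponential only the tangent inequality e^{-t} ≥ e^{-θ} (1 + θ - t) for the powers
-- (1 - 1/M)^n is used. Stirling₁ and Euler lead to e^{-θ} = 1/(1 + θ/κ) with θ = k/X and to
-- 1 - e^{-θ} = θ/(1 + κθ) with θ = n/M in the same way; for Pascal, p₁ is simply k/n.
-- Thus p₁ satisfies a Cauchy criterion in k/n, and φ(λ) is its limit along pairs with m/ℓ → 1 + λ.

module Submission where

import Defs
open import Algebra.Bundles using (CommutativeRing)
open import Data.Empty using (⊥; ⊥-elim)
import Data.Integer.Base as ℤ
import Data.Integer.Properties as ℤ
open import Data.Nat.Base as ℕ using (ℕ; zero; suc; z≤n; s≤s; NonZero; _!)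
import Data.Nat.DivMod as ℕ
import Data.Nat.Properties as ℕ
open import Data.Product using (Σ-syntax; ∃-syntax; _×_; _,_; proj₁; proj₂)
open import Data.Rational.Base as ℚ using (ℚ; 0ℚ; 1ℚ; ½)
import Data.Rational.Properties as ℚ
open import Data.Rational.Solver using (module +-*-Solver)
import Data.Rational.Unnormalised.Base as ℚᵘ
import Data.Rational.Unnormalised.Properties as ℚᵘ
open import Data.Sum using (_⊎_; inj₁; inj₂)
open import Function.Bundles using (Func; _⟨$⟩_)
open import Relation.Binary.PropositionalEquality
  using (_≡_; refl; sym; trans; cong; cong₂; subst; subst₂; module ≡-Reasoning)
open import Relation.Nullary using (Dec; yes; no)

module Prelude where

  open import Algebra.Properties.CommutativeSemiring.Exp
    (CommutativeRing.commutativeSemiring ℚ.+-*-commutativeRing) public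
    using (_^_; ^-homo-*; ^-assocʳ; ^-distrib-*)
  open import Data.Rational.Base public using (_+_; _*_; _-_; _≤_; _<_; _/_; nonNegative; positive)
  open import Data.Integer.Base using (+_)
  open +-*-Solver using (Polynomial; con)
  open +-*-Solver public using (solve; _:+_; _:*_; _:-_; _:=_)

  infix 8 #_
  infix 9 :#_

  #_ : ℕ → ℚ
  # n = + n / 1

  :#_ : ∀ {k} → ℕ → Polynomial k
  :# n = con (# n)

  :0 :1 :½ : ∀ {k} → Polynomial k
  :0 = con 0ℚ
  :1 = con 1ℚ
  :½ = con ½

module OrderedField where

  open Prelude
  open import Data.Integer.Base using (+_; +≤+; +<+)

  infixl 6 _⊕_
  infixl 7 _⊗_
  infix  8 ‖_

  -- Inequalities are proved by certificates: q - p is written as a polynomial with nonnegative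
  -- coefficients in quantities known to be nonnegative, and the identity is left to the ring solver.
  _⊕_ : ∀ {p q} → 0ℚ ≤ p → 0ℚ ≤ q → 0ℚ ≤ p + q
  _⊕_ = ℚ.+-mono-≤

  _⊗_ : ∀ {p q} → 0ℚ ≤ p → 0ℚ ≤ q → 0ℚ ≤ p * q
  _⊗_ {p} {q} 0≤p 0≤q = subst (_≤ p * q) (ℚ.*-zeroʳ p)
    (ℚ.*-monoˡ-≤-nonNeg p {{nonNegative 0≤p}} 0≤q)

  ‖_ : ∀ {p q} → p ≤ q → 0ℚ ≤ q - p
  ‖_ {p} {q} p≤q = subst (_≤ q - p) (ℚ.+-inverseʳ p) (ℚ.+-monoˡ-≤ (ℚ.- p) p≤q)

  by : ∀ {p q s} → 0ℚ ≤ s → q - p ≡ s → p ≤ q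
  by {p} {q} 0≤s refl = subst₂ _≤_ (solve 1 (λ p → :0 :+ p := p) refl p) (solve 2 (λ p q → q :- p :+ p := q) refl p q)
    (ℚ.+-monoˡ-≤ p 0≤s)

  by· : ∀ {p q s c} → 0ℚ < c → 0ℚ ≤ s → c * (q - p) ≡ s → p ≤ q
  by· {p} {q} {c = c} 0<c 0≤s refl = by
    (ℚ.*-cancelˡ-≤-pos c {{positive 0<c}} (subst (_≤ c * (q - p)) (sym (ℚ.*-zeroʳ c)) 0≤s)) refl

  by< : ∀ {p q s} → 0ℚ < s → q - p ≡ s → p < q
  by< {p} {q} 0<s refl = subst₂ _<_ (solve 1 (λ p → :0 :+ p := p) refl p) (solve 2 (λ p q → q :- p :+ p := q) refl p q)
    (ℚ.+-monoˡ-< p 0<s)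

  sq : ∀ p → 0ℚ ≤ p * p
  sq p with ℚ.≤-total 0ℚ p
  ... | inj₁ 0≤p = 0≤p ⊗ 0≤p
  ... | inj₂ p≤0 = subst (0ℚ ≤_) (solve 1 (λ p → (:0 :- p) :* (:0 :- p) := p :* p) refl p) (‖ p≤0 ⊗ ‖ p≤0)

  0<* : ∀ {p q} → 0ℚ < p → 0ℚ < q → 0ℚ < p * q
  0<* {p} {q} 0<p 0<q = subst (_< p * q) (ℚ.*-zeroʳ p) (ℚ.*-monoʳ-<-pos p {{positive 0<p}} 0<q)

  0<+ : ∀ {p q} → 0ℚ < p → 0ℚ ≤ q → 0ℚ < p + q
  0<+ = ℚ.+-mono-<-≤

  -- The embedding of ℕ is opaque: otherwise rational operations on ι n unfold.
  opaque
    ι : ℕ → ℚ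
    ι n = + n / 1

    ι-# : ∀ n → ι n ≡ # n
    ι-# n = refl

    private
      toℚᵘ-ι : ∀ n → ℚ.toℚᵘ (ι n) ℚᵘ.≃ ℚᵘ.mkℚᵘ (+ n) 0
      toℚᵘ-ι n = ℚ.toℚᵘ-fromℚᵘ (ℚᵘ.mkℚᵘ (+ n) 0)

    ι-+ : ∀ m n → ι (m ℕ.+ n) ≡ ι m + ι n
    ι-+ m n = ℚ.toℚᵘ-injective (ℚᵘ.≃-trans (toℚᵘ-ι (m ℕ.+ n)) (ℚᵘ.≃-trans
      (ℚᵘ.*≡* (cong (ℤ._* + 1) (sym (cong₂ ℤ._+_ (ℤ.*-identityʳ (+ m)) (ℤ.*-identityʳ (+ n))))))
      (ℚᵘ.≃-trans (ℚᵘ.+-cong (ℚᵘ.≃-sym (toℚᵘ-ι m)) (ℚᵘ.≃-sym (toℚᵘ-ι n)))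
        (ℚᵘ.≃-sym (ℚ.toℚᵘ-homo-+ (ι m) (ι n))))))

    ι-* : ∀ m n → ι (m ℕ.* n) ≡ ι m * ι n
    ι-* m n = ℚ.toℚᵘ-injective (ℚᵘ.≃-trans (toℚᵘ-ι (m ℕ.* n)) (ℚᵘ.≃-trans
      (ℚᵘ.*≡* (cong (ℤ._* + 1) (ℤ.pos-* m n)))
      (ℚᵘ.≃-trans (ℚᵘ.*-cong (ℚᵘ.≃-sym (toℚᵘ-ι m)) (ℚᵘ.≃-sym (toℚᵘ-ι n)))
        (ℚᵘ.≃-sym (ℚ.toℚᵘ-homo-* (ι m) (ι n))))))

    ι-mono : ∀ {m n} → m ℕ.≤ n → ι m ≤ ι n
    ι-mono {m} {n} m≤n = ℚ.toℚᵘ-cancel-≤ (ℚᵘ.≤-respˡ-≃ (ℚᵘ.≃-sym (toℚᵘ-ι m))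
      (ℚᵘ.≤-respʳ-≃ (ℚᵘ.≃-sym (toℚᵘ-ι n))
        (ℚᵘ.*≤* (ℤ.*-monoʳ-≤-nonNeg (+ 1) (+≤+ m≤n)))))

    ι-cancel : ∀ {m n} → ι m ≤ ι n → m ℕ.≤ n
    ι-cancel {m} {n} le with ℚᵘ.≤-respˡ-≃ (toℚᵘ-ι m) (ℚᵘ.≤-respʳ-≃ (toℚᵘ-ι n) (ℚ.toℚᵘ-mono-≤ le))
    ... | ℚᵘ.*≤* le′ = ℤ.drop‿+≤+ (ℤ.*-cancelʳ-≤-pos (+ m) (+ n) (+ 1) le′)

  ι0 : ι 0 ≡ 0ℚ
  ι0 = ι-# 0

  ι1 : ι 1 ≡ 1ℚ
  ι1 = ι-# 1

  ι-suc : ∀ n → ι (suc n) ≡ 1ℚ + ι n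
  ι-suc n = trans (ι-+ 1 n) (cong (_+ ι n) ι1)

  0≤ι : ∀ n → 0ℚ ≤ ι n
  0≤ι n = subst (_≤ ι n) ι0 (ι-mono {0} z≤n)

  0≤# : ∀ n → 0ℚ ≤ # n
  0≤# n = subst (0ℚ ≤_) (ι-# n) (0≤ι n)

  ι-mono-< : ∀ {m n} → m ℕ.< n → ι m < ι n
  ι-mono-< {m} {n} m<n = ℚ.≰⇒> λ n≤m → ℕ.<⇒≱ m<n (ι-cancel n≤m)

  0<ι : ∀ {n} → 0 ℕ.< n → 0ℚ < ι n
  0<ι {n} 0<n = subst (_< ι n) ι0 (ι-mono-< 0<n)

  0<# : ∀ n → 0ℚ < # (suc n)
  0<# n = subst (0ℚ <_) (ι-# (suc n)) (0<ι (s≤s z≤n))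

  ι-∸ : ∀ {m n} → m ℕ.≤ n → ι (n ℕ.∸ m) ≡ ι n - ι m
  ι-∸ {m} {n} m≤n = begin
    ι (n ℕ.∸ m)              ≡⟨ solve 2 (λ x y → x := x :+ y :- y) refl (ι(n ℕ.∸ m)) (ι m) ⟩
    ι (n ℕ.∸ m) + ι m - ι m  ≡⟨ cong (_- ι m) (sym (ι-+ (n ℕ.∸ m) m)) ⟩
    ι (n ℕ.∸ m ℕ.+ m) - ι m  ≡⟨ cong (λ k → ι k - ι m) (ℕ.m∸n+n≡m m≤n) ⟩
    ι n - ι m                ∎
    where open ≡-Reasoning

  *-cancelˡ : ∀ {c p q} → 0ℚ < c → c * p ≡ c * q → p ≡ q
  *-cancelˡ {c} 0<c eq = ℚ.≤-antisym
    (ℚ.*-cancelˡ-≤-pos c {{positive 0<c}} (ℚ.≤-reflexive eq))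
    (ℚ.*-cancelˡ-≤-pos c {{positive 0<c}} (ℚ.≤-reflexive (sym eq)))

  <⇒≱ : ∀ {p q} → p < q → q ≤ p → ⊥
  <⇒≱ p<q q≤p = ℚ.<-irrefl refl (ℚ.<-≤-trans p<q q≤p)

module Powers where

  open Prelude
  open OrderedField

  0≤^ : ∀ {p} n → 0ℚ ≤ p → 0ℚ ≤ p ^ n
  0≤^ zero    0≤p = 0≤# 1
  0≤^ (suc n) 0≤p = 0≤p ⊗ 0≤^ n 0≤p

  ^-mono : ∀ {p q} n → 0ℚ ≤ p → p ≤ q → p ^ n ≤ q ^ n
  ^-mono zero    0≤p p≤q = ℚ.≤-refl
  ^-mono {p} {q} (suc n) 0≤p p≤q = by (‖ p≤q ⊗ 0≤^ n 0≤p ⊕ ℚ.≤-trans 0≤p p≤q ⊗ ‖ ^-mono n 0≤p p≤q)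
    (solve 4 (λ p q P Q → q :* Q :- p :* P := (q :- p) :* P :+ q :* (Q :- P)) refl p q (p ^ n) (q ^ n))

  1^ : ∀ n → 1ℚ ^ n ≡ 1ℚ
  1^ zero    = refl
  1^ (suc n) = trans (ℚ.*-identityˡ (1ℚ ^ n)) (1^ n)

  ^≤1 : ∀ {p} n → 0ℚ ≤ p → p ≤ 1ℚ → p ^ n ≤ 1ℚ
  ^≤1 {p} n 0≤p p≤1 = subst (p ^ n ≤_) (1^ n) (^-mono n 0≤p p≤1)

  bernoulli⁺ : ∀ {y} n → 0ℚ ≤ y → 1ℚ + ι n * y ≤ (1ℚ + y) ^ n
  bernoulli⁺ {y} zero 0≤y rewrite ι0 = by (0≤# 0) (solve 1 (λ y → :1 :- (:1 :+ :0 :* y) := :# 0) refl y)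
  bernoulli⁺ {y} (suc n) 0≤y rewrite ι-suc n =
    (by ((0≤# 1 ⊕ 0≤y) ⊗ ‖ bernoulli⁺ n 0≤y ⊕ 0≤ι n ⊗ 0≤y ⊗ 0≤y)
      (solve 3 (λ n y P → (:1 :+ y) :* P :- (:1 :+ (:1 :+ n) :* y)
        := (:1 :+ y) :* (P :- (:1 :+ n :* y)) :+ n :* y :* y) refl (ι n) y ((1ℚ + y) ^ n)))

  bernoulli⁻ : ∀ {y} n → 0ℚ ≤ y → y ≤ 1ℚ → 1ℚ - ι n * y ≤ (1ℚ - y) ^ n
  bernoulli⁻ {y} zero 0≤y y≤1 rewrite ι0 = by (0≤# 0) (solve 1 (λ y → :1 :- (:1 :- :0 :* y) := :# 0) refl y)
  bernoulli⁻ {y} (suc n) 0≤y y≤1 rewrite ι-suc n =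
    (by (‖ y≤1 ⊗ ‖ bernoulli⁻ n 0≤y y≤1 ⊕ 0≤ι n ⊗ 0≤y ⊗ 0≤y)
      (solve 3 (λ n y P → (:1 :- y) :* P :- (:1 :- (:1 :+ n) :* y)
        := (:1 :- y) :* (P :- (:1 :- n :* y)) :+ n :* y :* y) refl (ι n) y ((1ℚ - y) ^ n)))

  ^-reciprocal : ∀ {y} n → 0ℚ ≤ y → y ≤ 1ℚ → (1ℚ - y) ^ n * (1ℚ + ι n * y) ≤ 1ℚ
  ^-reciprocal {y} n 0≤y y≤1 = ℚ.≤-trans
    (by (0≤^ n (‖ y≤1) ⊗ ‖ bernoulli⁺ n 0≤y)
      (solve 3 (λ P Q b → P :* Q :- P :* b
        := P :* (Q :- b)) refl ((1ℚ - y) ^ n) ((1ℚ + y) ^ n) (1ℚ + ι n * y)))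
    (subst (_≤ 1ℚ) (^-distrib-* (1ℚ - y) (1ℚ + y) n)
      (^≤1 n (‖ y≤1 ⊗ (0≤# 1 ⊕ 0≤y)) (by (sq y)
        (solve 1 (λ y → :1 :- (:1 :- y) :* (:1 :+ y) := y :* y) refl y))))

  -- e^s ≥ 1 + s in the form z^A ≥ z^B (1 + (B - A) y), for z = 1 - y and A on either side of B.
  tangent : ∀ {y} A B → 0ℚ ≤ y → y ≤ 1ℚ →
            (1ℚ - y) ^ B * (1ℚ + (ι B - ι A) * y) ≤ (1ℚ - y) ^ A
  tangent {y} A B 0≤y y≤1 with ℕ.≤-total A B
  ... | inj₁ A≤B = subst (λ C → (1ℚ - y) ^ C * (1ℚ + (ι B - ι A) * y) ≤ (1ℚ - y) ^ A)
    (ℕ.m+[n∸m]≡n A≤B)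
    (subst (λ P → P * (1ℚ + (ι B - ι A) * y) ≤ (1ℚ - y) ^ A) (sym (^-homo-* (1ℚ - y) A D))
      (subst (λ s → (1ℚ - y) ^ A * (1ℚ - y) ^ D * (1ℚ + s * y) ≤ (1ℚ - y) ^ A) (ι-∸ A≤B)
      (by (0≤^ A (‖ y≤1) ⊗ ‖ ^-reciprocal D 0≤y y≤1)
        (solve 3 (λ P Q s → P :- P :* Q :* (:1 :+ s)
          := P :* (:1 :- Q :* (:1 :+ s))) refl ((1ℚ - y) ^ A) ((1ℚ - y) ^ D) (ι D * y)))))
    where D = B ℕ.∸ A
  ... | inj₂ B≤A = subst (λ C → (1ℚ - y) ^ B * (1ℚ + (ι B - ι A) * y) ≤ (1ℚ - y) ^ C)
    (ℕ.m+[n∸m]≡n B≤A)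
    (subst ((1ℚ - y) ^ B * (1ℚ + (ι B - ι A) * y) ≤_) (sym (^-homo-* (1ℚ - y) B D))
      (subst (λ t → (1ℚ - y) ^ B * (1ℚ + t * y) ≤ (1ℚ - y) ^ B * (1ℚ - y) ^ D)
        (trans (cong (0ℚ -_) (ι-∸ B≤A)) (solve 2 (λ a b → :0 :- (a :- b) := b :- a) refl (ι A) (ι B)))
      (by (0≤^ B (‖ y≤1) ⊗ ‖ bernoulli⁻ D 0≤y y≤1)
        (solve 4 (λ P Q y d → P :* Q :- P :* (:1 :+ (:0 :- d) :* y)
          := P :* (Q :- (:1 :- d :* y))) refl ((1ℚ - y) ^ B) ((1ℚ - y) ^ D) y (ι D)))))
    where D = A ℕ.∸ B

  -- The tangent inequality e^{-θ′} ≥ e^{-θ} (1 + θ - θ′) for the approximations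
  -- (1 - 1/M)^n of e^{-n/M}; both powers are compared with powers of 1 - 1/(MM′).
  tangent-rescaled : ∀ n n′ {M M′ : ℕ} {x x′} → x * ι M ≡ 1ℚ → x′ * ι M′ ≡ 1ℚ →
    0ℚ ≤ x → x ≤ 1ℚ → 0ℚ ≤ x′ → x′ ≤ 1ℚ →
    (1ℚ - x) ^ n * (1ℚ + ι n * x - ι n′ * x′) ≤ (1ℚ - x′) ^ n′ + ι n′ * x′ * x′
  tangent-rescaled n n′ {M} {M′} {x} {x′} xM x′M′ 0≤x x≤1 0≤x′ x′≤1 = goal
    where
    y z e e′ δ : ℚ
    y  = x * x′
    z  = 1ℚ - y
    e  = (1ℚ - x) ^ n
    e′ = (1ℚ - x′) ^ n′
    δ  = 1ℚ + ι n * x - ι n′ * x′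
    0≤y : 0ℚ ≤ y
    0≤y = 0≤x ⊗ 0≤x′
    y≤1 : y ≤ 1ℚ
    y≤1 = by (0≤x ⊗ ‖ x′≤1 ⊕ ‖ x≤1)
      (solve 2 (λ x x′ → :1 :- x :* x′ := x :* (:1 :- x′) :+ (:1 :- x)) refl x x′)
    M′y : ι M′ * y ≡ x
    M′y = trans (solve 3 (λ x x′ m → m :* (x :* x′) := x :* (x′ :* m)) refl x x′ (ι M′)) (trans (cong (x *_) x′M′) (ℚ.*-identityʳ x))
    My : ι M * y ≡ x′
    My = trans (solve 3 (λ x x′ m → m :* (x :* x′) := x′ :* (x :* m)) refl x x′ (ι M)) (trans (cong (x′ *_) xM) (ℚ.*-identityʳ x′))
    A B : ℕ
    A = M ℕ.* n′
    B = M′ ℕ.* n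
    e≤ : e ≤ z ^ B
    e≤ = subst (e ≤_) (^-assocʳ z M′ n) (^-mono n (‖ x≤1)
      (subst (λ s → 1ℚ - s ≤ z ^ M′) M′y (bernoulli⁻ M′ 0≤y y≤1)))
    base′ : z ^ M * (1ℚ - x′ * x′) ≤ 1ℚ - x′
    base′ = by (‖ x′≤1 ⊗ ‖ subst (λ s → z ^ M * (1ℚ + s) ≤ 1ℚ) My (^-reciprocal M 0≤y y≤1))
      (solve 2 (λ Z x′ → :1 :- x′ :- Z :* (:1 :- x′ :* x′)
        := (:1 :- x′) :* (:1 :- Z :* (:1 :+ x′))) refl (z ^ M) x′)
    x′²≤1 : x′ * x′ ≤ 1ℚ
    x′²≤1 = by (0≤x′ ⊗ ‖ x′≤1 ⊕ ‖ x′≤1)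
      (solve 1 (λ x′ → :1 :- x′ :* x′ := x′ :* (:1 :- x′) :+ (:1 :- x′)) refl x′)
    0≤zM : 0ℚ ≤ z ^ M
    0≤zM = 0≤^ M (‖ y≤1)
    e′≥ : z ^ A ≤ e′ + ι n′ * x′ * x′
    e′≥ = subst (λ P → P ≤ e′ + ι n′ * x′ * x′) (^-assocʳ z M n′)
      (by (0≤^ n′ 0≤zM ⊗ ‖ bernoulli⁻′
          ⊕ ‖ subst (_≤ e′) (^-distrib-* (z ^ M) (1ℚ - x′ * x′) n′) (^-mono n′ (0≤zM ⊗ ‖ x′²≤1) base′)
          ⊕ (0≤ι n′ ⊗ 0≤x′ ⊗ 0≤x′) ⊗ ‖ ^≤1 n′ 0≤zM (^≤1 M (‖ y≤1) z≤1))
        (solve 4 (λ Z c e′ s → e′ :+ s :- Z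
          := Z :* (c :- (:1 :- s)) :+ (e′ :- Z :* c) :+ s :* (:1 :- Z))
          refl ((z ^ M) ^ n′) ((1ℚ - x′ * x′) ^ n′) e′ (ι n′ * x′ * x′)))
      where
      z≤1 : z ≤ 1ℚ
      z≤1 = by 0≤y (solve 1 (λ y → :1 :- (:1 :- y) := y) refl y)
      bernoulli⁻′ : 1ℚ - ι n′ * x′ * x′ ≤ (1ℚ - x′ * x′) ^ n′
      bernoulli⁻′ = subst (λ s → 1ℚ - s ≤ (1ℚ - x′ * x′) ^ n′) (sym (ℚ.*-assoc (ι n′) x′ x′))
        (bernoulli⁻ n′ (0≤x′ ⊗ 0≤x′) x′²≤1)
    Ay : (ι B - ι A) * y ≡ ι n * x - ι n′ * x′
    Ay = begin
      (ι (M′ ℕ.* n) - ι (M ℕ.* n′)) * y        ≡⟨ cong₂ (λ s t → (s - t) * y) (ι-* M′ n) (ι-* M n′) ⟩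
      (ι M′ * ι n - ι M * ι n′) * y            ≡⟨ solve 5 (λ a b c d y → (a :* b :- c :* d) :* y := b :* (a :* y) :- d :* (c :* y)) refl (ι M′) (ι n) (ι M) (ι n′) y ⟩
      ι n * (ι M′ * y) - ι n′ * (ι M * y)      ≡⟨ cong₂ (λ s t → ι n * s - ι n′ * t) M′y My ⟩
      ι n * x - ι n′ * x′                      ∎
      where open ≡-Reasoning
    0≤rhs : 0ℚ ≤ e′ + ι n′ * x′ * x′
    0≤rhs = 0≤^ n′ (‖ x′≤1) ⊕ 0≤ι n′ ⊗ 0≤x′ ⊗ 0≤x′
    goal : e * δ ≤ e′ + ι n′ * x′ * x′
    goal with ℚ.≤-total 0ℚ δ
    ... | inj₁ 0≤δ = ℚ.≤-trans
      (by (0≤δ ⊗ ‖ e≤) (solve 3 (λ e δ Z → Z :* δ :- e :* δ := δ :* (Z :- e)) refl e δ (z ^ B)))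
      (ℚ.≤-trans (subst (λ s → z ^ B * s ≤ z ^ A)
          (trans (cong (1ℚ +_) Ay) (solve 2 (λ a b → :1 :+ (a :- b) := :1 :+ a :- b) refl (ι n * x) (ι n′ * x′)))
          (tangent A B 0≤y y≤1)) e′≥)
    ... | inj₂ δ≤0 = ℚ.≤-trans
      (by (0≤^ n (‖ x≤1) ⊗ ‖ δ≤0) (solve 2 (λ e δ → :0 :- e :* δ := e :* (:0 :- δ)) refl e δ)) 0≤rhs

  ^-halving : ∀ {x} n → 0ℚ ≤ x → x ≤ 1ℚ → (1ℚ - x) ^ n ≤ (1ℚ - ½ * x) ^ n * (1ℚ - ½ * x) ^ n
  ^-halving {x} n 0≤x x≤1 = subst ((1ℚ - x) ^ n ≤_) (^-distrib-* (1ℚ - ½ * x) (1ℚ - ½ * x) n)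
    (^-mono n (‖ x≤1) (by (sq (½ * x))
      (solve 1 (λ x → (:1 :- :½ :* x) :* (:1 :- :½ :* x) :- (:1 :- x) := :½ :* x :* (:½ :* x)) refl x)))

  ½x≤1 : ∀ {x} → 0ℚ ≤ x → x ≤ 1ℚ → ½ * x ≤ 1ℚ
  ½x≤1 {x} 0≤x x≤1 = by· (0<# 1) (0≤# 1 ⊕ ‖ x≤1) (solve 1 (λ x → :# 2 :* (:1 :- :½ :* x) := :# 1 :+ (:1 :- x)) refl x)

  0≤½* : ∀ {x} → 0ℚ ≤ x → 0ℚ ≤ ½ * x
  0≤½* {x} 0≤x = by· (0<# 1) 0≤x (solve 1 (λ x → :# 2 :* (:½ :* x :- :0) := x) refl x)

  ^-second-order : ∀ {x} n → 0ℚ ≤ x → x ≤ 1ℚ → let θ = ι n * x in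
    (1ℚ - x) ^ n * ((# 2 + θ) * (# 2 + θ)) ≤ # 4
  ^-second-order {x} n 0≤x x≤1 = ℚ.≤-trans
    (by {((1ℚ - x) ^ n) * (((# 2) + ι n * x) * ((# 2) + ι n * x))} {h * h * (((# 2) + ι n * x) * ((# 2) + ι n * x))} (sq (((# 2) + ι n * x)) ⊗ ‖ ^-halving n 0≤x x≤1)
      (solve 3 (λ E h c → h :* h :* (c :* c) :- E :* (c :* c)
        := c :* c :* (h :* h :- E)) refl ((1ℚ - x) ^ n) h (# 2 + ι n * x)))
    (by (0≤# 4 ⊗ ((0≤h ⊗ (0≤# 1 ⊕ (0≤ι n ⊗ 0≤½* 0≤x)) ⊕ 0≤# 1) ⊗ ‖ h≤))
      (solve 3 (λ h x n → :# 4 :- h :* h :* ((:# 2 :+ n :* x) :* (:# 2 :+ n :* x))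
        := :# 4 :* ((h :* (:# 1 :+ n :* (:½ :* x)) :+ :# 1) :* (:# 1 :- h :* (:# 1 :+ n :* (:½ :* x)))))
        refl h x (ι n)))
    where
    h = (1ℚ - ½ * x) ^ n
    0≤h = 0≤^ n (‖ ½x≤1 0≤x x≤1)
    h≤ = ^-reciprocal n (0≤½* 0≤x) (½x≤1 0≤x x≤1)

  -- With X = 1 + q + ⋯ + q^{n-1}: the pairs i, n - 1 - i give X (1 + q^{n+1}) ≥ 2n q^n,
  -- and hence X² ≥ n² q^n.
  module _ {x : ℚ} (0≤x : 0ℚ ≤ x) (x≤1 : x ≤ 1ℚ) where
    private
      q : ℚ
      q = 1ℚ - x
      0≤q : 0ℚ ≤ q
      0≤q = ‖ x≤1
      X : ℕ → ℚ
      X zero    = 0ℚ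
      X (suc n) = 1ℚ + q * X n
      0≤X : ∀ n → 0ℚ ≤ X n
      0≤X zero    = 0≤# 0
      0≤X (suc n) = 0≤# 1 ⊕ 0≤q ⊗ 0≤X n
      xX : ∀ n → x * X n ≡ 1ℚ - q ^ n
      xX zero    = solve 1 (λ x → x :* :0 := :1 :- :1) refl x
      xX (suc n) = begin
        x * (1ℚ + q * X n)        ≡⟨ solve 2 (λ x X → x :* (:1 :+ (:1 :- x) :* X) := x :+ (:1 :- x) :* (x :* X)) refl x (X n) ⟩
        x + q * (x * X n)         ≡⟨ cong (λ s → x + q * s) (xX n) ⟩
        x + q * (1ℚ - q ^ n)      ≡⟨ solve 2 (λ x Q → x :+ (:1 :- x) :* (:1 :- Q) := :1 :- (:1 :- x) :* Q) refl x (q ^ n) ⟩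
        1ℚ - q * q ^ n            ∎
        where open ≡-Reasoning
      q^n : ∀ n → 1ℚ - x * X n ≡ q ^ n
      q^n n = trans (cong (1ℚ -_) (xX n)) (solve 1 (λ Q → :1 :- (:1 :- Q) := Q) refl (q ^ n))
      pairs : ∀ n → # 2 * ι n * q ^ n ≤ X n * (1ℚ + q * q ^ n)
      pairs zero rewrite ι0 = by (0≤# 0)
        (solve 1 (λ q → :0 :* (:1 :+ q :* :1) :- :# 2 :* :0 :* :1 := :# 0) refl q)
      pairs (suc n) rewrite ι-suc n = step (X n) (q ^ n) (q^n n) (0≤X n) (pairs n)
        where
        step : ∀ X Q → 1ℚ - x * X ≡ Q → 0ℚ ≤ X → # 2 * ι n * Q ≤ X * (1ℚ + q * Q) →
               # 2 * (1ℚ + ι n) * (q * Q) ≤ (1ℚ + q * X) * (1ℚ + q * (q * Q))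
        step X _ refl 0≤X ih = by (0≤q ⊗ ‖ ih ⊕ sq (1ℚ - (1ℚ - x) * (1ℚ - x * X)))
          (solve 3 (λ x X n → (:1 :+ (:1 :- x) :* X) :* (:1 :+ (:1 :- x) :* ((:1 :- x) :* (:1 :- x :* X)))
            :- :# 2 :* (:1 :+ n) :* ((:1 :- x) :* (:1 :- x :* X))
            := (:1 :- x) :* (X :* (:1 :+ (:1 :- x) :* (:1 :- x :* X)) :- :# 2 :* n :* (:1 :- x :* X))
            :+ (:1 :- (:1 :- x) :* (:1 :- x :* X)) :* (:1 :- (:1 :- x) :* (:1 :- x :* X))) refl x X (ι n))
      squares : ∀ n → ι n * ι n * q ^ n ≤ X n * X n
      squares zero rewrite ι0 = ℚ.≤-refl
      squares (suc n) rewrite ι-suc n = step (X n) (q ^ n) (q^n n) (0≤^ n 0≤q) (squares n) (pairs n)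
        where
        step : ∀ X Q → 1ℚ - x * X ≡ Q → 0ℚ ≤ Q → ι n * ι n * Q ≤ X * X → # 2 * ι n * Q ≤ X * (1ℚ + q * Q) →
               (1ℚ + ι n) * (1ℚ + ι n) * (q * Q) ≤ (1ℚ + q * X) * (1ℚ + q * X)
        step X _ refl 0≤Q ih pr = by (0≤q ⊗ ‖ ih ⊕ ‖ pr ⊕ 0≤x ⊗ (0≤# 2 ⊗ 0≤ι n ⊕ 0≤# 1) ⊗ 0≤Q)
          (solve 3 (λ x X n → (:1 :+ (:1 :- x) :* X) :* (:1 :+ (:1 :- x) :* X)
            :- (:1 :+ n) :* (:1 :+ n) :* ((:1 :- x) :* (:1 :- x :* X))
            := (:1 :- x) :* (X :* X :- n :* n :* (:1 :- x :* X))
            :+ (X :* (:1 :+ (:1 :- x) :* (:1 :- x :* X)) :- :# 2 :* n :* (:1 :- x :* X))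
            :+ x :* (:# 2 :* n :+ :# 1) :* (:1 :- x :* X)) refl x X (ι n))

    -- sinh(θ/2) ≥ θ/2
    sinh-bound : ∀ n → let E = q ^ n ; θ = ι n * x in θ * θ * E ≤ (1ℚ - E) * (1ℚ - E)
    sinh-bound n = subst (λ s → (ι n * x) * (ι n * x) * q ^ n ≤ s * s) (xX n)
      (by (sq x ⊗ ‖ squares n)
        (solve 4 (λ x X n E → x :* X :* (x :* X) :- n :* x :* (n :* x) :* E
          := x :* x :* (X :* X :- n :* n :* E)) refl x (X n) (ι n) (q ^ n)))

  0<^ : ∀ {p} n → 0ℚ < p → 0ℚ < p ^ n
  0<^ zero    0<p = 0<# 0
  0<^ (suc n) 0<p = 0<* 0<p (0<^ n 0<p)

  -- (1 - E)²/E decreases in E ≤ 1, and (1 - h²)²/h² = ((1 - h)²/h) ((1 - h)²/h + 4) for h = e^{-θ/2}.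
  sinh-bound-strict : ∀ {x} n → 0ℚ ≤ x → x ≤ 1ℚ → let E = (1ℚ - x) ^ n ; θ = ι n * x in
    θ * θ * (# 16 + θ * θ) * E ≤ # 16 * ((1ℚ - E) * (1ℚ - E))
  sinh-bound-strict {x} n 0≤x x≤1 =
    (by· (0<* 0<h 0<h) (0≤# 16 ⊗ ‖ E≤h² ⊗ ‖ h²E≤1
        ⊕ 0≤E ⊗ 0≤# 16 ⊗ ‖ sinh-bound (0≤½* 0≤x) (½x≤1 0≤x x≤1) n ⊗ (sq (1ℚ - h) ⊕ sq ((ι n) * (½ * x)) ⊗ 0≤h ⊕ 0≤# 4 ⊗ 0≤h))
      (solve 4 (λ x n E h → h :* h :* (:# 16 :* ((:1 :- E) :* (:1 :- E)) :- n :* x :* (n :* x) :* (:# 16 :+ n :* x :* (n :* x)) :* E)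
        := :# 16 :* (h :* h :- E) :* (:1 :- h :* h :* E)
        :+ E :* :# 16 :* ((:1 :- h) :* (:1 :- h) :- n :* (:½ :* x) :* (n :* (:½ :* x)) :* h) :* ((:1 :- h) :* (:1 :- h) :+ n :* (:½ :* x) :* (n :* (:½ :* x)) :* h :+ :# 4 :* h))
        refl x (ι n) E h))
    where
    E h : ℚ
    E = (1ℚ - x) ^ n
    h = (1ℚ - ½ * x) ^ n
    0≤E : 0ℚ ≤ E
    0≤E = 0≤^ n (‖ x≤1)
    E≤h² : E ≤ h * h
    E≤h² = ^-halving n 0≤x x≤1
    0<h : 0ℚ < h
    0<h = 0<^ n (ℚ.<-≤-trans (ℚ.positive⁻¹ ½) (by (0≤½* (‖ x≤1))
      (solve 1 (λ x → :1 :- :½ :* x :- :½ := :½ :* (:1 :- x)) refl x)))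
    0≤h : 0ℚ ≤ h
    0≤h = ℚ.<⇒≤ 0<h
    h≤1 : h ≤ 1ℚ
    h≤1 = ^≤1 n (‖ ½x≤1 0≤x x≤1) (by (0≤½* 0≤x) (solve 1 (λ x → :1 :- (:1 :- :½ :* x) := :½ :* x) refl x))
    E≤1 : E ≤ 1ℚ
    E≤1 = ^≤1 n (‖ x≤1) (by 0≤x (solve 1 (λ x → :1 :- (:1 :- x) := x) refl x))
    h²E≤1 : h * h * E ≤ 1ℚ
    h²E≤1 = by (0≤h ⊗ 0≤h ⊗ ‖ E≤1 ⊕ 0≤h ⊗ ‖ h≤1 ⊕ ‖ h≤1)
      (solve 2 (λ h E → :1 :- h :* h :* E := h :* h :* (:1 :- E) :+ h :* (:1 :- h) :+ (:1 :- h)) refl h E)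

module Means where

  open Prelude
  open OrderedField

  ∑ : ℕ → (ℕ → ℚ) → ℚ
  ∑ zero    f = 0ℚ
  ∑ (suc n) f = ∑ n f + f n

  ∑-cong : ∀ n {f g} → (∀ i → i ℕ.< n → f i ≡ g i) → ∑ n f ≡ ∑ n g
  ∑-cong zero    f≡g = refl
  ∑-cong (suc n) f≡g = cong₂ _+_ (∑-cong n λ i i<n → f≡g i (ℕ.m<n⇒m<1+n i<n)) (f≡g n (ℕ.n<1+n n))

  ∑-* : ∀ n c f → ∑ n (λ i → c * f i) ≡ c * ∑ n f
  ∑-* zero    c f = sym (ℚ.*-zeroʳ c)
  ∑-* (suc n) c f = trans (cong (_+ c * f n) (∑-* n c f)) (sym (ℚ.*-distribˡ-+ c (∑ n f) (f n)))

  ∑-+ : ∀ n f g → ∑ n (λ i → f i + g i) ≡ ∑ n f + ∑ n g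
  ∑-+ zero    f g = refl
  ∑-+ (suc n) f g = trans (cong (_+ (f n + g n)) (∑-+ n f g))
    (solve 4 (λ F G f g → F :+ G :+ (f :+ g) := F :+ f :+ (G :+ g)) refl (∑ n f) (∑ n g) (f n) (g n))

  ∑-mono : ∀ n {f g} → (∀ i → i ℕ.< n → f i ≤ g i) → ∑ n f ≤ ∑ n g
  ∑-mono zero    f≤g = ℚ.≤-refl
  ∑-mono (suc n) f≤g = ℚ.+-mono-≤ (∑-mono n λ i i<n → f≤g i (ℕ.m<n⇒m<1+n i<n)) (f≤g n (ℕ.n<1+n n))

  0≤∑ : ∀ n {f} → (∀ i → i ℕ.< n → 0ℚ ≤ f i) → 0ℚ ≤ ∑ n f
  0≤∑ zero    0≤f = ℚ.≤-refl
  0≤∑ (suc n) 0≤f = 0≤∑ n (λ i i<n → 0≤f i (ℕ.m<n⇒m<1+n i<n)) ⊕ 0≤f n (ℕ.n<1+n n)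

  ∑-split : ∀ m n f → ∑ (m ℕ.+ n) f ≡ ∑ m f + ∑ n (λ i → f (m ℕ.+ i))
  ∑-split m zero    f rewrite ℕ.+-identityʳ m = sym (ℚ.+-identityʳ (∑ m f))
  ∑-split m (suc n) f rewrite ℕ.+-suc m n =
    trans (cong (_+ f (m ℕ.+ n)) (∑-split m n f)) (ℚ.+-assoc (∑ m f) _ _)

  ∑-shift : ∀ n f → ∑ (suc n) f ≡ f 0 + ∑ n (λ i → f (suc i))
  ∑-shift n f = trans (∑-split 1 n f) (cong (_+ ∑ n (λ i → f (suc i))) (ℚ.+-identityˡ (f 0)))

  ∑-const-≤ : ∀ n {f c} → (∀ i → i ℕ.< n → c ≤ f i) → ι n * c ≤ ∑ n f
  ∑-const-≤ zero    {c = c} c≤f = subst (_≤ 0ℚ) (trans (sym (ℚ.*-zeroˡ c)) (cong (_* c) (sym ι0))) ℚ.≤-refl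
  ∑-const-≤ (suc n) {f} {c} c≤f = subst (_≤ ∑ n f + f n)
    (trans (solve 2 (λ n c → n :* c :+ c := (:1 :+ n) :* c) refl (ι n) c) (cong (_* c) (sym (ι-suc n))))
    (ℚ.+-mono-≤ (∑-const-≤ n λ i i<n → c≤f i (ℕ.m<n⇒m<1+n i<n)) (c≤f n (ℕ.n<1+n n)))

  -- In both lemmas w increases up to (decreases from) the mode on a stretch of length d
  -- and decays geometrically beyond, so the mass beyond is at most Q/d of the total;
  -- z is w times a decreasing function with values in [0 , 1] whose mean is C.

  module _ {w z : ℕ → ℚ} (0≤w : ∀ i → 0ℚ ≤ w i) (0≤z : ∀ i → 0ℚ ≤ z i) (z≤w : ∀ i → z i ≤ w i)
           {d : ℕ} {Q τ φ C : ℚ} (1≤Q : 1ℚ ≤ Q) (Q≤τd : Q ≤ τ * ι d) (0≤τ : 0ℚ ≤ τ) where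

    private
      0≤Q : 0ℚ ≤ Q
      0≤Q = ℚ.≤-trans (0≤# 1) 1≤Q

    mean-right : ∀ j R → let L = j ℕ.+ d ℕ.+ R in
      ∑ L z ≡ C * ∑ L w → 0ℚ < ∑ L w → φ ≤ 1ℚ →
      (∀ i → i ℕ.< j ℕ.+ d → φ * w i ≤ z i) →
      (∀ i → j ℕ.≤ i → w (suc i) ≤ w i) →
      (∀ i → j ℕ.+ d ℕ.≤ i → Q * w (suc i) ≤ (Q - 1ℚ) * w i) →
      φ ≤ C + τ
    mean-right j R mean 0<W φ≤1 φw≤z dec decay =
      (by· 0<W (‖ φW≤) (solve 4 (λ φ C τ W → W :* (C :+ τ :- φ) := C :* W :+ τ :* W :- φ :* W) refl φ C τ W))
      where
      s L : ℕ
      s = j ℕ.+ d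
      L = s ℕ.+ R
      W H V tail tailz Z : ℚ
      W     = ∑ L w
      Z     = ∑ s z
      H     = ∑ s w
      V     = w s
      tail  = ∑ R (λ i → w (s ℕ.+ i))
      tailz = ∑ R (λ i → z (s ℕ.+ i))
      W≡ : W ≡ H + tail
      W≡ = ∑-split s R w
      telescope : ∀ r → ∑ r (λ i → w (s ℕ.+ i)) + Q * w (s ℕ.+ r) ≤ Q * w (s ℕ.+ 0)
      telescope zero = by (0≤# 0) (solve 1 (λ a → a :- (:0 :+ a) := :# 0) refl (Q * w (s ℕ.+ 0)))
      telescope (suc r) = ℚ.≤-trans
        (subst (λ k → ∑ r (λ i → w (s ℕ.+ i)) + w (s ℕ.+ r) + Q * w k ≤ ∑ r (λ i → w (s ℕ.+ i)) + Q * w (s ℕ.+ r))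
          (sym (ℕ.+-suc s r))
          (by (‖ decay (s ℕ.+ r) (ℕ.m≤m+n s r))
            (solve 4 (λ S Q v v′ → S :+ Q :* v :- (S :+ v :+ Q :* v′)
              := (Q :- :1) :* v :- Q :* v′)
              refl (∑ r (λ i → w (s ℕ.+ i))) Q (w (s ℕ.+ r)) (w (suc (s ℕ.+ r))))))
        (telescope r)
      tail≤ : tail ≤ Q * V
      tail≤ = subst (λ k → tail ≤ Q * w k) (ℕ.+-identityʳ s)
        (ℚ.≤-trans (by (0≤Q ⊗ 0≤w (s ℕ.+ R)) (solve 2 (λ t a → t :+ a :- t := a) refl tail (Q * w (s ℕ.+ R)))) (telescope R))
      descend : ∀ e i → j ℕ.≤ i → w (i ℕ.+ e) ≤ w i
      descend zero    i j≤i rewrite ℕ.+-identityʳ i = ℚ.≤-refl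
      descend (suc e) i j≤i rewrite ℕ.+-suc i e =
        ℚ.≤-trans (dec (i ℕ.+ e) (ℕ.≤-trans j≤i (ℕ.m≤m+n i e))) (descend e i j≤i)
      dV≤H : ι d * V ≤ H
      dV≤H = subst (ι d * V ≤_) (sym (∑-split j d w)) (ℚ.≤-trans
        (∑-const-≤ d λ i i<d → subst (λ k → w k ≤ w (j ℕ.+ i))
          (trans (ℕ.+-assoc j i (d ℕ.∸ i)) (cong (j ℕ.+_) (ℕ.m+[n∸m]≡n (ℕ.<⇒≤ i<d))))
          (descend (d ℕ.∸ i) (j ℕ.+ i) (ℕ.m≤m+n j i)))
        (by (0≤∑ j (λ i _ → 0≤w i))
          (solve 2 (λ a b → b :+ a :- a := b) refl (∑ d (λ i → w (j ℕ.+ i))) (∑ j w))))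
      0≤tail : 0ℚ ≤ tail
      0≤tail = 0≤∑ R (λ i _ → 0≤w (s ℕ.+ i))
      φH≤Z : φ * H ≤ Z
      φH≤Z = subst (_≤ Z) (∑-* s φ w) (∑-mono s φw≤z)
      Z+tail : Z + tailz ≡ C * W
      Z+tail = trans (sym (∑-split s R z)) mean
      φW≤ : φ * W ≤ C * W + τ * W
      φW≤ = subst₂ _≤_ (cong (φ *_) (sym W≡)) (cong₂ _+_ Z+tail (cong (τ *_) (sym W≡)))
        (by (‖ φH≤Z ⊕ 0≤∑ R (λ i _ → 0≤z (s ℕ.+ i)) ⊕ ‖ φ≤1 ⊗ 0≤tail ⊕ ‖ tail≤ ⊕ 0≤w s ⊗ ‖ Q≤τd ⊕ 0≤τ ⊗ ‖ dV≤H
            ⊕ 0≤τ ⊗ 0≤tail)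
          (solve 9 (λ φ H t Z tz τ Q V d → Z :+ tz :+ τ :* (H :+ t) :- φ :* (H :+ t)
            := Z :- φ :* H :+ tz :+ (:1 :- φ) :* t :+ (Q :* V :- t) :+ V :* (τ :* d :- Q)
            :+ τ :* (H :- d :* V) :+ τ :* t) refl φ H tail Z tailz τ Q V (ι d)))

    mean-left : ∀ b R → let L = b ℕ.+ d ℕ.+ R in
      ∑ L z ≡ C * ∑ L w → 0ℚ < ∑ L w → 0ℚ ≤ φ →
      (∀ i → b ℕ.≤ i → z i ≤ φ * w i) →
      (∀ i → i ℕ.< b ℕ.+ d → w i ≤ w (suc i)) →
      (∀ i → i ℕ.< b → Q * w i ≤ (Q - 1ℚ) * w (suc i)) →
      C ≤ φ + τ
    mean-left b R mean 0<W 0≤φ z≤φw inc decay =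
      (by· 0<W (‖ CW≤) (solve 4 (λ φ C τ W → W :* (φ :+ τ :- C) := φ :* W :+ τ :* W :- C :* W) refl φ C τ W))
      where
      L M : ℕ
      M = d ℕ.+ R
      L = b ℕ.+ d ℕ.+ R
      W H V tail Z : ℚ
      W    = ∑ L w
      tail = ∑ b w
      H    = ∑ M (λ i → w (b ℕ.+ i))
      Z    = ∑ M (λ i → z (b ℕ.+ i))
      V    = w b
      split : ∀ f → ∑ L f ≡ ∑ b f + ∑ M (λ i → f (b ℕ.+ i))
      split f = trans (cong (λ k → ∑ k f) (ℕ.+-assoc b d R)) (∑-split b M f)
      telescope : ∀ r → r ℕ.≤ b → ∑ r w ≤ (Q - 1ℚ) * w r
      telescope zero    _   = ‖ 1≤Q ⊗ 0≤w 0
      telescope (suc r) r<b = by (‖ telescope r (ℕ.<⇒≤ r<b) ⊕ ‖ decay r r<b)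
        (solve 4 (λ S Q v v′ → (Q :- :1) :* v′ :- (S :+ v)
          := (Q :- :1) :* v :- S :+ ((Q :- :1) :* v′ :- Q :* v)) refl (∑ r w) Q (w r) (w (suc r)))
      ascend : ∀ e i → i ℕ.+ e ℕ.≤ b ℕ.+ d → w i ≤ w (i ℕ.+ e)
      ascend zero    i _ rewrite ℕ.+-identityʳ i = ℚ.≤-refl
      ascend (suc e) i le rewrite ℕ.+-suc i e = ℚ.≤-trans (ascend e i (ℕ.<⇒≤ le)) (inc (i ℕ.+ e) le)
      0≤w+ : ∀ i → 0ℚ ≤ w (b ℕ.+ i)
      0≤w+ i = 0≤w (b ℕ.+ i)
      dV≤H : ι d * V ≤ H
      dV≤H = subst (ι d * V ≤_) (sym (∑-split d R λ i → w (b ℕ.+ i))) (ℚ.≤-trans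
        (∑-const-≤ d λ i i<d → ascend i b (ℕ.+-monoʳ-≤ b (ℕ.<⇒≤ i<d)))
        (by (0≤∑ R (λ i _ → 0≤w+ (d ℕ.+ i)))
          (solve 2 (λ x y → x :+ y :- x
            := y) refl (∑ d (λ i → w (b ℕ.+ i))) (∑ R (λ i → w (b ℕ.+ (d ℕ.+ i)))))))
      Z≤φH : Z ≤ φ * H
      Z≤φH = subst (Z ≤_) (∑-* M φ (λ i → w (b ℕ.+ i))) (∑-mono M λ i _ → z≤φw (b ℕ.+ i) (ℕ.m≤m+n b i))
      CW≤ : C * W ≤ φ * W + τ * W
      CW≤ = subst₂ _≤_ (trans (sym (split z)) mean) (cong₂ _+_ (cong (φ *_) (sym (split w))) (cong (τ *_) (sym (split w))))
        (by (‖ Z≤φH ⊕ ‖ ∑-mono b (λ i _ → z≤w i) ⊕ 0≤φ ⊗ 0≤tail ⊕ ‖ telescope b ℕ.≤-refl ⊕ 0≤w b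
            ⊕ 0≤w b ⊗ ‖ Q≤τd ⊕ 0≤τ ⊗ ‖ dV≤H ⊕ 0≤τ ⊗ 0≤tail)
          (solve 9 (λ φ H t Z tz τ Q V d → φ :* (t :+ H) :+ τ :* (t :+ H) :- (tz :+ Z)
            := φ :* H :- Z :+ (t :- tz) :+ φ :* t :+ ((Q :- :1) :* V :- t) :+ V :+ V :* (τ :* d :- Q)
            :+ τ :* (H :- d :* V) :+ τ :* t) refl φ H tail Z (∑ b z) τ Q V (ι d)))
        where
        0≤tail : 0ℚ ≤ tail
        0≤tail = 0≤∑ b (λ i _ → 0≤w i)

module LogConcavity where

  open Prelude
  open OrderedField

  prev : (ℕ → ℚ) → ℕ → ℚ
  prev f zero    = 0ℚ
  prev f (suc k) = f k

  log-concave-step : ∀ {p s α β} {x₀ x₁ x₂ x₃ : ℚ} →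
    0ℚ ≤ p → 0ℚ ≤ p + α + α → 0ℚ ≤ s → 0ℚ ≤ s + β + β →
    x₀ * x₂ ≤ x₁ * x₁ → x₁ * x₃ ≤ x₂ * x₂ → x₀ * x₃ ≤ x₁ * x₂ →
    (p * x₀ + s * x₁) * ((p + α + α) * x₂ + (s + β + β) * x₃)
      ≤ ((p + α) * x₁ + (s + β) * x₂) * ((p + α) * x₁ + (s + β) * x₂)
  log-concave-step {p} {s} {α} {β} {x₀} {x₁} {x₂} {x₃} 0≤p 0≤p″ 0≤s 0≤s″ x₀x₂ x₁x₃ x₀x₃ =
    (by (0≤p ⊗ 0≤p″ ⊗ ‖ x₀x₂ ⊕ 0≤s ⊗ 0≤s″ ⊗ ‖ x₁x₃ ⊕ 0≤p ⊗ 0≤s″ ⊗ ‖ x₀x₃ ⊕ sq (α * x₁ + β * x₂))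
      (solve 8 (λ p s α β x₀ x₁ x₂ x₃ → ((p :+ α) :* x₁ :+ (s :+ β) :* x₂) :* ((p :+ α) :* x₁ :+ (s :+ β) :* x₂)
        :- (p :* x₀ :+ s :* x₁) :* ((p :+ α :+ α) :* x₂ :+ (s :+ β :+ β) :* x₃)
        := p :* (p :+ α :+ α) :* (x₁ :* x₁ :- x₀ :* x₂) :+ s :* (s :+ β :+ β) :* (x₂ :* x₂ :- x₁ :* x₃)
        :+ p :* (s :+ β :+ β) :* (x₁ :* x₂ :- x₀ :* x₃) :+ (α :* x₁ :+ β :* x₂) :* (α :* x₁ :+ β :* x₂))
        refl p s α β x₀ x₁ x₂ x₃))

  module Linear
    (D A B : ℕ → ℕ → ℚ) (α β : ℚ)
    (0≤D : ∀ n k → 0ℚ ≤ D n k)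
    (0<D : ∀ {n k} → 0 ℕ.< k → k ℕ.< n → 0ℚ < D n k)
    (D-outside : ∀ {n k} → n ℕ.< k → D n k ≡ 0ℚ)
    (D-suc : ∀ {n k} → k ℕ.≤ suc n → D (suc n) k ≡ A n k * prev (D n) k + B n k * D n k)
    (A-suc : ∀ n k → A n (suc k) ≡ A n k + α) (B-suc : ∀ n k → B n (suc k) ≡ B n k + β)
    (0≤A : ∀ {n k} → k ℕ.≤ suc n → 0ℚ ≤ A n k) (0≤B : ∀ n k → 0ℚ ≤ B n k)
    where

    outside-* : ∀ {n k} c {y} → n ℕ.< k → 0ℚ ≤ y → c * D n k ≤ y
    outside-* {n} c {y} n<k 0≤y = subst (_≤ y) (sym (trans (cong (c *_) (D-outside n<k)) (ℚ.*-zeroʳ c))) 0≤y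

    log-concave : ∀ n k → D n k * D n (suc (suc k)) ≤ D n (suc k) * D n (suc k)
    log-concave zero    k = outside-* (D 0 k) (s≤s z≤n) (sq (D 0 (suc k)))
    log-concave (suc n) k with suc k ℕ.≤? n
    ... | no  k≮n = outside-* (D (suc n) k) (s≤s (ℕ.≰⇒> k≮n)) (sq (D (suc n) (suc k)))
    ... | yes k<n = subst₂ _≤_
      (cong₂ _*_ (sym (D-suc k≤)) (trans (cong₂ (λ a b → a * x₂ + b * x₃) (sym A₂) (sym B₂)) (sym (D-suc k+2≤))))
      (cong₂ _*_ mid mid)
      (log-concave-step {A n k} {B n k} {α} {β} {x₀} {x₁} {x₂} {x₃} (0≤A k≤) (subst (0ℚ ≤_) A₂ (0≤A k+2≤))
        (0≤B n k) (subst (0ℚ ≤_) B₂ (0≤B n (suc (suc k))))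
        (adjacent k) (log-concave n k) (gap k))
      where
      x₀ x₁ x₂ x₃ : ℚ
      x₀ = prev (D n) k
      x₁ = D n k
      x₂ = D n (suc k)
      x₃ = D n (suc (suc k))
      k+2≤ : suc (suc k) ℕ.≤ suc n
      k+2≤ = s≤s k<n
      k+1≤ : suc k ℕ.≤ suc n
      k+1≤ = ℕ.<⇒≤ k+2≤
      k≤ : k ℕ.≤ suc n
      k≤ = ℕ.<⇒≤ k+1≤
      A₂ : A n (suc (suc k)) ≡ A n k + α + α
      A₂ = trans (A-suc n (suc k)) (cong (_+ α) (A-suc n k))
      B₂ : B n (suc (suc k)) ≡ B n k + β + β
      B₂ = trans (B-suc n (suc k)) (cong (_+ β) (B-suc n k))
      mid : (A n k + α) * x₁ + (B n k + β) * x₂ ≡ D (suc n) (suc k)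
      mid = trans (cong₂ (λ a b → a * x₁ + b * x₂) (sym (A-suc n k)) (sym (B-suc n k))) (sym (D-suc k+1≤))
      adjacent : ∀ k → prev (D n) k * D n (suc k) ≤ D n k * D n k
      adjacent zero    = subst (_≤ D n 0 * D n 0) (sym (ℚ.*-zeroˡ (D n 1))) (sq (D n 0))
      adjacent (suc k) = log-concave n k
      gap : ∀ k → prev (D n) k * D n (suc (suc k)) ≤ D n k * D n (suc k)
      gap zero    = subst (_≤ D n 0 * D n 1) (sym (ℚ.*-zeroˡ (D n 2))) (0≤D n 0 ⊗ 0≤D n 1)
      gap (suc k) with suc (suc (suc k)) ℕ.≤? n
      ... | no  k+2≮n = outside-* (D n k) (ℕ.≰⇒> k+2≮n) (0≤D n (suc k) ⊗ 0≤D n (suc (suc k)))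
      ... | yes k+2<n = by· (0<* (0<D (s≤s z≤n) (ℕ.<⇒≤ k+2<n)) (0<D (s≤s z≤n) k+2<n)) (‖ log-concave n k ⊗ (0≤D n (suc k) ⊗ 0≤D n (suc (suc (suc k))))
          ⊕ ‖ log-concave n (suc k) ⊗ (0≤D n (suc k) ⊗ 0≤D n (suc k)))
        (solve 4 (λ a b c d → b :* c :* (b :* c :- a :* d)
          := (b :* b :- a :* c) :* (b :* d) :+ (c :* c :- b :* d) :* (b :* b))
          refl (D n k) (D n (suc k)) (D n (suc (suc k))) (D n (suc (suc (suc k)))))

    ratio-right : ∀ {n j} {g h : ℚ} → 0 ℕ.< j → 0ℚ ≤ g → 0ℚ ≤ h → g * D n (suc j) ≤ h * D n j →
                  ∀ i → j ℕ.≤ i → g * D n (suc i) ≤ h * D n i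
    ratio-right {n} {j} {g} {h} 0<j 0≤g 0≤h start i j≤i =
      subst (λ i → g * D n (suc i) ≤ h * D n i) (ℕ.m+[n∸m]≡n j≤i) (go (i ℕ.∸ j))
      where
      go : ∀ e → g * D n (suc (j ℕ.+ e)) ≤ h * D n (j ℕ.+ e)
      go zero    rewrite ℕ.+-identityʳ j = start
      go (suc e) rewrite ℕ.+-suc j e with suc (suc (j ℕ.+ e)) ℕ.≤? n
      ... | no  i+1≮n = outside-* g (ℕ.≰⇒> i+1≮n) (0≤h ⊗ 0≤D n (suc (j ℕ.+ e)))
      ... | yes i+1<n = by· (0<D (ℕ.≤-trans 0<j (ℕ.m≤m+n j e)) (ℕ.<⇒≤ i+1<n)) (0≤g ⊗ ‖ log-concave n (j ℕ.+ e)
          ⊕ 0≤D n (suc (j ℕ.+ e)) ⊗ ‖ go e)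
        (solve 5 (λ g h a b c → a :* (h :* b :- g :* c)
          := g :* (b :* b :- a :* c) :+ b :* (h :* a :- g :* b))
          refl g h (D n (j ℕ.+ e)) (D n (suc (j ℕ.+ e))) (D n (suc (suc (j ℕ.+ e)))))

    ratio-left : ∀ {n j} {g h : ℚ} → suc j ℕ.< n → 0ℚ ≤ g → 0ℚ ≤ h → h * D n j ≤ g * D n (suc j) →
                 ∀ i → i ℕ.≤ j → h * D n i ≤ g * D n (suc i)
    ratio-left {n} {zero}  k<n 0≤g 0≤h start zero z≤n = start
    ratio-left {n} {suc j} {g} {h} k<n 0≤g 0≤h start i i≤j+1 with ℕ.m≤n⇒m<n∨m≡n i≤j+1
    ... | inj₂ refl      = start
    ... | inj₁ (s≤s i≤j) = ratio-left (ℕ.<⇒≤ k<n) 0≤g 0≤h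
      (by· (0<D (s≤s z≤n) k<n) (0≤h ⊗ ‖ log-concave n j ⊕ 0≤D n (suc j) ⊗ ‖ start)
        (solve 5 (λ g h a b c → c :* (g :* b :- h :* a)
          := h :* (b :* b :- a :* c) :+ b :* (g :* c :- h :* b))
          refl g h (D n j) (D n (suc j)) (D n (suc (suc j)))))
      i i≤j

module Triangles where

  open Prelude
  open OrderedField
  open Means
  open Defs using (T; T-outside; T-positive; a; b)

  T-suc : ∀ t n k → ι (T t (suc n) (suc k)) ≡ ι (a t (suc n) (suc k)) * ι (T t n k) + ι (b t (suc n) (suc k)) * ι (T t n (suc k))
  T-suc t n k = trans (ι-+ (a t (suc n) (suc k) ℕ.* T t n k) (b t (suc n) (suc k) ℕ.* T t n (suc k)))
    (cong₂ _+_ (ι-* (a t (suc n) (suc k)) (T t n k)) (ι-* (b t (suc n) (suc k)) (T t n (suc k))))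

  row-sum : ∀ t n L (g : ℕ → ℚ) → n ℕ.< L →
    ∑ (suc L) (λ k → ι (T t (suc n) k) * g k) ≡
    ∑ L (λ k → ι (T t n k) * (ι (a t (suc n) (suc k)) * g (suc k) + ι (b t (suc n) k) * g k))
  row-sum t n L g n<L = begin
    ∑ (suc L) (λ k → ι (T t (suc n) k) * g k)
      ≡⟨ ∑-shift L _ ⟩
    ι (b₀ ℕ.* T t n 0) * g 0 + ∑ L (λ k → ι (T t (suc n) (suc k)) * g (suc k))
      ≡⟨ cong₂ _+_ (cong (_* g 0) (ι-* b₀ (T t n 0))) (∑-cong L λ k _ → expand k) ⟩
    ι b₀ * ι (T t n 0) * g 0 + ∑ L (λ k → up k + stay (suc k))
      ≡⟨ cong (stay 0 +_) (∑-+ L up (λ k → stay (suc k))) ⟩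
    stay 0 + (∑ L up + ∑ L (λ k → stay (suc k)))
      ≡⟨ solve 3 (λ s u v → s :+ (u :+ v) := u :+ (s :+ v)) refl (stay 0) (∑ L up) (∑ L (λ k → stay (suc k))) ⟩
    ∑ L up + (stay 0 + ∑ L (λ k → stay (suc k)))
      ≡⟨ cong (∑ L up +_) (sym (∑-shift L stay)) ⟩
    ∑ L up + (∑ L stay + stay L)
      ≡⟨ cong (λ s → ∑ L up + (∑ L stay + s)) stay-L ⟩
    ∑ L up + (∑ L stay + 0ℚ)
      ≡⟨ cong (∑ L up +_) (ℚ.+-identityʳ (∑ L stay)) ⟩
    ∑ L up + ∑ L stay
      ≡⟨ sym (∑-+ L up stay) ⟩
    ∑ L (λ k → up k + stay k)
      ≡⟨ ∑-cong L (λ k _ → collect k) ⟩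
    ∑ L (λ k → ι (T t n k) * (ι (a t (suc n) (suc k)) * g (suc k) + ι (b t (suc n) k) * g k)) ∎
    where
    open ≡-Reasoning
    b₀ : ℕ
    b₀ = b t (suc n) 0
    up stay : ℕ → ℚ
    up k   = ι (a t (suc n) (suc k)) * ι (T t n k) * g (suc k)
    stay k = ι (b t (suc n) k) * ι (T t n k) * g k
    expand : ∀ k → ι (T t (suc n) (suc k)) * g (suc k) ≡ up k + stay (suc k)
    expand k = trans (cong (_* g (suc k)) (T-suc t n k))
      (ℚ.*-distribʳ-+ (g (suc k)) (ι (a t (suc n) (suc k)) * ι (T t n k)) (ι (b t (suc n) (suc k)) * ι (T t n (suc k))))
    stay-L : stay L ≡ 0ℚ
    stay-L rewrite T-outside t n<L | ι0 = solve 2 (λ b g → b :* :0 :* g := :0) refl (ι (b t (suc n) L)) (g L)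
    collect : ∀ k → up k + stay k ≡ ι (T t n k) * (ι (a t (suc n) (suc k)) * g (suc k) + ι (b t (suc n) k) * g k)
    collect k = solve 5 (λ A B t g h → A :* t :* g :+ B :* t :* h := t :* (A :* g :+ B :* h)) refl (ι (a t (suc n) (suc k))) (ι (b t (suc n) k)) (ι (T t n k)) (g (suc k)) (g k)

  total : ∀ t (G : ℕ → ℕ → ℚ) (X μ : ℕ → ℚ) → G 0 0 ≡ 1ℚ → X 0 ≡ 1ℚ → (∀ n → X (suc n) ≡ μ n * X n) →
    (∀ n k → k ℕ.≤ n → ι (a t (suc n) (suc k)) * G (suc n) (suc k) + ι (b t (suc n) k) * G (suc n) k ≡ μ n * G n k) →
    ∀ n {L} → n ℕ.< L → ∑ L (λ k → ι (T t n k) * G n k) ≡ X n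
  total t G X μ G00 X0 X-suc step zero {suc L} _ = begin
    ∑ (suc L) (λ k → ι (T t 0 k) * G 0 k)                     ≡⟨ ∑-shift L _ ⟩
    ι 1 * G 0 0 + ∑ L (λ k → ι 0 * G 0 (suc k))               ≡⟨ cong₂ (λ s u → ι 1 * s + u) G00 (∑-* L (ι 0) (λ k → G 0 (suc k))) ⟩
    ι 1 * 1ℚ + ι 0 * ∑ L (λ k → G 0 (suc k))                  ≡⟨ cong₂ (λ s u → s * 1ℚ + u * ∑ L (λ k → G 0 (suc k))) ι1 ι0 ⟩
    1ℚ * 1ℚ + 0ℚ * ∑ L (λ k → G 0 (suc k))                    ≡⟨ solve 1 (λ s → :1 :* :1 :+ :0 :* s := :1) refl (∑ L (λ k → G 0 (suc k))) ⟩
    1ℚ                                                        ≡⟨ sym X0 ⟩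
    X 0                                                       ∎
    where open ≡-Reasoning
  total t G X μ G00 X0 X-suc step (suc n) {suc L} (s≤s n<L) = begin
    ∑ (suc L) (λ k → ι (T t (suc n) k) * G (suc n) k)         ≡⟨ row-sum t n L (G (suc n)) n<L ⟩
    ∑ L (λ k → ι (T t n k) * (ι (a t (suc n) (suc k)) * G (suc n) (suc k) + ι (b t (suc n) k) * G (suc n) k))
                                                              ≡⟨ ∑-cong L (λ k _ → term k) ⟩
    ∑ L (λ k → μ n * (ι (T t n k) * G n k))                   ≡⟨ ∑-* L (μ n) _ ⟩
    μ n * ∑ L (λ k → ι (T t n k) * G n k)                     ≡⟨ cong (μ n *_) (total t G X μ G00 X0 X-suc step n n<L) ⟩
    μ n * X n                                                 ≡⟨ sym (X-suc n) ⟩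
    X (suc n)                                                 ∎
    where
    open ≡-Reasoning
    term : ∀ k → ι (T t n k) * (ι (a t (suc n) (suc k)) * G (suc n) (suc k) + ι (b t (suc n) k) * G (suc n) k)
               ≡ μ n * (ι (T t n k) * G n k)
    term k with k ℕ.≤? n
    ... | yes k≤n = trans (cong (ι (T t n k) *_) (step n k k≤n))
      (solve 3 (λ t m g → t :* (m :* g) := m :* (t :* g)) refl (ι (T t n k)) (μ n) (G n k))
    ... | no  k≰n rewrite T-outside t (ℕ.≰⇒> k≰n) | ι0 = solve 3 (λ r m g → :0 :* r := m :* (:0 :* g)) refl (ι (a t (suc n) (suc k)) * G (suc n) (suc k) + ι (b t (suc n) k) * G (suc n) k) (μ n) (G n k)

  0≤T : ∀ t n k → 0ℚ ≤ ι (T t n k)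
  0≤T t n k = 0≤ι (T t n k)

  0<T : ∀ t {n k} → 0 ℕ.< k → k ℕ.< n → 0ℚ < ι (T t n k)
  0<T t 0<k k<n = 0<ι (T-positive t 0<k k<n)

  ι-outside : ∀ t {n k} → n ℕ.< k → ι (T t n k) ≡ 0ℚ
  ι-outside t n<k = trans (cong ι (T-outside t n<k)) ι0

  T-suc₀ : ∀ t n → ι (T t (suc n) 0) ≡ ι (b t (suc n) 0) * ι (T t n 0)
  T-suc₀ t n = ι-* (b t (suc n) 0) (T t n 0)

  ratio-≤ : ∀ {w w′ g y : ℚ} → 0ℚ < g → 0ℚ ≤ w → g * w′ ≤ y * w → y ≤ g → w′ ≤ w
  ratio-≤ {w} {w′} {g} {y} 0<g 0≤w gw′≤yw y≤g = by· 0<g (‖ gw′≤yw ⊕ ‖ y≤g ⊗ 0≤w)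
    (solve 4 (λ w w′ g y → g :* (w :- w′) := y :* w :- g :* w′ :+ (g :- y) :* w) refl w w′ g y)

  ratio-decay : ∀ {w w′ g y Q : ℚ} → 0ℚ < g → 0ℚ ≤ w → 1ℚ ≤ Q → g * w′ ≤ y * w → Q * y ≤ (Q - 1ℚ) * g →
                Q * w′ ≤ (Q - 1ℚ) * w
  ratio-decay {w} {w′} {g} {y} {Q} 0<g 0≤w 1≤Q gw′≤yw Qy≤ = by· 0<g (ℚ.≤-trans (0≤# 1) 1≤Q ⊗ ‖ gw′≤yw
      ⊕ ‖ Qy≤ ⊗ 0≤w)
    (solve 5 (λ w w′ g y Q → g :* ((Q :- :1) :* w :- Q :* w′)
      := Q :* (y :* w :- g :* w′) :+ ((Q :- :1) :* g :- Q :* y) :* w) refl w w′ g y Q)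

  ι-∸-≥ : ∀ m n → ι m - ι n ≤ ι (m ℕ.∸ n)
  ι-∸-≥ m n with ℕ.≤-total n m
  ... | inj₁ n≤m = ℚ.≤-reflexive (sym (ι-∸ n≤m))
  ... | inj₂ m≤n = ℚ.≤-trans (by {(ι m) - (ι n)} {0ℚ} (‖ ι-mono m≤n)
    (solve 2 (λ m n → :0 :- (m :- n) := n :- m) refl (ι m) (ι n))) (0≤ι (m ℕ.∸ n))

module Transversality where

  open Prelude
  open OrderedField
  open Powers

  mono-* : ∀ {p q r s : ℚ} → 0ℚ ≤ p → 0ℚ ≤ s → p ≤ q → r ≤ s → p * r ≤ q * s
  mono-* {p} {q} {r} {s} 0≤p 0≤s p≤q r≤s = by (0≤p ⊗ ‖ r≤s ⊕ 0≤s ⊗ ‖ p≤q)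
    (solve 4 (λ p q r s → q :* s :- p :* r := p :* (s :- r) :+ s :* (q :- p)) refl p q r s)

  K₂ K₁ Kₑ : ℚ → ℚ
  K₂ B = (B * (1ℚ + B) + # 2 * B) * ((# 2 + B) * (# 2 + B))
  K₁ B = B * (1ℚ + B * B + B) + B * (1ℚ + B * B) * (# 2 + B) + B
  Kₑ B = # 2 * (B * (1ℚ + B) + B * (B + 1ℚ + B) + B * B + B) * ((# 16 + B * B) * ((1ℚ + B) * (1ℚ + B)))

  -- θ ↦ (1 - e^{-θ})/θ is decreasing: E and e stand for e^{-θ} and e^{-t}, θ = t + Δ.
  transversal₂ : ∀ {κ κ′ t Δ E e τ B : ℚ} → 0ℚ ≤ τ → 0ℚ ≤ t → 0ℚ ≤ Δ → t + Δ ≤ B → κ′ ≤ κ + τ →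
    E ≤ 1ℚ - κ * (t + Δ) + τ → 1ℚ - κ′ * t ≤ e + τ → e * (1ℚ - Δ) ≤ E + τ →
    e * ((# 2 + t) * (# 2 + t)) ≤ # 4 →
    Δ * (t * t) ≤ τ * K₂ B
  transversal₂ {κ} {κ′} {t} {Δ} {E} {e} {τ} {B} 0≤τ 0≤t 0≤Δ θ≤B κ′≤κ h₁ h₂ h₃ h₄ = ℚ.≤-trans
    (by {Δ * (t * t)} {τ * (((t + Δ) * (1ℚ + t) + (# 2) * t) * (((# 2) + t) * ((# 2) + t)))} (0≤Δ ⊗ (0≤# 1 ⊕ 0≤t) ⊗ ‖ h₄
        ⊕ sq ((# 2) + t) ⊗ ‖ close)
      (solve 4 (λ Δ t e τ → τ :* (((t :+ Δ) :* (:1 :+ t) :+ :# 2 :* t) :* ((:# 2 :+ t) :* (:# 2 :+ t)))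
        :- Δ :* (t :* t)
        := Δ :* (:# 1 :+ t) :* (:# 4 :- e :* ((:# 2 :+ t) :* (:# 2 :+ t)))
        :+ (:# 2 :+ t) :* (:# 2 :+ t) :* (τ :* ((t :+ Δ) :* (:1 :+ t) :+ :# 2 :* t) :- Δ :* (:1 :- e :- t :* e)))
        refl Δ t e τ))
    (by (0≤τ ⊗ ‖ mono-* (0≤θ ⊗ (0≤# 1 ⊕ 0≤t) ⊕ 0≤# 2 ⊗ 0≤t) (sq (# 2 + B))
        (ℚ.+-mono-≤ (mono-* 0≤θ (0≤# 1 ⊕ 0≤B) θ≤B (ℚ.+-monoʳ-≤ 1ℚ t≤B)) (mono-* (0≤# 2) 0≤B ℚ.≤-refl t≤B))
        (mono-* (0≤# 2 ⊕ 0≤t) (0≤# 2 ⊕ 0≤B) (ℚ.+-monoʳ-≤ (# 2) t≤B) (ℚ.+-monoʳ-≤ (# 2) t≤B)))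
      (solve 3 (λ a τ c → τ :* c :- τ :* a
        := τ :* (c :- a))
        refl (((t + Δ) * (1ℚ + t) + # 2 * t) * ((# 2 + t) * (# 2 + t))) τ ((B * (1ℚ + B) + # 2 * B) * ((# 2 + B) * (# 2 + B)))))
    where
    0≤θ : 0ℚ ≤ t + Δ
    0≤θ = 0≤t ⊕ 0≤Δ
    0≤B : 0ℚ ≤ B
    0≤B = ℚ.≤-trans 0≤θ θ≤B
    t≤B : t ≤ B
    t≤B = by (‖ θ≤B ⊕ 0≤Δ) (solve 3 (λ t Δ B → B :- t := B :- (t :+ Δ) :+ Δ) refl t Δ B)
    close : Δ * (1ℚ - e - t * e) ≤ τ * ((t + Δ) * (1ℚ + t) + # 2 * t)
    close = by (0≤θ ⊗ ‖ h₂ ⊕ 0≤θ ⊗ 0≤t ⊗ ‖ κ′≤κ ⊕ 0≤t ⊗ ‖ h₁ ⊕ 0≤t ⊗ ‖ h₃)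
      (solve 7 (λ κ κ′ t Δ E e τ → τ :* ((t :+ Δ) :* (:1 :+ t) :+ :# 2 :* t) :- Δ :* (:1 :- e :- t :* e)
        := (t :+ Δ) :* (e :+ τ :- (:1 :- κ′ :* t)) :+ (t :+ Δ) :* t :* (κ :+ τ :- κ′)
        :+ t :* (:1 :- κ :* (t :+ Δ) :+ τ :- E) :+ t :* (E :+ τ :- e :* (:1 :- Δ))) refl κ κ′ t Δ E e τ)

  -- θ ↦ (e^θ - 1)/θ is increasing.
  transversal₁ : ∀ {ν ν′ t Δ E e τ B γ : ℚ} → 0ℚ ≤ τ → 0ℚ ≤ t → 0ℚ ≤ Δ → t + Δ ≤ B → 0ℚ ≤ ν → ν ≤ B → 0ℚ ≤ ν′ → ν′ ≤ B →
    0ℚ ≤ e → e ≤ 1ℚ → ν ≤ ν′ + τ →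
    1ℚ ≤ (1ℚ + ν * (t + Δ)) * (E + τ) → (e - τ) * (1ℚ + ν′ * t) ≤ 1ℚ → E * (1ℚ + Δ) ≤ e + τ →
    γ ≤ t - 1ℚ + e + τ →
    Δ * γ ≤ τ * K₁ B
  transversal₁ {ν} {ν′} {t} {Δ} {E} {e} {τ} {B} {γ} 0≤τ 0≤t 0≤Δ θ≤B 0≤ν ν≤B 0≤ν′ ν′≤B 0≤e e≤1 ν≤ν′ h₁ h₂ h₃ γ≤ = ℚ.≤-trans
    (by {Δ * γ} {τ * ((t + Δ) * (1ℚ + ν′ * t + e * t) + t * (1ℚ + ν * (t + Δ)) * ((# 2) + Δ) + Δ)} (0≤θ ⊗ ‖ h₂
        ⊕ 0≤θ ⊗ 0≤e ⊗ 0≤t ⊗ ‖ ν≤ν′ ⊕ 0≤t ⊗ (0≤# 1 ⊕ 0≤Δ) ⊗ ‖ h₁ ⊕ 0≤t ⊗ (0≤# 1 ⊕ 0≤ν ⊗ 0≤θ) ⊗ ‖ h₃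
        ⊕ 0≤Δ ⊗ ‖ γ≤)
      (solve 8 (λ ν ν′ t Δ E e τ γ → τ :* ((t :+ Δ) :* (:1 :+ ν′ :* t :+ e :* t) :+ t :* (:1 :+ ν :* (t :+ Δ)) :* (:# 2 :+ Δ) :+ Δ)
        :- Δ :* γ
        := (t :+ Δ) :* (:1 :- (e :- τ) :* (:1 :+ ν′ :* t)) :+ (t :+ Δ) :* e :* t :* (ν′ :+ τ :- ν)
        :+ t :* (:# 1 :+ Δ) :* ((:1 :+ ν :* (t :+ Δ)) :* (E :+ τ) :- :1)
        :+ t :* (:# 1 :+ ν :* (t :+ Δ)) :* (e :+ τ :- E :* (:1 :+ Δ)) :+ Δ :* (t :- :1 :+ e :+ τ :- γ))
        refl ν ν′ t Δ E e τ γ))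
    (by (0≤τ ⊗ ‖ bound)
      (solve 3 (λ u τ c → τ :* c :- τ :* u
        := τ :* (c :- u))
        refl ((t + Δ) * (1ℚ + ν′ * t + e * t) + t * (1ℚ + ν * (t + Δ)) * (# 2 + Δ) + Δ) τ (B * (1ℚ + B * B + B) + B * (1ℚ + B * B) * (# 2 + B) + B)))
    where
    0≤θ : 0ℚ ≤ t + Δ
    0≤θ = 0≤t ⊕ 0≤Δ
    0≤B : 0ℚ ≤ B
    0≤B = ℚ.≤-trans 0≤θ θ≤B
    t≤B : t ≤ B
    t≤B = by (‖ θ≤B ⊕ 0≤Δ) (solve 3 (λ t Δ B → B :- t := B :- (t :+ Δ) :+ Δ) refl t Δ B)
    Δ≤B : Δ ≤ B
    Δ≤B = by (‖ θ≤B ⊕ 0≤t) (solve 3 (λ t Δ B → B :- Δ := B :- (t :+ Δ) :+ t) refl t Δ B)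
    bound : (t + Δ) * (1ℚ + ν′ * t + e * t) + t * (1ℚ + ν * (t + Δ)) * (# 2 + Δ) + Δ
          ≤ B * (1ℚ + B * B + B) + B * (1ℚ + B * B) * (# 2 + B) + B
    bound = ℚ.+-mono-≤ (ℚ.+-mono-≤
      (mono-* 0≤θ (0≤# 1 ⊕ 0≤B ⊗ 0≤B ⊕ 0≤B) θ≤B (ℚ.+-mono-≤ (ℚ.+-monoʳ-≤ 1ℚ (mono-* 0≤ν′ 0≤B ν′≤B t≤B))
        (by (0≤t ⊗ ‖ e≤1 ⊕ ‖ t≤B) (solve 3 (λ e t B → B :- e :* t := t :* (:1 :- e) :+ (B :- t)) refl e t B))))
      (mono-* (0≤t ⊗ (0≤# 1 ⊕ 0≤ν ⊗ 0≤θ)) (0≤# 2 ⊕ 0≤B)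
        (mono-* 0≤t (0≤# 1 ⊕ 0≤B ⊗ 0≤B) t≤B (ℚ.+-monoʳ-≤ 1ℚ (mono-* 0≤ν 0≤B ν≤B θ≤B))) (ℚ.+-monoʳ-≤ (# 2) Δ≤B))) Δ≤B

  -- θ ↦ 1/(1 - e^{-θ}) - 1/θ is increasing.
  transversalₑ : ∀ {κ κ′ θ Δ E e τ B : ℚ} → 0ℚ ≤ τ → 0ℚ ≤ θ → 0ℚ ≤ Δ → θ + Δ ≤ B → 0ℚ ≤ κ → κ ≤ 1ℚ → 0ℚ ≤ κ′ → κ′ ≤ 1ℚ →
    0ℚ ≤ E → E ≤ 1ℚ → 0ℚ ≤ e → e ≤ 1ℚ → κ′ ≤ κ + τ →
    (1ℚ - E - τ) * (1ℚ + κ * θ) ≤ θ → θ + Δ ≤ (1ℚ - e + τ) * (1ℚ + κ′ * (θ + Δ)) →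
    E * (1ℚ - Δ) ≤ e + τ → e ≤ E + τ →
    θ * θ * (# 16 + θ * θ) * E ≤ # 16 * ((1ℚ - E) * (1ℚ - E)) → E * (1ℚ + θ) ≤ 1ℚ → # 32 * Δ ≤ θ * θ * θ →
    Δ * (θ * θ * (θ * θ)) ≤ τ * Kₑ B
  transversalₑ {κ} {κ′} {θ} {Δ} {E} {e} {τ} {B} 0≤τ 0≤θ 0≤Δ θ′≤B 0≤κ κ≤1 0≤κ′ κ′≤1 0≤E E≤1 0≤e e≤1 κ′≤κ h₁ h₂ h₃ h₃′ h₄ h₅ h₆ =
    (by (0≤# 2 ⊗ (sq (1ℚ + θ) ⊗ (0≤# 16 ⊕ sq θ)) ⊗ ‖ near
        ⊕ 0≤# 2 ⊗ 0≤τ ⊗ 0≤K ⊗ ‖ mono-* (0≤# 16 ⊕ sq θ) (sq (1ℚ + B)) (ℚ.+-monoʳ-≤ (# 16) (mono-* 0≤θ 0≤B θ≤B θ≤B)) (mono-* (0≤# 1 ⊕ 0≤θ) (0≤# 1 ⊕ 0≤B) (ℚ.+-monoʳ-≤ 1ℚ θ≤B) (ℚ.+-monoʳ-≤ 1ℚ θ≤B))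
        ⊕ 0≤Δ ⊗ ‖ gap)
      (solve 7 (λ Δ θ E τ K U V → τ :* (:# 2 :* K :* (V :* U)) :- Δ :* (θ :* θ :* (θ :* θ))
        := :# 2 :* ((:1 :+ θ) :* (:1 :+ θ) :* (:# 16 :+ θ :* θ)) :* (τ :* K :- Δ :* ((:1 :- E) :* (:1 :- E) :- θ :* (θ :+ Δ) :* E))
        :+ :# 2 :* τ :* K :* (V :* U :- (:# 16 :+ θ :* θ) :* ((:1 :+ θ) :* (:1 :+ θ)))
        :+ Δ :* (:# 2 :* ((:# 16 :+ θ :* θ) :* ((:1 :+ θ) :* (:1 :+ θ))) :* ((:1 :- E) :* (:1 :- E) :- θ :* (θ :+ Δ) :* E) :- θ :* θ :* (θ :* θ)))
        refl Δ θ E τ K ((1ℚ + B) * (1ℚ + B)) (# 16 + B * B)))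
    where
    K θ′ : ℚ
    K  = B * (1ℚ + B) + B * (B + 1ℚ + B) + B * B + B
    θ′ = θ + Δ
    0≤θ′ : 0ℚ ≤ θ′
    0≤θ′ = 0≤θ ⊕ 0≤Δ
    0≤B : 0ℚ ≤ B
    0≤B = ℚ.≤-trans 0≤θ′ θ′≤B
    θ≤B : θ ≤ B
    θ≤B = by (‖ θ′≤B ⊕ 0≤Δ) (solve 3 (λ θ Δ B → B :- θ := B :- (θ :+ Δ) :+ Δ) refl θ Δ B)
    Δ≤B : Δ ≤ B
    Δ≤B = by (‖ θ′≤B ⊕ 0≤θ) (solve 3 (λ θ Δ B → B :- Δ := B :- (θ :+ Δ) :+ θ) refl θ Δ B)
    0≤K : 0ℚ ≤ K
    0≤K = 0≤B ⊗ (0≤# 1 ⊕ 0≤B) ⊕ 0≤B ⊗ (0≤B ⊕ 0≤# 1 ⊕ 0≤B) ⊕ 0≤B ⊗ 0≤B ⊕ 0≤B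
    1-e≤1 : 1ℚ - e ≤ 1ℚ
    1-e≤1 = by 0≤e (solve 1 (λ e → :1 :- (:1 :- e) := e) refl e)
    1-E≤1 : 1ℚ - E ≤ 1ℚ
    1-E≤1 = by 0≤E (solve 1 (λ E → :1 :- (:1 :- E) := E) refl E)
    scale : ∀ {p q r} → 0ℚ ≤ p → 0ℚ ≤ r → q ≤ 1ℚ → p ≤ r → p * q ≤ r
    scale {p} {q} {r} 0≤p 0≤r q≤1 p≤r = by (0≤p ⊗ ‖ q≤1 ⊕ ‖ p≤r)
      (solve 3 (λ p q r → r :- p :* q := p :* (:1 :- q) :+ (r :- p)) refl p q r)
    scale′ : ∀ {p q r} → 0ℚ ≤ p → p ≤ 1ℚ → 0ℚ ≤ q → q ≤ r → p * q ≤ r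
    scale′ {p} {q} {r} 0≤p p≤1 0≤q q≤r = by (0≤q ⊗ ‖ p≤1 ⊕ ‖ q≤r)
      (solve 3 (λ p q r → r :- p :* q := q :* (:1 :- p) :+ (r :- q)) refl p q r)
    near : Δ * ((1ℚ - E) * (1ℚ - E) - θ * (θ + Δ) * E) ≤ τ * K
    near = ℚ.≤-trans
      (by {Δ * ((1ℚ - E) * (1ℚ - E) - θ * (θ + Δ) * E)} {τ * ((θ + Δ) * (1ℚ - e) * (1ℚ + κ * θ) + θ * (1ℚ - E) * ((1ℚ - e) * (θ + Δ) + 1ℚ + κ′ * (θ + Δ)) + θ * (θ + Δ) + Δ * (1ℚ - E))} (0≤θ ⊗ ‖ E≤1 ⊗ ‖ h₂
          ⊕ 0≤θ ⊗ ‖ E≤1 ⊗ ‖ e≤1 ⊗ 0≤θ′ ⊗ ‖ κ′≤κ ⊕ 0≤θ′ ⊗ ‖ e≤1 ⊗ ‖ h₁ ⊕ 0≤θ ⊗ 0≤θ′ ⊗ ‖ h₃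
          ⊕ 0≤Δ ⊗ ‖ E≤1 ⊗ ‖ h₃′)
        (solve 7 (λ κ κ′ θ Δ E e τ → τ :* ((θ :+ Δ) :* (:1 :- e) :* (:1 :+ κ :* θ) :+ θ :* (:1 :- E) :* ((:1 :- e) :* (θ :+ Δ) :+ :1 :+ κ′ :* (θ :+ Δ)) :+ θ :* (θ :+ Δ) :+ Δ :* (:1 :- E))
          :- Δ :* ((:1 :- E) :* (:1 :- E) :- θ :* (θ :+ Δ) :* E)
          := θ :* (:1 :- E) :* ((:1 :- e :+ τ) :* (:1 :+ κ′ :* (θ :+ Δ)) :- (θ :+ Δ))
          :+ θ :* (:1 :- E) :* (:1 :- e) :* (θ :+ Δ) :* (κ :+ τ :- κ′)
          :+ (θ :+ Δ) :* (:1 :- e) :* (θ :- (:1 :- E :- τ) :* (:1 :+ κ :* θ))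
          :+ θ :* (θ :+ Δ) :* (e :+ τ :- E :* (:1 :- Δ)) :+ Δ :* (:1 :- E) :* (E :+ τ :- e))
          refl κ κ′ θ Δ E e τ))
      (by (0≤τ ⊗ ‖ ℚ.+-mono-≤ (ℚ.+-mono-≤ (ℚ.+-mono-≤
          (mono-* (0≤θ′ ⊗ ‖ e≤1) (0≤# 1 ⊕ 0≤B) (scale 0≤θ′ 0≤B 1-e≤1 θ′≤B) (ℚ.+-monoʳ-≤ 1ℚ (scale′ 0≤κ κ≤1 0≤θ θ≤B)))
          (mono-* (0≤θ ⊗ ‖ E≤1) (0≤B ⊕ 0≤# 1 ⊕ 0≤B) (scale 0≤θ 0≤B 1-E≤1 θ≤B)
            (ℚ.+-mono-≤ (ℚ.+-monoˡ-≤ 1ℚ (scale′ (‖ e≤1) 1-e≤1 0≤θ′ θ′≤B)) (scale′ 0≤κ′ κ′≤1 0≤θ′ θ′≤B))))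
          (mono-* 0≤θ 0≤B θ≤B θ′≤B)) (scale 0≤Δ 0≤B 1-E≤1 Δ≤B))
        (solve 3 (λ u τ K → τ :* K :- τ :* u
          := τ :* (K :- u))
          refl ((θ + Δ) * (1ℚ - e) * (1ℚ + κ * θ) + θ * (1ℚ - E) * ((1ℚ - e) * (θ + Δ) + 1ℚ + κ′ * (θ + Δ)) + θ * (θ + Δ) + Δ * (1ℚ - E)) τ K))
    gap : θ * θ * (θ * θ) ≤ # 2 * ((# 16 + θ * θ) * ((1ℚ + θ) * (1ℚ + θ))) * ((1ℚ - E) * (1ℚ - E) - θ * (θ + Δ) * E)
    gap = by· (0<# 15)
      ((0≤# 1 ⊕ 0≤θ) ⊗ (0≤# 1 ⊕ 0≤θ) ⊗ (((0≤# 32 ⊕ sq θ) ⊗ ‖ h₄) ⊕ (0≤# 16 ⊕ sq θ) ⊗ 0≤θ ⊗ 0≤E ⊗ ‖ h₆)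
        ⊕ 0≤# 16 ⊗ sq θ ⊗ (‖ h₅ ⊗ ((0≤# 1 ⊕ 0≤θ) ⊗ (‖ E≤1) ⊕ 0≤θ)))
      (solve 3 (λ θ Δ E → :# 16 :* (:# 2 :* ((:# 16 :+ θ :* θ) :* ((:1 :+ θ) :* (:1 :+ θ))) :* ((:1 :- E) :* (:1 :- E) :- θ :* (θ :+ Δ) :* E) :- θ :* θ :* (θ :* θ)) := (:# 1 :+ θ) :* (:# 1 :+ θ) :* ((:# 32 :+ θ :* θ) :* (:# 16 :* ((:1 :- E) :* (:1 :- E)) :- θ :* θ :* (:# 16 :+ θ :* θ) :* E) :+ (:# 16 :+ θ :* θ) :* θ :* E :* (θ :* θ :* θ :- :# 32 :* Δ)) :+ :# 16 :* (θ :* θ) :* ((:1 :- E :* (:1 :+ θ)) :* ((:# 1 :+ θ) :* (:1 :- E) :+ θ))) refl θ Δ E)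

module Approximation where

  open Prelude
  open OrderedField
  open Powers
  open Means
  open import Data.Integer.Base using (+_; +≤+; +<+)
  open Defs using (Triangle; T; p₁; a)

  opaque
    *-inverse : ∀ {p} → 0ℚ < p → Σ[ q ∈ ℚ ] 0ℚ < q × p * q ≡ 1ℚ
    *-inverse {p} 0<p = (ℚ.1/ p) {{ℚ.>-nonZero 0<p}} ,
      ℚ.positive⁻¹ ((ℚ.1/ p) {{ℚ.>-nonZero 0<p}}) {{ℚ.1/pos⇒pos p {{positive 0<p}}}} ,
      ℚ.*-inverseʳ p {{ℚ.>-nonZero 0<p}}

  opaque
    inverse-≤ : ∀ {x M c d} → x * M ≡ 1ℚ → 0ℚ ≤ x → c ≤ d * M → c * x ≤ d
    inverse-≤ {x} {M} {c} {d} xM 0≤x le = subst (c * x ≤_) (trans (cong (d *_) xM) (ℚ.*-identityʳ d))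
      (by (0≤x ⊗ ‖ le) (solve 4 (λ x M c d → d :* (x :* M) :- c :* x := x :* (d :* M :- c)) refl x M c d))

  opaque
    inverse-≥ : ∀ {x M c d} → x * M ≡ 1ℚ → 0ℚ ≤ x → d * M ≤ c → d ≤ c * x
    inverse-≥ {x} {M} {c} {d} xM 0≤x le = subst (_≤ c * x) (trans (cong (d *_) xM) (ℚ.*-identityʳ d))
      (by (0≤x ⊗ ‖ le) (solve 4 (λ x M c d → c :* x :- d :* (x :* M) := x :* (c :- d :* M)) refl x M c d))

  opaque
    small : ∀ {γ C} → 0ℚ < γ → 0ℚ ≤ C → Σ[ τ ∈ ℚ ] 0ℚ < τ × τ * (1ℚ + C) ≡ γ
    small {γ} {C} 0<γ 0≤C with *-inverse (0<+ (0<# 0) 0≤C)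
    ... | r , 0<r , Cr = γ * r , 0<* 0<γ 0<r ,
      trans (solve 3 (λ γ r C → γ :* r :* (:1 :+ C) := γ :* ((:1 :+ C) :* r)) refl γ r C) (trans (cong (γ *_) Cr) (ℚ.*-identityʳ γ))

  opaque
    archimedean : ∀ p → ∃[ N ] p ≤ ι N
    archimedean p@(ℚ.mkℚ n d-1 _) = ℤ.∣ n ∣ , subst (p ≤_) (sym (ι-# ℤ.∣ n ∣))
      (ℚ.toℚᵘ-cancel-≤ (ℚᵘ.≤-respʳ-≃ (ℚᵘ.≃-sym (ℚ.toℚᵘ-fromℚᵘ (ℚᵘ.mkℚᵘ (+ ℤ.∣ n ∣) 0)))
        (ℚᵘ.*≤* (ℤ.≤-trans (ℤ.*-monoʳ-≤-nonNeg (+ 1) (≤∣∣ n)) (ℤ.*-monoˡ-≤-nonNeg (+ ℤ.∣ n ∣) (ℤ.+≤+ (s≤s z≤n)))))))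
      where
      ≤∣∣ : ∀ i → i ℤ.≤ + ℤ.∣ i ∣
      ≤∣∣ (+ n)        = ℤ.≤-refl
      ≤∣∣ (ℤ.-[1+ n ]) = ℤ.-≤+

  opaque
    eventually : ∀ {τ} c → 0ℚ < τ → ∃[ N ] ∀ n → N ℕ.≤ n → c ≤ τ * ι n
    eventually {τ} c 0<τ with *-inverse 0<τ
    ... | r , 0<r , τr with archimedean (c * r)
    ...   | N , cr≤N = N , λ n N≤n → ℚ.≤-trans
      (ℚ.≤-reflexive (trans (sym (ℚ.*-identityʳ c)) (trans (cong (c *_) (sym τr)) (solve 3 (λ c τ r → c :* (τ :* r) := τ :* (c :* r)) refl c τ r))))
      (by (ℚ.<⇒≤ 0<τ ⊗ ‖ ℚ.≤-trans cr≤N (ι-mono N≤n))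
        (solve 3 (λ τ c n → τ :* n :- τ :* c := τ :* (n :- c)) refl τ (c * r) (ι n)))

  opaque
    ceiling : ∀ {ρ p} → 0ℚ < ρ → 0ℚ ≤ p → ∃[ M ] p ≤ ρ * ι M × ρ * ι M ≤ p + ρ
    ceiling {ρ} {p} 0<ρ 0≤p with eventually p 0<ρ
    ... | N , enough = descend N (enough N ℕ.≤-refl)
      where
      descend : ∀ N → p ≤ ρ * ι N → ∃[ M ] p ≤ ρ * ι M × ρ * ι M ≤ p + ρ
      descend zero le = zero , le , subst (λ z → ρ * z ≤ p + ρ) (sym ι0)
        (by (0≤p ⊕ ℚ.<⇒≤ 0<ρ) (solve 2 (λ ρ p → p :+ ρ :- ρ :* :0 := p :+ ρ) refl ρ p))
      descend (suc N) le with ℚ.≤-total p (ρ * ι N)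
      ... | inj₁ p≤ = descend N p≤
      ... | inj₂ ≤p = suc N , le , subst (λ z → ρ * z ≤ p + ρ) (sym (ι-suc N))
        (by (‖ ≤p) (solve 3 (λ ρ p n → p :+ ρ :- ρ :* (:1 :+ n) := p :- ρ :* n) refl ρ p (ι N)))

  opaque
    quotient : ∀ u {v} → 0 ℕ.< v → ∃[ q ] ι v * ι q ≤ ι u × ι u ≤ ι v * (1ℚ + ι q)
    quotient u {v} 0<v = q , subst (_≤ ι u) (ι-* v q) (ι-mono (subst (ℕ._≤ u) (ℕ.*-comm q v) (ℕ.m/n*n≤m u v))) ,
      subst (ι u ≤_) (trans (ι-* v (suc q)) (cong (ι v *_) (ι-suc q))) (ι-mono u≤)
      where
      instance
        v≢0 : ℕ.NonZero v
        v≢0 = ℕ.>-nonZero 0<v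
      q : ℕ
      q = u ℕ./ v
      u≤ : u ℕ.≤ v ℕ.* suc q
      u≤ = subst₂ ℕ._≤_ (sym (ℕ.m≡m%n+[m/n]*n u v)) (ℕ.*-comm (suc q) v) (ℕ.+-monoˡ-≤ (q ℕ.* v) (ℕ.<⇒≤ (ℕ.m%n<n u v)))

  record Scale (H σ : ℚ) (n : ℕ) : Set where
    field
      d    : ℕ
      Q    : ℚ
      1≤Q  : 1ℚ ≤ Q
      Hn≤  : H * ι n ≤ (Q - 1ℚ) * ι d
      Q≤   : Q ≤ σ * ι d
      1+d≤ : 1ℚ + ι d ≤ σ * ι n

  opaque
    scale : ∀ {σ H} → 0ℚ < σ → 0ℚ ≤ H → ∃[ N ] ∀ n → N ℕ.≤ n → Scale H σ n
    scale {σ} {H} 0<σ 0≤H with *-inverse 0<σ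
    ... | r , 0<r , σr with eventually (# 4 * r + # 2 * r * r * (1ℚ + H * (# 2 * r))) (0<# 0)
    ...   | N , large = N , λ n N≤n → build n (subst (s ≤_) (ℚ.*-identityˡ (ι n)) (large n N≤n))
      where
      Q s : ℚ
      Q = 1ℚ + H * (# 2 * r)
      s = # 4 * r + # 2 * r * r * Q
      0≤r : 0ℚ ≤ r
      0≤r = ℚ.<⇒≤ 0<r
      0≤Q : 0ℚ ≤ Q
      0≤Q = 0≤# 1 ⊕ 0≤H ⊗ (0≤# 2 ⊗ 0≤r)
      build : ∀ n → s ≤ ι n → Scale H σ n
      build n s≤n with ceiling (0<* (0<# 1) 0<r) (0≤ι n)
      ... | d , n≤cd , cd≤ = record
        { d    = d
        ; Q    = Q
        ; 1≤Q  = by (0≤H ⊗ (0≤# 2 ⊗ 0≤r))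
          (solve 2 (λ H r → :1 :+ H :* (:# 2 :* r) :- :1 := H :* (:# 2 :* r)) refl H r)
        ; Hn≤  = by (0≤H ⊗ ‖ n≤cd)
          (solve 4 (λ H n r d → (:1 :+ H :* (:# 2 :* r) :- :1) :* d :- H :* n
            := H :* (:# 2 :* r :* d :- n)) refl H (ι n) r (ι d))
        ; Q≤   = subst (_≤ σ * ι d) (trans (solve 3 (λ σ r Q → σ :* (r :* Q) := σ :* r :* Q) refl σ r Q) (trans (cong (_* Q) σr) (ℚ.*-identityˡ Q)))
            (by (ℚ.<⇒≤ 0<σ ⊗ ‖ rQ≤d)
              (solve 4 (λ σ r Q d → σ :* d :- σ :* (r :* Q) := σ :* (d :- r :* Q)) refl σ r Q (ι d)))
        ; 1+d≤ = subst (_≤ σ * ι n) (trans (solve 3 (λ σ r e → σ :* (r :* e) := σ :* r :* e) refl σ r (1ℚ + ι d)) (trans (cong (_* (1ℚ + ι d)) σr) (ℚ.*-identityˡ (1ℚ + ι d))))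
            (by (ℚ.<⇒≤ 0<σ ⊗ ‖ r[1+d]≤n)
              (solve 4 (λ σ r d n → σ :* n :- σ :* (r :* (:1 :+ d))
                := σ :* (n :- r :* (:1 :+ d))) refl σ r (ι d) (ι n)))
        }
        where
        rQ≤d : r * Q ≤ ι d
        rQ≤d = by· (0<* (0<# 1) 0<r) (‖ n≤cd ⊕ ‖ s≤n ⊕ 0≤# 4 ⊗ 0≤r)
          (solve 4 (λ r Q d n → :# 2 :* r :* (d :- r :* Q)
            := :# 2 :* r :* d :- n :+ (n :- (:# 4 :* r :+ :# 2 :* r :* r :* Q)) :+ :# 4 :* r)
            refl r Q (ι d) (ι n))
        r[1+d]≤n : r * (1ℚ + ι d) ≤ ι n
        r[1+d]≤n = by· (0<# 1) (‖ cd≤ ⊕ ‖ s≤n ⊕ 0≤# 2 ⊗ 0≤r ⊗ 0≤r ⊗ 0≤Q)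
          (solve 4 (λ r d n Q → :# 2 :* (n :- r :* (:1 :+ d))
            := n :+ :# 2 :* r :- :# 2 :* r :* d :+ (n :- (:# 4 :* r :+ :# 2 :* r :* r :* Q))
            :+ :# 2 :* r :* r :* Q) refl r (ι d) (ι n) Q)

  stretch-≤ : ∀ {H σ n x G} → 0ℚ ≤ σ → 0ℚ ≤ x → ι n * x ≤ G → (sc : Scale H σ n) → (1ℚ + ι (Scale.d sc)) * x ≤ σ * G
  stretch-≤ {H} {σ} {n} {x} {G} 0≤σ 0≤x nx≤G sc = by (0≤x ⊗ ‖ Scale.1+d≤ sc ⊕ 0≤σ ⊗ ‖ nx≤G)
    (solve 5 (λ d x σ G n → σ :* G :- (:1 :+ d) :* x
      := x :* (σ :* n :- (:1 :+ d)) :+ σ :* (G :- n :* x)) refl (ι (Scale.d sc)) x σ G (ι n))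

  -- κ = k/n stays away from 0 and 1.
  record Regular (B : ℚ) (n k : ℕ) (κ : ℚ) : Set where
    field
      κn   : κ * ι n ≡ ι k
      k<n  : k ℕ.< n
      n≤Bk : ι n ≤ B * ι k
      n≤B[n-k] : ι n ≤ B * (ι n - ι k)

    0<n : 0ℚ < ι n
    0<n = 0<ι (ℕ.≤-<-trans z≤n k<n)
    κ≤1 : κ ≤ 1ℚ
    κ≤1 = ℚ.*-cancelʳ-≤-pos (ι n) {{positive 0<n}} (subst₂ _≤_ (sym κn) (sym (ℚ.*-identityˡ (ι n))) (ι-mono (ℕ.<⇒≤ k<n)))
    0≤κ : 0ℚ ≤ κ
    0≤κ = ℚ.*-cancelʳ-≤-pos (ι n) {{positive 0<n}} (subst₂ _≤_ (sym (ℚ.*-zeroˡ (ι n))) (sym κn) (0≤ι k))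

  module _ {B κ : ℚ} {n j : ℕ} (reg : Regular B n (suc j) κ) where
    open Regular reg

    two≤k : 0ℚ < B → # 4 * B ≤ ι n → 0 ℕ.< j
    two≤k 0<B 4B≤n = ℕ.s≤s⁻¹ (ι-cancel (subst (_≤ ι (suc j)) (sym (ι-# 2)) (by· 0<B (‖ n≤Bk ⊕ ‖ 4B≤n
        ⊕ 0≤# 2 ⊗ ℚ.<⇒≤ 0<B)
      (solve 3 (λ B n k → B :* (k :- :# 2)
        := B :* k :- n :+ (n :- :# 4 :* B) :+ :# 2 :* B) refl B (ι n) (ι (suc j))))))

    stretch-fits : ∀ {σ H} → 0ℚ ≤ σ → σ * B ≤ 1ℚ → (sc : Scale H σ n) → Scale.d sc ℕ.≤ j
    stretch-fits {σ} 0≤σ σB≤1 sc = ℕ.s≤s⁻¹ (ι-cancel (subst (_≤ ι (suc j)) (sym (ι-suc (Scale.d sc)))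
      (by (‖ Scale.1+d≤ sc ⊕ 0≤σ ⊗ ‖ n≤Bk ⊕ 0≤ι (suc j) ⊗ ‖ σB≤1)
        (solve 5 (λ e σ B n k → k :- (:1 :+ e)
          := σ :* n :- (:1 :+ e) :+ σ :* (B :* k :- n) :+ k :* (:1 :- σ :* B))
          refl (ι (Scale.d sc)) σ B (ι n) (ι (suc j))))))

  fraction-≥0 : ∀ {a s p} → 0ℚ < s → 0ℚ ≤ a → p * s ≡ a → 0ℚ ≤ p
  fraction-≥0 {s = s} {p} 0<s 0≤a eq = by· 0<s 0≤a (trans (solve 2 (λ s p → s :* (p :- :0) := p :* s) refl s p) eq)

  fraction-≤1 : ∀ {a r p} → 0ℚ < a + r → 0ℚ ≤ r → p * (a + r) ≡ a → p ≤ 1ℚ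
  fraction-≤1 {a} {r} {p} 0<s 0≤r eq = by· 0<s 0≤r (trans (solve 2 (λ s p → s :* (:1 :- p) := s :- p :* s) refl (a + r) p)
    (trans (cong (λ t → a + r - t) eq) (solve 2 (λ a r → a :+ r :- a := r) refl a r)))

  -- p is p₁ (n + 1 , j + 1).
  Probability : Triangle → ℕ → ℕ → ℚ → Set
  Probability t n j p = p * ι (T t (suc n) (suc j)) ≡ ι (a t (suc n) (suc j)) * ι (T t n j)

  CauchyCriterion : Triangle → Set
  CauchyCriterion t = ∀ {B ε} → 1ℚ ≤ B → 0ℚ < ε → Σ[ δ ∈ ℚ ] 0ℚ < δ × (∃[ N ] ∀ {n j n′ j′ κ κ′ p p′} →
    N ℕ.≤ n → N ℕ.≤ n′ → Regular B n (suc j) κ → Regular B n′ (suc j′) κ′ → κ ≤ κ′ + δ → κ′ ≤ κ + δ →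
    Probability t n j p → Probability t n′ j′ p′ → p′ ≤ p + ε)

module Parameters where

  open Prelude
  open OrderedField
  open Powers
  open Approximation

  record Large (h R σ : ℚ) (n : ℕ) : Set where
    field
      sc   : Scale h σ n
      R≤σn : R ≤ σ * ι n

  record Setup (B ε : ℚ) (C γ S h R : ℚ → ℚ → ℚ) : Set where
    field
      η H τ σ : ℚ
      0<η   : 0ℚ < η
      η≤ε   : η ≤ ε
      ηB≤1  : η * B ≤ 1ℚ
      0<H   : 0ℚ < H
      ηH≡1  : η * H ≡ 1ℚ
      0<τ   : 0ℚ < τ
      τC≡γ  : τ * (1ℚ + C η H) ≡ γ η H
      0<σ   : 0ℚ < σ
      σS≡τ  : σ * (1ℚ + S η H) ≡ τ
      N     : ℕ
      large : ∀ n → N ℕ.≤ n → Large (h η H) (R η H) σ n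

  opaque
    setup : ∀ {B ε} (C γ S h R : ℚ → ℚ → ℚ) → 1ℚ ≤ B → 0ℚ < ε →
      (∀ {η H} → 0ℚ < η → 0ℚ < H → 0ℚ ≤ C η H × 0ℚ < γ η H × 0ℚ ≤ S η H × 0ℚ ≤ h η H) → Setup B ε C γ S h R
    setup {B} {ε} C γ S h R 1≤B 0<ε pos = from-inverse (*-inverse (ℚ.<-≤-trans (0<# 0) 1≤B))
      where
      0≤B : 0ℚ ≤ B
      0≤B = ℚ.≤-trans (0≤# 1) 1≤B
      from-η : ∀ η → 0ℚ < η → η ≤ ε → η * B ≤ 1ℚ → Setup B ε C γ S h R
      from-η η 0<η η≤ε ηB≤1 with *-inverse 0<η
      ... | H , 0<H , ηH with pos 0<η 0<H
      ...   | 0≤C , 0<γ , 0≤S , 0≤h with small 0<γ 0≤C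
      ...     | τ , 0<τ , τC with small 0<τ 0≤S
      ...       | σ , 0<σ , σS with scale {σ} {h η H} 0<σ 0≤h | eventually (R η H) 0<σ
      ...         | N₁ , sc | N₂ , ev = record
        { η = η ; H = H ; τ = τ ; σ = σ ; 0<η = 0<η ; η≤ε = η≤ε ; ηB≤1 = ηB≤1 ; 0<H = 0<H ; ηH≡1 = ηH
        ; 0<τ = 0<τ ; τC≡γ = τC ; 0<σ = 0<σ ; σS≡τ = σS ; N = N₁ ℕ.⊔ N₂
        ; large = λ n N≤n → record
          { sc = sc n (ℕ.≤-trans (ℕ.m≤m⊔n N₁ N₂) N≤n) ; R≤σn = ev n (ℕ.≤-trans (ℕ.m≤n⊔m N₁ N₂) N≤n) } }
      from-inverse : Σ[ r ∈ ℚ ] 0ℚ < r × B * r ≡ 1ℚ → Setup B ε C γ S h R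
      from-inverse (r , 0<r , Br) with ℚ.≤-total ε r
      ... | inj₁ ε≤r = from-η ε 0<ε ℚ.≤-refl (subst (ε * B ≤_) (trans (ℚ.*-comm r B) Br)
        (by (0≤B ⊗ ‖ ε≤r) (solve 3 (λ e B r → r :* B :- e :* B := B :* (r :- e)) refl ε B r)))
      ... | inj₂ r≤ε = from-η r 0<r r≤ε (ℚ.≤-reflexive (trans (ℚ.*-comm r B) Br))

module Stirling₂ where

  open Prelude
  open OrderedField
  open Powers
  open Means
  open LogConcavity
  open Triangles
  open Defs using (stirling₂; T)

  S : ℕ → ℕ → ℚ
  S n k = ι (T stirling₂ n k)

  S-suc : ∀ {n k} → k ℕ.≤ suc n → S (suc n) k ≡ 1ℚ * prev (S n) k + ι k * S n k
  S-suc {n} {zero} _ = trans (T-suc₀ stirling₂ n) (solve 1 (λ x → x := :1 :* :0 :+ x) refl (ι 0 * S n 0))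
  S-suc {n} {suc k} _ = trans (T-suc stirling₂ n k) (cong (λ o → o * S n k + ι (suc k) * S n (suc k)) ι1)

  open Linear S (λ _ _ → 1ℚ) (λ _ → ι) 0ℚ 1ℚ (0≤T stirling₂) (0<T stirling₂) (ι-outside stirling₂)
    S-suc (λ _ _ → sym (ℚ.+-identityʳ 1ℚ)) (λ _ k → trans (ι-suc k) (ℚ.+-comm 1ℚ (ι k))) (λ _ → 0≤# 1) (λ _ → 0≤ι) public

  ff : ℕ → ℕ → ℚ
  ff M zero    = 1ℚ
  ff M (suc k) = ff M k * ι (M ℕ.∸ k)

  0≤ff : ∀ M k → 0ℚ ≤ ff M k
  0≤ff M zero    = 0≤# 1
  0≤ff M (suc k) = 0≤ff M k ⊗ 0≤ι (M ℕ.∸ k)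

  ff-outside : ∀ {M k} → M ℕ.< k → ff M k ≡ 0ℚ
  ff-outside {M} {suc k} (s≤s M≤k) rewrite ℕ.m≤n⇒m∸n≡0 M≤k | ι0 = ℚ.*-zeroʳ (ff M k)

  ff-total : ∀ M n {L} → n ℕ.< L → ∑ L (λ k → S n k * ff M k) ≡ ι M ^ n
  ff-total M n {L} = total stirling₂ (λ _ → ff M) (ι M ^_) (λ _ → ι M) refl refl (λ _ → refl) (λ _ k _ → ff-step k) n {L}
    where
    ff-step : ∀ k → ι 1 * (ff M k * ι (M ℕ.∸ k)) + ι k * ff M k ≡ ι M * ff M k
    ff-step k with k ℕ.≤? M
    ... | yes k≤M = trans (cong₂ (λ o d → o * (ff M k * d) + ι k * ff M k) ι1 (ι-∸ k≤M))
      (solve 3 (λ f m k → :1 :* (f :* (m :- k)) :+ k :* f := m :* f) refl (ff M k) (ι M) (ι k))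
    ... | no  k≰M = trans (cong (λ f → ι 1 * (f * ι (M ℕ.∸ k)) + ι k * f) f≡0)
      (trans (solve 4 (λ o m d k → o :* (:0 :* d) :+ k :* :0 := m :* :0) refl (ι 1) (ι M) (ι (M ℕ.∸ k)) (ι k)) (cong (ι M *_) (sym f≡0)))
      where
      f≡0 : ff M k ≡ 0ℚ
      f≡0 = ff-outside (ℕ.≰⇒> k≰M)

  ff-pred : ∀ m k → ι (suc m) * ff m k ≡ ι (suc m ℕ.∸ k) * ff (suc m) k
  ff-pred m zero    = refl
  ff-pred m (suc k) = begin
    ι (suc m) * (ff m k * ι (m ℕ.∸ k))                    ≡⟨ sym (ℚ.*-assoc (ι (suc m)) (ff m k) _) ⟩
    ι (suc m) * ff m k * ι (m ℕ.∸ k)                      ≡⟨ cong (_* ι (m ℕ.∸ k)) (ff-pred m k) ⟩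
    ι (suc m ℕ.∸ k) * ff (suc m) k * ι (m ℕ.∸ k)          ≡⟨ solve 3 (λ x f y → x :* f :* y := y :* (f :* x)) refl (ι (suc m ℕ.∸ k)) (ff (suc m) k) (ι (m ℕ.∸ k)) ⟩
    ι (m ℕ.∸ k) * (ff (suc m) k * ι (suc m ℕ.∸ k))        ∎
    where open ≡-Reasoning

  -- w k is proportional to the probability that n balls thrown into M boxes occupy k of them,
  -- and z k = w k (M - k)/M: on average a proportion (1 - 1/M)^n of the boxes stays empty.
  module _ {n m : ℕ} {x : ℚ} (xM : x * ι (suc m) ≡ 1ℚ) (0≤x : 0ℚ ≤ x)
           {d : ℕ} {Q τ : ℚ} (1≤Q : 1ℚ ≤ Q) (M≤Qd : ι (suc m) ≤ (Q - 1ℚ) * ι d)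
           (Q≤τd : Q ≤ τ * ι d) (0≤τ : 0ℚ ≤ τ) where
    private
      M : ℕ
      M = suc m
      w z : ℕ → ℚ
      w k = S n k * ff M k
      z k = S n k * ff m k
      0≤w : ∀ k → 0ℚ ≤ w k
      0≤w k = 0≤T stirling₂ n k ⊗ 0≤ff M k
      0≤z : ∀ k → 0ℚ ≤ z k
      0≤z k = 0≤T stirling₂ n k ⊗ 0≤ff m k
      0<M : 0ℚ < ι M
      0<M = 0<ι (s≤s z≤n)
      Mz : ∀ k → ι M * z k ≡ ι (M ℕ.∸ k) * w k
      Mz k = begin
        ι M * (S n k * ff m k)          ≡⟨ solve 3 (λ M s f → M :* (s :* f) := s :* (M :* f)) refl (ι M) (S n k) (ff m k) ⟩
        S n k * (ι M * ff m k)          ≡⟨ cong (S n k *_) (ff-pred m k) ⟩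
        S n k * (ι (M ℕ.∸ k) * ff M k)  ≡⟨ solve 3 (λ y s f → s :* (y :* f) := y :* (s :* f)) refl (ι (M ℕ.∸ k)) (S n k) (ff M k) ⟩
        ι (M ℕ.∸ k) * (S n k * ff M k)  ∎
        where open ≡-Reasoning
      z-≤ : ∀ φ k → ι (M ℕ.∸ k) ≤ φ * ι M → z k ≤ φ * w k
      z-≤ φ k le = by· 0<M (‖ le ⊗ 0≤w k) (trans
        (trans (solve 4 (λ M φ w z → M :* (φ :* w :- z) := φ :* M :* w :- M :* z) refl (ι M) φ (w k) (z k)) (cong (λ s → φ * ι M * w k - s) (Mz k)))
        (solve 3 (λ a w y → a :* w :- y :* w := (a :- y) :* w) refl (φ * ι M) (w k) (ι (M ℕ.∸ k))))
      z-≥ : ∀ φ k → φ * ι M ≤ ι (M ℕ.∸ k) → φ * w k ≤ z k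
      z-≥ φ k le = by· 0<M (‖ le ⊗ 0≤w k) (trans
        (trans (solve 4 (λ M φ w z → M :* (z :- φ :* w) := M :* z :- φ :* M :* w) refl (ι M) φ (w k) (z k)) (cong (λ s → s - φ * ι M * w k) (Mz k)))
        (solve 3 (λ a w y → y :* w :- a :* w := (y :- a) :* w) refl (φ * ι M) (w k) (ι (M ℕ.∸ k))))
      z≤w : ∀ k → z k ≤ w k
      z≤w k = subst (z k ≤_) (ℚ.*-identityˡ (w k))
        (z-≤ 1ℚ k (subst (ι (M ℕ.∸ k) ≤_) (sym (ℚ.*-identityˡ (ι M))) (ι-mono (ℕ.m∸n≤m M k))))
      mean : ∀ L → n ℕ.< L → ∑ L z ≡ (1ℚ - x) ^ n * ∑ L w
      mean L n<L = begin
        ∑ L z                       ≡⟨ ff-total m n n<L ⟩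
        ι m ^ n                     ≡⟨ cong (_^ n) m≡ ⟩
        ((1ℚ - x) * ι M) ^ n        ≡⟨ ^-distrib-* (1ℚ - x) (ι M) n ⟩
        (1ℚ - x) ^ n * ι M ^ n      ≡⟨ cong ((1ℚ - x) ^ n *_) (sym (ff-total M n n<L)) ⟩
        (1ℚ - x) ^ n * ∑ L w        ∎
        where
        open ≡-Reasoning
        m≡ : ι m ≡ (1ℚ - x) * ι M
        m≡ = trans (trans (solve 1 (λ m → m := :1 :+ m :- :1) refl (ι m)) (cong₂ _-_ (sym (ι-suc m)) (sym xM)))
          (solve 2 (λ M x → M :- x :* M := (:1 :- x) :* M) refl (ι M) x)
      0<W : ∀ L → n ℕ.< L → 0ℚ < ∑ L w
      0<W L n<L = subst (0ℚ <_) (sym (ff-total M n n<L)) (0<^ n 0<M)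
      n<s+n : ∀ s → n ℕ.< s ℕ.+ suc n
      n<s+n s = ℕ.m≤n+m (suc n) s
      φM : ∀ i → (1ℚ - ι i * x) * ι M ≡ ι M - ι i
      φM i = trans (solve 3 (λ i x M → (:1 :- i :* x) :* M := M :- i :* (x :* M)) refl (ι i) x (ι M))
        (cong (ι M -_) (trans (cong (ι i *_) xM) (ℚ.*-identityʳ (ι i))))
      w-suc : ∀ {g y} i → g * S n (suc i) ≤ y * S n i → g * w (suc i) ≤ ι (M ℕ.∸ i) * y * w i
      w-suc {g} {y} i le = by (‖ le ⊗ (0≤ff M i ⊗ 0≤ι (M ℕ.∸ i)))
        (solve 6 (λ g s s′ f d y → d :* y :* (s :* f) :- g :* (s′ :* (f :* d))
          := (y :* s :- g :* s′) :* (f :* d)) refl g (S n i) (S n (suc i)) (ff M i) (ι (M ℕ.∸ i)) y)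

    S₂-right : ∀ {j} → 0 ℕ.< j → j ℕ.< M → ι (M ℕ.∸ j) * S n (suc j) ≤ S n j →
               1ℚ - ι (j ℕ.+ d) * x ≤ (1ℚ - x) ^ n + τ
    S₂-right {j} 0<j j<M start = mean-right {w} {z} 0≤w 0≤z z≤w {d} {Q} {τ} {1ℚ - ι s * x} {(1ℚ - x) ^ n} 1≤Q Q≤τd 0≤τ j (suc n)
      (mean L (n<s+n s)) (0<W L (n<s+n s)) φ≤1 φw≤z dec decay
      where
      s L : ℕ
      s = j ℕ.+ d
      L = s ℕ.+ suc n
      g : ℚ
      g = ι (M ℕ.∸ j)
      0<g : 0ℚ < g
      0<g = 0<ι (ℕ.m<n⇒0<n∸m j<M)
      φ≤1 : 1ℚ - ι s * x ≤ 1ℚ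
      φ≤1 = by (0≤ι s ⊗ 0≤x) (solve 2 (λ s x → :1 :- (:1 :- s :* x) := s :* x) refl (ι s) x)
      φw≤z : ∀ i → i ℕ.< s → (1ℚ - ι s * x) * w i ≤ z i
      φw≤z i i<s = z-≥ (1ℚ - ι s * x) i (subst (_≤ ι (M ℕ.∸ i)) (sym (φM s)) (ℚ.≤-trans
        (by {(ι M) - (ι s)} {(ι M) - (ι i)} (‖ ι-mono (ℕ.<⇒≤ i<s))
          (solve 3 (λ M s i → M :- i :- (M :- s) := s :- i) refl (ι M) (ι s) (ι i))) (ι-∸-≥ M i)))
      bound : ∀ i → j ℕ.≤ i → g * w (suc i) ≤ ι (M ℕ.∸ i) * w i
      bound i j≤i = subst (λ y → g * w (suc i) ≤ y * w i) (ℚ.*-identityʳ (ι (M ℕ.∸ i)))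
        (w-suc {g} {1ℚ} i (ratio-right {n} {j} {g} {1ℚ} 0<j (0≤ι (M ℕ.∸ j)) (0≤# 1) (subst (g * S n (suc j) ≤_) (sym (ℚ.*-identityˡ (S n j))) start) i j≤i))
      dec : ∀ i → j ℕ.≤ i → w (suc i) ≤ w i
      dec i j≤i = ratio-≤ 0<g (0≤w i) (bound i j≤i) (ι-mono (ℕ.∸-monoʳ-≤ M j≤i))
      decay : ∀ i → s ℕ.≤ i → Q * w (suc i) ≤ (Q - 1ℚ) * w i
      decay i s≤i = ratio-decay 0<g (0≤w i) 1≤Q (bound i j≤i) Qy≤
        where
        j≤i : j ℕ.≤ i
        j≤i = ℕ.≤-trans (ℕ.m≤m+n j d) s≤i
        Qy≤ : Q * ι (M ℕ.∸ i) ≤ (Q - 1ℚ) * g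
        Qy≤ with i ℕ.≤? M
        ... | no i≰M = subst (λ y → Q * y ≤ (Q - 1ℚ) * g) (sym (trans (cong ι (ℕ.m≤n⇒m∸n≡0 (ℕ.<⇒≤ (ℕ.≰⇒> i≰M)))) ι0))
          (by (‖ 1≤Q ⊗ ℚ.<⇒≤ 0<g) (solve 2 (λ Q g → (Q :- :1) :* g :- Q :* :0 := (Q :- :1) :* g) refl Q g))
        ... | yes i≤M = subst₂ (λ y g → Q * y ≤ (Q - 1ℚ) * g) (sym (ι-∸ i≤M)) (sym (ι-∸ (ℕ.<⇒≤ j<M)))
          (by ((‖ 1≤Q ⊕ 0≤# 1) ⊗ ‖ subst (_≤ ι i) (ι-+ j d) (ι-mono s≤i) ⊕ ‖ M≤Qd ⊕ 0≤ι j ⊕ 0≤ι d)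
            (solve 5 (λ Q M i j d → (Q :- :1) :* (M :- j) :- Q :* (M :- i)
              := (Q :- :1 :+ :# 1) :* (i :- (j :+ d)) :+ ((Q :- :1) :* d :- M) :+ j :+ d)
              refl Q (ι M) (ι i) (ι j) (ι d)))

    S₂-left : ∀ {b} → suc (b ℕ.+ d) ℕ.< n → b ℕ.+ d ℕ.< M →
              S n (b ℕ.+ d) ≤ ι (M ℕ.∸ (b ℕ.+ d)) * S n (suc (b ℕ.+ d)) →
              (1ℚ - x) ^ n ≤ 1ℚ - ι b * x + τ
    S₂-left {b} k<n j<M start = mean-left {w} {z} 0≤w 0≤z z≤w {d} {Q} {τ} {1ℚ - ι b * x} {(1ℚ - x) ^ n} 1≤Q Q≤τd 0≤τ b (suc n)
      (mean L (n<s+n j)) (0<W L (n<s+n j)) 0≤φ z≤φw inc decay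
      where
      j L : ℕ
      j = b ℕ.+ d
      L = j ℕ.+ suc n
      g : ℚ
      g = ι (M ℕ.∸ j)
      b≤M : b ℕ.≤ M
      b≤M = ℕ.≤-trans (ℕ.m≤m+n b d) (ℕ.<⇒≤ j<M)
      0≤φ : 0ℚ ≤ 1ℚ - ι b * x
      0≤φ = ‖ subst (ι b * x ≤_) xM (by (0≤x ⊗ ‖ ι-mono b≤M)
        (solve 3 (λ M b x → x :* M :- b :* x := x :* (M :- b)) refl (ι M) (ι b) x))
      z≤φw : ∀ i → b ℕ.≤ i → z i ≤ (1ℚ - ι b * x) * w i
      z≤φw i b≤i = z-≤ (1ℚ - ι b * x) i (subst (ι (M ℕ.∸ i) ≤_) (sym (φM b)) (subst (ι (M ℕ.∸ i) ≤_) (ι-∸ b≤M) (ι-mono (ℕ.∸-monoʳ-≤ M b≤i))))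
      bound : ∀ i → i ℕ.≤ j → ι (M ℕ.∸ i) * w i ≤ g * w (suc i)
      bound i i≤j = by (‖ ratio-left {n} {j} {g} {1ℚ} k<n (0≤ι (M ℕ.∸ j)) (0≤# 1) (subst (_≤ g * S n (suc j)) (sym (ℚ.*-identityˡ (S n j))) start) i i≤j ⊗ (0≤ff M i ⊗ 0≤ι (M ℕ.∸ i)))
        (solve 5 (λ g s s′ f d → g :* (s′ :* (f :* d)) :- d :* (s :* f)
          := (g :* s′ :- :1 :* s) :* (f :* d)) refl g (S n i) (S n (suc i)) (ff M i) (ι (M ℕ.∸ i)))
      0<y : ∀ i → i ℕ.≤ j → 0ℚ < ι (M ℕ.∸ i)
      0<y i i≤j = 0<ι (ℕ.m<n⇒0<n∸m (ℕ.≤-<-trans i≤j j<M))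
      inc : ∀ i → i ℕ.< j → w i ≤ w (suc i)
      inc i i<j = ratio-≤ (0<y i (ℕ.<⇒≤ i<j)) (0≤w (suc i)) (bound i (ℕ.<⇒≤ i<j)) (ι-mono (ℕ.∸-monoʳ-≤ M (ℕ.<⇒≤ i<j)))
      decay : ∀ i → i ℕ.< b → Q * w i ≤ (Q - 1ℚ) * w (suc i)
      decay i i<b = ratio-decay (0<y i i≤j) (0≤w (suc i)) 1≤Q (bound i i≤j) Qg≤
        where
        i≤j : i ℕ.≤ j
        i≤j = ℕ.≤-trans (ℕ.<⇒≤ i<b) (ℕ.m≤m+n b d)
        i≤M : i ℕ.≤ M
        i≤M = ℕ.≤-trans i≤j (ℕ.<⇒≤ j<M)
        Qg≤ : Q * g ≤ (Q - 1ℚ) * ι (M ℕ.∸ i)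
        Qg≤ = subst₂ (λ g y → Q * g ≤ (Q - 1ℚ) * y) (sym (trans (ι-∸ (ℕ.<⇒≤ j<M)) (cong (λ s → ι M - s) (ι-+ b d)))) (sym (ι-∸ i≤M))
          (by ((‖ 1≤Q ⊕ 0≤# 1) ⊗ ‖ ι-mono (ℕ.<⇒≤ i<b) ⊕ ‖ M≤Qd ⊕ 0≤ι d ⊕ 0≤ι i)
            (solve 5 (λ Q M i b d → (Q :- :1) :* (M :- i) :- Q :* (M :- (b :+ d))
              := (Q :- :1 :+ :# 1) :* (b :- i) :+ ((Q :- :1) :* d :- M) :+ d :+ i)
              refl Q (ι M) (ι i) (ι b) (ι d)))

module Stirling₁ where

  open Prelude
  open OrderedField
  open Powers
  open Means
  open LogConcavity
  open Triangles
  open Defs using (stirling₁; T)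

  c : ℕ → ℕ → ℚ
  c n k = ι (T stirling₁ n k)

  0<! : ∀ k → 0ℚ < ι (k !)
  0<! zero    = 0<ι (s≤s z≤n)
  0<! (suc k) = subst (0ℚ <_) (sym (ι-* (suc k) (k !))) (0<* (0<ι (s≤s z≤n)) (0<! k))

  0≤! : ∀ k → 0ℚ ≤ ι (k !)
  0≤! k = ℚ.<⇒≤ (0<! k)

  -- The factorial makes up for the lack of strictness in the log-concavity of k ↦ x^k.
  D : ℕ → ℕ → ℚ
  D n k = ι (k !) * c n k

  D-suc : ∀ {n k} → k ℕ.≤ suc n → D (suc n) k ≡ ι k * prev (D n) k + ι n * D n k
  D-suc {n} {zero} _ = begin
    ι (0 !) * c (suc n) 0             ≡⟨ cong (ι (0 !) *_) (T-suc₀ stirling₁ n) ⟩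
    ι (0 !) * (ι n * c n 0)           ≡⟨ solve 4 (λ f n t z → f :* (n :* t) := z :* :0 :+ n :* (f :* t)) refl (ι (0 !)) (ι n) (c n 0) (ι 0) ⟩
    ι 0 * 0ℚ + ι n * (ι (0 !) * c n 0) ∎
    where open ≡-Reasoning
  D-suc {n} {suc k} _ = begin
    ι (suc k !) * c (suc n) (suc k)
      ≡⟨ cong (ι (suc k !) *_) (T-suc stirling₁ n k) ⟩
    ι (suc k !) * (ι 1 * c n k + ι n * c n (suc k))
      ≡⟨ solve 5 (λ f o t n u → f :* (o :* t :+ n :* u) := f :* (o :* t) :+ n :* (f :* u)) refl (ι (suc k !)) (ι 1) (c n k) (ι n) (c n (suc k)) ⟩
    ι (suc k !) * (ι 1 * c n k) + ι n * D n (suc k)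
      ≡⟨ cong₂ (λ f o → f * (o * c n k) + ι n * D n (suc k)) (ι-* (suc k) (k !)) ι1 ⟩
    ι (suc k) * ι (k !) * (1ℚ * c n k) + ι n * D n (suc k)
      ≡⟨ solve 4 (λ s f t r → s :* f :* (:1 :* t) :+ r := s :* (f :* t) :+ r) refl (ι (suc k)) (ι (k !)) (c n k) (ι n * D n (suc k)) ⟩
    ι (suc k) * D n k + ι n * D n (suc k) ∎
    where open ≡-Reasoning

  private
    0≤D′ : ∀ n k → 0ℚ ≤ D n k
    0≤D′ n k = 0≤! k ⊗ 0≤T stirling₁ n k

    0<D′ : ∀ {n k} → 0 ℕ.< k → k ℕ.< n → 0ℚ < D n k
    0<D′ {n} {k} 0<k k<n = 0<* (0<! k) (0<T stirling₁ 0<k k<n)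

    D-outside′ : ∀ {n k} → n ℕ.< k → D n k ≡ 0ℚ
    D-outside′ {n} {k} n<k = trans (cong (ι (k !) *_) (ι-outside stirling₁ n<k)) (ℚ.*-zeroʳ (ι (k !)))

    ι-suc′ : ∀ k → ι (suc k) ≡ ι k + 1ℚ
    ι-suc′ k = trans (ι-suc k) (ℚ.+-comm 1ℚ (ι k))

  open Linear D (λ _ → ι) (λ n _ → ι n) 1ℚ 0ℚ 0≤D′ 0<D′ D-outside′ D-suc
    (λ _ → ι-suc′) (λ n _ → sym (ℚ.+-identityʳ (ι n))) (λ _ → 0≤ι _) (λ n _ → 0≤ι n) public

  rising : ℕ → ℕ → ℚ
  rising x zero    = 1ℚ
  rising x (suc n) = (ι x + ι n) * rising x n

  0<rising : ∀ x n → 0ℚ < rising (suc x) n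
  0<rising x zero    = 0<# 0
  0<rising x (suc n) = 0<* (0<+ (0<ι (s≤s z≤n)) (0≤ι n)) (0<rising x n)

  rising-total : ∀ x n {L} → n ℕ.< L → ∑ L (λ k → c n k * ι x ^ k) ≡ rising x n
  rising-total x n {L} = total stirling₁ (λ _ k → ι x ^ k) (rising x) (λ n → ι x + ι n) refl refl (λ _ → refl) (λ n k _ → step n k) n {L}
    where
    step : ∀ n k → ι 1 * (ι x * ι x ^ k) + ι n * ι x ^ k ≡ (ι x + ι n) * ι x ^ k
    step n k = trans (cong (λ o → o * (ι x * ι x ^ k) + ι n * ι x ^ k) ι1)
      (solve 3 (λ x n p → :1 :* (x :* p) :+ n :* p := (x :+ n) :* p) refl (ι x) (ι n) (ι x ^ k))

  rising-pred : ∀ m n → (ι m + ι n) * rising m n ≡ ι m * rising (suc m) n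
  rising-pred m zero    = cong (_* 1ℚ) (trans (cong (ι m +_) ι0) (ℚ.+-identityʳ (ι m)))
  rising-pred m (suc n) = begin
    (ι m + ι (suc n)) * ((ι m + ι n) * rising m n)    ≡⟨ cong₂ _*_ shift (rising-pred m n) ⟩
    (ι (suc m) + ι n) * (ι m * rising (suc m) n)      ≡⟨ solve 3 (λ s m r → s :* (m :* r) := m :* (s :* r)) refl (ι (suc m) + ι n) (ι m) (rising (suc m) n) ⟩
    ι m * ((ι (suc m) + ι n) * rising (suc m) n)      ∎
    where
    open ≡-Reasoning
    shift : ι m + ι (suc n) ≡ ι (suc m) + ι n
    shift = trans (sym (ι-+ m (suc n))) (trans (cong ι (ℕ.+-suc m n)) (ι-+ (suc m) n))

  -- Tilting by x^k and evaluating at x - 1 gives the mean of (1 - 1/x)^k.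
  module _ {n m : ℕ} {x y : ℚ} (xX : x * ι (suc m) ≡ 1ℚ) (0≤x : 0ℚ ≤ x) (x≤1 : x ≤ 1ℚ)
           (y[m+n] : y * (ι m + ι n) ≡ 1ℚ)
           {d : ℕ} {Q τ : ℚ} (1≤Q : 1ℚ ≤ Q) (n≤Qd : ι n ≤ (Q - 1ℚ) * ι d)
           (Q≤τd : Q ≤ τ * ι d) (0≤τ : 0ℚ ≤ τ) where
    private
      X : ℕ
      X = suc m
      q : ℚ
      q = 1ℚ - x
      0≤q : 0ℚ ≤ q
      0≤q = ‖ x≤1
      q≤1 : q ≤ 1ℚ
      q≤1 = by 0≤x (solve 1 (λ x → :1 :- (:1 :- x) := x) refl x)
      w z : ℕ → ℚ
      w k = c n k * ι X ^ k
      z k = c n k * ι m ^ k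
      0≤w : ∀ k → 0ℚ ≤ w k
      0≤w k = 0≤T stirling₁ n k ⊗ 0≤^ k (0≤ι X)
      0≤z : ∀ k → 0ℚ ≤ z k
      0≤z k = 0≤T stirling₁ n k ⊗ 0≤^ k (0≤ι m)
      z≡ : ∀ k → z k ≡ q ^ k * w k
      z≡ k = begin
        c n k * ι m ^ k              ≡⟨ cong (λ s → c n k * s ^ k) m≡ ⟩
        c n k * (q * ι X) ^ k        ≡⟨ cong (c n k *_) (^-distrib-* q (ι X) k) ⟩
        c n k * (q ^ k * ι X ^ k)    ≡⟨ solve 3 (λ c q x → c :* (q :* x) := q :* (c :* x)) refl (c n k) (q ^ k) (ι X ^ k) ⟩
        q ^ k * (c n k * ι X ^ k)    ∎
        where
        open ≡-Reasoning
        m≡ : ι m ≡ q * ι X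
        m≡ = trans (trans (solve 1 (λ m → m := :1 :+ m :- :1) refl (ι m)) (cong₂ _-_ (sym (ι-suc m)) (sym xX)))
          (solve 2 (λ M x → M :- x :* M := (:1 :- x) :* M) refl (ι X) x)
      ^-antitone : ∀ {i k} → i ℕ.≤ k → q ^ k ≤ q ^ i
      ^-antitone {i} {k} i≤k = subst (λ k → q ^ k ≤ q ^ i) (ℕ.m+[n∸m]≡n i≤k)
        (subst (_≤ q ^ i) (sym (^-homo-* q i (k ℕ.∸ i)))
          (by (0≤^ i 0≤q ⊗ ‖ ^≤1 (k ℕ.∸ i) 0≤q q≤1)
            (solve 2 (λ a b → a :- a :* b := a :* (:1 :- b)) refl (q ^ i) (q ^ (k ℕ.∸ i)))))
      z≤w : ∀ k → z k ≤ w k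
      z≤w k = subst (_≤ w k) (sym (z≡ k))
        (by (‖ ^≤1 k 0≤q q≤1 ⊗ 0≤w k) (solve 2 (λ q w → w :- q :* w := (:1 :- q) :* w) refl (q ^ k) (w k)))
      mean : ∀ L → n ℕ.< L → ∑ L z ≡ ι m * y * ∑ L w
      mean L n<L = begin
        ∑ L z                                   ≡⟨ rising-total m n n<L ⟩
        rising m n                              ≡⟨ sym (ℚ.*-identityˡ (rising m n)) ⟩
        1ℚ * rising m n                         ≡⟨ cong (_* rising m n) (sym y[m+n]) ⟩
        y * (ι m + ι n) * rising m n            ≡⟨ ℚ.*-assoc y (ι m + ι n) (rising m n) ⟩
        y * ((ι m + ι n) * rising m n)          ≡⟨ cong (y *_) (rising-pred m n) ⟩
        y * (ι m * rising X n)                  ≡⟨ solve 3 (λ y m r → y :* (m :* r) := m :* y :* r) refl y (ι m) (rising X n) ⟩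
        ι m * y * rising X n                    ≡⟨ cong (ι m * y *_) (sym (rising-total X n n<L)) ⟩
        ι m * y * ∑ L w                         ∎
        where open ≡-Reasoning
      0<W : ∀ L → n ℕ.< L → 0ℚ < ∑ L w
      0<W L n<L = subst (0ℚ <_) (sym (rising-total X n n<L)) (0<rising m n)
      n<s+n : ∀ s → n ℕ.< s ℕ.+ suc n
      n<s+n s = ℕ.m≤n+m (suc n) s

    S₁-right : ∀ {j} → 0 ℕ.< j → suc j ℕ.≤ n → ι X * c n (suc j) ≤ c n j → q ^ (j ℕ.+ d) ≤ ι m * y + τ
    S₁-right {j} 0<j k≤n start = mean-right {w} {z} 0≤w 0≤z z≤w {d} {Q} {τ} {q ^ s} {ι m * y} 1≤Q Q≤τd 0≤τ j (suc n)
      (mean L (n<s+n s)) (0<W L (n<s+n s)) (^≤1 s 0≤q q≤1) φw≤z dec decay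
      where
      s L : ℕ
      s = j ℕ.+ d
      L = s ℕ.+ suc n
      k : ℚ
      k = ι (suc j)
      φw≤z : ∀ i → i ℕ.< s → q ^ s * w i ≤ z i
      φw≤z i i<s = subst (q ^ s * w i ≤_) (sym (z≡ i))
        (by (‖ ^-antitone (ℕ.<⇒≤ i<s) ⊗ 0≤w i)
          (solve 3 (λ a b w → b :* w :- a :* w := (b :- a) :* w) refl (q ^ s) (q ^ i) (w i)))
      start′ : ι X * D n (suc j) ≤ k * D n j
      start′ = subst (λ f → ι X * (f * c n (suc j)) ≤ k * (ι (j !) * c n j)) (sym (ι-* (suc j) (j !)))
        (by (0≤ι (suc j) ⊗ 0≤! j ⊗ ‖ start)
          (solve 5 (λ X k f u v → k :* (f :* u) :- X :* (k :* f :* v)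
            := k :* f :* (u :- X :* v)) refl (ι X) (ι (suc j)) (ι (j !)) (c n j) (c n (suc j))))
      bound : ∀ i → j ℕ.≤ i → ι (suc i) * w (suc i) ≤ k * w i
      bound i j≤i = cancel (ι (suc i !)) (ι X ^ suc i) refl refl (ratio-right {n} {j} {ι X} {k} 0<j (0≤ι X) (0≤ι (suc j)) start′ i j≤i)
        where
        cancel : ∀ F P → F ≡ ι (suc i !) → P ≡ ι X ^ suc i → ι X * (F * c n (suc i)) ≤ k * (ι (i !) * c n i) →
                 ι (suc i) * (c n (suc i) * P) ≤ k * (c n i * ι X ^ i)
        cancel _ _ refl refl le rewrite ι-* (suc i) (i !) =
          (by· (0<! i) (0≤^ i (0≤ι X) ⊗ ‖ le)
            (solve 7 (λ X k s f u v p → f :* (k :* (u :* p) :- s :* (v :* (X :* p)))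
              := p :* (k :* (f :* u) :- X :* (s :* f :* v)))
              refl (ι X) k (ι (suc i)) (ι (i !)) (c n i) (c n (suc i)) (ι X ^ i)))
      0<i : ∀ i → 0ℚ < ι (suc i)
      0<i i = 0<ι (s≤s z≤n)
      dec : ∀ i → j ℕ.≤ i → w (suc i) ≤ w i
      dec i j≤i = ratio-≤ (0<i i) (0≤w i) (bound i j≤i) (ι-mono (s≤s j≤i))
      decay : ∀ i → s ℕ.≤ i → Q * w (suc i) ≤ (Q - 1ℚ) * w i
      decay i s≤i = ratio-decay (0<i i) (0≤w i) 1≤Q (bound i (ℕ.≤-trans (ℕ.m≤m+n j d) s≤i))
        (by (‖ 1≤Q ⊗ ‖ subst (_≤ ι (suc i)) (ι-+ (suc j) d) (ι-mono (s≤s s≤i)) ⊕ ‖ n≤Qd ⊕ ‖ ι-mono k≤n)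
          (solve 5 (λ Q k i n d → (Q :- :1) :* i :- Q :* k
            := (Q :- :1) :* (i :- (k :+ d)) :+ ((Q :- :1) :* d :- n) :+ (n :- k))
            refl Q k (ι (suc i)) (ι n) (ι d)))

    S₁-left : ∀ {b} → suc (b ℕ.+ d) ℕ.< n → c n (b ℕ.+ d) ≤ ι X * c n (suc (b ℕ.+ d)) → ι m * y ≤ q ^ b + τ
    S₁-left {b} k<n start = mean-left {w} {z} 0≤w 0≤z z≤w {d} {Q} {τ} {q ^ b} {ι m * y} 1≤Q Q≤τd 0≤τ b (suc n)
      (mean L (n<s+n j)) (0<W L (n<s+n j)) (0≤^ b 0≤q) z≤φw inc decay
      where
      j L : ℕ
      j = b ℕ.+ d
      L = j ℕ.+ suc n
      k : ℚ
      k = ι (suc j)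
      z≤φw : ∀ i → b ℕ.≤ i → z i ≤ q ^ b * w i
      z≤φw i b≤i = subst (_≤ q ^ b * w i) (sym (z≡ i))
        (by (‖ ^-antitone b≤i ⊗ 0≤w i)
          (solve 3 (λ a b w → b :* w :- a :* w := (b :- a) :* w) refl (q ^ i) (q ^ b) (w i)))
      start′ : k * D n j ≤ ι X * D n (suc j)
      start′ = subst (λ f → k * (ι (j !) * c n j) ≤ ι X * (f * c n (suc j))) (sym (ι-* (suc j) (j !)))
        (by (0≤ι (suc j) ⊗ 0≤! j ⊗ ‖ start)
          (solve 5 (λ X k f u v → X :* (k :* f :* v) :- k :* (f :* u)
            := k :* f :* (X :* v :- u)) refl (ι X) (ι (suc j)) (ι (j !)) (c n j) (c n (suc j))))
      0<k : 0ℚ < k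
      0<k = 0<ι (s≤s z≤n)
      bound : ∀ i → i ℕ.≤ j → k * w i ≤ ι (suc i) * w (suc i)
      bound i i≤j = cancel (ι (suc i !)) (ι X ^ suc i) refl refl (ratio-left {n} {j} {ι X} {k} k<n (0≤ι X) (0≤ι (suc j)) start′ i i≤j)
        where
        cancel : ∀ F P → F ≡ ι (suc i !) → P ≡ ι X ^ suc i → k * (ι (i !) * c n i) ≤ ι X * (F * c n (suc i)) →
                 k * (c n i * ι X ^ i) ≤ ι (suc i) * (c n (suc i) * P)
        cancel _ _ refl refl le rewrite ι-* (suc i) (i !) =
          (by· (0<! i) (0≤^ i (0≤ι X) ⊗ ‖ le)
            (solve 7 (λ X k s f u v p → f :* (s :* (v :* (X :* p)) :- k :* (u :* p))
              := p :* (X :* (s :* f :* v) :- k :* (f :* u)))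
              refl (ι X) k (ι (suc i)) (ι (i !)) (c n i) (c n (suc i)) (ι X ^ i)))
      inc : ∀ i → i ℕ.< j → w i ≤ w (suc i)
      inc i i<j = ratio-≤ 0<k (0≤w (suc i)) (bound i (ℕ.<⇒≤ i<j)) (ι-mono (s≤s (ℕ.<⇒≤ i<j)))
      decay : ∀ i → i ℕ.< b → Q * w i ≤ (Q - 1ℚ) * w (suc i)
      decay i i<b = ratio-decay 0<k (0≤w (suc i)) 1≤Q (bound i (ℕ.≤-trans (ℕ.<⇒≤ i<b) (ℕ.m≤m+n b d)))
        (by ((‖ 1≤Q ⊕ 0≤# 1) ⊗ ‖ subst (_≤ k) (ι-+ (suc i) d) (ι-mono (s≤s (ℕ.+-monoˡ-≤ d (ℕ.<⇒≤ i<b))))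
            ⊕ ‖ n≤Qd ⊕ ‖ ι-mono (ℕ.<⇒≤ k<n) ⊕ 0≤ι d)
          (solve 5 (λ Q k i n d → (Q :- :1) :* k :- Q :* i
            := (Q :- :1 :+ :# 1) :* (k :- (i :+ d)) :+ ((Q :- :1) :* d :- n) :+ (n :- k) :+ d)
            refl Q k (ι (suc i)) (ι n) (ι d)))

module Binomial where

  open Prelude
  open OrderedField
  open Triangles
  open Defs using (pascal; T)

  C : ℕ → ℕ → ℚ
  C n k = ι (T pascal n k)

  C-0 : ∀ n → C n 0 ≡ 1ℚ
  C-0 zero    = ι1
  C-0 (suc n) = trans (cong ι (ℕ.*-identityˡ (T pascal n 0))) (C-0 n)

  C-suc : ∀ n k → C (suc n) (suc k) ≡ C n k + C n (suc k)
  C-suc n k = trans (cong ι (cong₂ ℕ._+_ (ℕ.*-identityˡ (T pascal n k)) (ℕ.*-identityˡ (T pascal n (suc k)))))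
    (ι-+ (T pascal n k) (T pascal n (suc k)))

  absorb : ∀ n k → ι (suc k) * C (suc n) (suc k) ≡ ι (suc n) * C n k
  absorb zero zero = cong (ι 1 *_) (trans (C-suc 0 0) (trans (cong (ι 1 +_) ι0) (ℚ.+-identityʳ (ι 1))))
  absorb zero (suc k) = trans (cong (ι (suc (suc k)) *_) C≡0) (trans (ℚ.*-zeroʳ (ι (suc (suc k))))
    (sym (trans (cong (ι 1 *_) ι0) (ℚ.*-zeroʳ (ι 1)))))
    where
    C≡0 : C 1 (suc (suc k)) ≡ 0ℚ
    C≡0 = ι-outside pascal {1} {suc (suc k)} (s≤s (s≤s z≤n))
  absorb (suc n) zero = begin
    ι 1 * C (suc (suc n)) 1            ≡⟨ cong (ι 1 *_) (C-suc (suc n) 0) ⟩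
    ι 1 * (C (suc n) 0 + C (suc n) 1)  ≡⟨ ℚ.*-distribˡ-+ (ι 1) (C (suc n) 0) (C (suc n) 1) ⟩
    ι 1 * C (suc n) 0 + ι 1 * C (suc n) 1 ≡⟨ cong₂ _+_ (cong (_* C (suc n) 0) ι1) (trans (absorb n 0) (cong (ι (suc n) *_) (trans (C-0 n) (sym (C-0 (suc n)))))) ⟩
    1ℚ * C (suc n) 0 + ι (suc n) * C (suc n) 0 ≡⟨ sym (ℚ.*-distribʳ-+ (C (suc n) 0) 1ℚ (ι (suc n))) ⟩
    (1ℚ + ι (suc n)) * C (suc n) 0     ≡⟨ cong (_* C (suc n) 0) (sym (ι-suc (suc n))) ⟩
    ι (suc (suc n)) * C (suc n) 0      ∎
    where open ≡-Reasoning
  absorb (suc n) (suc k) = begin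
    ι (suc (suc k)) * C (suc (suc n)) (suc (suc k))
      ≡⟨ cong (ι (suc (suc k)) *_) (C-suc (suc n) (suc k)) ⟩
    ι (suc (suc k)) * (C (suc n) (suc k) + C (suc n) (suc (suc k)))
      ≡⟨ ℚ.*-distribˡ-+ (ι (suc (suc k))) _ _ ⟩
    ι (suc (suc k)) * C (suc n) (suc k) + ι (suc (suc k)) * C (suc n) (suc (suc k))
      ≡⟨ cong₂ (λ s t → s * C (suc n) (suc k) + t) (ι-suc (suc k)) (absorb n (suc k)) ⟩
    (1ℚ + ι (suc k)) * C (suc n) (suc k) + ι (suc n) * C n (suc k)
      ≡⟨ solve 3 (λ k c r → (:1 :+ k) :* c :+ r := c :+ (k :* c :+ r)) refl (ι (suc k)) (C (suc n) (suc k)) (ι (suc n) * C n (suc k)) ⟩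
    C (suc n) (suc k) + (ι (suc k) * C (suc n) (suc k) + ι (suc n) * C n (suc k))
      ≡⟨ cong (λ s → C (suc n) (suc k) + (s + ι (suc n) * C n (suc k))) (absorb n k) ⟩
    C (suc n) (suc k) + (ι (suc n) * C n k + ι (suc n) * C n (suc k))
      ≡⟨ cong (C (suc n) (suc k) +_) (trans (sym (ℚ.*-distribˡ-+ (ι (suc n)) (C n k) (C n (suc k)))) (cong (ι (suc n) *_) (sym (C-suc n k)))) ⟩
    C (suc n) (suc k) + ι (suc n) * C (suc n) (suc k)
      ≡⟨ solve 2 (λ n c → c :+ n :* c := (:1 :+ n) :* c) refl (ι (suc n)) (C (suc n) (suc k)) ⟩
    (1ℚ + ι (suc n)) * C (suc n) (suc k)
      ≡⟨ cong (_* C (suc n) (suc k)) (sym (ι-suc (suc n))) ⟩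
    ι (suc (suc n)) * C (suc n) (suc k) ∎
    where open ≡-Reasoning

  upper : ∀ n k → (ι (suc n) - ι (suc k)) * C (suc n) (suc k) ≡ ι (suc n) * C n (suc k)
  upper n k = begin
    (ι (suc n) - ι (suc k)) * C (suc n) (suc k)
      ≡⟨ solve 3 (λ n k c → (n :- k) :* c := n :* c :- k :* c) refl (ι (suc n)) (ι (suc k)) (C (suc n) (suc k)) ⟩
    ι (suc n) * C (suc n) (suc k) - ι (suc k) * C (suc n) (suc k)
      ≡⟨ cong₂ (λ s t → ι (suc n) * s - t) (C-suc n k) (absorb n k) ⟩
    ι (suc n) * (C n k + C n (suc k)) - ι (suc n) * C n k
      ≡⟨ solve 3 (λ n c e → n :* (c :+ e) :- n :* c := n :* e) refl (ι (suc n)) (C n k) (C n (suc k)) ⟩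
    ι (suc n) * C n (suc k) ∎
    where open ≡-Reasoning

  lower : ∀ n k → ι (suc k) * C n (suc k) ≡ (ι n - ι k) * C n k
  lower n k = begin
    ι (suc k) * C n (suc k)
      ≡⟨ solve 3 (λ k c e → k :* e := k :* (c :+ e) :- k :* c) refl (ι (suc k)) (C n k) (C n (suc k)) ⟩
    ι (suc k) * (C n k + C n (suc k)) - ι (suc k) * C n k
      ≡⟨ cong (_- ι (suc k) * C n k) (trans (cong (ι (suc k) *_) (sym (C-suc n k))) (absorb n k)) ⟩
    ι (suc n) * C n k - ι (suc k) * C n k
      ≡⟨ cong₂ (λ s t → s * C n k - t * C n k) (ι-suc n) (ι-suc k) ⟩
    (1ℚ + ι n) * C n k - (1ℚ + ι k) * C n k
      ≡⟨ solve 3 (λ n k c → (:1 :+ n) :* c :- (:1 :+ k) :* c := (n :- k) :* c) refl (ι n) (ι k) (C n k) ⟩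
    (ι n - ι k) * C n k ∎
    where open ≡-Reasoning

module Euler where

  open Prelude
  open OrderedField
  open Powers
  open Means
  open LogConcavity
  open Triangles
  open Defs using (pascal; euler; T)
  open Binomial

  A : ℕ → ℕ → ℚ
  A n k = ι (T euler n k)

  private
    α′ β′ : ℕ → ℕ → ℚ
    α′ n k = 1ℚ + ι n - ι k
    β′ n k = 1ℚ + ι k

  A-suc : ∀ {n k} → k ℕ.≤ suc n → A (suc n) k ≡ α′ n k * prev (A n) k + β′ n k * A n k
  A-suc {n} {zero} _ = trans (T-suc₀ euler n) (trans (cong (_* A n 0) (ι-suc 0))
    (solve 2 (λ c x → x := c :* :0 :+ x) refl (α′ n 0) (β′ n 0 * A n 0)))
  A-suc {n} {suc k} (s≤s k≤n) = trans (T-suc euler n k) (cong₂ (λ s t → s * A n k + t * A n (suc k))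
    (trans (ι-∸ k≤n) (trans (solve 2 (λ n k → n :- k := :1 :+ n :- (:1 :+ k)) refl (ι n) (ι k)) (cong (1ℚ + ι n -_) (sym (ι-suc k)))))
    (trans (cong ι (ℕ.+-comm (suc k) 1)) (ι-suc (suc k))))

  private
    α-suc : ∀ n k → α′ n (suc k) ≡ α′ n k + (0ℚ - 1ℚ)
    α-suc n k = trans (cong (1ℚ + ι n -_) (ι-suc k)) (solve 2 (λ n k → :1 :+ n :- (:1 :+ k) := :1 :+ n :- k :+ (:0 :- :1)) refl (ι n) (ι k))
    β-suc : ∀ n k → β′ n (suc k) ≡ β′ n k + 1ℚ
    β-suc n k = trans (cong (1ℚ +_) (ι-suc k)) (solve 1 (λ k → :1 :+ (:1 :+ k) := :1 :+ k :+ :1) refl (ι k))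
    0≤α : ∀ {n k} → k ℕ.≤ suc n → 0ℚ ≤ α′ n k
    0≤α {n} {k} k≤ = subst (λ s → 0ℚ ≤ s - ι k) (ι-suc n) (‖ ι-mono k≤)
    0≤β : ∀ n k → 0ℚ ≤ β′ n k
    0≤β n k = 0≤# 1 ⊕ 0≤ι k

  open Linear A α′ β′ (0ℚ - 1ℚ) 1ℚ (0≤T euler) (0<T euler) (ι-outside euler)
    A-suc α-suc β-suc 0≤α 0≤β public

  -- Worpitzky's identity
  worpitzky : ∀ M n {L} → n ℕ.< L → ∑ L (λ k → A n k * C (M ℕ.+ k) n) ≡ ι M ^ n
  worpitzky M n {L} = total euler (λ n k → C (M ℕ.+ k) n) (ι M ^_) (λ _ → ι M) (C-0 (M ℕ.+ 0)) refl (λ _ → refl) step n {L}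
    where
    step : ∀ n k → k ℕ.≤ n → ι (n ℕ.∸ k) * C (M ℕ.+ suc k) (suc n) + ι (k ℕ.+ 1) * C (M ℕ.+ k) (suc n) ≡ ι M * C (M ℕ.+ k) n
    step n k k≤n = *-cancelˡ (0<ι (s≤s z≤n)) (begin
      s * (ι (n ℕ.∸ k) * C (M ℕ.+ suc k) (suc n) + ι (k ℕ.+ 1) * C N (suc n))
        ≡⟨ cong₂ (λ d N → s * (d * C N (suc n) + ι (k ℕ.+ 1) * C (M ℕ.+ k) (suc n))) (ι-∸ k≤n) (ℕ.+-suc M k) ⟩
      s * ((ι n - ι k) * C (suc N) (suc n) + ι (k ℕ.+ 1) * C N (suc n))
        ≡⟨ solve 5 (λ s d c k e → s :* (d :* c :+ k :* e) := d :* (s :* c) :+ k :* (s :* e)) refl s (ι n - ι k) (C (suc N) (suc n)) (ι (k ℕ.+ 1)) (C N (suc n)) ⟩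
      (ι n - ι k) * (s * C (suc N) (suc n)) + ι (k ℕ.+ 1) * (s * C N (suc n))
        ≡⟨ cong₂ (λ p q → (ι n - ι k) * p + ι (k ℕ.+ 1) * q) (absorb N n) (lower N n) ⟩
      (ι n - ι k) * (ι (suc N) * c) + ι (k ℕ.+ 1) * ((ι N - ι n) * c)
        ≡⟨ cong₂ (λ p q → (ι n - ι k) * (p * c) + q * ((ι N - ι n) * c)) (ι-suc N) (trans (ι-+ k 1) (cong (ι k +_) ι1)) ⟩
      (ι n - ι k) * ((1ℚ + ι N) * c) + (ι k + 1ℚ) * ((ι N - ι n) * c)
        ≡⟨ cong (λ p → (ι n - ι k) * ((1ℚ + p) * c) + (ι k + 1ℚ) * ((p - ι n) * c)) (ι-+ M k) ⟩
      (ι n - ι k) * ((1ℚ + (ι M + ι k)) * c) + (ι k + 1ℚ) * ((ι M + ι k - ι n) * c)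
        ≡⟨ solve 4 (λ n k M c → (n :- k) :* ((:1 :+ (M :+ k)) :* c) :+ (k :+ :1) :* ((M :+ k :- n) :* c) := (:1 :+ n) :* (M :* c)) refl (ι n) (ι k) (ι M) c ⟩
      (1ℚ + ι n) * (ι M * c)
        ≡⟨ cong (_* (ι M * c)) (sym (ι-suc n)) ⟩
      s * (ι M * c) ∎)
      where
      open ≡-Reasoning
      N : ℕ
      N = M ℕ.+ k
      s c : ℚ
      s = ι (suc n)
      c = C N n

  -- The weights w k = A(n , k) C(M + k , n), and z k = w k n/(M + k), the difference
  -- of the weights for M and M - 1.
  module _ {n′ m : ℕ} {x : ℚ} (xM : x * ι (suc m) ≡ 1ℚ)
           {d : ℕ} {Q τ : ℚ} (1≤Q : 1ℚ ≤ Q)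
           ([M+n]²≤Qdn : (ι (suc m) + ι (suc n′)) * (ι (suc m) + ι (suc n′)) ≤ (Q - 1ℚ) * ι d * ι (suc n′))
           (Q≤τd : Q ≤ τ * ι d) (0≤τ : 0ℚ ≤ τ) where
    private
      n M : ℕ
      n = suc n′
      M = suc m
      E : ℚ
      E = (1ℚ - x) ^ n
      w z : ℕ → ℚ
      w k = A n k * C (M ℕ.+ k) n
      z k = A n k * C (m ℕ.+ k) n′
      0≤w : ∀ k → 0ℚ ≤ w k
      0≤w k = 0≤T euler n k ⊗ 0≤T pascal (M ℕ.+ k) n
      0≤z : ∀ k → 0ℚ ≤ z k
      0≤z k = 0≤T euler n k ⊗ 0≤T pascal (m ℕ.+ k) n′
      w≡ : ∀ k → w k ≡ A n k * C (m ℕ.+ k) n + z k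
      w≡ k = trans (cong (A n k *_) (C-suc (m ℕ.+ k) n′))
        (solve 3 (λ a c e → a :* (c :+ e) := a :* e :+ a :* c) refl (A n k) (C (m ℕ.+ k) n′) (C (m ℕ.+ k) n))
      z≤w : ∀ k → z k ≤ w k
      z≤w k = subst (z k ≤_) (sym (w≡ k)) (by (0≤T euler n k ⊗ 0≤T pascal (m ℕ.+ k) n)
        (solve 2 (λ z r → r :+ z :- z := r) refl (z k) (A n k * C (m ℕ.+ k) n)))
      [M+k]z : ∀ k → ι (M ℕ.+ k) * z k ≡ ι n * w k
      [M+k]z k = begin
        ι (M ℕ.+ k) * (A n k * C (m ℕ.+ k) n′)   ≡⟨ solve 3 (λ s a c → s :* (a :* c) := a :* (s :* c)) refl (ι (M ℕ.+ k)) (A n k) (C (m ℕ.+ k) n′) ⟩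
        A n k * (ι (M ℕ.+ k) * C (m ℕ.+ k) n′)   ≡⟨ cong (A n k *_) (sym (absorb (m ℕ.+ k) n′)) ⟩
        A n k * (ι n * C (M ℕ.+ k) n)            ≡⟨ solve 3 (λ s a c → a :* (s :* c) := s :* (a :* c)) refl (ι n) (A n k) (C (M ℕ.+ k) n) ⟩
        ι n * w k                                ∎
        where open ≡-Reasoning
      0<M+ : ∀ k → 0ℚ < ι (M ℕ.+ k)
      0<M+ k = 0<ι (s≤s z≤n)
      0<M : 0ℚ < ι M
      0<M = 0<ι (s≤s z≤n)
      mean : ∀ L → n ℕ.< L → ∑ L z ≡ (1ℚ - E) * ∑ L w
      mean L n<L = begin
        ∑ L z                                         ≡⟨ solve 2 (λ a c → a := c :+ a :- c) refl (∑ L z) (∑ L v) ⟩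
        ∑ L v + ∑ L z - ∑ L v                         ≡⟨ cong₂ _-_ (trans (sym (∑-+ L v z)) (∑-cong L λ k _ → sym (w≡ k))) (worpitzky m n n<L) ⟩
        ∑ L w - ι m ^ n                               ≡⟨ cong (λ s → ∑ L w - s) m^n ⟩
        ∑ L w - E * ∑ L w                             ≡⟨ solve 2 (λ W E → W :- E :* W := (:1 :- E) :* W) refl (∑ L w) E ⟩
        (1ℚ - E) * ∑ L w                              ∎
        where
        open ≡-Reasoning
        v : ℕ → ℚ
        v k = A n k * C (m ℕ.+ k) n
        m≡ : ι m ≡ (1ℚ - x) * ι M
        m≡ = trans (trans (solve 1 (λ m → m := :1 :+ m :- :1) refl (ι m)) (cong₂ _-_ (sym (ι-suc m)) (sym xM)))
          (solve 2 (λ M x → M :- x :* M := (:1 :- x) :* M) refl (ι M) x)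
        m^n : ι m ^ n ≡ E * ∑ L w
        m^n = trans (cong (_^ n) m≡) (trans (^-distrib-* (1ℚ - x) (ι M) n) (cong (E *_) (sym (worpitzky M n n<L))))
      0<W : ∀ L → n ℕ.< L → 0ℚ < ∑ L w
      0<W L n<L = subst (0ℚ <_) (sym (worpitzky M n n<L)) (0<^ n 0<M)
      n<s+n : ∀ s → n ℕ.< s ℕ.+ suc n
      n<s+n s = ℕ.m≤n+m (suc n) s
      z-≤ : ∀ φ i → ι n ≤ φ * ι (M ℕ.+ i) → z i ≤ φ * w i
      z-≤ φ i le = by· (0<M+ i) (‖ le ⊗ 0≤w i) (trans
        (trans (solve 4 (λ M φ w z → M :* (φ :* w :- z) := φ :* M :* w :- M :* z) refl (ι (M ℕ.+ i)) φ (w i) (z i)) (cong (λ s → φ * ι (M ℕ.+ i) * w i - s) ([M+k]z i)))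
        (solve 3 (λ a w n → a :* w :- n :* w := (a :- n) :* w) refl (φ * ι (M ℕ.+ i)) (w i) (ι n)))
      z-≥ : ∀ φ i → φ * ι (M ℕ.+ i) ≤ ι n → φ * w i ≤ z i
      z-≥ φ i le = by· (0<M+ i) (‖ le ⊗ 0≤w i) (trans
        (trans (solve 4 (λ M φ w z → M :* (z :- φ :* w) := M :* z :- φ :* M :* w) refl (ι (M ℕ.+ i)) φ (w i) (z i)) (cong (λ s → s - φ * ι (M ℕ.+ i) * w i) ([M+k]z i)))
        (solve 3 (λ a w n → n :* w :- a :* w := (n :- a) :* w) refl (φ * ι (M ℕ.+ i)) (w i) (ι n)))
      C-ratio : ∀ i → (ι (suc (M ℕ.+ i)) - ι n) * C (suc (M ℕ.+ i)) n ≡ ι (suc (M ℕ.+ i)) * C (M ℕ.+ i) n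
      C-ratio i = upper (M ℕ.+ i) n′
      w-suc : ∀ i → w (suc i) ≡ A n (suc i) * C (suc (M ℕ.+ i)) n
      w-suc i = cong (λ N → A n (suc i) * C N n) (ℕ.+-suc M i)
      ι[M+] : ∀ i → ι (suc (M ℕ.+ i)) ≡ 1ℚ + (ι M + ι i)
      ι[M+] i = trans (ι-suc (M ℕ.+ i)) (cong (1ℚ +_) (ι-+ M i))
      g-right : ∀ {g y} i → g * A n (suc i) ≤ y * A n i →
                g * (ι (suc (M ℕ.+ i)) - ι n) * w (suc i) ≤ y * ι (suc (M ℕ.+ i)) * w i
      g-right {g} {y} i le = subst (λ s → g * (N₁ - ι n) * s ≤ y * N₁ * w i) (sym (w-suc i))
        (by (0≤N₁C ⊗ ‖ le) (trans
          (cong (λ s → y * N₁ * (u * c) - s) (trans (solve 4 (λ g D u′ c′ → g :* D :* (u′ :* c′) := g :* u′ :* (D :* c′)) refl g (N₁ - ι n) u′ c′) (cong (g * u′ *_) (C-ratio i))))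
          (solve 6 (λ g y N₁ u u′ c → y :* N₁ :* (u :* c) :- g :* u′ :* (N₁ :* c) := N₁ :* c :* (y :* u :- g :* u′)) refl g y N₁ u u′ c)))
        where
        N₁ u u′ c c′ : ℚ
        N₁ = ι (suc (M ℕ.+ i))
        u  = A n i
        u′ = A n (suc i)
        c  = C (M ℕ.+ i) n
        c′ = C (suc (M ℕ.+ i)) n
        0≤N₁C : 0ℚ ≤ N₁ * c
        0≤N₁C = 0≤ι (suc (M ℕ.+ i)) ⊗ 0≤T pascal (M ℕ.+ i) n
      g-left : ∀ {g y} i → y * A n i ≤ g * A n (suc i) →
               y * ι (suc (M ℕ.+ i)) * w i ≤ g * (ι (suc (M ℕ.+ i)) - ι n) * w (suc i)
      g-left {g} {y} i le = subst (λ s → y * N₁ * w i ≤ g * (N₁ - ι n) * s) (sym (w-suc i))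
        (by (0≤N₁C ⊗ ‖ le) (trans
          (cong (λ s → s - y * N₁ * (u * c)) (trans (solve 4 (λ g D u′ c′ → g :* D :* (u′ :* c′) := g :* u′ :* (D :* c′)) refl g (N₁ - ι n) u′ c′) (cong (g * u′ *_) (C-ratio i))))
          (solve 6 (λ g y N₁ u u′ c → g :* u′ :* (N₁ :* c) :- y :* N₁ :* (u :* c) := N₁ :* c :* (g :* u′ :- y :* u)) refl g y N₁ u u′ c)))
        where
        N₁ u u′ c c′ : ℚ
        N₁ = ι (suc (M ℕ.+ i))
        u  = A n i
        u′ = A n (suc i)
        c  = C (M ℕ.+ i) n
        c′ = C (suc (M ℕ.+ i)) n
        0≤N₁C : 0ℚ ≤ N₁ * c
        0≤N₁C = 0≤ι (suc (M ℕ.+ i)) ⊗ 0≤T pascal (M ℕ.+ i) n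

    module _ {j : ℕ} (k<n : suc j ℕ.< n) (n<M+k : n ℕ.< suc (M ℕ.+ j)) where
      private
        N Y : ℚ
        N = ι (suc (M ℕ.+ j))
        Y = N - ι n
        0<Y : 0ℚ < Y
        0<Y = subst (0ℚ <_) (ι-∸ (ℕ.<⇒≤ n<M+k)) (0<ι (ℕ.m<n⇒0<n∸m n<M+k))
        0<N : 0ℚ < N
        0<N = 0<ι (s≤s z≤n)

      euler-right : ∀ {φ} → 0 ℕ.< j → N * A n (suc j) ≤ Y * A n j → φ * ι (M ℕ.+ (j ℕ.+ d)) ≡ ι n → 0ℚ ≤ φ → φ ≤ 1ℚ - E + τ
      euler-right {φ} 0<j start φ≡ 0≤φ = mean-right {w} {z} 0≤w 0≤z z≤w {d} {Q} {τ} {φ} {1ℚ - E} 1≤Q Q≤τd 0≤τ j (suc n)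
        (mean L (n<s+n s)) (0<W L (n<s+n s)) φ≤1 φw≤z dec decay
        where
        s L : ℕ
        s = j ℕ.+ d
        L = s ℕ.+ suc n
        φ≤1 : φ ≤ 1ℚ
        φ≤1 = by· (0<M+ s) (‖ ι-mono n≤M+s) (trans (solve 2 (λ a φ → a :* (:1 :- φ) := a :- φ :* a) refl (ι (M ℕ.+ s)) φ) (cong (λ t → ι (M ℕ.+ s) - t) φ≡))
          where
          n≤M+s : n ℕ.≤ M ℕ.+ s
          n≤M+s = ℕ.≤-trans (ℕ.s≤s⁻¹ n<M+k) (ℕ.+-monoʳ-≤ M (ℕ.m≤m+n j d))
        φw≤z : ∀ i → i ℕ.< s → φ * w i ≤ z i
        φw≤z i i<s = z-≥ φ i (subst (φ * ι (M ℕ.+ i) ≤_) φ≡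
          (by (0≤φ ⊗ ‖ ι-mono (ℕ.+-monoʳ-≤ M (ℕ.<⇒≤ i<s)))
            (solve 3 (λ φ a b → φ :* b :- φ :* a := φ :* (b :- a)) refl φ (ι (M ℕ.+ i)) (ι (M ℕ.+ s)))))
        bound : ∀ i → j ℕ.≤ i → N * (ι (suc (M ℕ.+ i)) - ι n) * w (suc i) ≤ Y * ι (suc (M ℕ.+ i)) * w i
        bound i j≤i = g-right {N} {Y} i (ratio-right {n} {j} {N} {Y} 0<j (ℚ.<⇒≤ 0<N) (ℚ.<⇒≤ 0<Y) start i j≤i)
        N≤ : ∀ {i} → j ℕ.≤ i → N ≤ ι (suc (M ℕ.+ i))
        N≤ j≤i = ι-mono (s≤s (ℕ.+-monoʳ-≤ M j≤i))
        0<g : ∀ i → j ℕ.≤ i → 0ℚ < N * (ι (suc (M ℕ.+ i)) - ι n)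
        0<g i j≤i = 0<* 0<N (ℚ.<-≤-trans 0<Y
          (by (‖ N≤ j≤i) (solve 3 (λ N P n → P :- n :- (N :- n) := P :- N) refl N (ι (suc (M ℕ.+ i))) (ι n))))
        dec : ∀ i → j ℕ.≤ i → w (suc i) ≤ w i
        dec i j≤i = ratio-≤ (0<g i j≤i) (0≤w i) (bound i j≤i)
          (by (0≤ι n ⊗ ‖ N≤ j≤i)
            (solve 3 (λ N P n → N :* (P :- n) :- (N :- n) :* P
              := n :* (P :- N)) refl N (ι (suc (M ℕ.+ i))) (ι n)))
        decay : ∀ i → s ℕ.≤ i → Q * w (suc i) ≤ (Q - 1ℚ) * w i
        decay i s≤i with suc i ℕ.≤? n
        ... | no  i≮n = subst (λ a → Q * (a * C (M ℕ.+ suc i) n) ≤ (Q - 1ℚ) * w i) (sym (ι-outside euler (ℕ.≰⇒> i≮n)))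
          (by (‖ 1≤Q ⊗ 0≤w i)
            (solve 3 (λ Q c w → (Q :- :1) :* w :- Q :* (:0 :* c)
              := (Q :- :1) :* w) refl Q (C (M ℕ.+ suc i) n) (w i)))
        ... | yes i<n = ratio-decay (0<g i j≤i) (0≤w i) 1≤Q (bound i j≤i) Qy≤
          where
          j≤i : j ℕ.≤ i
          j≤i = ℕ.≤-trans (ℕ.m≤m+n j d) s≤i
          Qy≤ : Q * (Y * ι (suc (M ℕ.+ i))) ≤ (Q - 1ℚ) * (N * (ι (suc (M ℕ.+ i)) - ι n))
          Qy≤ = subst₂ (λ N P → Q * ((N - ι n) * P) ≤ (Q - 1ℚ) * (N * (P - ι n))) (sym (ι[M+] j)) (sym (ι[M+] i))
            (by (0≤ι n ⊗ (‖ 1≤Q ⊕ 0≤# 1) ⊗ ‖ subst (_≤ ι i) (ι-+ j d) (ι-mono s≤i) ⊕ ‖ [M+n]²≤Qdn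
                ⊕ 0≤ι d ⊗ 0≤ι n ⊕ (0≤ι M ⊕ 0≤ι n) ⊗ ‖ subst (_≤ ι n) (ι-suc j) (ι-mono (ℕ.<⇒≤ k<n))
                ⊕ (0≤# 1 ⊕ (0≤ι M ⊕ 0≤ι j)) ⊗ (‖ subst (_≤ ι n) (ι-suc i) (ι-mono i<n) ⊕ 0≤ι n))
              (solve 6 (λ Q M i j d n → (Q :- :1) :* ((:1 :+ (M :+ j)) :* (:1 :+ (M :+ i) :- n))
                :- Q :* ((:1 :+ (M :+ j) :- n) :* (:1 :+ (M :+ i)))
                := n :* (Q :- :1 :+ :# 1) :* (i :- (j :+ d))
                :+ ((Q :- :1) :* d :* n :- (M :+ n) :* (M :+ n)) :+ d :* n :+ (M :+ n) :* (n :- (:1 :+ j))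
                :+ (:# 1 :+ (M :+ j)) :* (n :- (:1 :+ i) :+ n)) refl Q (ι M) (ι i) (ι j) (ι d) (ι n)))

      euler-left : ∀ {b φ} → j ≡ b ℕ.+ d → Y * A n j ≤ N * A n (suc j) → φ * ι (M ℕ.+ b) ≡ ι n → 0ℚ ≤ φ → 1ℚ - E ≤ φ + τ
      euler-left {b} {φ} refl start φ≡ 0≤φ = mean-left {w} {z} 0≤w 0≤z z≤w {d} {Q} {τ} {φ} {1ℚ - E} 1≤Q Q≤τd 0≤τ b (suc n)
        (mean L (n<s+n j)) (0<W L (n<s+n j)) 0≤φ z≤φw inc decay
        where
        L : ℕ
        L = j ℕ.+ suc n
        z≤φw : ∀ i → b ℕ.≤ i → z i ≤ φ * w i
        z≤φw i b≤i = z-≤ φ i (subst (_≤ φ * ι (M ℕ.+ i)) φ≡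
          (by (0≤φ ⊗ ‖ ι-mono (ℕ.+-monoʳ-≤ M b≤i))
            (solve 3 (λ φ a b → φ :* b :- φ :* a := φ :* (b :- a)) refl φ (ι (M ℕ.+ b)) (ι (M ℕ.+ i)))))
        bound : ∀ i → i ℕ.≤ j → Y * ι (suc (M ℕ.+ i)) * w i ≤ N * (ι (suc (M ℕ.+ i)) - ι n) * w (suc i)
        bound i i≤j = g-left {N} {Y} i (ratio-left {n} {j} {N} {Y} k<n (ℚ.<⇒≤ 0<N) (ℚ.<⇒≤ 0<Y) start i i≤j)
        0<g : ∀ i → 0ℚ < Y * ι (suc (M ℕ.+ i))
        0<g i = 0<* 0<Y (0<ι (s≤s z≤n))
        N≥ : ∀ {i} → i ℕ.≤ j → ι (suc (M ℕ.+ i)) ≤ N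
        N≥ i≤j = ι-mono (s≤s (ℕ.+-monoʳ-≤ M i≤j))
        inc : ∀ i → i ℕ.< j → w i ≤ w (suc i)
        inc i i<j = ratio-≤ (0<g i) (0≤w (suc i)) (bound i (ℕ.<⇒≤ i<j))
          (by (0≤ι n ⊗ ‖ N≥ (ℕ.<⇒≤ i<j))
            (solve 3 (λ N P n → (N :- n) :* P :- N :* (P :- n)
              := n :* (N :- P)) refl N (ι (suc (M ℕ.+ i))) (ι n)))
        decay : ∀ i → i ℕ.< b → Q * w i ≤ (Q - 1ℚ) * w (suc i)
        decay i i<b = ratio-decay (0<g i) (0≤w (suc i)) 1≤Q (bound i i≤j) Qg≤
          where
          i≤j : i ℕ.≤ j
          i≤j = ℕ.≤-trans (ℕ.<⇒≤ i<b) (ℕ.m≤m+n b d)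
          Qg≤ : Q * (N * (ι (suc (M ℕ.+ i)) - ι n)) ≤ (Q - 1ℚ) * (Y * ι (suc (M ℕ.+ i)))
          Qg≤ = subst₂ (λ N P → Q * (N * (P - ι n)) ≤ (Q - 1ℚ) * ((N - ι n) * P)) (sym (trans (ι[M+] j) (cong (λ s → 1ℚ + (ι M + s)) (ι-+ b d)))) (sym (ι[M+] i))
            (by (0≤ι n ⊗ (‖ 1≤Q ⊕ 0≤# 1) ⊗ ‖ ι-mono (ℕ.<⇒≤ i<b) ⊕ ‖ [M+n]²≤Qdn ⊕ 0≤ι d ⊗ 0≤ι n
                ⊕ (0≤ι M ⊕ 0≤ι n) ⊗ ‖ 1+j≤n ⊕ (0≤# 1 ⊕ (0≤ι M ⊕ (0≤ι b ⊕ 0≤ι d))) ⊗ ‖ 1+i≤n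
                ⊕ 0≤ι n ⊗ (0≤# 1 ⊕ (0≤ι M ⊕ 0≤ι i)))
              (solve 6 (λ Q M i b d n → (Q :- :1) :* ((:1 :+ (M :+ (b :+ d)) :- n) :* (:1 :+ (M :+ i)))
                :- Q :* ((:1 :+ (M :+ (b :+ d))) :* (:1 :+ (M :+ i) :- n))
                := n :* (Q :- :1 :+ :# 1) :* (b :- i) :+ ((Q :- :1) :* d :* n :- (M :+ n) :* (M :+ n))
                :+ d :* n :+ (M :+ n) :* (n :- (:1 :+ (b :+ d)))
                :+ (:# 1 :+ (M :+ (b :+ d))) :* (n :- (:1 :+ i)) :+ n :* (:# 1 :+ (M :+ i)))
                refl Q (ι M) (ι i) (ι b) (ι d) (ι n)))
            where
            1+j≤n : 1ℚ + (ι b + ι d) ≤ ι n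
            1+j≤n = subst (_≤ ι n) (trans (ι-suc (b ℕ.+ d)) (cong (1ℚ +_) (ι-+ b d))) (ι-mono (ℕ.<⇒≤ k<n))
            1+i≤n : 1ℚ + ι i ≤ ι n
            1+i≤n = subst (_≤ ι n) (ι-suc i) (ι-mono (ℕ.≤-trans (s≤s i≤j) (ℕ.<⇒≤ k<n)))

module CauchyPascal where

  open Prelude
  open OrderedField
  open Triangles
  open Approximation
  open Defs using (pascal)

  open Binomial
  open Regular

  cauchy-pascal : CauchyCriterion pascal
  cauchy-pascal {B} {ε} 1≤B 0<ε = ½ * ε , 0<½ε , proj₁ enough , λ {n} {j} {n′} {j′} {κ} {κ′} {p} {p′} N≤n _ reg reg′ κ≤κ′ κ′≤κ prob prob′ →
    let eq  = solved {n} {j} {κ} {p} reg prob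
        eq′ = solved {n′} {j′} {κ′} {p′} reg′ prob′ in
    ℚ.≤-trans {p′} {κ′} {p + ε}
      (by· {(p′)} {(κ′)} (0<+ (0<# 0) (0≤ι n′)) (‖ ℚ.≤-reflexive eq′ ⊕ 0≤κ reg′)
        (solve 3 (λ p κ n → (:# 1 :+ n) :* (κ :- p) := κ :* n :- p :* (:1 :+ n) :+ κ) refl p′ κ′ (ι n′)))
      (by· {κ′} {p + ε} (0<+ (0<# 0) (0≤ι n)) ((0≤# 1 ⊕ 0≤ι n) ⊗ ‖ κ′≤κ ⊕ ‖ ℚ.≤-reflexive (sym eq)
          ⊕ ‖ proj₂ enough n N≤n ⊕ ‖ κ≤1 reg ⊕ ℚ.<⇒≤ 0<½ε)
        (solve 5 (λ p κ κ′ ε n → (:# 1 :+ n) :* (p :+ ε :- κ′)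
          := (:# 1 :+ n) :* (κ :+ :½ :* ε :- κ′) :+ (p :* (:1 :+ n) :- κ :* n) :+ (:½ :* ε :* n :- :1)
          :+ (:1 :- κ) :+ :½ :* ε) refl p κ κ′ ε (ι n)))
    where
    0<½ε : 0ℚ < ½ * ε
    0<½ε = 0<* (ℚ.positive⁻¹ ½) 0<ε
    enough : ∃[ N ] ∀ n → N ℕ.≤ n → 1ℚ ≤ ½ * ε * ι n
    enough = eventually 1ℚ 0<½ε
    solved : ∀ {n j κ p} → Regular B n (suc j) κ → Probability pascal n j p → p * (1ℚ + ι n) ≡ κ * ι n
    solved {n} {j} {κ} {p} reg prob = *-cancelˡ (0<T pascal {suc n} {suc j} (s≤s z≤n) (ℕ.m<n⇒m<1+n (k<n reg))) (begin
      C (suc n) (suc j) * (p * (1ℚ + ι n))    ≡⟨ solve 3 (λ c p s → c :* (p :* s) := p :* c :* s) refl (C (suc n) (suc j)) p (1ℚ + ι n) ⟩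
      p * C (suc n) (suc j) * (1ℚ + ι n)      ≡⟨ cong₂ _*_ (trans prob (trans (cong (_* C n j) ι1) (ℚ.*-identityˡ (C n j)))) (sym (ι-suc n)) ⟩
      C n j * ι (suc n)                       ≡⟨ ℚ.*-comm (C n j) (ι (suc n)) ⟩
      ι (suc n) * C n j                       ≡⟨ sym (absorb n j) ⟩
      ι (suc j) * C (suc n) (suc j)           ≡⟨ ℚ.*-comm (ι (suc j)) _ ⟩
      C (suc n) (suc j) * ι (suc j)           ≡⟨ cong (C (suc n) (suc j) *_) (sym (κn reg)) ⟩
      C (suc n) (suc j) * (κ * ι n)           ∎)
      where open ≡-Reasoning

module CauchyStirling₂ where

  open Prelude
  open OrderedField
  open Powers
  open Triangles
  open Approximation
  open Transversality
  open Parameters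
  open Defs using (stirling₂; T; T-positive)

  open Stirling₂
  open Regular
  open Scale

  module _ {B σ : ℚ} (0≤B : 0ℚ ≤ B) (0<σ : 0ℚ < σ) {n j m : ℕ} {x κ H : ℚ} (reg : Regular B n (suc j) κ)
           (xM : x * ι (suc m) ≡ 1ℚ) (0≤x : 0ℚ ≤ x) (nx≤B : ι n * x ≤ B)
           (sc : Scale H σ n) (M≤Hn : ι (suc m) ≤ H * ι n) where
    private
      M≤ : ι (suc m) ≤ (Q sc - 1ℚ) * ι (d sc)
      M≤ = ℚ.≤-trans M≤Hn (Hn≤ sc)
      [1+d]x≤ : (1ℚ + ι (d sc)) * x ≤ σ * B
      [1+d]x≤ = stretch-≤ {H} {σ} {n} {x} {B} (ℚ.<⇒≤ 0<σ) 0≤x nx≤B sc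

    right₂ : 0 ℕ.< j → ι (suc m ℕ.∸ j) * S n (suc j) ≤ S n j → 1ℚ - ι (suc j) * x ≤ (1ℚ - x) ^ n + σ * (1ℚ + B)
    right₂ 0<j start with j ℕ.<? suc m
    ... | yes j<M = subst (λ k → 1ℚ - k * x ≤ (1ℚ - x) ^ n + σ * (1ℚ + B)) (sym (ι-suc j))
      (by (‖ bound ⊕ ‖ [1+d]x≤ ⊕ 0≤# 2 ⊗ 0≤x)
        (solve 6 (λ j d x σ E B → E :+ σ :* (:1 :+ B) :- (:1 :- (:1 :+ j) :* x)
          := E :+ σ :- (:1 :- (j :+ d) :* x) :+ (σ :* B :- (:1 :+ d) :* x) :+ :# 2 :* x)
          refl (ι j) (ι (d sc)) x σ ((1ℚ - x) ^ n) B))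
      where
      bound : 1ℚ - (ι j + ι (d sc)) * x ≤ (1ℚ - x) ^ n + σ
      bound = subst (λ s → 1ℚ - s * x ≤ (1ℚ - x) ^ n + σ) (ι-+ j (d sc))
        (S₂-right {n} {m} {x} xM 0≤x {d sc} {Q sc} {σ} (1≤Q sc) M≤ (Q≤ sc) (ℚ.<⇒≤ 0<σ) 0<j j<M start)
    ... | no  j≮M = by (‖ inverse-≥ {x} {ι (suc m)} {ι (suc j)} {1ℚ} xM 0≤x (subst (_≤ ι (suc j)) (sym (ℚ.*-identityˡ (ι (suc m)))) (ι-mono (ℕ.m≤n⇒m≤1+n (ℕ.≮⇒≥ j≮M))))
        ⊕ 0≤^ n (‖ x≤1) ⊕ ℚ.<⇒≤ 0<σ ⊗ (0≤# 1 ⊕ 0≤B))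
      (solve 5 (λ e x σ E B → E :+ σ :* (:1 :+ B) :- (:1 :- e :* x)
        := e :* x :- :1 :+ E :+ σ :* (:# 1 :+ B)) refl (ι (suc j)) x σ ((1ℚ - x) ^ n) B)
      where
      x≤1 : x ≤ 1ℚ
      x≤1 = subst (_≤ 1ℚ) (ℚ.*-identityˡ x) (inverse-≤ {x} {ι (suc m)} {1ℚ} {1ℚ} xM 0≤x (subst₂ _≤_ ι1 (sym (ℚ.*-identityˡ (ι (suc m)))) (ι-mono (s≤s z≤n))))

    left₂ : σ * B ≤ 1ℚ → suc j ℕ.< n → j ℕ.< suc m → S n j ≤ ι (suc m ℕ.∸ j) * S n (suc j) →
            (1ℚ - x) ^ n ≤ 1ℚ - ι (suc j) * x + σ * (1ℚ + B)
    left₂ σB≤1 k<n j<M start = finish (j ℕ.∸ d sc) (sym (ℕ.m∸n+n≡m d≤j))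
      where
      d≤j : d sc ℕ.≤ j
      d≤j = stretch-fits {B} {κ} {n} {j} reg {σ} {H} (ℚ.<⇒≤ 0<σ) σB≤1 sc
      finish : ∀ b → j ≡ b ℕ.+ d sc → (1ℚ - x) ^ n ≤ 1ℚ - ι (suc j) * x + σ * (1ℚ + B)
      finish b refl = subst (λ k → (1ℚ - x) ^ n ≤ 1ℚ - k * x + σ * (1ℚ + B))
        (sym (trans (ι-suc j) (cong (1ℚ +_) (ι-+ b (d sc)))))
        (by (‖ S₂-left {n} {m} {x} xM 0≤x {d sc} {Q sc} {σ} (1≤Q sc) M≤ (Q≤ sc) (ℚ.<⇒≤ 0<σ) k<n j<M start
            ⊕ ‖ [1+d]x≤)
          (solve 6 (λ b d x σ E B → :1 :- (:1 :+ (b :+ d)) :* x :+ σ :* (:1 :+ B) :- E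
            := :1 :- b :* x :+ σ :- E :+ (σ :* B :- (:1 :+ d) :* x))
            refl (ι b) (ι (d sc)) x σ ((1ℚ - x) ^ n) B))

  module _ {B η H τ σ : ℚ} (1≤B : 1ℚ ≤ B) (0<η : 0ℚ < η) (η≤1 : η ≤ 1ℚ) (ηH≡1 : η * H ≡ 1ℚ) (0<H : 0ℚ < H)
    (0<τ : 0ℚ < τ) (0<σ : 0ℚ < σ) (σB≡τ : σ * (1ℚ + B) ≡ τ)
    (τK≤ : # 64 * (τ * K₂ B) + # 64 * (τ * B) + # 64 * τ ≤ η * η * η)
    {n j n′ j′ : ℕ} {κ κ′ p p′ : ℚ}
    (reg : Regular B n (suc j) κ) (reg′ : Regular B n′ (suc j′) κ′) (κ≤κ′ : κ ≤ κ′ + τ) (κ′≤κ : κ′ ≤ κ + τ)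
    (sc : Scale (# 3 * H) σ n) (sc′ : Scale (# 3 * H) σ n′) (R≤ : # 4 * B * B ≤ σ * ι n) (R≤′ : # 4 * B * B ≤ σ * ι n′)
    (prob : Probability stirling₂ n j p) (prob′ : Probability stirling₂ n′ j′ p′) where
    private
      K : ℚ
      K = K₂ B
      0≤B : 0ℚ ≤ B
      0≤B = ℚ.≤-trans (0≤# 1) 1≤B
      0≤τ : 0ℚ ≤ τ
      0≤τ = ℚ.<⇒≤ 0<τ
      0≤η : 0ℚ ≤ η
      0≤η = ℚ.<⇒≤ 0<η
      0≤K : 0ℚ ≤ K
      0≤K = (0≤B ⊗ (0≤# 1 ⊕ 0≤B) ⊕ 0≤# 2 ⊗ 0≤B) ⊗ sq (# 2 + B)
      η³≤η : η * η * η ≤ η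
      η³≤η = by (‖ η≤1 ⊗ 0≤η ⊗ (0≤# 1 ⊕ 0≤η))
        (solve 1 (λ η → η :- η :* η :* η := (:1 :- η) :* η :* (:# 1 :+ η)) refl η)
      64τ≤η : # 64 * τ + # 64 * (τ * B) ≤ η
      64τ≤η = by (0≤# 64 ⊗ (0≤τ ⊗ 0≤K) ⊕ ‖ τK≤ ⊕ ‖ η³≤η)
        (solve 4 (λ τ B K η → η :- (:# 64 :* τ :+ :# 64 :* (τ :* B))
          := :# 64 :* (τ :* K) :+ (η :* η :* η :- (:# 64 :* (τ :* K) :+ :# 64 :* (τ :* B) :+ :# 64 :* τ))
          :+ (η :- η :* η :* η)) refl τ B K η)
      σ≤τ : σ + σ * B ≤ τ
      σ≤τ = ℚ.≤-reflexive (trans (solve 2 (λ σ B → σ :+ σ :* B := σ :* (:1 :+ B)) refl σ B) σB≡τ)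
      σB≤1 : σ * B ≤ 1ℚ
      σB≤1 = by· (0<# 63) (0≤# 64 ⊗ ℚ.<⇒≤ 0<σ ⊕ 0≤# 64 ⊗ ‖ σ≤τ ⊕ ‖ 64τ≤η ⊕ 0≤# 64 ⊗ (0≤τ ⊗ 0≤B) ⊕ ‖ η≤1
          ⊕ 0≤# 63)
        (solve 4 (λ σ B τ η → :# 64 :* (:1 :- σ :* B)
          := :# 64 :* σ :+ :# 64 :* (τ :- (σ :+ σ :* B)) :+ (η :- (:# 64 :* τ :+ :# 64 :* (τ :* B)))
          :+ :# 64 :* (τ :* B) :+ (:1 :- η) :+ :# 63) refl σ B τ η)

      0<B : 0ℚ < B
      0<B = ℚ.<-≤-trans (0<# 0) 1≤B
      u v u′ v′ : ℚ
      u  = S n j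
      v  = S n (suc j)
      u′ = S n′ j′
      v′ = S n′ (suc j′)
      k k′ : ℚ
      k  = ι (suc j)
      k′ = ι (suc j′)
      0<v : 0ℚ < v
      0<v = 0<T stirling₂ (s≤s z≤n) (k<n reg)
      0<v′ : 0ℚ < v′
      0<v′ = 0<T stirling₂ (s≤s z≤n) (k<n reg′)
      0≤u : 0ℚ ≤ u
      0≤u = 0≤T stirling₂ n j
      0≤u′ : 0ℚ ≤ u′
      0≤u′ = 0≤T stirling₂ n′ j′
      unfold : ∀ {n j p} → Probability stirling₂ n j p → p * (S n j + ι (suc j) * S n (suc j)) ≡ S n j
      unfold {n} {j} {p} pr = trans (cong (p *_) (sym (trans (T-suc stirling₂ n j)
          (cong (_+ ι (suc j) * S n (suc j)) (trans (cong (_* S n j) ι1) (ℚ.*-identityˡ (S n j)))))))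
        (trans pr (trans (cong (_* S n j) ι1) (ℚ.*-identityˡ (S n j))))
      0<u+kv : 0ℚ < u + k * v
      0<u+kv = subst (0ℚ <_) (ℚ.+-comm (k * v) u) (0<+ (0<* (0<ι (s≤s z≤n)) 0<v) 0≤u)
      0<u+kv′ : 0ℚ < u′ + k′ * v′
      0<u+kv′ = subst (0ℚ <_) (ℚ.+-comm (k′ * v′) u′) (0<+ (0<* (0<ι (s≤s z≤n)) 0<v′) 0≤u′)
      eq : p * (u + k * v) ≡ u
      eq = unfold {n} {j} {p} prob
      eq′ : p′ * (u′ + k′ * v′) ≡ u′
      eq′ = unfold {n′} {j′} {p′} prob′
      0≤p : 0ℚ ≤ p
      0≤p = fraction-≥0 {u} {u + k * v} {p} 0<u+kv 0≤u eq
      0≤p′ : 0ℚ ≤ p′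
      0≤p′ = fraction-≥0 {u′} {u′ + k′ * v′} {p′} 0<u+kv′ 0≤u′ eq′
      p′≤1 : p′ ≤ 1ℚ
      p′≤1 = fraction-≤1 {u′} {k′ * v′} {p′} 0<u+kv′ (0≤ι (suc j′) ⊗ ℚ.<⇒≤ 0<v′) eq′

      module Tilt {q : ℕ} (vq≤u : v * ι q ≤ u) (u≤v : u ≤ v * (1ℚ + ι q)) {x : ℚ} (0<x : 0ℚ < x) (xM : x * ι (suc (j ℕ.+ q)) ≡ 1ℚ) where
        M m : ℕ
        m = j ℕ.+ q
        M = suc m
        0≤x : 0ℚ ≤ x
        0≤x = ℚ.<⇒≤ 0<x
        θ : ℚ
        θ = ι n * x
        M≡ : ι M ≡ k + ι q
        M≡ = ι-+ (suc j) q
        1-kx≤p : 1ℚ - k * x ≤ p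
        1-kx≤p = by· 0<u+kv (0≤ι (suc j) ⊗ 0≤x ⊗ ‖ vq≤u) (trans
          (trans (solve 4 (λ s p k x → s :* (p :- (:1 :- k :* x)) := p :* s :* :1 :- s :* (:1 :- k :* x)) refl (u + k * v) p k x)
            (cong₂ (λ a o → a * o - (u + k * v) * (o - k * x)) eq (trans (sym xM) (cong (x *_) M≡))))
          (solve 5 (λ u v k x q → u :* (x :* (k :+ q)) :- (u :+ k :* v) :* (x :* (k :+ q) :- k :* x) := k :* x :* (u :- v :* q)) refl u v k x (ι q)))

        trivial : H * ι n ≤ ι M → p′ ≤ p + η
        trivial Hn≤M = by (‖ p′≤1 ⊕ ‖ 1-kx≤p ⊕ 0≤x ⊗ ‖ ι-mono (ℕ.<⇒≤ (k<n reg)) ⊕ ‖ θ≤η)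
          (solve 6 (λ p′ p η k x n → p :+ η :- p′
            := :1 :- p′ :+ (p :- (:1 :- k :* x)) :+ x :* (n :- k) :+ (η :- n :* x)) refl p′ p η k x (ι n))
          where
          θ≤η : ι n * x ≤ η
          θ≤η = inverse-≤ {x} {ι M} {ι n} {η} xM 0≤x (subst (_≤ η * ι M)
            (trans (solve 3 (λ η H n → η :* (H :* n) := η :* H :* n) refl η H (ι n)) (trans (cong (_* ι n) ηH≡1) (ℚ.*-identityˡ (ι n))))
            (by (0≤η ⊗ ‖ Hn≤M) (solve 3 (λ η a M → η :* M :- η :* a := η :* (M :- a)) refl η (H * ι n) (ι M))))

        module Transfer (M≤Hn : ι M ≤ H * ι n) where
          n≤BM : ι n ≤ B * ι M
          n≤BM = ℚ.≤-trans (n≤Bk reg) (subst (λ s → B * k ≤ B * s) (sym M≡)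
            (by (0≤B ⊗ 0≤ι q) (solve 3 (λ B k q → B :* (k :+ q) :- B :* k := B :* q) refl B k (ι q))))
          θ≤B : θ ≤ B
          θ≤B = inverse-≤ {x} {ι M} {ι n} {B} xM 0≤x n≤BM
          η≤θ : η ≤ θ
          η≤θ = inverse-≥ {x} {ι M} {ι n} {η} xM 0≤x (subst (η * ι M ≤_)
            (trans (solve 3 (λ η H n → η :* (H :* n) := η :* H :* n) refl η H (ι n)) (trans (cong (_* ι n) ηH≡1) (ℚ.*-identityˡ (ι n))))
            (by (0≤η ⊗ ‖ M≤Hn) (solve 3 (λ η a M → η :* a :- η :* M := η :* (a :- M)) refl η (H * ι n) (ι M))))
          B≤σM : # 4 * B ≤ σ * ι M
          B≤σM = by· 0<B (‖ R≤ ⊕ ℚ.<⇒≤ 0<σ ⊗ ‖ n≤BM)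
            (solve 4 (λ B σ n M → B :* (σ :* M :- :# 4 :* B)
              := σ :* n :- :# 4 :* B :* B :+ σ :* (B :* M :- n)) refl B σ (ι n) (ι M))
          4x≤σ : # 4 * x ≤ σ
          4x≤σ = inverse-≤ {x} {ι M} {# 4} {σ} xM 0≤x (ℚ.≤-trans (by {(# 4)} {(# 4) * B} (0≤# 4 ⊗ ‖ 1≤B)
            (solve 1 (λ B → :# 4 :* B :- :# 4 := :# 4 :* (B :- :1)) refl B)) B≤σM)
          k+1<n : suc (suc j) ℕ.≤ n
          k+1<n = k<n reg
          left : (1ℚ - x) ^ n ≤ 1ℚ - k * x + τ
          left = subst (λ s → (1ℚ - x) ^ n ≤ 1ℚ - k * x + s) σB≡τ
            (left₂ {B} {σ} 0≤B 0<σ {n} {j} {m} {x} {κ} {# 3 * H} reg xM 0≤x θ≤B sc M≤3Hn σB≤1 k+1<n (s≤s (ℕ.m≤m+n j q)) start)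
            where
            M≤3Hn : ι M ≤ # 3 * H * ι n
            M≤3Hn = by (‖ M≤Hn ⊕ 0≤# 2 ⊗ ℚ.<⇒≤ 0<H ⊗ 0≤ι n)
              (solve 3 (λ H n M → :# 3 :* H :* n :- M := H :* n :- M :+ :# 2 :* H :* n) refl H (ι n) (ι M))
            start : u ≤ ι (M ℕ.∸ j) * v
            start = subst (u ≤_) (trans (ℚ.*-comm v (1ℚ + ι q)) (cong (_* v) (trans (sym (ι-suc q)) (cong ι (sym
              (trans (cong (ℕ._∸ j) (sym (ℕ.+-suc j q))) (ℕ.m+n∸m≡n j (suc q)))))))) u≤v

          kx≡κθ : k * x ≡ κ * θ
          kx≡κθ = trans (cong (_* x) (sym (κn reg))) (ℚ.*-assoc κ (ι n) x)

          ρ : ℚ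
          ρ = θ - ½ * (½ * η)

          module Primed {m′ : ℕ} {x′ : ℚ} (0≤x′ : 0ℚ ≤ x′) (x′M′ : x′ * ι (suc m′) ≡ 1ℚ)
            (n′≤ρM′ : ι n′ ≤ ρ * ι (suc m′)) (ρM′≤ : ρ * ι (suc m′) ≤ ι n′ + ρ) where
            M′ : ℕ
            M′ = suc m′
            t Δ e : ℚ
            t = ι n′ * x′
            Δ = θ - t
            e = (1ℚ - x′) ^ n′
            t≤ρ : t ≤ ρ
            t≤ρ = inverse-≤ {x′} {ι M′} {ι n′} {ρ} x′M′ 0≤x′ n′≤ρM′
            ¼η≤Δ : ½ * (½ * η) ≤ Δ
            ¼η≤Δ = by (‖ t≤ρ)
              (solve 3 (λ θ η t → θ :- t :- :½ :* (:½ :* η) := θ :- :½ :* (:½ :* η) :- t) refl θ η t)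
            0≤¼η : 0ℚ ≤ ½ * (½ * η)
            0≤¼η = 0≤½* (0≤½* 0≤η)
            0≤Δ : 0ℚ ≤ Δ
            0≤Δ = ℚ.≤-trans 0≤¼η ¼η≤Δ
            0≤t : 0ℚ ≤ t
            0≤t = 0≤ι n′ ⊗ 0≤x′
            ρ≤B : ρ ≤ B
            ρ≤B = by (‖ θ≤B ⊕ 0≤¼η) (solve 3 (λ θ h B → B :- (θ :- h) := B :- θ :+ h) refl θ (½ * (½ * η)) B)
            n′≤BM′ : ι n′ ≤ B * ι M′
            n′≤BM′ = by (‖ n′≤ρM′ ⊕ ‖ ρ≤B ⊗ 0≤ι M′)
              (solve 4 (λ n ρ B M → B :* M :- n := ρ :* M :- n :+ (B :- ρ) :* M) refl (ι n′) ρ B (ι M′))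
            B≤σM′ : # 4 * B ≤ σ * ι M′
            B≤σM′ = by· 0<B (‖ R≤′ ⊕ ℚ.<⇒≤ 0<σ ⊗ ‖ n′≤BM′)
              (solve 4 (λ B σ n M → B :* (σ :* M :- :# 4 :* B)
                := σ :* n :- :# 4 :* B :* B :+ σ :* (B :* M :- n)) refl B σ (ι n′) (ι M′))
            4x′≤σ : # 4 * x′ ≤ σ
            4x′≤σ = inverse-≤ {x′} {ι M′} {# 4} {σ} x′M′ 0≤x′ (ℚ.≤-trans (by {(# 4)} {(# 4) * B} (0≤# 4 ⊗ ‖ 1≤B)
              (solve 1 (λ B → :# 4 :* B :- :# 4 := :# 4 :* (B :- :1)) refl B)) B≤σM′)
            4Bx′≤σ : # 4 * B * x′ ≤ σ
            4Bx′≤σ = inverse-≤ {x′} {ι M′} {# 4 * B} {σ} x′M′ 0≤x′ B≤σM′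
            σ≤η : # 64 * σ ≤ η
            σ≤η = by (0≤# 64 ⊗ ℚ.<⇒≤ 0<σ ⊗ 0≤B ⊕ 0≤# 64 ⊗ ‖ σ≤τ ⊕ ‖ 64τ≤η ⊕ 0≤# 64 ⊗ (0≤τ ⊗ 0≤B))
              (solve 4 (λ σ B τ η → η :- :# 64 :* σ
                := :# 64 :* σ :* B :+ :# 64 :* (τ :- (σ :+ σ :* B))
                :+ (η :- (:# 64 :* τ :+ :# 64 :* (τ :* B))) :+ :# 64 :* (τ :* B)) refl σ B τ η)
            ρ-ρx′≤t : ρ - ρ * x′ ≤ t
            ρ-ρx′≤t = subst (_≤ t) (trans (solve 3 (λ ρ x′ M → (ρ :* M :- ρ) :* x′ := ρ :* (x′ :* M) :- ρ :* x′) refl ρ x′ (ι M′))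
              (cong (λ s → s - ρ * x′) (trans (cong (ρ *_) x′M′) (ℚ.*-identityʳ ρ))))
              (by (0≤x′ ⊗ ‖ ρM′≤)
                (solve 4 (λ n ρ x′ M → n :* x′ :- (ρ :* M :- ρ) :* x′
                  := x′ :* (n :+ ρ :- ρ :* M)) refl (ι n′) ρ x′ (ι M′)))
            Δ≤½η : # 2 * Δ ≤ η
            Δ≤½η = by· (0<# 1) (0≤# 4 ⊗ ‖ ρ-ρx′≤t ⊕ 0≤# 4 ⊗ ‖ ρ≤B ⊗ 0≤x′ ⊕ ‖ 4Bx′≤σ ⊕ ‖ σ≤η
                ⊕ 0≤# 63 ⊗ ℚ.<⇒≤ 0<σ)
              (solve 6 (λ θ η t x′ B σ → :# 2 :* (η :- :# 2 :* (θ :- t))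
                := :# 4 :* (t :- (θ :- :½ :* (:½ :* η) :- (θ :- :½ :* (:½ :* η)) :* x′))
                :+ :# 4 :* (B :- (θ :- :½ :* (:½ :* η))) :* x′ :+ (σ :- :# 4 :* B :* x′) :+ (η :- :# 64 :* σ)
                :+ :# 63 :* σ) refl θ η t x′ B σ)
            ½η≤t : η ≤ # 2 * t
            ½η≤t = by (‖ Δ≤½η ⊕ 0≤# 2 ⊗ ‖ η≤θ)
              (solve 3 (λ θ η t → :# 2 :* t :- η := η :- :# 2 :* (θ :- t) :+ :# 2 :* (θ :- η)) refl θ η t)
            k′x′≡κ′t : k′ * x′ ≡ κ′ * t
            k′x′≡κ′t = trans (cong (_* x′) (sym (κn reg′))) (ℚ.*-assoc κ′ (ι n′) x′)
            x′≤1 : x′ ≤ 1ℚ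
            x′≤1 = by· (0<# 255) (0≤# 64 ⊗ ‖ 4x′≤σ ⊕ ‖ σ≤η ⊕ ‖ η≤1 ⊕ 0≤# 255)
              (solve 3 (λ x′ σ η → :# 256 :* (:1 :- x′)
                := :# 64 :* (σ :- :# 4 :* x′) :+ (η :- :# 64 :* σ) :+ (:1 :- η) :+ :# 255) refl x′ σ η)
            x≤1 : x ≤ 1ℚ
            x≤1 = by· (0<# 255) (0≤# 64 ⊗ ‖ 4x≤σ ⊕ ‖ σ≤η ⊕ ‖ η≤1 ⊕ 0≤# 255)
              (solve 3 (λ x σ η → :# 256 :* (:1 :- x)
                := :# 64 :* (σ :- :# 4 :* x) :+ (η :- :# 64 :* σ) :+ (:1 :- η) :+ :# 255) refl x σ η)

            absurd : ι (M′ ℕ.∸ j′) * v′ ≤ u′ → ⊥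
            absurd start = <⇒≱ 0<τ (by· (0<# 63) (0≤# 64 ⊗ ‖ steep ⊕ ‖ τK≤ ⊕ 0≤# 64 ⊗ (0≤τ ⊗ 0≤B)
                ⊕ 0≤# 3 ⊗ (0≤η ⊗ 0≤η ⊗ 0≤η)
                ⊕ 0≤# 4 ⊗ (4Δ-η ⊗ 0≤# 4 ⊗ (0≤t ⊗ 0≤t) ⊕ 0≤η ⊗ ‖ ½η≤t ⊗ (0≤# 2 ⊗ 0≤t ⊕ 0≤η)))
              (solve 6 (λ τ K B Δ t η → :# 64 :* (:0 :- τ)
                := :# 64 :* (τ :* K :- Δ :* (t :* t))
                :+ (η :* η :* η :- (:# 64 :* (τ :* K) :+ :# 64 :* (τ :* B) :+ :# 64 :* τ))
                :+ :# 64 :* (τ :* B) :+ :# 3 :* (η :* η :* η)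
                :+ :# 4 :* ((:# 4 :* Δ :- η) :* :# 4 :* (t :* t) :+ η :* (:# 2 :* t :- η) :* (:# 2 :* t :+ η)))
                refl τ K B Δ t η))
              where
              4Δ-η : 0ℚ ≤ # 4 * Δ - η
              4Δ-η = ‖ (by {η} {(# 4) * (Δ)} (0≤# 4 ⊗ ‖ ¼η≤Δ)
                (solve 2 (λ Δ η → :# 4 :* Δ :- η := :# 4 :* (Δ :- :½ :* (:½ :* η))) refl Δ η))
              σ≤1 : σ ≤ 1ℚ
              σ≤1 = by· (0<# 63) (‖ σ≤η ⊕ ‖ η≤1 ⊕ 0≤# 63)
                (solve 2 (λ σ η → :# 64 :* (:1 :- σ) := η :- :# 64 :* σ :+ (:1 :- η) :+ :# 63) refl σ η)
              B≤n′ : # 4 * B ≤ ι n′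
              B≤n′ = by (‖ R≤′ ⊕ ‖ σ≤1 ⊗ 0≤ι n′ ⊕ 0≤# 4 ⊗ 0≤B ⊗ ‖ 1≤B)
                (solve 3 (λ B σ n → n :- :# 4 :* B
                  := σ :* n :- :# 4 :* B :* B :+ (:1 :- σ) :* n :+ :# 4 :* B :* (B :- :1)) refl B σ (ι n′))
              0<j′ : 0 ℕ.< j′
              0<j′ = two≤k {B} {κ′} {n′} {j′} reg′ 0<B B≤n′
              ηM′≤3n′ : η * ι M′ ≤ # 3 * ι n′
              ηM′≤3n′ = by· (0<# 2) (0≤# 4 ⊗ ‖ ρM′≤ ⊕ 0≤# 4 ⊗ 0≤ι M′ ⊗ ‖ η≤θ ⊕ 0≤# 4 ⊗ ‖ ρ≤B ⊕ ‖ B≤n′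
                  ⊕ 0≤# 4 ⊗ 0≤ι n′)
                (solve 5 (λ η M n θ B → :# 3 :* (:# 3 :* n :- η :* M)
                  := :# 4 :* (n :+ (θ :- :½ :* (:½ :* η)) :- (θ :- :½ :* (:½ :* η)) :* M)
                  :+ :# 4 :* M :* (θ :- η) :+ :# 4 :* (B :- (θ :- :½ :* (:½ :* η))) :+ (n :- :# 4 :* B)
                  :+ :# 4 :* n) refl η (ι M′) (ι n′) θ B)
              M′≤3Hn′ : ι M′ ≤ # 3 * H * ι n′
              M′≤3Hn′ = subst (_≤ # 3 * H * ι n′)
                (trans (solve 3 (λ H η M → H :* (η :* M) := η :* H :* M) refl H η (ι M′)) (trans (cong (_* ι M′) ηH≡1) (ℚ.*-identityˡ (ι M′))))
                (by (ℚ.<⇒≤ 0<H ⊗ ‖ ηM′≤3n′)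
                  (solve 3 (λ H z n → :# 3 :* H :* n :- H :* z
                    := H :* (:# 3 :* n :- z)) refl H (η * ι M′) (ι n′)))
              right : 1ℚ - κ′ * t ≤ e + τ
              right = subst₂ (λ a b → 1ℚ - a ≤ e + b) k′x′≡κ′t σB≡τ
                (right₂ {B} {σ} 0≤B 0<σ {n′} {j′} {m′} {x′} {κ′} {# 3 * H} reg′ x′M′ 0≤x′ (ℚ.≤-trans t≤ρ ρ≤B) sc′ M′≤3Hn′ 0<j′ start)
              left′ : (1ℚ - x) ^ n ≤ 1ℚ - κ * (t + Δ) + τ
              left′ = subst (λ s → (1ℚ - x) ^ n ≤ 1ℚ - s + τ) (trans kx≡κθ (cong (κ *_) (solve 2 (λ t θ → θ := t :+ (θ :- t)) refl t θ))) left
              tangent₂ : e * (1ℚ - Δ) ≤ (1ℚ - x) ^ n + τ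
              tangent₂ = ℚ.≤-trans (ℚ.≤-reflexive (cong (e *_) (solve 2 (λ t θ → :1 :- (θ :- t) := :1 :+ t :- θ) refl t θ)))
                (ℚ.≤-trans (tangent-rescaled n′ n {M′} {M} {x′} {x} x′M′ xM 0≤x′ x′≤1 0≤x x≤1)
                  (by· (0<# 3) (0≤# 4 ⊗ 0≤x ⊗ ‖ θ≤B ⊕ ‖ 4x≤σ ⊗ 0≤B ⊕ 0≤# 4 ⊗ ‖ σ≤τ ⊕ 0≤# 4 ⊗ ℚ.<⇒≤ 0<σ
                      ⊕ 0≤# 3 ⊗ (ℚ.<⇒≤ 0<σ ⊗ 0≤B))
                    (solve 6 (λ E n x B σ τ → :# 4 :* (E :+ τ :- (E :+ n :* x :* x))
                      := :# 4 :* x :* (B :- n :* x) :+ (σ :- :# 4 :* x) :* B :+ :# 4 :* (τ :- (σ :+ σ :* B))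
                      :+ :# 4 :* σ :+ :# 3 :* (σ :* B)) refl ((1ℚ - x) ^ n) (ι n) x B σ τ)))
              steep : Δ * (t * t) ≤ τ * K
              steep = transversal₂ {κ} {κ′} {t} {Δ} {(1ℚ - x) ^ n} {e} {τ} {B} 0≤τ 0≤t 0≤Δ
                (subst (_≤ B) (solve 2 (λ t θ → θ := t :+ (θ :- t)) refl t θ) θ≤B) κ′≤κ left′ right tangent₂ (^-second-order n′ 0≤x′ x′≤1)

            p′≤g′x′ : u′ ≤ ι (M′ ℕ.∸ j′) * v′ → j′ ℕ.≤ M′ → p′ ≤ 1ℚ - k′ * x′ + x′
            p′≤g′x′ u′≤ j′≤M′ = by (‖ p′≤ ⊕ (0≤p′ ⊗ 0≤x′))
              (solve 3 (λ p k x′ → :1 :- k :* x′ :+ x′ :- p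
                := :1 :- k :* x′ :+ x′ :- (p :+ p :* x′) :+ p :* x′) refl p′ k′ x′)
              where
              g′ : ℚ
              g′ = ι (M′ ℕ.∸ j′)
              g′+k′ : g′ + k′ ≡ 1ℚ + ι M′
              g′+k′ = trans (sym (ι-+ (M′ ℕ.∸ j′) (suc j′))) (trans (cong ι (trans (ℕ.+-suc (M′ ℕ.∸ j′) j′) (cong suc (ℕ.m∸n+n≡m j′≤M′)))) (ι-suc M′))
              scaled : p′ * (1ℚ + ι M′) ≤ 1ℚ + ι M′ - k′
              scaled = subst (λ s → p′ * s ≤ s - k′) g′+k′ (by· 0<u+kv′ (0≤ι (suc j′) ⊗ ‖ u′≤) (trans
                (trans (solve 4 (λ s p g k → s :* (g :+ k :- k :- p :* (g :+ k)) := s :* g :- p :* s :* (g :+ k)) refl (u′ + k′ * v′) p′ g′ k′)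
                  (cong (λ z → (u′ + k′ * v′) * g′ - z * (g′ + k′)) eq′))
                (solve 4 (λ u v g k → (u :+ k :* v) :* g :- u :* (g :+ k) := k :* (g :* v :- u)) refl u′ v′ g′ k′)))
              p′≤ : p′ + p′ * x′ ≤ 1ℚ - k′ * x′ + x′
              p′≤ = subst₂ _≤_
                (trans (solve 3 (λ p x′ M → p :* (:1 :+ M) :* x′ := p :* (x′ :* M) :+ p :* x′) refl p′ x′ (ι M′)) (cong (_+ p′ * x′) (trans (cong (p′ *_) x′M′) (ℚ.*-identityʳ p′))))
                (trans (solve 3 (λ k x′ M → (:1 :+ M :- k) :* x′ := x′ :* M :- k :* x′ :+ x′) refl k′ x′ (ι M′)) (cong (λ z → z - k′ * x′ + x′) x′M′))
                (by (0≤x′ ⊗ ‖ scaled)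
                  (solve 3 (λ a c x′ → c :* x′ :- a :* x′
                    := x′ :* (c :- a)) refl (p′ * (1ℚ + ι M′)) (1ℚ + ι M′ - k′) x′))

            bound : u′ ≤ ι (M′ ℕ.∸ j′) * v′ → p′ ≤ p + η
            bound u′≤ with j′ ℕ.≤? M′
            ... | yes j′≤M′ = by· (0<# 255) (0≤# 256 ⊗ ‖ subst (λ s → p′ ≤ 1ℚ - s + x′) k′x′≡κ′t (p′≤g′x′ u′≤ j′≤M′)
                ⊕ 0≤# 256 ⊗ ‖ subst (λ s → 1ℚ - s ≤ p) kx≡κθ 1-kx≤p ⊕ 0≤# 256 ⊗ 0≤t ⊗ ‖ κ≤κ′
                ⊕ 0≤# 256 ⊗ ‖ κ≤1 reg ⊗ 0≤Δ ⊕ 0≤# 128 ⊗ ‖ Δ≤½η ⊕ 0≤# 256 ⊗ 0≤τ ⊗ ‖ ℚ.≤-trans t≤ρ ρ≤B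
                ⊕ 0≤# 4 ⊗ ‖ 64τ≤η ⊕ 0≤# 256 ⊗ 0≤τ ⊕ 0≤# 64 ⊗ ‖ 4x′≤σ ⊕ ‖ σ≤η ⊕ 0≤# 123 ⊗ 0≤η)
              (solve 11 (λ p p′ η κ κ′ θ t x′ τ B σ → :# 256 :* (p :+ η :- p′)
                := :# 256 :* (:1 :- κ′ :* t :+ x′ :- p′) :+ :# 256 :* (p :- (:1 :- κ :* θ))
                :+ :# 256 :* t :* (κ′ :+ τ :- κ) :+ :# 256 :* (:1 :- κ) :* (θ :- t)
                :+ :# 128 :* (η :- :# 2 :* (θ :- t)) :+ :# 256 :* τ :* (B :- t)
                :+ :# 4 :* (η :- (:# 64 :* τ :+ :# 64 :* (τ :* B))) :+ :# 256 :* τ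
                :+ :# 64 :* (σ :- :# 4 :* x′) :+ (η :- :# 64 :* σ) :+ :# 123 :* η)
                refl p p′ η κ κ′ θ t x′ τ B σ)
            ... | no  j′≰M′ = by (‖ p′≤0 ⊕ 0≤p ⊕ 0≤η)
              (solve 3 (λ p p′ η → p :+ η :- p′ := :0 :- p′ :+ p :+ η) refl p p′ η)
              where
              p′≤0 : p′ ≤ 0ℚ
              p′≤0 = by· 0<u+kv′ (‖ u′≤) (trans (trans (solve 3 (λ s p v → s :* (:0 :- p) := :0 :* v :- p :* s) refl (u′ + k′ * v′) p′ v′)
                (cong (λ z → 0ℚ * v′ - z) eq′))
                (cong (λ z → z * v′ - u′) (sym (trans (cong ι (ℕ.m≤n⇒m∸n≡0 (ℕ.<⇒≤ (ℕ.≰⇒> j′≰M′)))) ι0))))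

      module ChooseM′ {q : ℕ} (vq≤u : v * ι q ≤ u) (u≤v : u ≤ v * (1ℚ + ι q)) {x : ℚ} (0<x : 0ℚ < x)
                      (xM : x * ι (suc (j ℕ.+ q)) ≡ 1ℚ) (M≤Hn : ι (suc (j ℕ.+ q)) ≤ H * ι n) where
        open Tilt {q} vq≤u u≤v {x} 0<x xM using (module Transfer)
        open Transfer M≤Hn using (η≤θ; ρ; module Primed)
        0<ρ : 0ℚ < ρ
        0<ρ = ℚ.<-≤-trans (0<* (ℚ.positive⁻¹ ½) 0<η) (by (‖ η≤θ ⊕ 0≤½* (0≤½* 0≤η))
          (solve 2 (λ η θ → θ :- :½ :* (:½ :* η) :- :½ :* η := θ :- η :+ :½ :* (:½ :* η)) refl η (ι n * x)))
        choose-x′ : ∀ m′ → ι n′ ≤ ρ * ι (suc m′) → ρ * ι (suc m′) ≤ ι n′ + ρ →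
                    Σ[ x′ ∈ ℚ ] 0ℚ < x′ × ι (suc m′) * x′ ≡ 1ℚ → p′ ≤ p + η
        choose-x′ m′ n′≤ ≤n′+ρ (x′ , 0<x′ , Mx′) with ℚ.≤-total u′ (ι (suc m′ ℕ.∸ j′) * v′)
        ... | inj₁ u′≤ = Primed.bound {m′} {x′} (ℚ.<⇒≤ 0<x′) (trans (ℚ.*-comm x′ (ι (suc m′))) Mx′) n′≤ ≤n′+ρ u′≤
        ... | inj₂ ≤u′ = ⊥-elim (Primed.absurd {m′} {x′} (ℚ.<⇒≤ 0<x′) (trans (ℚ.*-comm x′ (ι (suc m′))) Mx′) n′≤ ≤n′+ρ ≤u′)
        choose-M′ : (∃[ M′ ] ι n′ ≤ ρ * ι M′ × ρ * ι M′ ≤ ι n′ + ρ) → p′ ≤ p + η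
        choose-M′ (zero   , n′≤ , _)     = ⊥-elim (<⇒≱ (0<n reg′) (subst (ι n′ ≤_) (trans (cong (ρ *_) ι0) (ℚ.*-zeroʳ ρ)) n′≤))
        choose-M′ (suc m′ , n′≤ , ≤n′+ρ) = choose-x′ m′ n′≤ ≤n′+ρ (*-inverse (0<ι {suc m′} (s≤s z≤n)))

      choose-x : ∀ q → v * ι q ≤ u → u ≤ v * (1ℚ + ι q) → Σ[ x ∈ ℚ ] 0ℚ < x × ι (suc (j ℕ.+ q)) * x ≡ 1ℚ → p′ ≤ p + η
      choose-x q vq≤u u≤v (x , 0<x , Mx) with ℚ.≤-total (H * ι n) (ι (suc (j ℕ.+ q)))
      ... | inj₁ Hn≤M = Tilt.trivial {q} vq≤u u≤v {x} 0<x (trans (ℚ.*-comm x (ι (suc (j ℕ.+ q)))) Mx) Hn≤M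
      ... | inj₂ M≤Hn = choose-M′ (ceiling 0<ρ (0≤ι n′))
        where open ChooseM′ {q} vq≤u u≤v {x} 0<x (trans (ℚ.*-comm x (ι (suc (j ℕ.+ q)))) Mx) M≤Hn

    stirling₂-dominated : p′ ≤ p + η
    stirling₂-dominated = from-quotient (quotient (T stirling₂ n j) (T-positive stirling₂ {n} {suc j} (s≤s z≤n) (k<n reg)))
      where
      from-quotient : (∃[ q ] v * ι q ≤ u × u ≤ v * (1ℚ + ι q)) → p′ ≤ p + η
      from-quotient (q , vq≤u , u≤v) = choose-x q vq≤u u≤v (*-inverse (0<ι {suc (j ℕ.+ q)} (s≤s z≤n)))

  cauchy-stirling₂ : CauchyCriterion stirling₂
  cauchy-stirling₂ {B} {ε} 1≤B 0<ε = τ , 0<τ , N , λ {n} {j} {n′} {j′} {κ} {κ′} {p} {p′} N≤n N≤n′ reg reg′ κ≤κ′ κ′≤κ prob prob′ →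
    ℚ.≤-trans
      (stirling₂-dominated {B} {η} {H} {τ} {σ} 1≤B 0<η η≤1 ηH≡1 0<H 0<τ 0<σ σS≡τ τK≤ {n} {j} {n′} {j′} {κ} {κ′} {p} {p′} reg reg′ κ≤κ′ κ′≤κ
        (Large.sc (large n N≤n)) (Large.sc (large n′ N≤n′)) (Large.R≤σn (large n N≤n)) (Large.R≤σn (large n′ N≤n′)) prob prob′)
      (by (‖ η≤ε) (solve 3 (λ p η ε → p :+ ε :- (p :+ η) := ε :- η) refl p η ε))
    where
    K : ℚ
    K = K₂ B
    0≤B : 0ℚ ≤ B
    0≤B = ℚ.≤-trans (0≤# 1) 1≤B
    0≤K : 0ℚ ≤ K
    0≤K = (0≤B ⊗ (0≤# 1 ⊕ 0≤B) ⊕ 0≤# 2 ⊗ 0≤B) ⊗ sq (# 2 + B)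
    parameters : Setup B ε (λ _ _ → # 64 * K + # 64 * B + # 64) (λ η _ → η * η * η) (λ _ _ → B) (λ _ H → # 3 * H) (λ _ _ → # 4 * B * B)
    parameters = setup {B} {ε} (λ _ _ → # 64 * K + # 64 * B + # 64) (λ η _ → η * η * η) (λ _ _ → B) (λ _ H → # 3 * H) (λ _ _ → # 4 * B * B) 1≤B 0<ε
      (λ 0<η 0<H → 0≤# 64 ⊗ 0≤K ⊕ 0≤# 64 ⊗ 0≤B ⊕ 0≤# 64 , 0<* (0<* 0<η 0<η) 0<η , 0≤B , 0≤# 3 ⊗ ℚ.<⇒≤ 0<H)
    open Setup parameters
    η≤1 : η ≤ 1ℚ
    η≤1 = by (‖ ηB≤1 ⊕ ℚ.<⇒≤ 0<η ⊗ ‖ 1≤B)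
      (solve 2 (λ η B → :1 :- η := :1 :- η :* B :+ η :* (B :- :1)) refl η B)
    τK≤ : # 64 * (τ * K) + # 64 * (τ * B) + # 64 * τ ≤ η * η * η
    τK≤ = subst (# 64 * (τ * K) + # 64 * (τ * B) + # 64 * τ ≤_) τC≡γ
      (by (ℚ.<⇒≤ 0<τ)
        (solve 3 (λ τ K B → τ :* (:1 :+ (:# 64 :* K :+ :# 64 :* B :+ :# 64))
          :- (:# 64 :* (τ :* K) :+ :# 64 :* (τ :* B) :+ :# 64 :* τ)
          := τ) refl τ K B))

module CauchyStirling₁ where

  open Prelude
  open OrderedField
  open Powers
  open Triangles
  open Approximation
  open Transversality
  open Parameters
  open Defs using (stirling₁; T; T-positive)

  open Stirling₁
  open Regular
  open Scale

  -- (1 - 1/x)^k is compared with C = (X - 1)/(X - 1 + n), which is 1/(1 + ζ) up to 1/X.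
  module _ {σ G : ℚ} (0<σ : 0ℚ < σ) {n j m : ℕ} {x : ℚ} (k<n : suc j ℕ.< n)
           (xX : x * ι (suc m) ≡ 1ℚ) (0≤x : 0ℚ ≤ x) (x≤σ : x ≤ σ) (σ≤1 : σ ≤ 1ℚ) (nx≤G : ι n * x ≤ G)
           (sc : Scale 1ℚ σ n) where
    private
      X : ℚ
      X = ι (suc m)
      ζ E : ℚ
      ζ = ι n * x
      E = (1ℚ - x) ^ suc j
      x≤1 : x ≤ 1ℚ
      x≤1 = ℚ.≤-trans x≤σ σ≤1
      0≤q : 0ℚ ≤ 1ℚ - x
      0≤q = ‖ x≤1
      q≤1 : 1ℚ - x ≤ 1ℚ
      q≤1 = by 0≤x (solve 1 (λ x → :1 :- (:1 :- x) := x) refl x)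
      0≤σ : 0ℚ ≤ σ
      0≤σ = ℚ.<⇒≤ 0<σ
      n≤ : ι n ≤ (Q sc - 1ℚ) * ι (d sc)
      n≤ = subst (_≤ (Q sc - 1ℚ) * ι (d sc)) (ℚ.*-identityˡ (ι n)) (Hn≤ sc)
      [1+d]x≤ : (1ℚ + ι (d sc)) * x ≤ σ * G
      [1+d]x≤ = stretch-≤ {1ℚ} {σ} {n} {x} {G} 0≤σ 0≤x nx≤G sc
      0<m+n : 0ℚ < ι m + ι n
      0<m+n = subst (0ℚ <_) (ℚ.+-comm (ι n) (ι m)) (0<+ (0<ι (ℕ.≤-<-trans z≤n k<n)) (0≤ι m))
      X≡ : X ≡ 1ℚ + ι m
      X≡ = ι-suc m
      module _ {y : ℚ} (y[m+n] : y * (ι m + ι n) ≡ 1ℚ) (0≤y : 0ℚ ≤ y) where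
        C : ℚ
        C = ι m * y
        1-C[1+ζ] : 1ℚ - C * (1ℚ + ζ) ≡ x * (ι n * y)
        1-C[1+ζ] = begin
          1ℚ - C * (1ℚ + ζ)
            ≡⟨ cong₂ (λ o e → e * o - C * (e + ζ)) (sym y[m+n]) (sym xX) ⟩
          x * X * (y * (ι m + ι n)) - C * (x * X + ζ)
            ≡⟨ cong (λ X → x * X * (y * (ι m + ι n)) - C * (x * X + ζ)) X≡ ⟩
          x * (1ℚ + ι m) * (y * (ι m + ι n)) - C * (x * (1ℚ + ι m) + ζ)
            ≡⟨ solve 4 (λ x m y n → x :* (:1 :+ m) :* (y :* (m :+ n)) :- m :* y :* (x :* (:1 :+ m) :+ n :* x) := x :* (n :* y)) refl x (ι m) y (ι n) ⟩
          x * (ι n * y) ∎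
          where open ≡-Reasoning
        ny≤1 : ι n * y ≤ 1ℚ
        ny≤1 = subst (ι n * y ≤_) y[m+n] (by (0≤ι m ⊗ 0≤y)
          (solve 3 (λ n m y → y :* (m :+ n) :- n :* y := m :* y) refl (ι n) (ι m) y))
        C≤ : C * (1ℚ + ζ) ≤ 1ℚ
        C≤ = by (0≤x ⊗ (0≤ι n ⊗ 0≤y)) 1-C[1+ζ]
        ≤C : 1ℚ ≤ (1ℚ + ζ) * (C + x)
        ≤C = by (‖ ℚ.≤-reflexive 1-C[1+ζ] ⊕ 0≤x ⊗ ‖ ny≤1 ⊕ (0≤ι n ⊗ 0≤x) ⊗ 0≤x)
          (solve 4 (λ C ζ x r → (:1 :+ ζ) :* (C :+ x) :- :1
            := x :* r :- (:1 :- C :* (:1 :+ ζ)) :+ x :* (:1 :- r) :+ ζ :* x) refl C ζ x (ι n * y))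

    private
      y-inverse : Σ[ y ∈ ℚ ] 0ℚ < y × (ι m + ι n) * y ≡ 1ℚ
      y-inverse = *-inverse 0<m+n

    right₁ : 0 ℕ.< j → X * c n (suc j) ≤ c n j → (E - σ * (1ℚ + G)) * (1ℚ + ζ) ≤ 1ℚ
    right₁ 0<j start = go y-inverse
      where
      antitone : E * (1ℚ - x) ^ d sc ≤ (1ℚ - x) ^ (j ℕ.+ d sc)
      antitone = subst (E * (1ℚ - x) ^ d sc ≤_) (sym (^-homo-* (1ℚ - x) j (d sc)))
        (by (‖ q≤1 ⊗ (0≤^ j 0≤q ⊗ 0≤^ (d sc) 0≤q))
          (solve 3 (λ q A D → A :* D :- q :* A :* D
            := (:1 :- q) :* (A :* D)) refl (1ℚ - x) ((1ℚ - x) ^ j) ((1ℚ - x) ^ d sc)))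
      go : Σ[ y ∈ ℚ ] 0ℚ < y × (ι m + ι n) * y ≡ 1ℚ → (E - σ * (1ℚ + G)) * (1ℚ + ζ) ≤ 1ℚ
      go (y , 0<y , ym) = by ((0≤# 1 ⊕ (0≤ι n ⊗ 0≤x)) ⊗ (‖ S₁-right {n} {m} {x} {y} xX 0≤x x≤1 y[m+n] {d sc} {Q sc} {σ} (1≤Q sc) n≤ (Q≤ sc) 0≤σ {j} 0<j (ℕ.<⇒≤ k<n) start ⊕ ‖ antitone ⊕ 0≤^ (suc j) 0≤q ⊗ ‖ bernoulli⁻ (d sc) 0≤x x≤1 ⊕ ‖ ^≤1 (suc j) 0≤q q≤1 ⊗ (0≤ι (d sc) ⊗ 0≤x) ⊕ ‖ [1+d]x≤ ⊕ 0≤x)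
          ⊕ ‖ C≤ {y} y[m+n] (ℚ.<⇒≤ 0<y))
        (solve 9 (λ E σ G ζ C D F d x → :1 :- (E :- σ :* (:1 :+ G)) :* (:1 :+ ζ)
          := (:# 1 :+ ζ) :* (C :+ σ :- F :+ (F :- E :* D) :+ E :* (D :- (:1 :- d :* x)) :+ (:1 :- E) :* (d :* x) :+ (σ :* G :- (:1 :+ d) :* x) :+ x)
          :+ (:1 :- C :* (:1 :+ ζ)))
          refl E σ G ζ (ι m * y) ((1ℚ - x) ^ d sc) ((1ℚ - x) ^ (j ℕ.+ d sc)) (ι (d sc)) x)
        where
        y[m+n] : y * (ι m + ι n) ≡ 1ℚ
        y[m+n] = trans (ℚ.*-comm y (ι m + ι n)) ym

    left₁ : d sc ℕ.≤ j → c n j ≤ X * c n (suc j) → 1ℚ ≤ (1ℚ + ζ) * (E + σ * (# 2 + G))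
    left₁ d≤j start = finish (j ℕ.∸ d sc) (sym (ℕ.m∸n+n≡m d≤j)) y-inverse
      where
      finish : ∀ b → j ≡ b ℕ.+ d sc → Σ[ y ∈ ℚ ] 0ℚ < y × (ι m + ι n) * y ≡ 1ℚ → 1ℚ ≤ (1ℚ + ζ) * (E + σ * (# 2 + G))
      finish b refl (y , 0<y , ym) = by (‖ ≤C {y} y[m+n] (ℚ.<⇒≤ 0<y)
          ⊕ (0≤# 1 ⊕ (0≤ι n ⊗ 0≤x)) ⊗ (‖ S₁-left {n} {m} {x} {y} xX 0≤x x≤1 y[m+n] {d sc} {Q sc} {σ} (1≤Q sc) n≤ (Q≤ sc) 0≤σ {b} k<n start ⊕ ‖ split ⊕ 0≤^ b 0≤q ⊗ ‖ bernoulli ⊕ ‖ ^≤1 b 0≤q q≤1 ⊗ ((0≤# 1 ⊕ 0≤ι (d sc)) ⊗ 0≤x) ⊕ ‖ [1+d]x≤ ⊕ ‖ x≤σ))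
        (solve 9 (λ E σ G ζ C A D d x → (:1 :+ ζ) :* (E :+ σ :* (:# 2 :+ G)) :- :1
          := (:1 :+ ζ) :* (C :+ x) :- :1
          :+ (:# 1 :+ ζ) :* (A :+ σ :- C :+ (E :- A :* D) :+ A :* (D :- (:1 :- (:1 :+ d) :* x)) :+ (:1 :- A) :* ((:1 :+ d) :* x) :+ (σ :* G :- (:1 :+ d) :* x) :+ (σ :- x)))
          refl E σ G ζ (ι m * y) ((1ℚ - x) ^ b) ((1ℚ - x) ^ suc (d sc)) (ι (d sc)) x)
        where
        y[m+n] : y * (ι m + ι n) ≡ 1ℚ
        y[m+n] = trans (ℚ.*-comm y (ι m + ι n)) ym
        split : (1ℚ - x) ^ b * (1ℚ - x) ^ suc (d sc) ≤ E
        split = ℚ.≤-reflexive (trans (sym (^-homo-* (1ℚ - x) b (suc (d sc)))) (cong ((1ℚ - x) ^_) (ℕ.+-suc b (d sc))))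
        bernoulli : 1ℚ - (1ℚ + ι (d sc)) * x ≤ (1ℚ - x) ^ suc (d sc)
        bernoulli = subst (λ s → 1ℚ - s * x ≤ (1ℚ - x) ^ suc (d sc)) (ι-suc (d sc)) (bernoulli⁻ (suc (d sc)) 0≤x x≤1)

  module _ {B η H τ σ : ℚ} (1≤B : 1ℚ ≤ B) (0<η : 0ℚ < η) (ηB≤1 : η * B ≤ 1ℚ) (ηH≡1 : η * H ≡ 1ℚ) (0<H : 0ℚ < H)
    (0<τ : 0ℚ < τ) (0<σ : 0ℚ < σ) (σH≡τ : σ * (1ℚ + (1ℚ + # 2 * H)) ≡ τ)
    (τK≤ : # 128 * (τ * K₁ H) + # 128 * τ ≤ (η * η) * (η * η) * (η * η))
    {n j n′ j′ : ℕ} {κ κ′ ν ν′ p p′ : ℚ}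
    (reg : Regular B n (suc j) κ) (reg′ : Regular B n′ (suc j′) κ′)
    (νk : ν * ι (suc j) ≡ ι n) (ν′k′ : ν′ * ι (suc j′) ≡ ι n′) (0≤ν : 0ℚ ≤ ν) (0≤ν′ : 0ℚ ≤ ν′) (ν≤B : ν ≤ B) (ν′≤B : ν′ ≤ B)
    (ν≤ν′ : ν ≤ ν′ + τ) (ν′≤ν : ν′ ≤ ν + τ)
    (sc : Scale 1ℚ σ n) (sc′ : Scale 1ℚ σ n′) (R≤ : # 4 * B * H * H ≤ σ * ι n) (R≤′ : # 4 * B * H * H ≤ σ * ι n′)
    (prob : Probability stirling₁ n j p) (prob′ : Probability stirling₁ n′ j′ p′) where
    private
      K : ℚ
      K = K₁ H
      0≤B : 0ℚ ≤ B
      0≤B = ℚ.≤-trans (0≤# 1) 1≤B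
      0<B : 0ℚ < B
      0<B = ℚ.<-≤-trans (0<# 0) 1≤B
      0≤τ : 0ℚ ≤ τ
      0≤τ = ℚ.<⇒≤ 0<τ
      0≤η : 0ℚ ≤ η
      0≤η = ℚ.<⇒≤ 0<η
      0≤H : 0ℚ ≤ H
      0≤H = ℚ.<⇒≤ 0<H
      0≤σ : 0ℚ ≤ σ
      0≤σ = ℚ.<⇒≤ 0<σ
      η≤1 : η ≤ 1ℚ
      η≤1 = by (‖ ηB≤1 ⊕ 0≤η ⊗ ‖ 1≤B) (solve 2 (λ η B → :1 :- η := :1 :- η :* B :+ η :* (B :- :1)) refl η B)
      H*η* : ∀ c → H * (η * c) ≡ c
      H*η* c = trans (solve 3 (λ H η c → H :* (η :* c) := η :* H :* c) refl H η c) (trans (cong (_* c) ηH≡1) (ℚ.*-identityˡ c))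
      η*H* : ∀ c → η * (H * c) ≡ c
      η*H* c = trans (solve 3 (λ H η c → η :* (H :* c) := η :* H :* c) refl H η c) (trans (cong (_* c) ηH≡1) (ℚ.*-identityˡ c))
      1≤H : 1ℚ ≤ H
      1≤H = subst (_≤ H) ηH≡1 (by (‖ η≤1 ⊗ 0≤H) (solve 2 (λ η H → H :- η :* H := (:1 :- η) :* H) refl η H))
      B≤H : B ≤ H
      B≤H = subst (_≤ H) (H*η* B) (by (0≤H ⊗ ‖ ηB≤1)
        (solve 3 (λ η B H → H :- H :* (η :* B) := H :* (:1 :- η :* B)) refl η B H))
      0≤K-H : 0ℚ ≤ H * (1ℚ + H * H + H) + H * (1ℚ + H * H) * (# 2 + H)
      0≤K-H = 0≤H ⊗ (0≤# 1 ⊕ 0≤H ⊗ 0≤H ⊕ 0≤H) ⊕ 0≤H ⊗ (0≤# 1 ⊕ 0≤H ⊗ 0≤H) ⊗ (0≤# 2 ⊕ 0≤H)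
      η⁶≤ : (η * η) * (η * η) * (η * η) ≤ η * η
      η⁶≤ = by (0≤η ⊗ 0≤η ⊗ (0≤# 1 ⊕ 0≤η) ⊗ ‖ η≤1 ⊗ (0≤# 1 ⊕ 0≤η ⊗ 0≤η))
        (solve 1 (λ η → η :* η :- η :* η :* (η :* η) :* (η :* η)
          := η :* η :* (:# 1 :+ η) :* (:1 :- η) :* (:# 1 :+ η :* η)) refl η)
      τH≤ : # 128 * (τ * H) + # 128 * τ ≤ η * η
      τH≤ = by (0≤# 128 ⊗ (0≤τ ⊗ 0≤K-H) ⊕ ‖ τK≤ ⊕ ‖ η⁶≤)
        (solve 4 (λ τ K′ H η → η :* η :- (:# 128 :* (τ :* H) :+ :# 128 :* τ)
          := :# 128 :* (τ :* K′)
          :+ (η :* η :* (η :* η) :* (η :* η) :- (:# 128 :* (τ :* (K′ :+ H)) :+ :# 128 :* τ))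
          :+ (η :* η :- η :* η :* (η :* η) :* (η :* η)))
          refl τ (H * (1ℚ + H * H + H) + H * (1ℚ + H * H) * (# 2 + H)) H η)
      σ≤τ : # 2 * σ + # 2 * (σ * H) ≤ τ
      σ≤τ = ℚ.≤-reflexive (trans (solve 2 (λ σ H → :# 2 :* σ :+ :# 2 :* (σ :* H) := σ :* (:1 :+ (:1 :+ :# 2 :* H))) refl σ H) σH≡τ)
      σ≤η² : # 128 * σ ≤ η * η
      σ≤η² = by (0≤# 128 ⊗ 0≤σ ⊕ 0≤# 256 ⊗ (0≤σ ⊗ 0≤H) ⊕ 0≤# 128 ⊗ ‖ σ≤τ ⊕ ‖ τH≤ ⊕ 0≤# 128 ⊗ (0≤τ ⊗ 0≤H))
        (solve 4 (λ σ H τ η → η :* η :- :# 128 :* σ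
          := :# 128 :* σ :+ :# 256 :* (σ :* H) :+ :# 128 :* (τ :- (:# 2 :* σ :+ :# 2 :* (σ :* H)))
          :+ (η :* η :- (:# 128 :* (τ :* H) :+ :# 128 :* τ)) :+ :# 128 :* (τ :* H)) refl σ H τ η)
      η²≤η : η * η ≤ η
      η²≤η = by (0≤η ⊗ ‖ η≤1) (solve 1 (λ η → η :- η :* η := η :* (:1 :- η)) refl η)
      σ≤1 : σ ≤ 1ℚ
      σ≤1 = by· (0<# 127) (‖ σ≤η² ⊕ ‖ η²≤η ⊕ ‖ η≤1 ⊕ 0≤# 127)
        (solve 2 (λ σ η → :# 128 :* (:1 :- σ)
          := η :* η :- :# 128 :* σ :+ (η :- η :* η) :+ (:1 :- η) :+ :# 127) refl σ η)
      τ≤1 : τ ≤ 1ℚ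
      τ≤1 = by· (0<# 127) (‖ τH≤ ⊕ 0≤# 128 ⊗ (0≤τ ⊗ 0≤H) ⊕ ‖ η²≤η ⊕ ‖ η≤1 ⊕ 0≤# 127)
        (solve 3 (λ τ η H → :# 128 :* (:1 :- τ)
          := η :* η :- (:# 128 :* (τ :* H) :+ :# 128 :* τ) :+ :# 128 :* (τ :* H) :+ (η :- η :* η) :+ (:1 :- η)
          :+ :# 127) refl τ η H)
      4≤R : # 4 * B ≤ # 4 * B * H * H
      4≤R = by (0≤# 4 ⊗ 0≤B ⊗ ‖ 1≤H ⊗ (0≤# 1 ⊕ 0≤H))
        (solve 2 (λ B H → :# 4 :* B :* H :* H :- :# 4 :* B := :# 4 :* B :* (H :- :1) :* (:# 1 :+ H)) refl B H)
      B≤σn : # 4 * B ≤ σ * ι n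
      B≤σn = ℚ.≤-trans 4≤R R≤
      B≤n′ : # 4 * B ≤ ι n′
      B≤n′ = by (‖ ℚ.≤-trans 4≤R R≤′ ⊕ ‖ σ≤1 ⊗ 0≤ι n′)
        (solve 3 (λ b σ n → n :- b := σ :* n :- b :+ (:1 :- σ) :* n) refl (# 4 * B) σ (ι n′))

      u v u′ v′ : ℚ
      u  = c n j
      v  = c n (suc j)
      u′ = c n′ j′
      v′ = c n′ (suc j′)
      k k′ : ℚ
      k  = ι (suc j)
      k′ = ι (suc j′)
      0<v : 0ℚ < v
      0<v = 0<T stirling₁ (s≤s z≤n) (k<n reg)
      0<v′ : 0ℚ < v′
      0<v′ = 0<T stirling₁ (s≤s z≤n) (k<n reg′)
      0≤u : 0ℚ ≤ u
      0≤u = 0≤T stirling₁ n j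
      0≤u′ : 0ℚ ≤ u′
      0≤u′ = 0≤T stirling₁ n′ j′
      unfold : ∀ {n j p} → Probability stirling₁ n j p → p * (c n j + ι n * c n (suc j)) ≡ c n j
      unfold {n} {j} {p} pr = trans (cong (p *_) (sym (trans (T-suc stirling₁ n j)
          (cong (_+ ι n * c n (suc j)) (trans (cong (_* c n j) ι1) (ℚ.*-identityˡ (c n j)))))))
        (trans pr (trans (cong (_* c n j) ι1) (ℚ.*-identityˡ (c n j))))
      0<u+nv : 0ℚ < u + ι n * v
      0<u+nv = subst (0ℚ <_) (ℚ.+-comm (ι n * v) u) (0<+ (0<* (0<n reg) 0<v) 0≤u)
      0<u+nv′ : 0ℚ < u′ + ι n′ * v′
      0<u+nv′ = subst (0ℚ <_) (ℚ.+-comm (ι n′ * v′) u′) (0<+ (0<* (0<n reg′) 0<v′) 0≤u′)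
      eq : p * (u + ι n * v) ≡ u
      eq = unfold {n} {j} {p} prob
      eq′ : p′ * (u′ + ι n′ * v′) ≡ u′
      eq′ = unfold {n′} {j′} {p′} prob′
      0≤p : 0ℚ ≤ p
      0≤p = fraction-≥0 {u} {u + ι n * v} {p} 0<u+nv 0≤u eq
      p≤1 : p ≤ 1ℚ
      p≤1 = fraction-≤1 {u} {ι n * v} {p} 0<u+nv (0≤ι n ⊗ ℚ.<⇒≤ 0<v) eq
      p′≤1 : p′ ≤ 1ℚ
      p′≤1 = fraction-≤1 {u′} {ι n′ * v′} {p′} 0<u+nv′ (0≤ι n′ ⊗ ℚ.<⇒≤ 0<v′) eq′
      d≤j : d sc ℕ.≤ j
      d≤j = stretch-fits {B} {κ} {n} {j} reg {σ} {1ℚ} 0≤σ σB≤1 sc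
        where
        σB≤1 : σ * B ≤ 1ℚ
        σB≤1 = by (0≤σ ⊗ ‖ B≤H ⊕ 0≤# 2 ⊗ 0≤σ ⊕ 0≤σ ⊗ 0≤H ⊕ ‖ σ≤τ ⊕ ‖ τ≤1)
          (solve 4 (λ σ B H τ → :1 :- σ :* B
            := σ :* (H :- B) :+ :# 2 :* σ :+ σ :* H :+ (τ :- (:# 2 :* σ :+ :# 2 :* (σ :* H))) :+ (:1 :- τ))
            refl σ B H τ)

      module Tilt {q z : ℕ} (vq≤u : v * ι q ≤ u) (u≤v : u ≤ v * (1ℚ + ι q)) (ηn≤X₀ : η * ι n ≤ ι (suc z)) (X₀≤ : ι (suc z) ≤ η * ι n + 1ℚ)
                  {x : ℚ} (0<x : 0ℚ < x) (xX : x * ι (suc (q ℕ.+ z)) ≡ 1ℚ) where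
        X m : ℕ
        m = q ℕ.+ z
        X = suc m
        0≤x : 0ℚ ≤ x
        0≤x = ℚ.<⇒≤ 0<x
        ζ θ : ℚ
        ζ = ι n * x
        θ = k * x
        0≤ζ : 0ℚ ≤ ζ
        0≤ζ = 0≤ι n ⊗ 0≤x
        X≡ : ι X ≡ ι q + ι (suc z)
        X≡ = trans (cong ι (sym (ℕ.+-suc q z))) (ι-+ q (suc z))
        ηn≤X : η * ι n ≤ ι X
        ηn≤X = subst (η * ι n ≤_) (sym X≡) (by (‖ ηn≤X₀ ⊕ 0≤ι q)
          (solve 3 (λ a q z → q :+ z :- a := z :- a :+ q) refl (η * ι n) (ι q) (ι (suc z))))
        ζ≤H : ζ ≤ H
        ζ≤H = inverse-≤ {x} {ι X} {ι n} {H} xX 0≤x (subst (_≤ H * ι X) (H*η* (ι n))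
          (by (0≤H ⊗ ‖ ηn≤X) (solve 3 (λ H a X → H :* X :- H :* a := H :* (X :- a)) refl H (η * ι n) (ι X))))
        4≤σX : # 4 ≤ σ * ι X
        4≤σX = by (0≤σ ⊗ ‖ ηn≤X ⊕ ‖ ηR≤ ⊕ ‖ 4≤ηR)
          (solve 4 (λ a X σ r → σ :* X :- :# 4
            := σ :* (X :- a) :+ (σ :* a :- r) :+ (r :- :# 4)) refl (η * ι n) (ι X) σ (η * (# 4 * B * H * H)))
          where
          4≤ηR : # 4 ≤ η * (# 4 * B * H * H)
          4≤ηR = subst (# 4 ≤_) (sym (trans (solve 3 (λ η B H → η :* (:# 4 :* B :* H :* H) := η :* (H :* (:# 4 :* B :* H))) refl η B H) (η*H* (# 4 * B * H))))
            (by (0≤# 4 ⊗ (0≤B ⊗ ‖ 1≤H ⊕ ‖ 1≤B))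
              (solve 2 (λ B H → :# 4 :* B :* H :- :# 4 := :# 4 :* (B :* (H :- :1) :+ (B :- :1))) refl B H))
          ηR≤ : η * (# 4 * B * H * H) ≤ σ * (η * ι n)
          ηR≤ = by (0≤η ⊗ ‖ R≤)
            (solve 4 (λ η R σ n → σ :* (η :* n) :- η :* R
              := η :* (σ :* n :- R)) refl η (# 4 * B * H * H) σ (ι n))
        4x≤σ : # 4 * x ≤ σ
        4x≤σ = inverse-≤ {x} {ι X} {# 4} {σ} xX 0≤x 4≤σX
        x≤σ : x ≤ σ
        x≤σ = by (‖ 4x≤σ ⊕ 0≤# 3 ⊗ 0≤x) (solve 2 (λ x σ → σ :- x := σ :- :# 4 :* x :+ :# 3 :* x) refl x σ)
        1≤ηn : 1ℚ ≤ η * ι n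
        1≤ηn = by· (0<# 127) (‖ σ≤η² ⊗ 0≤ι n ⊕ ‖ η²≤η ⊗ 0≤ι n ⊕ 0≤# 127 ⊗ 0≤η ⊗ 0≤ι n
            ⊕ 0≤# 128 ⊗ (‖ B≤σn ⊕ 0≤# 4 ⊗ ‖ 1≤B ⊕ 0≤# 3))
          (solve 4 (λ η σ n B → :# 128 :* (η :* n :- :1)
            := (η :* η :- :# 128 :* σ) :* n :+ (η :- η :* η) :* n :+ :# 127 :* η :* n
            :+ :# 128 :* (σ :* n :- :# 4 :* B :+ :# 4 :* (B :- :1) :+ :# 3)) refl η σ (ι n) B)
        X₀x≤ : ι (suc z) * x ≤ # 2 * η * ζ
        X₀x≤ = by (0≤x ⊗ (‖ X₀≤ ⊕ ‖ 1≤ηn))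
          (solve 4 (λ z x η n → :# 2 :* η :* (n :* x) :- z :* x
            := x :* (η :* n :+ :1 :- z :+ (η :* n :- :1))) refl (ι (suc z)) x η (ι n))
        1≤p[1+ζ] : 1ℚ ≤ p * (1ℚ + ζ) + # 2 * η * ζ
        1≤p[1+ζ] = by (‖ 1-r≤ ⊕ ‖ X₀x≤)
          (solve 4 (λ p ζ s r → p :* (:1 :+ ζ) :+ s :- :1
            := p :* (:1 :+ ζ) :- (:1 :- r) :+ (s :- r)) refl p ζ (# 2 * η * ζ) (ι (suc z) * x))
          where
          q≤ : ι q ≤ p * (ι q + ι n)
          q≤ = by· 0<u+nv (0≤ι n ⊗ ‖ vq≤u) (trans
            (trans (solve 4 (λ s p q n → s :* (p :* (q :+ n) :- q) := p :* s :* (q :+ n) :- s :* q) refl (u + ι n * v) p (ι q) (ι n)) (cong (λ a → a * (ι q + ι n) - (u + ι n * v) * ι q) eq))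
            (solve 4 (λ u v q n → u :* (q :+ n) :- (u :+ n :* v) :* q := n :* (u :- v :* q)) refl u v (ι q) (ι n)))
          1-r≤ : 1ℚ - ι (suc z) * x ≤ p * (1ℚ + ζ)
          1-r≤ = subst (λ o → o - ι (suc z) * x ≤ p * (o + ζ)) (trans (cong (x *_) (sym X≡)) xX)
            (by (0≤x ⊗ (‖ q≤ ⊕ 0≤p ⊗ 0≤ι (suc z)))
              (solve 5 (λ x q z p n → p :* (x :* (q :+ z) :+ n :* x) :- (x :* (q :+ z) :- z :* x)
                := x :* (p :* (q :+ n) :- q :+ p :* z)) refl x (ι q) (ι (suc z)) p (ι n)))

        trivial : H * ι n ≤ ι X → p′ ≤ p + # 4 * η
        trivial Hn≤X = by (‖ p′≤1 ⊕ ‖ 1≤p[1+ζ] ⊕ ‖ p≤1 ⊗ 0≤ζ ⊕ (0≤# 1 ⊕ 0≤# 2 ⊗ 0≤η) ⊗ ‖ ζ≤η ⊕ 0≤# 2 ⊗ ‖ η²≤η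
            ⊕ 0≤η)
          (solve 4 (λ p′ p η ζ → p :+ :# 4 :* η :- p′
            := :1 :- p′ :+ (p :* (:1 :+ ζ) :+ :# 2 :* η :* ζ :- :1) :+ (:1 :- p) :* ζ
            :+ (:# 1 :+ :# 2 :* η) :* (η :- ζ) :+ :# 2 :* (η :- η :* η) :+ η) refl p′ p η ζ)
          where
          ζ≤η : ζ ≤ η
          ζ≤η = inverse-≤ {x} {ι X} {ι n} {η} xX 0≤x (subst (_≤ η * ι X) (η*H* (ι n))
            (by (0≤η ⊗ ‖ Hn≤X) (solve 3 (λ η a X → η :* X :- η :* a := η :* (X :- a)) refl η (H * ι n) (ι X))))

        module Transfer (X≤Hn : ι X ≤ H * ι n) where
          θ≤H : θ ≤ H
          θ≤H = by (0≤x ⊗ ‖ ι-mono (ℕ.<⇒≤ (k<n reg)) ⊕ ‖ ζ≤H)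
            (solve 4 (λ k n x H → H :- k :* x := x :* (n :- k) :+ (H :- n :* x)) refl k (ι n) x H)
          0≤θ : 0ℚ ≤ θ
          0≤θ = 0≤ι (suc j) ⊗ 0≤x
          η²≤θ : η * η ≤ θ
          η²≤θ = inverse-≥ {x} {ι X} {k} {η * η} xX 0≤x (subst (_≤ k) (ℚ.*-assoc η η (ι X) ⁻¹)
            (by (0≤η ⊗ 0≤η ⊗ ‖ X≤Hn ⊕ 0≤η ⊗ ‖ ℚ.≤-reflexive (η*H* (ι n)) ⊕ 0≤η ⊗ ‖ n≤Bk reg
                ⊕ ‖ ηB≤1 ⊗ 0≤ι (suc j))
              (solve 6 (λ η X n B k H → k :- η :* (η :* X)
                := η :* η :* (H :* n :- X) :+ η :* (n :- η :* (H :* n)) :+ η :* (B :* k :- n)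
                :+ (:1 :- η :* B) :* k) refl η (ι X) (ι n) B k H)))
            where
            _⁻¹ : ∀ {a b : ℚ} → a ≡ b → b ≡ a
            _⁻¹ = sym
          E : ℚ
          E = (1ℚ - x) ^ suc j
          left : 1ℚ ≤ (1ℚ + ζ) * (E + τ)
          left = by (‖ left₁ {σ} {H} 0<σ {n} {j} {m} {x} (k<n reg) xX 0≤x x≤σ σ≤1 ζ≤H sc d≤j start
              ⊕ (0≤# 1 ⊕ 0≤ζ) ⊗ (‖ σ≤τ ⊕ 0≤σ ⊗ 0≤H))
            (solve 5 (λ ζ E τ σ H → (:1 :+ ζ) :* (E :+ τ) :- :1
              := (:1 :+ ζ) :* (E :+ σ :* (:# 2 :+ H)) :- :1
              :+ (:# 1 :+ ζ) :* (τ :- (:# 2 :* σ :+ :# 2 :* (σ :* H)) :+ σ :* H)) refl ζ E τ σ H)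
            where
            start : u ≤ ι X * v
            start = by (‖ u≤v ⊕ ℚ.<⇒≤ 0<v ⊗ ‖ 1+q≤X)
              (solve 4 (λ u v q X → X :* v :- u
                := v :* (:1 :+ q) :- u :+ v :* (X :- (:1 :+ q))) refl u v (ι q) (ι X))
              where
              1+q≤X : 1ℚ + ι q ≤ ι X
              1+q≤X = subst (_≤ ι X) (ι-suc q) (ι-mono (s≤s (ℕ.m≤m+n q z)))
          ζ≡νθ : ζ ≡ ν * θ
          ζ≡νθ = trans (cong (_* x) (sym νk)) (ℚ.*-assoc ν k x)

          ρ : ℚ
          ρ = θ - ½ * (½ * (η * η))

          module Primed {m′ : ℕ} {x′ : ℚ} (0≤x′ : 0ℚ ≤ x′) (x′X′ : x′ * ι (suc m′) ≡ 1ℚ)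
            (k′≤ρX′ : k′ ≤ ρ * ι (suc m′)) (ρX′≤ : ρ * ι (suc m′) ≤ k′ + ρ) where
            X′ : ℕ
            X′ = suc m′
            g t Δ e ζ′ : ℚ
            g = ½ * (½ * (η * η))
            t = k′ * x′
            Δ = θ - t
            e = (1ℚ - x′) ^ suc j′
            ζ′ = ι n′ * x′
            0≤g : 0ℚ ≤ g
            0≤g = 0≤½* (0≤½* (0≤η ⊗ 0≤η))
            t≤ρ : t ≤ ρ
            t≤ρ = inverse-≤ {x′} {ι X′} {k′} {ρ} x′X′ 0≤x′ k′≤ρX′
            g≤Δ : g ≤ Δ
            g≤Δ = by (‖ t≤ρ) (solve 3 (λ θ g t → θ :- t :- g := θ :- g :- t) refl θ g t)
            0≤Δ : 0ℚ ≤ Δ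
            0≤Δ = ℚ.≤-trans 0≤g g≤Δ
            0≤t : 0ℚ ≤ t
            0≤t = 0≤ι (suc j′) ⊗ 0≤x′
            0≤ζ′ : 0ℚ ≤ ζ′
            0≤ζ′ = 0≤ι n′ ⊗ 0≤x′
            ρ≤H : ρ ≤ H
            ρ≤H = by (‖ θ≤H ⊕ 0≤g) (solve 3 (λ θ g H → H :- (θ :- g) := H :- θ :+ g) refl θ g H)
            t≤H : t ≤ H
            t≤H = ℚ.≤-trans t≤ρ ρ≤H
            H≤σX′ : # 4 * H ≤ σ * ι X′
            H≤σX′ = by· (0<* 0<B 0<H) (‖ R≤′ ⊕ 0≤σ ⊗ (‖ n≤Bk reg′ ⊕ 0≤B ⊗ (‖ k′≤ρX′ ⊕ ‖ ρ≤H ⊗ 0≤ι X′)))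
              (solve 7 (λ B H σ n X k ρ → B :* H :* (σ :* X :- :# 4 :* H)
                := σ :* n :- :# 4 :* B :* H :* H
                :+ σ :* (B :* k :- n :+ B :* (ρ :* X :- k :+ (H :- ρ) :* X))) refl B H σ (ι n′) (ι X′) k′ ρ)
            4Hx′≤σ : # 4 * H * x′ ≤ σ
            4Hx′≤σ = inverse-≤ {x′} {ι X′} {# 4 * H} {σ} x′X′ 0≤x′ H≤σX′
            Hx′≤σ : H * x′ ≤ σ
            Hx′≤σ = by (‖ 4Hx′≤σ ⊕ 0≤# 3 ⊗ (0≤H ⊗ 0≤x′))
              (solve 3 (λ H x′ σ → σ :- H :* x′ := σ :- :# 4 :* H :* x′ :+ :# 3 :* (H :* x′)) refl H x′ σ)
            x′≤σ : x′ ≤ σ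
            x′≤σ = by (‖ Hx′≤σ ⊕ ‖ 1≤H ⊗ 0≤x′)
              (solve 3 (λ H x′ σ → σ :- x′ := σ :- H :* x′ :+ (H :- :1) :* x′) refl H x′ σ)
            ρ-ρx′≤t : ρ - ρ * x′ ≤ t
            ρ-ρx′≤t = subst (_≤ t) (trans (solve 3 (λ ρ x′ X → (ρ :* X :- ρ) :* x′ := ρ :* (x′ :* X) :- ρ :* x′) refl ρ x′ (ι X′))
              (cong (λ s → s - ρ * x′) (trans (cong (ρ *_) x′X′) (ℚ.*-identityʳ ρ))))
              (by (0≤x′ ⊗ ‖ ρX′≤)
                (solve 4 (λ k ρ x′ X → k :* x′ :- (ρ :* X :- ρ) :* x′
                  := x′ :* (k :+ ρ :- ρ :* X)) refl k′ ρ x′ (ι X′)))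
            2Δ≤η² : # 2 * Δ ≤ η * η
            2Δ≤η² = by· (0<# 1) (0≤# 4 ⊗ ‖ ρ-ρx′≤t ⊕ 0≤# 4 ⊗ ‖ ρ≤H ⊗ 0≤x′ ⊕ ‖ 4Hx′≤σ ⊕ ‖ σ≤η² ⊕ 0≤# 127 ⊗ 0≤σ)
              (solve 6 (λ θ η t x′ H σ → :# 2 :* (η :* η :- :# 2 :* (θ :- t))
                := :# 4 :* (t :- (θ :- :½ :* (:½ :* (η :* η)) :- (θ :- :½ :* (:½ :* (η :* η))) :* x′))
                :+ :# 4 :* (H :- (θ :- :½ :* (:½ :* (η :* η)))) :* x′ :+ (σ :- :# 4 :* H :* x′)
                :+ (η :* η :- :# 128 :* σ) :+ :# 127 :* σ) refl θ η t x′ H σ)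
            η²≤2t : η * η ≤ # 2 * t
            η²≤2t = by (‖ 2Δ≤η² ⊕ 0≤# 2 ⊗ ‖ η²≤θ)
              (solve 3 (λ θ η t → :# 2 :* t :- η :* η
                := η :* η :- :# 2 :* (θ :- t) :+ :# 2 :* (θ :- η :* η)) refl θ η t)
            ζ′≡ν′t : ζ′ ≡ ν′ * t
            ζ′≡ν′t = trans (cong (_* x′) (sym ν′k′)) (ℚ.*-assoc ν′ k′ x′)
            ζ′≤2H : ζ′ ≤ # 2 * H
            ζ′≤2H = subst (_≤ # 2 * H) (sym ζ′≡ν′t) (by (‖ ν′≤ν ⊗ 0≤t ⊕ (0≤ν ⊕ 0≤τ) ⊗ 0≤Δ
                ⊕ ‖ subst (_≤ H) ζ≡νθ ζ≤H ⊕ 0≤τ ⊗ ‖ θ≤H ⊕ ‖ τ≤1 ⊗ 0≤H)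
              (solve 6 (λ ν ν′ t θ τ H → :# 2 :* H :- ν′ :* t
                := (ν :+ τ :- ν′) :* t :+ (ν :+ τ) :* (θ :- t) :+ (H :- ν :* θ) :+ τ :* (H :- θ)
                :+ (:1 :- τ) :* H) refl ν ν′ t θ τ H))
            x≤1 : x ≤ 1ℚ
            x≤1 = ℚ.≤-trans x≤σ σ≤1
            x′≤1 : x′ ≤ 1ℚ
            x′≤1 = ℚ.≤-trans x′≤σ σ≤1
            0≤e : 0ℚ ≤ e
            0≤e = 0≤^ (suc j′) (‖ x′≤1)
            tx′≤τ : k′ * x′ * x′ ≤ τ
            tx′≤τ = by (0≤x′ ⊗ ‖ t≤H ⊕ ‖ Hx′≤σ ⊕ ‖ σ≤τ ⊕ 0≤σ ⊕ 0≤# 2 ⊗ (0≤σ ⊗ 0≤H))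
              (solve 5 (λ t x′ H σ τ → τ :- t :* x′
                := x′ :* (H :- t) :+ (σ :- H :* x′) :+ (τ :- (:# 2 :* σ :+ :# 2 :* (σ :* H))) :+ σ
                :+ :# 2 :* (σ :* H)) refl t x′ H σ τ)
            e+≤ : e + k′ * x′ * x′ ≤ e + τ
            e+≤ = ℚ.+-monoʳ-≤ e tx′≤τ

            -- e^{-t} ≥ (1 - t/2)², by the tangent at t/2.
            gap : g * g ≤ t - 1ℚ + e + τ
            gap with ℚ.≤-total t (# 2)
            ... | inj₂ 2≤t = by (‖ g≤1 ⊗ 0≤g ⊕ ‖ g≤1 ⊕ ‖ 2≤t ⊕ 0≤e ⊕ 0≤τ)
              (solve 4 (λ g t e τ → t :- :1 :+ e :+ τ :- g :* g
                := (:1 :- g) :* g :+ (:1 :- g) :+ (t :- :# 2) :+ e :+ τ) refl g t e τ)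
              where
              g≤1 : g ≤ 1ℚ
              g≤1 = by· (0<# 3) (‖ η²≤η ⊕ ‖ η≤1 ⊕ 0≤# 3)
                (solve 1 (λ η → :# 4 :* (:1 :- :½ :* (:½ :* (η :* η)))
                  := η :- η :* η :+ (:1 :- η) :+ :# 3) refl η)
            ... | inj₁ t≤2 = by· (0<# 15) (0≤# 16 ⊗ ‖ e≥ ⊕ ‖ η²≤2t ⊗ (0≤# 2 ⊗ 0≤t ⊕ 0≤η ⊗ 0≤η))
              (solve 4 (λ η t e τ → :# 16 :* (t :- :1 :+ e :+ τ :- :½ :* (:½ :* (η :* η)) :* (:½ :* (:½ :* (η :* η))))
                := :# 16 :* (e :+ τ :- (:1 :- :½ :* t) :* (:1 :- :½ :* t))
                :+ (:# 2 :* t :- η :* η) :* (:# 2 :* t :+ η :* η)) refl η t e τ)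
              where
              0≤½x′ : 0ℚ ≤ ½ * x′
              0≤½x′ = 0≤½* 0≤x′
              h : ℚ
              h = (1ℚ - ½ * x′) ^ suc j′
              ½x′[2X′] : ½ * x′ * ι (X′ ℕ.+ X′) ≡ 1ℚ
              ½x′[2X′] = trans (cong (½ * x′ *_) (ι-+ X′ X′)) (trans (solve 2 (λ x′ X → :½ :* x′ :* (X :+ X) := x′ :* X) refl x′ (ι X′)) x′X′)
              at-half : h * (1ℚ - ½ * t) ≤ e + τ
              at-half = ℚ.≤-trans (ℚ.≤-reflexive (cong (h *_) (solve 2 (λ k x′ → :1 :- :½ :* (k :* x′) := :1 :+ k :* (:½ :* x′) :- k :* x′) refl k′ x′)))
                (ℚ.≤-trans (tangent-rescaled (suc j′) (suc j′) {X′ ℕ.+ X′} {X′} {½ * x′} {x′} ½x′[2X′] x′X′ 0≤½x′ (½x≤1 0≤x′ x′≤1) 0≤x′ x′≤1) e+≤)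
              h≥ : 1ℚ - ½ * t ≤ h
              h≥ = ℚ.≤-trans (ℚ.≤-reflexive (cong (1ℚ -_) (solve 2 (λ k x′ → :½ :* (k :* x′) := k :* (:½ :* x′)) refl k′ x′))) (bernoulli⁻ (suc j′) 0≤½x′ (½x≤1 0≤x′ x′≤1))
              e≥ : (1ℚ - ½ * t) * (1ℚ - ½ * t) ≤ e + τ
              e≥ = by (0≤s ⊗ ‖ h≥ ⊕ ‖ at-half)
                (solve 3 (λ s h r → r :- s :* s
                  := s :* (h :- s) :+ (r :- h :* s)) refl (1ℚ - ½ * t) h (e + τ))
                where
                0≤s : 0ℚ ≤ 1ℚ - ½ * t
                0≤s = ‖ (by· {½ * (t)} {1ℚ} (0<# 1) (‖ t≤2)
                  (solve 1 (λ t → :# 2 :* (:1 :- :½ :* t) := :# 2 :- t) refl t))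

            absurd : ι X′ * v′ ≤ u′ → ⊥
            absurd start = <⇒≱ 0<τ (by· (0<# 127) (0≤# 128 ⊗ ‖ steep ⊕ ‖ τK≤ ⊕ 0≤# 128 ⊗ ‖ g≤Δ ⊗ (0≤g ⊗ 0≤g)
                ⊕ (sq (η * η) ⊗ sq η))
              (solve 4 (λ τ K Δ η → :# 128 :* (:0 :- τ)
                := :# 128 :* (τ :* K :- Δ :* (:½ :* (:½ :* (η :* η)) :* (:½ :* (:½ :* (η :* η)))))
                :+ (η :* η :* (η :* η) :* (η :* η) :- (:# 128 :* (τ :* K) :+ :# 128 :* τ))
                :+ :# 128 :* (Δ :- :½ :* (:½ :* (η :* η))) :* (:½ :* (:½ :* (η :* η)) :* (:½ :* (:½ :* (η :* η))))
                :+ η :* η :* (η :* η) :* (η :* η)) refl τ K Δ η))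
              where
              0<j′ : 0 ℕ.< j′
              0<j′ = two≤k {B} {κ′} {n′} {j′} reg′ 0<B B≤n′
              right : (e - τ) * (1ℚ + ν′ * t) ≤ 1ℚ
              right = subst (λ s → (e - τ) * (1ℚ + s) ≤ 1ℚ) ζ′≡ν′t (by (‖ right₁ {σ} {# 2 * H} 0<σ {n′} {j′} {m′} {x′} (k<n reg′) x′X′ 0≤x′ x′≤σ σ≤1 ζ′≤2H sc′ 0<j′ start
                  ⊕ (0≤# 1 ⊕ 0≤ζ′) ⊗ (‖ σ≤τ ⊕ 0≤σ))
                (solve 5 (λ e ζ τ σ H → :1 :- (e :- τ) :* (:1 :+ ζ)
                  := :1 :- (e :- σ :* (:1 :+ :# 2 :* H)) :* (:1 :+ ζ)
                  :+ (:# 1 :+ ζ) :* (τ :- (:# 2 :* σ :+ :# 2 :* (σ :* H)) :+ σ)) refl e ζ′ τ σ H))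
              t+Δ≡θ : t + Δ ≡ θ
              t+Δ≡θ = solve 2 (λ t θ → t :+ (θ :- t) := θ) refl t θ
              left′ : 1ℚ ≤ (1ℚ + ν * (t + Δ)) * (E + τ)
              left′ = subst (λ s → 1ℚ ≤ (1ℚ + s) * (E + τ)) (trans ζ≡νθ (cong (ν *_) (sym t+Δ≡θ))) left
              tangent₁ : E * (1ℚ + Δ) ≤ e + τ
              tangent₁ = ℚ.≤-trans (ℚ.≤-reflexive (cong (E *_) (solve 2 (λ t θ → :1 :+ (θ :- t) := :1 :+ θ :- t) refl t θ)))
                (ℚ.≤-trans (tangent-rescaled (suc j) (suc j′) {X} {X′} {x} {x′} xX x′X′ 0≤x x≤1 0≤x′ x′≤1) e+≤)
              e≤1 : e ≤ 1ℚ
              e≤1 = ^≤1 (suc j′) (‖ x′≤1) (by 0≤x′ (solve 1 (λ x′ → :1 :- (:1 :- x′) := x′) refl x′))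
              steep : Δ * (g * g) ≤ τ * K
              steep = transversal₁ {ν} {ν′} {t} {Δ} {E} {e} {τ} {H} {g * g} 0≤τ 0≤t 0≤Δ (subst (_≤ H) (sym t+Δ≡θ) θ≤H)
                0≤ν (ℚ.≤-trans ν≤B B≤H) 0≤ν′ (ℚ.≤-trans ν′≤B B≤H) 0≤e e≤1 ν≤ν′ left′ right tangent₁ gap

            bound : u′ ≤ ι X′ * v′ → p′ ≤ p + # 4 * η
            bound u′≤ = by· (0<+ (0<# 0) 0≤ζ′) (‖ p′[1+ζ′]≤1 ⊕ ‖ 1≤p[1+ζ] ⊕ (0≤p ⊕ 0≤# 2 ⊗ 0≤η) ⊗ ‖ ζ≤ζ′+gain
                ⊕ 0≤# 2 ⊗ 0≤η ⊗ 0≤ζ′ ⊕ ‖ p≤1 ⊗ 0≤gain ⊕ ‖ gain≤η ⊕ 0≤# 2 ⊗ 0≤η ⊗ ‖ ℚ.≤-trans gain≤η η≤1 ⊕ 0≤η)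
              (solve 6 (λ p p′ η ζ ζ′ D → (:# 1 :+ ζ′) :* (p :+ :# 4 :* η :- p′)
                := :1 :- p′ :* (:1 :+ ζ′) :+ (p :* (:1 :+ ζ) :+ :# 2 :* η :* ζ :- :1)
                :+ (p :+ :# 2 :* η) :* (ζ′ :+ D :- ζ) :+ :# 2 :* η :* ζ′ :+ (:1 :- p) :* D :+ (η :- D)
                :+ :# 2 :* η :* (:1 :- D) :+ η) refl p p′ η ζ ζ′ gain)
              where
              gain : ℚ
              gain = B * Δ + τ * H
              0≤gain : 0ℚ ≤ gain
              0≤gain = 0≤B ⊗ 0≤Δ ⊕ 0≤τ ⊗ 0≤H
              gain≤η : gain ≤ η
              gain≤η = by· (0<# 127) (0≤# 64 ⊗ (0≤B ⊗ ‖ 2Δ≤η² ⊕ 0≤η ⊗ ‖ ηB≤1) ⊕ ‖ τH≤ ⊕ 0≤# 128 ⊗ 0≤τ ⊕ ‖ η²≤η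
                  ⊕ 0≤# 63 ⊗ 0≤η)
                (solve 5 (λ B Δ τ H η → :# 128 :* (η :- (B :* Δ :+ τ :* H))
                  := :# 64 :* (B :* (η :* η :- :# 2 :* Δ) :+ η :* (:1 :- η :* B))
                  :+ (η :* η :- (:# 128 :* (τ :* H) :+ :# 128 :* τ)) :+ :# 128 :* τ :+ (η :- η :* η)
                  :+ :# 63 :* η) refl B Δ τ H η)
              ζ≤ζ′+gain : ζ ≤ ζ′ + gain
              ζ≤ζ′+gain = subst₂ (λ a b → a ≤ b + gain) (sym ζ≡νθ) (sym ζ′≡ν′t)
                (by (0≤θ ⊗ ‖ ν≤ν′ ⊕ ‖ ν′≤B ⊗ 0≤Δ ⊕ 0≤τ ⊗ ‖ θ≤H)
                  (solve 7 (λ ν ν′ θ t τ H B → ν′ :* t :+ (B :* (θ :- t) :+ τ :* H) :- ν :* θ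
                    := θ :* (ν′ :+ τ :- ν) :+ (B :- ν′) :* (θ :- t) :+ τ :* (H :- θ)) refl ν ν′ θ t τ H B))
              scaled : p′ * (ι X′ + ι n′) ≤ ι X′
              scaled = by· 0<u+nv′ (0≤ι n′ ⊗ ‖ u′≤) (trans
                (trans (solve 4 (λ s p X n → s :* (X :- p :* (X :+ n)) := s :* X :- p :* s :* (X :+ n)) refl (u′ + ι n′ * v′) p′ (ι X′) (ι n′))
                  (cong (λ z → (u′ + ι n′ * v′) * ι X′ - z * (ι X′ + ι n′)) eq′))
                (solve 4 (λ u v X n → (u :+ n :* v) :* X :- u :* (X :+ n) := n :* (X :* v :- u)) refl u′ v′ (ι X′) (ι n′)))
              p′[1+ζ′]≤1 : p′ * (1ℚ + ζ′) ≤ 1ℚ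
              p′[1+ζ′]≤1 = subst (λ o → p′ * (o + ζ′) ≤ o) x′X′
                (by (0≤x′ ⊗ ‖ scaled)
                  (solve 4 (λ p x′ X n → x′ :* X :- p :* (x′ :* X :+ n :* x′)
                    := x′ :* (X :- p :* (X :+ n))) refl p′ x′ (ι X′) (ι n′)))

      module ChooseX′ {q z : ℕ} (vq≤u : v * ι q ≤ u) (u≤v : u ≤ v * (1ℚ + ι q)) (ηn≤X₀ : η * ι n ≤ ι (suc z)) (X₀≤ : ι (suc z) ≤ η * ι n + 1ℚ)
                      {x : ℚ} (0<x : 0ℚ < x) (xX : x * ι (suc (q ℕ.+ z)) ≡ 1ℚ) (X≤Hn : ι (suc (q ℕ.+ z)) ≤ H * ι n) where
        open Tilt {q} {z} vq≤u u≤v ηn≤X₀ X₀≤ {x} 0<x xX using (module Transfer)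
        open Transfer X≤Hn using (η²≤θ; ρ; module Primed)
        0<ρ : 0ℚ < ρ
        0<ρ = ℚ.<-≤-trans (0<* (ℚ.positive⁻¹ ½) (0<* 0<η 0<η)) (by (‖ η²≤θ ⊕ 0≤½* (0≤½* (0≤η ⊗ 0≤η)))
          (solve 2 (λ η θ → θ :- :½ :* (:½ :* (η :* η)) :- :½ :* (η :* η)
            := θ :- η :* η :+ :½ :* (:½ :* (η :* η))) refl η (k * x)))
        choose-x′ : ∀ m′ → k′ ≤ ρ * ι (suc m′) → ρ * ι (suc m′) ≤ k′ + ρ →
                    Σ[ x′ ∈ ℚ ] 0ℚ < x′ × ι (suc m′) * x′ ≡ 1ℚ → p′ ≤ p + # 4 * η
        choose-x′ m′ k′≤ ≤k′+ρ (x′ , 0<x′ , Xx′) with ℚ.≤-total u′ (ι (suc m′) * v′)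
        ... | inj₁ u′≤ = Primed.bound {m′} {x′} (ℚ.<⇒≤ 0<x′) (trans (ℚ.*-comm x′ (ι (suc m′))) Xx′) k′≤ ≤k′+ρ u′≤
        ... | inj₂ ≤u′ = ⊥-elim (Primed.absurd {m′} {x′} (ℚ.<⇒≤ 0<x′) (trans (ℚ.*-comm x′ (ι (suc m′))) Xx′) k′≤ ≤k′+ρ ≤u′)
        choose-X′ : (∃[ X′ ] k′ ≤ ρ * ι X′ × ρ * ι X′ ≤ k′ + ρ) → p′ ≤ p + # 4 * η
        choose-X′ (zero   , k′≤ , _)     = ⊥-elim (<⇒≱ (0<ι {suc j′} (s≤s z≤n)) (subst (k′ ≤_) (trans (cong (ρ *_) ι0) (ℚ.*-zeroʳ ρ)) k′≤))
        choose-X′ (suc m′ , k′≤ , ≤k′+ρ) = choose-x′ m′ k′≤ ≤k′+ρ (*-inverse (0<ι {suc m′} (s≤s z≤n)))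

      choose-x : ∀ q z → v * ι q ≤ u → u ≤ v * (1ℚ + ι q) → η * ι n ≤ ι (suc z) → ι (suc z) ≤ η * ι n + 1ℚ →
                 Σ[ x ∈ ℚ ] 0ℚ < x × ι (suc (q ℕ.+ z)) * x ≡ 1ℚ → p′ ≤ p + # 4 * η
      choose-x q z vq≤u u≤v ηn≤ ≤ηn (x , 0<x , Xx) with ℚ.≤-total (H * ι n) (ι (suc (q ℕ.+ z)))
      ... | inj₁ Hn≤X = Tilt.trivial {q} {z} vq≤u u≤v ηn≤ ≤ηn {x} 0<x (trans (ℚ.*-comm x (ι (suc (q ℕ.+ z)))) Xx) Hn≤X
      ... | inj₂ X≤Hn = choose-X′ (ceiling 0<ρ (0≤ι (suc j′)))
        where open ChooseX′ {q} {z} vq≤u u≤v ηn≤ ≤ηn {x} 0<x (trans (ℚ.*-comm x (ι (suc (q ℕ.+ z)))) Xx) X≤Hn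

      choose-X : (∃[ q ] v * ι q ≤ u × u ≤ v * (1ℚ + ι q)) → (∃[ X₀ ] η * ι n ≤ 1ℚ * ι X₀ × 1ℚ * ι X₀ ≤ η * ι n + 1ℚ) → p′ ≤ p + # 4 * η
      choose-X _ (zero , ηn≤ , _) = ⊥-elim (<⇒≱ (0<* 0<η (0<n reg)) (subst (η * ι n ≤_) (trans (cong (1ℚ *_) ι0) (ℚ.*-zeroʳ 1ℚ)) ηn≤))
      choose-X (q , vq≤u , u≤v) (suc z , ηn≤ , ≤ηn) = choose-x q z vq≤u u≤v
        (subst (η * ι n ≤_) (ℚ.*-identityˡ (ι (suc z))) ηn≤) (subst (_≤ η * ι n + 1ℚ) (ℚ.*-identityˡ (ι (suc z))) ≤ηn)
        (*-inverse (0<ι {suc (q ℕ.+ z)} (s≤s z≤n)))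

    stirling₁-dominated : p′ ≤ p + # 4 * η
    stirling₁-dominated = choose-X (quotient (T stirling₁ n j) (T-positive stirling₁ {n} {suc j} (s≤s z≤n) (k<n reg)))
      (ceiling {1ℚ} {η * ι n} (0<# 0) (0≤η ⊗ 0≤ι n))

  module Inverse {B : ℚ} {n k : ℕ} {κ : ℚ} (reg : Regular B n k κ) (0<k : 0 ℕ.< k) where
    private
      k-inverse : Σ[ r ∈ ℚ ] 0ℚ < r × ι k * r ≡ 1ℚ
      k-inverse = *-inverse (0<ι 0<k)
      r : ℚ
      r = proj₁ k-inverse
      rk : r * ι k ≡ 1ℚ
      rk = trans (ℚ.*-comm r (ι k)) (proj₂ (proj₂ k-inverse))
      0≤r : 0ℚ ≤ r
      0≤r = ℚ.<⇒≤ (proj₁ (proj₂ k-inverse))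
    ν : ℚ
    ν = ι n * r
    νk : ν * ι k ≡ ι n
    νk = trans (ℚ.*-assoc (ι n) r (ι k)) (trans (cong (ι n *_) rk) (ℚ.*-identityʳ (ι n)))
    0≤ν : 0ℚ ≤ ν
    0≤ν = 0≤ι n ⊗ 0≤r
    ν≤B : ν ≤ B
    ν≤B = inverse-≤ {r} {ι k} {ι n} {B} rk 0≤r (n≤Bk reg)
    κν : κ * ν ≡ 1ℚ
    κν = trans (sym (ℚ.*-assoc κ (ι n) r)) (trans (cong (_* r) (κn reg)) (trans (ℚ.*-comm (ι k) r) rk))

  inverse-close : ∀ {B κ κ′ ν ν′ δ} → κ * ν ≡ 1ℚ → κ′ * ν′ ≡ 1ℚ → 0ℚ ≤ ν → 0ℚ ≤ ν′ → ν ≤ B → ν′ ≤ B → 0ℚ ≤ δ →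
                  κ′ ≤ κ + δ → ν ≤ ν′ + δ * (B * B)
  inverse-close {B} {κ} {κ′} {ν} {ν′} {δ} κν κ′ν′ 0≤ν 0≤ν′ ν≤B ν′≤B 0≤δ κ′≤κ = subst₂ (λ a b → a ≤ b + δ * (B * B))
    (trans (cong (ν *_) κ′ν′) (ℚ.*-identityʳ ν)) (trans (cong (ν′ *_) κν) (ℚ.*-identityʳ ν′))
    (by (0≤ν ⊗ 0≤ν′ ⊗ ‖ κ′≤κ ⊕ 0≤δ ⊗ ‖ mono-* 0≤ν (ℚ.≤-trans 0≤ν ν≤B) ν≤B ν′≤B)
      (solve 6 (λ κ κ′ ν ν′ δ B → ν′ :* (κ :* ν) :+ δ :* (B :* B) :- ν :* (κ′ :* ν′)
        := ν :* ν′ :* (κ :+ δ :- κ′) :+ δ :* (B :* B :- ν :* ν′)) refl κ κ′ ν ν′ δ B))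

  cauchy-stirling₁ : CauchyCriterion stirling₁
  cauchy-stirling₁ {B} {ε} 1≤B 0<ε = δ , 0<δ , N ,
    λ {n} {j} {n′} {j′} {κ} {κ′} {p} {p′} → main {n} {j} {n′} {j′} {κ} {κ′} {p} {p′}
    where
    0≤B : 0ℚ ≤ B
    0≤B = ℚ.≤-trans (0≤# 1) 1≤B
    0≤K : ∀ {H} → 0ℚ ≤ H → 0ℚ ≤ K₁ H
    0≤K 0≤H = 0≤H ⊗ (0≤# 1 ⊕ 0≤H ⊗ 0≤H ⊕ 0≤H) ⊕ 0≤H ⊗ (0≤# 1 ⊕ 0≤H ⊗ 0≤H) ⊗ (0≤# 2 ⊕ 0≤H) ⊕ 0≤H
    Cf γf Sf hf Rf : ℚ → ℚ → ℚ
    Cf _ H = # 128 * K₁ H + # 128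
    γf η _ = (η * η) * (η * η) * (η * η)
    Sf _ H = 1ℚ + # 2 * H
    hf _ _ = 1ℚ
    Rf _ H = # 4 * B * H * H
    parameters : Setup B (½ * (½ * ε)) Cf γf Sf hf Rf
    parameters = setup {B} {½ * (½ * ε)} Cf γf Sf hf Rf 1≤B (0<* (ℚ.positive⁻¹ ½) (0<* (ℚ.positive⁻¹ ½) 0<ε))
      (λ {η} {H} 0<η 0<H → 0≤# 128 ⊗ 0≤K (ℚ.<⇒≤ 0<H) ⊕ 0≤# 128 , 0<* (0<* (0<* 0<η 0<η) (0<* 0<η 0<η)) (0<* 0<η 0<η) , 0≤# 1 ⊕ 0≤# 2 ⊗ ℚ.<⇒≤ 0<H , 0≤# 1)
    open Setup parameters
    δ-choice : Σ[ δ ∈ ℚ ] 0ℚ < δ × δ * (1ℚ + B * B) ≡ τ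
    δ-choice = small 0<τ (0≤B ⊗ 0≤B)
    δ : ℚ
    δ = proj₁ δ-choice
    0<δ : 0ℚ < δ
    0<δ = proj₁ (proj₂ δ-choice)
    weaken : ∀ x y → x ≤ y + δ * (B * B) → x ≤ y + τ
    weaken x y le = by (‖ le ⊕ ‖ ℚ.≤-reflexive (proj₂ (proj₂ δ-choice)) ⊕ ℚ.<⇒≤ 0<δ)
      (solve 5 (λ x y δ B τ → y :+ τ :- x
        := y :+ δ :* (B :* B) :- x :+ (τ :- δ :* (:1 :+ B :* B)) :+ δ) refl x y δ B τ)
    τK≤ : # 128 * (τ * K₁ H) + # 128 * τ ≤ (η * η) * (η * η) * (η * η)
    τK≤ = subst (# 128 * (τ * K₁ H) + # 128 * τ ≤_) τC≡γ
      (by (ℚ.<⇒≤ 0<τ)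
        (solve 2 (λ τ K → τ :* (:1 :+ (:# 128 :* K :+ :# 128)) :- (:# 128 :* (τ :* K) :+ :# 128 :* τ)
          := τ) refl τ (K₁ H)))
    main : ∀ {n j n′ j′ κ κ′ p p′} → N ℕ.≤ n → N ℕ.≤ n′ → Regular B n (suc j) κ → Regular B n′ (suc j′) κ′ → κ ≤ κ′ + δ → κ′ ≤ κ + δ →
           Probability stirling₁ n j p → Probability stirling₁ n′ j′ p′ → p′ ≤ p + ε
    main {n} {j} {n′} {j′} {κ} {κ′} {p} {p′} N≤n N≤n′ reg reg′ κ≤κ′ κ′≤κ prob prob′ = ℚ.≤-trans
      (stirling₁-dominated {B} {η} {H} {τ} {σ} 1≤B 0<η ηB≤1 ηH≡1 0<H 0<τ 0<σ σS≡τ τK≤ {n} {j} {n′} {j′} {κ} {κ′} {I.ν} {I′.ν} {p} {p′} reg reg′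
        I.νk I′.νk I.0≤ν I′.0≤ν I.ν≤B I′.ν≤B
        (weaken I.ν I′.ν (inverse-close {B} {κ} {κ′} I.κν I′.κν I.0≤ν I′.0≤ν I.ν≤B I′.ν≤B (ℚ.<⇒≤ 0<δ) κ′≤κ))
        (weaken I′.ν I.ν (inverse-close {B} {κ′} {κ} I′.κν I.κν I′.0≤ν I.0≤ν I′.ν≤B I.ν≤B (ℚ.<⇒≤ 0<δ) κ≤κ′))
        (Large.sc (large n N≤n)) (Large.sc (large n′ N≤n′)) (Large.R≤σn (large n N≤n)) (Large.R≤σn (large n′ N≤n′)) prob prob′)
      (by (0≤# 4 ⊗ ‖ η≤ε)
        (solve 3 (λ p η ε → p :+ ε :- (p :+ :# 4 :* η) := :# 4 :* (:½ :* (:½ :* ε) :- η)) refl p η ε))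
      where
      module I  = Inverse {B} {n} {suc j} {κ} reg (s≤s z≤n)
      module I′ = Inverse {B} {n′} {suc j′} {κ′} reg′ (s≤s z≤n)

module CauchyEuler where

  open Prelude
  open OrderedField
  open Powers
  open Triangles
  open Approximation
  open Transversality
  open Parameters
  open Defs using (euler; T; T-outside)

  open Euler
  open Regular
  open Scale

  -- The comparison of 1 - (1 - 1/M)^n with n/(M + k), multiplied out.
  module _ {σ G H : ℚ} (0<σ : 0ℚ < σ) {n₁ j m : ℕ} {x : ℚ} (k<n : suc j ℕ.< suc n₁)
           (xM : x * ι (suc m) ≡ 1ℚ) (0≤x : 0ℚ ≤ x) (x≤1 : x ≤ 1ℚ) (σ≤1 : σ ≤ 1ℚ) (nx≤G : ι (suc n₁) * x ≤ G)
           (sc : Scale (H * H) σ (suc n₁)) (M+n≤ : ι (suc m) + ι (suc n₁) ≤ H * ι (suc n₁)) (n<M+k : suc n₁ ℕ.< suc (suc m ℕ.+ j)) where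
    private
      n : ℕ
      n = suc n₁
      M k N E : ℚ
      M = ι (suc m)
      k = ι (suc j)
      N = ι (suc (suc m ℕ.+ j))
      E = (1ℚ - x) ^ n
      0≤σ : 0ℚ ≤ σ
      0≤σ = ℚ.<⇒≤ 0<σ
      0≤E : 0ℚ ≤ E
      0≤E = 0≤^ n (‖ x≤1)
      E≤1 : E ≤ 1ℚ
      E≤1 = ^≤1 n (‖ x≤1) (by 0≤x (solve 1 (λ x → :1 :- (:1 :- x) := x) refl x))
      square : (M + ι n) * (M + ι n) ≤ (Q sc - 1ℚ) * ι (d sc) * ι n
      square = by (‖ Hn≤ sc ⊗ 0≤ι n ⊕ ‖ M+n≤ ⊗ (0≤ι (suc m) ⊕ 0≤ι n ⊕ ℚ.≤-trans (0≤ι (suc m) ⊕ 0≤ι n) M+n≤))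
        (solve 5 (λ M n H Q d → (Q :- :1) :* d :* n :- (M :+ n) :* (M :+ n)
          := ((Q :- :1) :* d :- H :* H :* n) :* n :+ (H :* n :- (M :+ n)) :* (M :+ n :+ H :* n))
          refl M (ι n) H (Q sc) (ι (d sc)))
      [1+d]x≤ : (1ℚ + ι (d sc)) * x ≤ σ * G
      [1+d]x≤ = stretch-≤ {H * H} {σ} {n} {x} {G} 0≤σ 0≤x nx≤G sc
      quotient-by : ∀ i → Σ[ φ ∈ ℚ ] 0ℚ ≤ φ × φ * ι (suc m ℕ.+ i) ≡ ι n
      quotient-by i = from (*-inverse (0<ι {suc m ℕ.+ i} (s≤s z≤n)))
        where
        from : Σ[ r ∈ ℚ ] 0ℚ < r × ι (suc m ℕ.+ i) * r ≡ 1ℚ → Σ[ φ ∈ ℚ ] 0ℚ ≤ φ × φ * ι (suc m ℕ.+ i) ≡ ι n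
        from (r , 0<r , Mr) = ι n * r , 0≤ι n ⊗ ℚ.<⇒≤ 0<r ,
          trans (solve 3 (λ n r M → n :* r :* M := n :* (M :* r)) refl (ι n) r (ι (suc m ℕ.+ i))) (trans (cong (ι n *_) Mr) (ℚ.*-identityʳ (ι n)))

    rightₑ : 0 ℕ.< j → N * A n (suc j) ≤ (N - ι n) * A n j → ι n * x ≤ (1ℚ - E + σ * (1ℚ + # 2 * G)) * (1ℚ + k * x)
    rightₑ 0<j start = finish (quotient-by (j ℕ.+ d sc))
      where
      finish : Σ[ φ ∈ ℚ ] 0ℚ ≤ φ × φ * ι (suc m ℕ.+ (j ℕ.+ d sc)) ≡ ι n → ι n * x ≤ (1ℚ - E + σ * (1ℚ + # 2 * G)) * (1ℚ + k * x)
      finish (φ , 0≤φ , φM) = subst₂ (λ o k → ι n * x ≤ (1ℚ - E + σ * (1ℚ + # 2 * G)) * (o + k * x)) xM (sym (ι-suc j))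
        (by (0≤x ⊗ (‖ n≤φM ⊕ (0≤ι (suc m) ⊕ (0≤ι j ⊕ 0≤ι (d sc))) ⊗ ‖ φ≤) ⊕ 0≤# 2 ⊗ ‖ [1+d]x≤ ⊕ 0≤# 2 ⊗ 0≤x
            ⊕ 0≤x ⊗ (‖ E≤1 ⊕ 0≤σ) ⊕ (0≤ι (d sc) ⊗ 0≤x) ⊗ (0≤E ⊕ ‖ σ≤1) ⊕ 0≤# 2 ⊗ 0≤σ ⊗ 0≤G ⊗ ‖ 1≤)
          (solve 9 (λ n x E σ G M j d φ → (:1 :- E :+ σ :* (:1 :+ :# 2 :* G)) :* (x :* M :+ (:1 :+ j) :* x)
            :- n :* x
            := x :* (φ :* (M :+ (j :+ d)) :- n :+ (M :+ (j :+ d)) :* (:1 :- E :+ σ :- φ))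
            :+ :# 2 :* (σ :* G :- (:1 :+ d) :* x) :+ :# 2 :* x :+ x :* (:1 :- E :+ σ)
            :+ d :* x :* (E :+ (:1 :- σ)) :+ :# 2 :* σ :* G :* (x :* M :+ (:1 :+ j) :* x :- :1))
            refl (ι n) x E σ G M (ι j) (ι (d sc)) φ))
        where
        φ≤ : φ ≤ 1ℚ - E + σ
        φ≤ = euler-right {n₁} {m} {x} xM {d sc} {Q sc} {σ} (1≤Q sc) square (Q≤ sc) 0≤σ {j} k<n n<M+k {φ} 0<j start φM 0≤φ
        n≤φM : ι n ≤ φ * (M + (ι j + ι (d sc)))
        n≤φM = ℚ.≤-reflexive (trans (sym φM) (cong (φ *_) (trans (ι-+ (suc m) (j ℕ.+ d sc)) (cong (M +_) (ι-+ j (d sc))))))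
        0≤G : 0ℚ ≤ G
        0≤G = ℚ.≤-trans (0≤ι n ⊗ 0≤x) nx≤G
        1≤ : 1ℚ ≤ x * M + (1ℚ + ι j) * x
        1≤ = subst (λ o → o ≤ x * M + (1ℚ + ι j) * x) xM (by ((0≤# 1 ⊕ 0≤ι j) ⊗ 0≤x)
          (solve 3 (λ a j x → a :+ (:1 :+ j) :* x :- a := (:# 1 :+ j) :* x) refl (x * M) (ι j) x))

    leftₑ : d sc ℕ.≤ j → (N - ι n) * A n j ≤ N * A n (suc j) → (1ℚ - E - σ * (1ℚ + G)) * (1ℚ + k * x) ≤ ι n * x
    leftₑ d≤j start = finish (quotient-by i₀)
      where
      i₀ : ℕ
      i₀ = j ℕ.∸ d sc
      j≡ : j ≡ i₀ ℕ.+ d sc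
      j≡ = sym (ℕ.m∸n+n≡m d≤j)
      finish : Σ[ φ ∈ ℚ ] 0ℚ ≤ φ × φ * ι (suc m ℕ.+ i₀) ≡ ι n → (1ℚ - E - σ * (1ℚ + G)) * (1ℚ + k * x) ≤ ι n * x
      finish (φ , 0≤φ , φM) = subst₂ (λ o k → (1ℚ - E - σ * (1ℚ + G)) * (o + k * x) ≤ ι n * x) xM
        (sym (trans (ι-suc j) (cong (1ℚ +_) (trans (cong ι j≡) (ι-+ i₀ (d sc))))))
        (by (0≤x ⊗ (‖ φM≤n ⊕ (0≤ι (suc m) ⊕ 0≤ι i₀) ⊗ ‖ ≤φ) ⊕ ‖ [1+d]x≤
            ⊕ (0≤# 1 ⊕ 0≤ι (d sc)) ⊗ 0≤x ⊗ (0≤E ⊕ 0≤σ) ⊕ 0≤σ ⊗ 0≤G ⊗ ‖ 1≤)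
          (solve 9 (λ n x E σ G M b d φ → n :* x
            :- (:1 :- E :- σ :* (:1 :+ G)) :* (x :* M :+ (:1 :+ (b :+ d)) :* x)
            := x :* (n :- φ :* (M :+ b) :+ (M :+ b) :* (φ :+ σ :- (:1 :- E))) :+ (σ :* G :- (:1 :+ d) :* x)
            :+ (:# 1 :+ d) :* x :* (E :+ σ) :+ σ :* G :* (x :* M :+ (:1 :+ (b :+ d)) :* x :- :1))
            refl (ι n) x E σ G M (ι i₀) (ι (d sc)) φ))
        where
        ≤φ : 1ℚ - E ≤ φ + σ
        ≤φ = euler-left {n₁} {m} {x} xM {d sc} {Q sc} {σ} (1≤Q sc) square (Q≤ sc) 0≤σ {j} k<n n<M+k {i₀} {φ} j≡ start φM 0≤φ
        φM≤n : φ * (M + ι i₀) ≤ ι n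
        φM≤n = ℚ.≤-reflexive (trans (cong (φ *_) (sym (ι-+ (suc m) i₀))) φM)
        0≤G : 0ℚ ≤ G
        0≤G = ℚ.≤-trans (0≤ι n ⊗ 0≤x) nx≤G
        1≤ : 1ℚ ≤ x * M + (1ℚ + (ι i₀ + ι (d sc))) * x
        1≤ = subst (λ o → o ≤ x * M + (1ℚ + (ι i₀ + ι (d sc))) * x) xM
          (by ((0≤# 1 ⊕ (0≤ι i₀ ⊕ 0≤ι (d sc))) ⊗ 0≤x)
            (solve 4 (λ a b d x → a :+ (:1 :+ (b :+ d)) :* x :- a
              := (:# 1 :+ (b :+ d)) :* x) refl (x * M) (ι i₀) (ι (d sc)) x))

  search : ∀ (u v n : ℚ) → 0ℚ ≤ v → 0ℚ ≤ n → ∀ cap → ∃[ r ] r ℕ.≤ cap × u * ι r ≤ v * (n + ι r) ×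
           (r ≡ cap ⊎ v * (n + (1ℚ + ι r)) ≤ u * (1ℚ + ι r))
  search u v n 0≤v 0≤n zero = 0 , z≤n , subst (λ z → u * z ≤ v * (n + z)) (sym ι0)
    (by (0≤v ⊗ 0≤n) (solve 3 (λ u v n → v :* (n :+ :0) :- u :* :0 := v :* n) refl u v n)) , inj₁ refl
  search u v n 0≤v 0≤n (suc cap) = extend (search u v n 0≤v 0≤n cap)
    where
    extend : (∃[ r ] r ℕ.≤ cap × u * ι r ≤ v * (n + ι r) × (r ≡ cap ⊎ v * (n + (1ℚ + ι r)) ≤ u * (1ℚ + ι r))) →
             ∃[ r ] r ℕ.≤ suc cap × u * ι r ≤ v * (n + ι r) × (r ≡ suc cap ⊎ v * (n + (1ℚ + ι r)) ≤ u * (1ℚ + ι r))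
    extend (r , r≤ , le , inj₂ stop) = r , ℕ.m≤n⇒m≤1+n r≤ , le , inj₂ stop
    extend (r , r≤ , le , inj₁ refl) with ℚ.≤-total (u * (1ℚ + ι r)) (v * (n + (1ℚ + ι r)))
    ... | inj₁ more = suc r , ℕ.≤-refl , subst (λ s → u * s ≤ v * (n + s)) (sym (ι-suc r)) more , inj₁ refl
    ... | inj₂ stop = r , ℕ.m≤n⇒m≤1+n r≤ , le , inj₂ stop

  module _ {B ω H τ σ : ℚ} (1≤B : 1ℚ ≤ B) (0<ω : 0ℚ < ω) (ωB≤1 : ω * (# 16 * B) ≤ 1ℚ) (ωH≡1 : ω * H ≡ 1ℚ) (0<H : 0ℚ < H)
    (0<τ : 0ℚ < τ) (0<σ : 0ℚ < σ) (σG≡τ : σ * (1ℚ + # 2 * (# 2 * B)) ≡ τ)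
    (τK≤ : τ * Kₑ (# 2 * B) + # 8 * (τ * (# 2 * B)) + # 8 * τ ≤ ω * ω * ω * (ω * ω * (ω * ω)))
    {n₁ j n₁′ j′ : ℕ} {κ κ′ p p′ : ℚ}
    (reg : Regular B (suc n₁) (suc j) κ) (reg′ : Regular B (suc n₁′) (suc j′) κ′) (κ≤κ′ : κ ≤ κ′ + τ) (κ′≤κ : κ′ ≤ κ + τ)
    (sc : Scale (H * H) σ (suc n₁)) (sc′ : Scale (H * H) σ (suc n₁′)) (R≤ : # 16 * B * B ≤ σ * ι (suc n₁)) (R≤′ : # 16 * B * B ≤ σ * ι (suc n₁′))
    (prob : Probability euler (suc n₁) j p) (prob′ : Probability euler (suc n₁′) j′ p′)
    {w : ℚ} (p≤w : p ≤ w) (1-κ≤w : 1ℚ - κ ≤ w) where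
    private
      n n′ : ℕ
      n  = suc n₁
      n′ = suc n₁′
      G K ω³ : ℚ
      G  = # 2 * B
      K  = Kₑ G
      ω³ = ω * ω * ω
      0≤B : 0ℚ ≤ B
      0≤B = ℚ.≤-trans (0≤# 1) 1≤B
      0<G : 0ℚ < G
      0<G = 0<* (0<# 1) (ℚ.<-≤-trans (0<# 0) 1≤B)
      0≤G : 0ℚ ≤ G
      0≤G = ℚ.<⇒≤ 0<G
      0≤τ : 0ℚ ≤ τ
      0≤τ = ℚ.<⇒≤ 0<τ
      0≤ω : 0ℚ ≤ ω
      0≤ω = ℚ.<⇒≤ 0<ω
      0≤H : 0ℚ ≤ H
      0≤H = ℚ.<⇒≤ 0<H
      0≤σ : 0ℚ ≤ σ
      0≤σ = ℚ.<⇒≤ 0<σ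
      H*ω* : ∀ c → H * (ω * c) ≡ c
      H*ω* c = trans (solve 3 (λ H ω c → H :* (ω :* c) := ω :* H :* c) refl H ω c) (trans (cong (_* c) ωH≡1) (ℚ.*-identityˡ c))
      16ω≤1 : # 16 * ω ≤ 1ℚ
      16ω≤1 = by (‖ ωB≤1 ⊕ 0≤# 16 ⊗ 0≤ω ⊗ ‖ 1≤B)
        (solve 2 (λ ω B → :1 :- :# 16 :* ω := :1 :- ω :* (:# 16 :* B) :+ :# 16 :* ω :* (B :- :1)) refl ω B)
      ω≤1 : ω ≤ 1ℚ
      ω≤1 = by (‖ 16ω≤1 ⊕ 0≤# 15 ⊗ 0≤ω) (solve 1 (λ ω → :1 :- ω := :1 :- :# 16 :* ω :+ :# 15 :* ω) refl ω)
      0≤ω³ : 0ℚ ≤ ω³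
      0≤ω³ = 0≤ω ⊗ 0≤ω ⊗ 0≤ω
      ω³≤ω : # 16 * ω³ ≤ ω
      ω³≤ω = by (0≤ω ⊗ (‖ 16ω≤1 ⊗ 0≤ω ⊕ ‖ ω≤1))
        (solve 1 (λ ω → ω :- :# 16 :* (ω :* ω :* ω) := ω :* ((:1 :- :# 16 :* ω) :* ω :+ (:1 :- ω))) refl ω)
      0≤K : 0ℚ ≤ K
      0≤K = 0≤# 2 ⊗ (0≤G ⊗ (0≤# 1 ⊕ 0≤G) ⊕ 0≤G ⊗ (0≤G ⊕ 0≤# 1 ⊕ 0≤G) ⊕ 0≤G ⊗ 0≤G ⊕ 0≤G) ⊗ ((0≤# 16 ⊕ 0≤G ⊗ 0≤G) ⊗ sq (1ℚ + G))
      ω⁴≤1 : ω * ω * (ω * ω) ≤ 1ℚ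
      ω⁴≤1 = by (‖ ω≤1 ⊗ ((0≤# 1 ⊕ 0≤ω) ⊗ (0≤# 1 ⊕ 0≤ω ⊗ 0≤ω)))
        (solve 1 (λ ω → :1 :- ω :* ω :* (ω :* ω) := (:1 :- ω) :* ((:# 1 :+ ω) :* (:# 1 :+ ω :* ω))) refl ω)
      8τG≤ω³ : # 8 * (τ * G) + # 8 * τ ≤ ω³
      8τG≤ω³ = by (‖ τK≤ ⊕ 0≤τ ⊗ 0≤K ⊕ 0≤ω³ ⊗ ‖ ω⁴≤1)
        (solve 5 (λ τ G K c q → c :- (:# 8 :* (τ :* G) :+ :# 8 :* τ)
          := c :* q :- (τ :* K :+ :# 8 :* (τ :* G) :+ :# 8 :* τ) :+ τ :* K :+ c :* (:1 :- q))
          refl τ G K ω³ (ω * ω * (ω * ω)))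
      σ≤τ : σ + # 2 * (σ * G) ≤ τ
      σ≤τ = ℚ.≤-reflexive (trans (solve 2 (λ σ G → σ :+ :# 2 :* (σ :* G) := σ :* (:1 :+ :# 2 :* G)) refl σ G) σG≡τ)
      8σ≤ω³ : # 8 * σ ≤ ω³
      8σ≤ω³ = by (0≤# 16 ⊗ (0≤σ ⊗ 0≤G) ⊕ 0≤# 8 ⊗ ‖ σ≤τ ⊕ ‖ 8τG≤ω³ ⊕ 0≤# 8 ⊗ (0≤τ ⊗ 0≤G))
        (solve 4 (λ σ G τ c → c :- :# 8 :* σ
          := :# 16 :* (σ :* G) :+ :# 8 :* (τ :- (σ :+ :# 2 :* (σ :* G)))
          :+ (c :- (:# 8 :* (τ :* G) :+ :# 8 :* τ)) :+ :# 8 :* (τ :* G)) refl σ G τ ω³)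
      σ≤1 : σ ≤ 1ℚ
      σ≤1 = by· (0<# 127) (0≤# 16 ⊗ ‖ 8σ≤ω³ ⊕ ‖ ω³≤ω ⊕ ‖ ω≤1 ⊕ 0≤# 127)
        (solve 3 (λ σ c ω → :# 128 :* (:1 :- σ)
          := :# 16 :* (c :- :# 8 :* σ) :+ (ω :- :# 16 :* c) :+ (:1 :- ω) :+ :# 127) refl σ ω³ ω)
      16B≤R : # 16 * B ≤ # 16 * B * B
      16B≤R = by (0≤# 16 ⊗ 0≤B ⊗ ‖ 1≤B)
        (solve 1 (λ B → :# 16 :* B :* B :- :# 16 :* B := :# 16 :* B :* (B :- :1)) refl B)
      B≤σn : # 16 * B ≤ σ * ι n
      B≤σn = ℚ.≤-trans 16B≤R R≤
      B≤σn′ : # 16 * B ≤ σ * ι n′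
      B≤σn′ = ℚ.≤-trans 16B≤R R≤′
      B≤n : # 16 * B ≤ ι n
      B≤n = by (‖ B≤σn ⊕ ‖ σ≤1 ⊗ 0≤ι n)
        (solve 3 (λ b σ n → n :- b := σ :* n :- b :+ (:1 :- σ) :* n) refl (# 16 * B) σ (ι n))
      B≤n′ : # 16 * B ≤ ι n′
      B≤n′ = by (‖ B≤σn′ ⊕ ‖ σ≤1 ⊗ 0≤ι n′)
        (solve 3 (λ b σ n → n :- b := σ :* n :- b :+ (:1 :- σ) :* n) refl (# 16 * B) σ (ι n′))
      two≤ : ∀ {n j κ} → Regular B n (suc j) κ → # 16 * B ≤ ι n → 0 ℕ.< j
      two≤ {n} {j} {κ} reg B≤n = two≤k {B} {κ} {n} {j} reg (ℚ.<-≤-trans (0<# 0) 1≤B)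
        (by (‖ B≤n ⊕ 0≤# 12 ⊗ 0≤B)
          (solve 2 (λ B n → n :- :# 4 :* B := n :- :# 16 :* B :+ :# 12 :* B) refl B (ι n)))

      u v u′ v′ : ℚ
      u  = A n j
      v  = A n (suc j)
      u′ = A n′ j′
      v′ = A n′ (suc j′)
      k k′ α α′ : ℚ
      k  = ι (suc j)
      k′ = ι (suc j′)
      α  = ι n + 1ℚ - k
      α′ = ι n′ + 1ℚ - k′
      0<v : 0ℚ < v
      0<v = 0<T euler (s≤s z≤n) (k<n reg)
      0<u : 0ℚ < u
      0<u = 0<T euler (two≤ reg B≤n) (ℕ.<-trans (ℕ.n<1+n j) (k<n reg))
      0≤v : 0ℚ ≤ v
      0≤v = ℚ.<⇒≤ 0<v
      0<u′ : 0ℚ < u′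
      0<u′ = 0<T euler (two≤ reg′ B≤n′) (ℕ.<-trans (ℕ.n<1+n j′) (k<n reg′))
      0<v′ : 0ℚ < v′
      0<v′ = 0<T euler (s≤s z≤n) (k<n reg′)
      coefficient : ∀ {n j} → suc j ℕ.< n → ι (n ℕ.∸ j) ≡ ι n + 1ℚ - ι (suc j)
      coefficient {n} {j} k<n = trans (ι-∸ (ℕ.≤-trans (ℕ.n≤1+n j) (ℕ.<⇒≤ k<n)))
        (trans (solve 2 (λ n j → n :- j := n :+ :1 :- (:1 :+ j)) refl (ι n) (ι j)) (cong (λ s → ι n + 1ℚ - s) (sym (ι-suc j))))
      unfold : ∀ {n j p} → suc j ℕ.< n → Probability euler n j p →
               p * ((ι n + 1ℚ - ι (suc j)) * A n j + (ι (suc j) + 1ℚ) * A n (suc j)) ≡ (ι n + 1ℚ - ι (suc j)) * A n j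
      unfold {n} {j} {p} k<n pr = trans (cong (p *_) (sym (trans (T-suc euler n j)
          (cong₂ (λ s t → s * A n j + t * A n (suc j)) (coefficient k<n) (trans (ι-+ (suc j) 1) (cong (ι (suc j) +_) ι1))))))
        (trans pr (cong (_* A n j) (coefficient k<n)))
      0<α : ∀ {n k} → k ℕ.< n → 0ℚ < ι n + 1ℚ - ι k
      0<α {n} {k} k<n = ℚ.<-≤-trans (0<# 0) (by (‖ ι-mono (ℕ.<⇒≤ k<n))
        (solve 2 (λ n k → n :+ :1 :- k :- :# 1 := n :- k) refl (ι n) (ι k)))
      eq : p * (α * u + (k + 1ℚ) * v) ≡ α * u
      eq = unfold {n} {j} {p} (k<n reg) prob
      eq′ : p′ * (α′ * u′ + (k′ + 1ℚ) * v′) ≡ α′ * u′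
      eq′ = unfold {n′} {j′} {p′} (k<n reg′) prob′
      0<s : 0ℚ < α * u + (k + 1ℚ) * v
      0<s = 0<+ (0<* (0<α (k<n reg)) 0<u) ((0≤ι (suc j) ⊕ 0≤# 1) ⊗ 0≤v)
      0<s′ : 0ℚ < α′ * u′ + (k′ + 1ℚ) * v′
      0<s′ = 0<+ (0<* (0<α (k<n reg′)) 0<u′) ((0≤ι (suc j′) ⊕ 0≤# 1) ⊗ ℚ.<⇒≤ 0<v′)
      p≤1 : p ≤ 1ℚ
      p≤1 = fraction-≤1 {α * u} {(k + 1ℚ) * v} {p} 0<s ((0≤ι (suc j) ⊕ 0≤# 1) ⊗ 0≤v) eq
      p′≤1 : p′ ≤ 1ℚ
      p′≤1 = fraction-≤1 {α′ * u′} {(k′ + 1ℚ) * v′} {p′} 0<s′ ((0≤ι (suc j′) ⊕ 0≤# 1) ⊗ ℚ.<⇒≤ 0<v′) eq′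
      d≤j : d sc ℕ.≤ j
      d≤j = stretch-fits {B} {κ} {n} {j} reg {σ} {H * H} 0≤σ σB≤1 sc
        where
        τ≤1 : τ ≤ 1ℚ
        τ≤1 = by· (0<# 127) (0≤# 16 ⊗ ‖ 8τG≤ω³ ⊕ 0≤# 256 ⊗ (0≤τ ⊗ 0≤B) ⊕ ‖ ω³≤ω ⊕ ‖ ω≤1 ⊕ 0≤# 127)
          (solve 4 (λ τ B c ω → :# 128 :* (:1 :- τ)
            := :# 16 :* (c :- (:# 8 :* (τ :* (:# 2 :* B)) :+ :# 8 :* τ)) :+ :# 256 :* (τ :* B)
            :+ (ω :- :# 16 :* c) :+ (:1 :- ω) :+ :# 127) refl τ B ω³ ω)
        σB≤1 : σ * B ≤ 1ℚ
        σB≤1 = by (0≤# 3 ⊗ (0≤σ ⊗ 0≤B) ⊕ 0≤σ ⊕ ‖ σ≤τ ⊕ ‖ τ≤1)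
          (solve 3 (λ σ B τ → :1 :- σ :* B
            := :# 3 :* (σ :* B) :+ σ :+ (τ :- (σ :+ :# 2 :* (σ :* (:# 2 :* B)))) :+ (:1 :- τ)) refl σ B τ)

      module Tilt {m r cap : ℕ} (0<r : 0 ℕ.< r) (M≡ : ι (suc m) ≡ ι n - k + ι r) (start : u * ι r ≤ v * (ι n + ι r))
                  (stop : r ≡ cap ⊎ v * (ι n + (1ℚ + ι r)) ≤ u * (1ℚ + ι r))
                  (r≤cap : r ℕ.≤ cap) (n≤8ωcap : ι n ≤ # 8 * ω * ι cap) (8ωcap≤ : # 8 * ω * ι cap ≤ ι n + # 8 * ω)
                  {x : ℚ} (0<x : 0ℚ < x) (xM : x * ι (suc m) ≡ 1ℚ) where
        M : ℚ
        M = ι (suc m)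
        0≤x : 0ℚ ≤ x
        0≤x = ℚ.<⇒≤ 0<x
        θ : ℚ
        θ = ι n * x
        0≤θ : 0ℚ ≤ θ
        0≤θ = 0≤ι n ⊗ 0≤x
        n-k≤M : ι n - k ≤ M
        n-k≤M = subst (ι n - k ≤_) (sym M≡) (by (0≤ι r)
          (solve 2 (λ a r → a :+ r :- a := r) refl (ι n - k) (ι r)))
        n≤BM : ι n ≤ B * M
        n≤BM = ℚ.≤-trans (n≤B[n-k] reg) (by (0≤B ⊗ ‖ n-k≤M)
          (solve 3 (λ B a M → B :* M :- B :* a := B :* (M :- a)) refl B (ι n - k) M))
        θ≤B : θ ≤ B
        θ≤B = inverse-≤ {x} {M} {ι n} {B} xM 0≤x n≤BM
        θ≤G : θ ≤ G
        θ≤G = by (‖ θ≤B ⊕ 0≤B) (solve 2 (λ θ B → :# 2 :* B :- θ := B :- θ :+ B) refl θ B)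
        4ωM≤n : # 4 * ω * M ≤ ι n
        4ωM≤n = by· (0<# 1) (0≤# 8 ⊗ 0≤ω ⊗ (‖ ℚ.≤-reflexive M≡ ⊕ 0≤ι (suc j) ⊕ ‖ ι-mono r≤cap) ⊕ ‖ 8ωcap≤
            ⊕ 0≤# 8 ⊗ 0≤ω ⊗ ‖ ι1≤n ⊕ ‖ 16ω≤1 ⊗ 0≤ι n)
          (solve 6 (λ ω M n k r c → :# 2 :* (n :- :# 4 :* ω :* M)
            := :# 8 :* ω :* (n :- k :+ r :- M :+ k :+ (c :- r)) :+ (n :+ :# 8 :* ω :- :# 8 :* ω :* c)
            :+ :# 8 :* ω :* (n :- :# 1) :+ (:1 :- :# 16 :* ω) :* n) refl ω M (ι n) k (ι r) (ι cap))
          where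
          ι1≤n : # 1 ≤ ι n
          ι1≤n = subst (_≤ ι n) (ι-# 1) (ι-mono (s≤s z≤n))
        4ω≤θ : # 4 * ω ≤ θ
        4ω≤θ = inverse-≥ {x} {M} {ι n} {# 4 * ω} xM 0≤x 4ωM≤n
        16≤σM : # 16 * B ≤ σ * M
        16≤σM = by· (ℚ.<-≤-trans (0<# 0) 1≤B) (‖ R≤ ⊕ 0≤σ ⊗ ‖ n≤BM)
          (solve 4 (λ B σ n M → B :* (σ :* M :- :# 16 :* B)
            := σ :* n :- :# 16 :* B :* B :+ σ :* (B :* M :- n)) refl B σ (ι n) M)
        x≤σ : x ≤ σ
        x≤σ = subst (_≤ σ) (ℚ.*-identityˡ x) (inverse-≤ {x} {M} {1ℚ} {σ} xM 0≤x
          (ℚ.≤-trans (by {1ℚ} {(# 16) * B} (0≤# 16 ⊗ ‖ 1≤B ⊕ 0≤# 15)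
            (solve 1 (λ B → :# 16 :* B :- :1 := :# 16 :* (B :- :1) :+ :# 15) refl B)) 16≤σM))
        x≤1 : x ≤ 1ℚ
        x≤1 = ℚ.≤-trans x≤σ σ≤1
        E : ℚ
        E = (1ℚ - x) ^ n
        0≤E : 0ℚ ≤ E
        0≤E = 0≤^ n (‖ x≤1)
        E≤1 : E ≤ 1ℚ
        E≤1 = ^≤1 n (‖ x≤1) (by 0≤x (solve 1 (λ x → :1 :- (:1 :- x) := x) refl x))
        kx≡κθ : k * x ≡ κ * θ
        kx≡κθ = trans (cong (_* x) (sym (κn reg))) (ℚ.*-assoc κ (ι n) x)
        N≡ : ι (suc (suc m ℕ.+ j)) ≡ ι n + ι r
        N≡ = trans (cong ι (sym (ℕ.+-suc (suc m) j))) (trans (ι-+ (suc m) (suc j)) (trans (cong (_+ k) M≡)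
          (solve 3 (λ n k r → n :- k :+ r :+ k := n :+ r) refl (ι n) k (ι r))))
        n<N : n ℕ.< suc (suc m ℕ.+ j)
        n<N = ℕ.≰⇒> λ N≤n → <⇒≱ (0<ι 0<r) (by (‖ subst (_≤ ι n) N≡ (ι-mono N≤n))
          (solve 2 (λ n r → :0 :- r := n :- (n :+ r)) refl (ι n) (ι r)))
        left : (1ℚ - E - τ) * (1ℚ + k * x) ≤ θ
        left = by (‖ leftₑ {σ} {G} {H} 0<σ {n₁} {j} {m} {x} (k<n reg) xM 0≤x x≤1 σ≤1 θ≤G sc M+n≤Hn n<N d≤j start′
            ⊕ (0≤# 1 ⊕ (0≤ι (suc j) ⊗ 0≤x)) ⊗ (‖ σ≤τ ⊕ 0≤σ ⊗ 0≤G))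
          (solve 6 (λ E τ σ G kx θ → θ :- (:1 :- E :- τ) :* (:1 :+ kx)
            := θ :- (:1 :- E :- σ :* (:1 :+ G)) :* (:1 :+ kx)
            :+ (:# 1 :+ kx) :* (τ :- (σ :+ :# 2 :* (σ :* G)) :+ σ :* G)) refl E τ σ G (k * x) θ)
          where
          start′ : (ι (suc (suc m ℕ.+ j)) - ι n) * u ≤ ι (suc (suc m ℕ.+ j)) * v
          start′ = subst (λ N → (N - ι n) * u ≤ N * v) (sym N≡)
            (by (‖ start)
              (solve 4 (λ n r u v → (n :+ r) :* v :- (n :+ r :- n) :* u
                := v :* (n :+ r) :- u :* r) refl (ι n) (ι r) u v))
          M+n≤Hn : M + ι n ≤ H * ι n
          M+n≤Hn = subst (_≤ H * ι n) (H*ω* (M + ι n))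
            (by· (0<# 3) (0≤H ⊗ (‖ 4ωM≤n ⊕ ‖ 4ωn≤n ⊕ 0≤# 2 ⊗ 0≤ι n))
              (solve 4 (λ H ω M n → :# 4 :* (H :* n :- H :* (ω :* (M :+ n)))
                := H :* (n :- :# 4 :* ω :* M :+ (n :- :# 4 :* ω :* n) :+ :# 2 :* n)) refl H ω M (ι n)))
            where
            4ωn≤n : # 4 * ω * ι n ≤ ι n
            4ωn≤n = by (0≤ι n ⊗ (‖ 16ω≤1 ⊕ 0≤# 12 ⊗ 0≤ω))
              (solve 2 (λ ω n → n :- :# 4 :* ω :* n := n :* (:1 :- :# 16 :* ω :+ :# 12 :* ω)) refl ω (ι n))

        limit : ℚ
        limit = (1ℚ - κ) * (1ℚ + κ * θ)

        limit≤w : limit ≤ w + # 8 * ω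
        limit≤w = from stop
          where
          from : r ≡ cap ⊎ v * (ι n + (1ℚ + ι r)) ≤ u * (1ℚ + ι r) → limit ≤ w + # 8 * ω
          from (inj₁ refl) = by (‖ 1-κ≤w ⊕ ‖ θ≤8ω ⊕ 0≤θ ⊗ (‖ κ≤1 reg ⊕ 0≤κ reg ⊗ 0≤κ reg))
            (solve 4 (λ κ θ w ω → w :+ :# 8 :* ω :- (:1 :- κ) :* (:1 :+ κ :* θ)
              := w :- (:1 :- κ) :+ (:# 8 :* ω :- θ) :+ θ :* (:1 :- κ :+ κ :* κ)) refl κ θ w ω)
            where
            θ≤8ω : θ ≤ # 8 * ω
            θ≤8ω = inverse-≤ {x} {M} {ι n} {# 8 * ω} xM 0≤x (by (‖ n≤8ωcap
                ⊕ 0≤# 8 ⊗ 0≤ω ⊗ (‖ ℚ.≤-reflexive (sym M≡) ⊕ ‖ ι-mono (ℕ.<⇒≤ (k<n reg))))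
              (solve 5 (λ n ω c M k → :# 8 :* ω :* M :- n
                := :# 8 :* ω :* c :- n :+ :# 8 :* ω :* (M :- (n :- k :+ c) :+ (n :- k)))
                refl (ι n) ω (ι r) M k))
          from (inj₂ beyond) = by (‖ limit≤ ⊕ ‖ p≤w ⊕ ‖ 3σ≤)
            (solve 5 (λ l p w σ ω → w :+ :# 8 :* ω :- l
              := p :+ :# 3 :* σ :- l :+ (w :- p) :+ (:# 8 :* ω :- :# 3 :* σ)) refl limit p w σ ω)
            where
            3σ≤ : # 3 * σ ≤ # 8 * ω
            3σ≤ = by· (0<# 15) (0≤# 6 ⊗ ‖ 8σ≤ω³ ⊕ 0≤# 10 ⊗ 0≤ω³ ⊕ ‖ ω³≤ω ⊕ 0≤# 127 ⊗ 0≤ω)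
              (solve 3 (λ σ c ω → :# 16 :* (:# 8 :* ω :- :# 3 :* σ)
                := :# 6 :* (c :- :# 8 :* σ) :+ :# 10 :* c :+ (ω :- :# 16 :* c) :+ :# 127 :* ω) refl σ ω³ ω)
            N₁ : ℚ
            N₁ = ι n + (1ℚ + ι r)
            αN₁≤ : α * N₁ ≤ p * (α * N₁ + (k + 1ℚ) * (1ℚ + ι r))
            αN₁≤ = by· 0<s ((0≤ι (suc j) ⊕ 0≤# 1) ⊗ ℚ.<⇒≤ (0<α (k<n reg)) ⊗ ‖ beyond) (trans
              (trans (solve 4 (λ s p a b → s :* (p :* (a :+ b) :- a) := p :* s :* (a :+ b) :- s :* a) refl (α * u + (k + 1ℚ) * v) p (α * N₁) ((k + 1ℚ) * (1ℚ + ι r)))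
                (cong (λ t → t * (α * N₁ + (k + 1ℚ) * (1ℚ + ι r)) - (α * u + (k + 1ℚ) * v) * (α * N₁)) eq))
              (solve 6 (λ a u v N b y → a :* u :* (a :* N :+ b :* y) :- (a :* u :+ b :* v) :* (a :* N) := b :* a :* (u :* y :- v :* N)) refl α u v N₁ (k + 1ℚ) (1ℚ + ι r)))
            limit≤ : limit ≤ p + # 3 * σ
            limit≤ = by· (0<n reg) (‖ scaled)
              (solve 5 (λ κ n p σ θ → n :* (p :+ :# 3 :* σ :- (:1 :- κ) :* (:1 :+ κ :* θ))
                := n :* p :+ :# 3 :* (σ :* n) :- (n :- κ :* n) :* (:1 :+ κ :* θ)) refl κ (ι n) p σ θ)
              where
              2+2B≤σn : # 2 * (1ℚ + x + k * x) ≤ # 2 * (σ * ι n)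
              2+2B≤σn = by (0≤# 2 ⊗ (‖ x≤1 ⊕ ‖ kx≤θ ⊕ ‖ θ≤B ⊕ ‖ B≤σn ⊕ 0≤# 15 ⊗ ‖ 1≤B ⊕ 0≤# 13))
                (solve 5 (λ x kx s B θ → :# 2 :* s :- :# 2 :* (:1 :+ x :+ kx)
                  := :# 2 :* (:1 :- x :+ (θ :- kx) :+ (B :- θ) :+ (s :- :# 16 :* B) :+ :# 15 :* (B :- :1) :+ :# 13))
                  refl x (k * x) (σ * ι n) B θ)
                where
                kx≤θ : k * x ≤ θ
                kx≤θ = by (0≤x ⊗ ‖ ι-mono (ℕ.<⇒≤ (k<n reg)))
                  (solve 3 (λ k x n → n :* x :- k :* x := x :* (n :- k)) refl k x (ι n))
              core : (ι n - k) * (M + k) ≤ p * (ι n * M) + ι n + # 2 * (1ℚ + M + k)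
              core = subst (λ M → (ι n - k) * (M + k) ≤ p * (ι n * M) + ι n + # 2 * (1ℚ + M + k)) (sym M≡)
                (by (‖ αN₁≤ ⊕ ‖ p≤1 ⊗ (0≤# 2 ⊗ (0≤# 1 ⊕ 0≤ι n ⊕ 0≤ι r)) ⊕ ‖ ι-mono (ℕ.<⇒≤ (k<n reg))
                    ⊕ 0≤# 2 ⊗ 0≤ι n ⊕ 0≤ι r ⊕ 0≤# 1)
                  (solve 4 (λ n k r p → p :* (n :* (n :- k :+ r)) :+ n :+ :# 2 :* (:1 :+ (n :- k :+ r) :+ k)
                    :- (n :- k) :* (n :- k :+ r :+ k)
                    := p :* ((n :+ :1 :- k) :* (n :+ (:1 :+ r)) :+ (k :+ :1) :* (:1 :+ r))
                    :- (n :+ :1 :- k) :* (n :+ (:1 :+ r)) :+ (:1 :- p) :* (:# 2 :* (:# 1 :+ n :+ r))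
                    :+ (n :- k) :+ :# 2 :* n :+ r :+ :# 1) refl (ι n) k (ι r) p))
              core-x : (ι n - k) * (1ℚ + k * x) ≤ ι n * (p * 1ℚ) + (θ + # 2 * (1ℚ + x + k * x))
              core-x = subst (λ o → (ι n - k) * (o + k * x) ≤ ι n * (p * o) + (θ + # 2 * (o + x + k * x))) xM
                (by (0≤x ⊗ ‖ core)
                  (solve 5 (λ n k x M p → n :* (p :* (x :* M)) :+ (n :* x :+ :# 2 :* (x :* M :+ x :+ k :* x))
                    :- (n :- k) :* (x :* M :+ k :* x)
                    := x :* (p :* (n :* M) :+ n :+ :# 2 :* (:1 :+ M :+ k) :- (n :- k) :* (M :+ k)))
                    refl (ι n) k x M p))
              scaled : (ι n - κ * ι n) * (1ℚ + κ * θ) ≤ ι n * p + # 3 * (σ * ι n)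
              scaled = subst₂ (λ a b → (ι n - a) * (1ℚ + b) ≤ ι n * p + # 3 * (σ * ι n)) (sym (κn reg)) kx≡κθ
                (by (‖ core-x ⊕ 0≤ι n ⊗ ‖ x≤σ ⊕ ‖ 2+2B≤σn)
                  (solve 5 (λ n k x p σ → n :* p :+ :# 3 :* (σ :* n) :- (n :- k) :* (:1 :+ k :* x)
                    := n :* (p :* :1) :+ (n :* x :+ :# 2 :* (:1 :+ x :+ k :* x)) :- (n :- k) :* (:1 :+ k :* x)
                    :+ n :* (σ :- x) :+ (:# 2 :* (σ :* n) :- :# 2 :* (:1 :+ x :+ k :* x))) refl (ι n) k x p σ))

        ρ : ℚ
        ρ = θ + # 2 * ω³

        module Primed {m′ : ℕ} {x′ : ℚ} (0<x′ : 0ℚ < x′) (x′M′ : x′ * ι (suc m′) ≡ 1ℚ)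
          (n′≤ρM′ : ι n′ ≤ ρ * ι (suc m′)) (ρM′≤ : ρ * ι (suc m′) ≤ ι n′ + ρ) where
          M′ : ℚ
          M′ = ι (suc m′)
          0≤x′ : 0ℚ ≤ x′
          0≤x′ = ℚ.<⇒≤ 0<x′
          θ′ Δ e : ℚ
          θ′ = ι n′ * x′
          Δ  = θ′ - θ
          e  = (1ℚ - x′) ^ n′
          0≤θ′ : 0ℚ ≤ θ′
          0≤θ′ = 0≤ι n′ ⊗ 0≤x′
          θ′≤ρ : θ′ ≤ ρ
          θ′≤ρ = inverse-≤ {x′} {M′} {ι n′} {ρ} x′M′ 0≤x′ n′≤ρM′
          Δ≤2ω³ : Δ ≤ # 2 * ω³
          Δ≤2ω³ = by (‖ θ′≤ρ) (solve 3 (λ s θ c → :# 2 :* c :- (s :- θ) := θ :+ :# 2 :* c :- s) refl θ′ θ ω³)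
          ρ≤G : ρ ≤ G
          ρ≤G = by (‖ θ≤B ⊕ ‖ 1≤B ⊕ ‖ ω≤1 ⊕ ‖ ω³≤ω ⊕ 0≤# 14 ⊗ 0≤ω³)
            (solve 4 (λ θ B c ω → :# 2 :* B :- (θ :+ :# 2 :* c)
              := B :- θ :+ (B :- :1) :+ (:1 :- ω) :+ (ω :- :# 16 :* c) :+ :# 14 :* c) refl θ B ω³ ω)
          θ′≤G : θ′ ≤ G
          θ′≤G = ℚ.≤-trans θ′≤ρ ρ≤G
          8B≤σM′ : # 8 * B ≤ σ * M′
          8B≤σM′ = by· 0<G (‖ R≤′ ⊕ 0≤σ ⊗ (‖ n′≤ρM′ ⊕ ‖ ρ≤G ⊗ 0≤ι (suc m′)))
            (solve 5 (λ B σ n M ρ → :# 2 :* B :* (σ :* M :- :# 8 :* B)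
              := σ :* n :- :# 16 :* B :* B :+ σ :* (ρ :* M :- n :+ (:# 2 :* B :- ρ) :* M))
              refl B σ (ι n′) M′ ρ)
          8Bx′≤σ : # 8 * B * x′ ≤ σ
          8Bx′≤σ = inverse-≤ {x′} {M′} {# 8 * B} {σ} x′M′ 0≤x′ 8B≤σM′
          x′≤σ : x′ ≤ σ
          x′≤σ = by (‖ 8Bx′≤σ ⊕ 0≤# 8 ⊗ ‖ 1≤B ⊗ 0≤x′ ⊕ 0≤# 7 ⊗ 0≤x′)
            (solve 3 (λ B x′ σ → σ :- x′
              := σ :- :# 8 :* B :* x′ :+ :# 8 :* (B :- :1) :* x′ :+ :# 7 :* x′) refl B x′ σ)
          x′≤1 : x′ ≤ 1ℚ
          x′≤1 = ℚ.≤-trans x′≤σ σ≤1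
          ω³≤Δ : ω³ ≤ Δ
          ω³≤Δ = by· (0<# 3) (0≤# 4 ⊗ ‖ ρ-ρx′≤θ′ ⊕ 0≤# 4 ⊗ ‖ ρ≤G ⊗ 0≤x′ ⊕ ‖ 8Bx′≤σ ⊕ ‖ 8σ≤ω³ ⊕ 0≤# 7 ⊗ 0≤σ
              ⊕ 0≤# 3 ⊗ 0≤ω³)
            (solve 6 (λ c s θ x′ B σ → :# 4 :* (s :- θ :- c)
              := :# 4 :* (s :- (θ :+ :# 2 :* c :- (θ :+ :# 2 :* c) :* x′))
              :+ :# 4 :* (:# 2 :* B :- (θ :+ :# 2 :* c)) :* x′ :+ (σ :- :# 8 :* B :* x′) :+ (c :- :# 8 :* σ)
              :+ :# 7 :* σ :+ :# 3 :* c) refl ω³ θ′ θ x′ B σ)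
            where
            ρ-ρx′≤θ′ : ρ - ρ * x′ ≤ θ′
            ρ-ρx′≤θ′ = subst (_≤ θ′) (trans (solve 3 (λ ρ x′ M → (ρ :* M :- ρ) :* x′ := ρ :* (x′ :* M) :- ρ :* x′) refl ρ x′ M′)
              (cong (λ s → s - ρ * x′) (trans (cong (ρ *_) x′M′) (ℚ.*-identityʳ ρ))))
              (by (0≤x′ ⊗ ‖ ρM′≤)
                (solve 4 (λ n ρ x′ M → n :* x′ :- (ρ :* M :- ρ) :* x′
                  := x′ :* (n :+ ρ :- ρ :* M)) refl (ι n′) ρ x′ M′))
          0≤Δ : 0ℚ ≤ Δ
          0≤Δ = ℚ.≤-trans 0≤ω³ ω³≤Δ
          k′x′≡κ′θ′ : k′ * x′ ≡ κ′ * θ′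
          k′x′≡κ′θ′ = trans (cong (_* x′) (sym (κn reg′))) (ℚ.*-assoc κ′ (ι n′) x′)
          N′ : ℚ
          N′ = ι (suc (suc m′ ℕ.+ j′))
          N′≡ : N′ ≡ M′ + k′
          N′≡ = trans (cong ι (sym (ℕ.+-suc (suc m′) j′))) (ι-+ (suc m′) (suc j′))
          limit′ : ℚ
          limit′ = (1ℚ - κ′) * (1ℚ + κ′ * θ′)
          limit′≤ : limit′ ≤ limit + # 2 * ω³ + # 2 * (τ * G) + τ
          limit′≤ = by ((0≤# 1 ⊕ 0≤κ reg′ ⊗ 0≤θ′) ⊗ ‖ κ≤κ′ ⊕ 0≤τ ⊗ ‖ κ′s≤G
              ⊕ ‖ κ≤1 reg ⊗ (0≤θ′ ⊗ ‖ κ′≤κ ⊕ 0≤τ ⊗ ‖ θ′≤G ⊕ 0≤κ reg ⊗ ‖ Δ≤2ω³) ⊕ 0≤κ reg ⊗ 0≤τ ⊗ 0≤G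
              ⊕ 0≤# 2 ⊗ 0≤ω³ ⊗ (‖ κ≤1 reg ⊕ 0≤κ reg ⊗ 0≤κ reg))
            (solve 7 (λ κ κ′ θ s τ G c → (:1 :- κ) :* (:1 :+ κ :* θ) :+ :# 2 :* c :+ :# 2 :* (τ :* G) :+ τ
              :- (:1 :- κ′) :* (:1 :+ κ′ :* s)
              := (:# 1 :+ κ′ :* s) :* (κ′ :+ τ :- κ) :+ τ :* (G :- κ′ :* s)
              :+ (:1 :- κ) :* (s :* (κ :+ τ :- κ′) :+ τ :* (G :- s) :+ κ :* (:# 2 :* c :- (s :- θ)))
              :+ κ :* τ :* G :+ :# 2 :* c :* (:1 :- κ :+ κ :* κ)) refl κ κ′ θ θ′ τ G ω³)
            where
            κ′s≤G : κ′ * θ′ ≤ G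
            κ′s≤G = by (‖ κ≤1 reg′ ⊗ 0≤θ′ ⊕ ‖ θ′≤G)
              (solve 3 (λ κ s G → G :- κ :* s := (:1 :- κ) :* s :+ (G :- s)) refl κ′ θ′ G)
          final : p′ ≤ limit′ + σ → p′ ≤ w + # 12 * ω
          final p′≤ = by (‖ p′≤ ⊕ ‖ limit′≤ ⊕ ‖ limit≤w ⊕ ‖ 8τG≤ω³ ⊕ 0≤# 6 ⊗ (0≤τ ⊗ 0≤G) ⊕ 0≤# 7 ⊗ 0≤τ
              ⊕ ‖ 8σ≤ω³ ⊕ 0≤# 7 ⊗ 0≤σ ⊕ ‖ ω³≤ω ⊕ 0≤# 12 ⊗ 0≤ω³ ⊕ 0≤# 3 ⊗ 0≤ω)
            (solve 9 (λ p l l′ w ω c τ G σ → w :+ :# 12 :* ω :- p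
              := l′ :+ σ :- p :+ (l :+ :# 2 :* c :+ :# 2 :* (τ :* G) :+ τ :- l′) :+ (w :+ :# 8 :* ω :- l)
              :+ (c :- (:# 8 :* (τ :* G) :+ :# 8 :* τ)) :+ :# 6 :* (τ :* G) :+ :# 7 :* τ :+ (c :- :# 8 :* σ)
              :+ :# 7 :* σ :+ (ω :- :# 16 :* c) :+ :# 12 :* c :+ :# 3 :* ω) refl p′ limit limit′ w ω ω³ τ G σ)

          -- If M′ + k′ ≤ n′ the bound is at least 1.
          degenerate : M′ + k′ ≤ ι n′ → p′ ≤ w + # 12 * ω
          degenerate M′+k′≤n′ = final (by (‖ p′≤1 ⊕ 0≤σ ⊕ 0≤κ reg′ ⊗ ‖ one≤)
            (solve 4 (λ p κ s σ → (:1 :- κ) :* (:1 :+ κ :* s) :+ σ :- p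
              := :1 :- p :+ σ :+ κ :* (s :- (:1 :+ κ :* s))) refl p′ κ′ θ′ σ))
            where
            one≤ : 1ℚ + κ′ * θ′ ≤ θ′
            one≤ = subst₂ (λ o b → o + b ≤ θ′) x′M′ k′x′≡κ′θ′
              (by (0≤x′ ⊗ ‖ M′+k′≤n′)
                (solve 4 (λ x′ M k n → n :* x′ :- (x′ :* M :+ k :* x′)
                  := x′ :* (n :- (M :+ k))) refl x′ M′ k′ (ι n′)))

          bound : ι n′ ≤ M′ + k′ → u′ * (M′ + k′ - ι n′) ≤ v′ * (M′ + k′) → p′ ≤ w + # 12 * ω
          bound n′≤M′+k′ start′ = final (by· (0<n reg′) (‖ scaled′ ⊕ ‖ 1+κs≤σn)
            (solve 5 (λ n p κ s σ → n :* ((:1 :- κ) :* (:1 :+ κ :* s) :+ σ :- p)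
              := (n :+ :1 :- κ :* n) :* (:1 :+ κ :* s) :- n :* p :+ (σ :* n :- (:1 :+ κ :* s)))
              refl (ι n′) p′ κ′ θ′ σ))
            where
            Z : ℚ
            Z = M′ + k′
            pZ≤ : p′ * (α′ * Z + (k′ + 1ℚ) * (Z - ι n′)) ≤ α′ * Z
            pZ≤ = by· 0<s′ ((0≤ι (suc j′) ⊕ 0≤# 1) ⊗ ℚ.<⇒≤ (0<α (k<n reg′)) ⊗ ‖ start′) (trans
              (trans (solve 4 (λ s p a b → s :* (a :- p :* (a :+ b)) := s :* a :- p :* s :* (a :+ b)) refl (α′ * u′ + (k′ + 1ℚ) * v′) p′ (α′ * Z) ((k′ + 1ℚ) * (Z - ι n′)))
                (cong (λ t → (α′ * u′ + (k′ + 1ℚ) * v′) * (α′ * Z) - t * (α′ * Z + (k′ + 1ℚ) * (Z - ι n′))) eq′))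
              (solve 6 (λ a u v Z b y → (a :* u :+ b :* v) :* (a :* Z) :- a :* u :* (a :* Z :+ b :* y) := b :* a :* (v :* Z :- u :* y)) refl α′ u′ v′ Z (k′ + 1ℚ) (Z - ι n′)))
            0≤p′ : 0ℚ ≤ p′
            0≤p′ = fraction-≥0 {α′ * u′} {α′ * u′ + (k′ + 1ℚ) * v′} {p′} 0<s′ (ℚ.<⇒≤ (0<α (k<n reg′)) ⊗ ℚ.<⇒≤ 0<u′) eq′
            nM≤ : ι n′ * (p′ * M′) ≤ α′ * Z
            nM≤ = by (‖ pZ≤ ⊕ 0≤p′ ⊗ (‖ n′≤M′+k′ ⊕ (0≤ι (suc m′) ⊕ 0≤ι (suc j′))))
              (solve 4 (λ n p M k → (n :+ :1 :- k) :* (M :+ k) :- n :* (p :* M)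
                := (n :+ :1 :- k) :* (M :+ k)
                :- p :* ((n :+ :1 :- k) :* (M :+ k) :+ (k :+ :1) :* (M :+ k :- n))
                :+ p :* (M :+ k :- n :+ (M :+ k))) refl (ι n′) p′ M′ k′)
            scaled′ : ι n′ * p′ ≤ (ι n′ + 1ℚ - κ′ * ι n′) * (1ℚ + κ′ * θ′)
            scaled′ = subst₂ (λ a b → ι n′ * p′ ≤ (ι n′ + 1ℚ - a) * (1ℚ + b)) (sym (κn reg′)) k′x′≡κ′θ′
              (ℚ.≤-trans (ℚ.≤-reflexive (solve 2 (λ n p → n :* p := n :* (p :* :1)) refl (ι n′) p′))
                (subst (λ o → ι n′ * (p′ * o) ≤ α′ * (o + k′ * x′)) x′M′
                  (by (0≤x′ ⊗ ‖ nM≤)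
                    (solve 6 (λ n p M k x′ a → a :* (x′ :* M :+ k :* x′) :- n :* (p :* (x′ :* M))
                      := x′ :* (a :* (M :+ k) :- n :* (p :* M))) refl (ι n′) p′ M′ k′ x′ α′))))
            1+κs≤σn : 1ℚ + κ′ * θ′ ≤ σ * ι n′
            1+κs≤σn = by (‖ κ≤1 reg′ ⊗ 0≤θ′ ⊕ ‖ θ′≤G ⊕ ‖ B≤σn′ ⊕ 0≤# 14 ⊗ ‖ 1≤B ⊕ 0≤# 13)
              (solve 4 (λ κ s B b → b :- (:1 :+ κ :* s)
                := (:1 :- κ) :* s :+ (:# 2 :* B :- s) :+ (b :- :# 16 :* B) :+ :# 14 :* (B :- :1) :+ :# 13)
                refl κ′ θ′ B (σ * ι n′))

          absurd : ι n′ < M′ + k′ → v′ * (M′ + k′) ≤ u′ * (M′ + k′ - ι n′) → ⊥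
          absurd n′<M′+k′ start′ = <⇒≱ 0<τ (by· (0<# 7) (‖ steep ⊕ ‖ τK≤ ⊕ 0≤# 8 ⊗ (0≤τ ⊗ 0≤G)
              ⊕ ‖ ω³≤Δ ⊗ sq (θ * θ) ⊕ 0≤ω³ ⊗ (‖ 16ω²≤θ² ⊗ (sq θ ⊕ 0≤# 16 ⊗ sq ω) ⊕ 0≤# 255 ⊗ sq (ω * ω)))
            (solve 6 (λ τ K G Δ θ ω → :# 8 :* (:0 :- τ)
              := τ :* K :- Δ :* (θ :* θ :* (θ :* θ))
              :+ (ω :* ω :* ω :* (ω :* ω :* (ω :* ω)) :- (τ :* K :+ :# 8 :* (τ :* G) :+ :# 8 :* τ))
              :+ :# 8 :* (τ :* G) :+ (Δ :- ω :* ω :* ω) :* (θ :* θ :* (θ :* θ))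
              :+ ω :* ω :* ω :* ((θ :* θ :- :# 16 :* (ω :* ω)) :* (θ :* θ :+ :# 16 :* (ω :* ω)) :+ :# 255 :* (ω :* ω :* (ω :* ω))))
              refl τ K G Δ θ ω))
            where
            16ω²≤θ² : # 16 * (ω * ω) ≤ θ * θ
            16ω²≤θ² = by (‖ 4ω≤θ ⊗ (0≤θ ⊕ 0≤# 4 ⊗ 0≤ω))
              (solve 2 (λ ω θ → θ :* θ :- :# 16 :* (ω :* ω) := (θ :- :# 4 :* ω) :* (θ :+ :# 4 :* ω)) refl ω θ)
            32Δ≤θ³ : # 32 * Δ ≤ θ * θ * θ
            32Δ≤θ³ = by (0≤# 32 ⊗ ‖ Δ≤2ω³ ⊕ ‖ 16ω²≤θ² ⊗ 0≤θ ⊕ 0≤# 16 ⊗ sq ω ⊗ ‖ 4ω≤θ)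
              (solve 3 (λ Δ θ ω → θ :* θ :* θ :- :# 32 :* Δ
                := :# 32 :* (:# 2 :* (ω :* ω :* ω) :- Δ) :+ (θ :* θ :- :# 16 :* (ω :* ω)) :* θ
                :+ :# 16 :* (ω :* ω) :* (θ :- :# 4 :* ω)) refl Δ θ ω)
            n<N′ : n′ ℕ.< suc (suc m′ ℕ.+ j′)
            n<N′ = ℕ.≰⇒> λ N≤n → <⇒≱ n′<M′+k′ (subst (_≤ ι n′) N′≡ (ι-mono N≤n))
            M′+n′≤Hn′ : M′ + ι n′ ≤ H * ι n′
            M′+n′≤Hn′ = subst (_≤ H * ι n′) (H*ω* (M′ + ι n′))
              (by· (0<# 3) (0≤H ⊗ (‖ 4ωM′≤2n′ ⊕ ‖ 16ω≤1 ⊗ 0≤ι n′ ⊕ 0≤# 12 ⊗ 0≤ω ⊗ 0≤ι n′ ⊕ 0≤ι n′))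
                (solve 4 (λ H ω M n → :# 4 :* (H :* n :- H :* (ω :* (M :+ n)))
                  := H :* (:# 2 :* n :- :# 4 :* ω :* M :+ (:1 :- :# 16 :* ω) :* n :+ :# 12 :* ω :* n :+ n))
                  refl H ω M′ (ι n′)))
              where
              4ωM′≤2n′ : # 4 * ω * M′ ≤ # 2 * ι n′
              4ωM′≤2n′ = by (‖ 4ω≤θ ⊗ 0≤ι (suc m′) ⊕ 0≤# 2 ⊗ 0≤ω³ ⊗ 0≤ι (suc m′) ⊕ ‖ ρM′≤ ⊕ ‖ ρ≤G ⊕ ‖ B≤n′
                  ⊕ 0≤# 14 ⊗ 0≤B)
                (solve 6 (λ ω M n θ c B → :# 2 :* n :- :# 4 :* ω :* M
                  := (θ :- :# 4 :* ω) :* M :+ :# 2 :* c :* M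
                  :+ (n :+ (θ :+ :# 2 :* c) :- (θ :+ :# 2 :* c) :* M) :+ (:# 2 :* B :- (θ :+ :# 2 :* c))
                  :+ (n :- :# 16 :* B) :+ :# 14 :* B) refl ω M′ (ι n′) θ ω³ B)
            right : θ′ ≤ (1ℚ - e + τ) * (1ℚ + κ′ * θ′)
            right = subst (λ b → θ′ ≤ (1ℚ - e + τ) * (1ℚ + b)) k′x′≡κ′θ′ (subst (λ s → θ′ ≤ (1ℚ - e + s) * (1ℚ + k′ * x′)) σG≡τ
              (rightₑ {σ} {G} {H} 0<σ {n₁′} {j′} {m′} {x′} (k<n reg′) x′M′ 0≤x′ x′≤1 σ≤1 θ′≤G sc′ M′+n′≤Hn′ n<N′ (two≤ reg′ B≤n′)
                (subst (λ N → N * v′ ≤ (N - ι n′) * u′) (sym N′≡)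
                  (by (‖ start′)
                    (solve 4 (λ Z n u v → (Z :- n) :* u :- Z :* v
                      := u :* (Z :- n) :- v :* Z) refl (M′ + k′) (ι n′) u′ v′)))))
            0≤e : 0ℚ ≤ e
            0≤e = 0≤^ n′ (‖ x′≤1)
            e≤1 : e ≤ 1ℚ
            e≤1 = ^≤1 n′ (‖ x′≤1) (by 0≤x′ (solve 1 (λ x′ → :1 :- (:1 :- x′) := x′) refl x′))
            error : ∀ {θ x} → θ ≤ G → 0ℚ ≤ x → x ≤ σ → θ * x ≤ τ
            error {θ} {x} θ≤G 0≤x x≤σ = by (0≤x ⊗ ‖ θ≤G ⊕ 0≤G ⊗ ‖ x≤σ ⊕ ‖ σ≤τ ⊕ 0≤σ ⊕ 0≤σ ⊗ 0≤G)
              (solve 5 (λ θ x σ τ G → τ :- θ :* x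
                := x :* (G :- θ) :+ G :* (σ :- x) :+ (τ :- (σ :+ :# 2 :* (σ :* G))) :+ σ :+ σ :* G)
                refl θ x σ τ G)
            tangent₁ : E * (1ℚ - Δ) ≤ e + τ
            tangent₁ = ℚ.≤-trans (ℚ.≤-reflexive (cong (E *_) (solve 2 (λ θ s → :1 :- (s :- θ) := :1 :+ θ :- s) refl θ θ′)))
              (ℚ.≤-trans (tangent-rescaled n n′ {suc m} {suc m′} {x} {x′} xM x′M′ 0≤x x≤1 0≤x′ x′≤1) (ℚ.+-monoʳ-≤ e (error θ′≤G 0≤x′ x′≤σ)))
            e≤E+τ : e ≤ E + τ
            e≤E+τ = by (‖ tangent-rescaled n′ n {suc m′} {suc m} {x′} {x} x′M′ xM 0≤x′ x′≤1 0≤x x≤1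
                ⊕ 0≤e ⊗ 0≤Δ ⊕ ‖ error θ≤G 0≤x x≤σ)
              (solve 6 (λ e E τ θ s r → E :+ τ :- e
                := E :+ r :- e :* (:1 :+ s :- θ) :+ e :* (s :- θ) :+ (τ :- r)) refl e E τ θ θ′ (θ * x))
            θ+Δ : θ + Δ ≡ θ′
            θ+Δ = solve 2 (λ θ s → θ :+ (s :- θ) := s) refl θ θ′
            steep : Δ * (θ * θ * (θ * θ)) ≤ τ * K
            steep = transversalₑ {κ} {κ′} {θ} {Δ} {E} {e} {τ} {G} 0≤τ 0≤θ 0≤Δ (subst (_≤ G) (sym θ+Δ) θ′≤G)
              (0≤κ reg) (κ≤1 reg) (0≤κ reg′) (κ≤1 reg′) 0≤E E≤1 0≤e e≤1 κ′≤κ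
              (subst (λ b → (1ℚ - E - τ) * (1ℚ + b) ≤ θ) kx≡κθ left)
              (subst (λ s → s ≤ (1ℚ - e + τ) * (1ℚ + κ′ * s)) (sym θ+Δ) right)
              tangent₁ e≤E+τ (sinh-bound-strict n 0≤x x≤1) (^-reciprocal n 0≤x x≤1) 32Δ≤θ³

      near-1 : v * (ι n + (1ℚ + ι 0)) ≤ u * (1ℚ + ι 0) → p′ ≤ w + # 12 * ω
      near-1 stop = by (‖ p′≤1 ⊕ ‖ 1≤p+σ ⊕ ‖ p≤w ⊕ ‖ 8σ≤ω³ ⊕ 0≤# 7 ⊗ 0≤σ ⊕ ‖ ω³≤ω ⊕ 0≤# 15 ⊗ 0≤ω³
          ⊕ 0≤# 11 ⊗ 0≤ω)
        (solve 6 (λ p′ p w σ c ω → w :+ :# 12 :* ω :- p′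
          := :1 :- p′ :+ (p :+ σ :- :1) :+ (w :- p) :+ (c :- :# 8 :* σ) :+ :# 7 :* σ :+ (ω :- :# 16 :* c)
          :+ :# 15 :* c :+ :# 11 :* ω) refl p′ p w σ ω³ ω)
        where
        stop′ : v * (ι n + 1ℚ) ≤ u
        stop′ = subst₂ _≤_ (cong (λ z → v * (ι n + z)) (trans (cong (1ℚ +_) ι0) (ℚ.+-identityʳ 1ℚ)))
          (trans (cong (u *_) (trans (cong (1ℚ +_) ι0) (ℚ.+-identityʳ 1ℚ))) (ℚ.*-identityʳ u)) stop
        [1-p]α≤1 : (1ℚ - p) * α ≤ 1ℚ
        [1-p]α≤1 = by· 0<u
          (‖ stop′ ⊕ 0≤v ⊗ ‖ ι-mono (ℕ.<⇒≤ (k<n reg)) ⊕ (0≤ι (suc j) ⊕ 0≤# 1) ⊗ 0≤v ⊗ ‖ p≤1)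
          (trans (solve 5 (λ u p a b v → u :* (:1 :- (:1 :- p) :* a) := u :- a :* u :+ p :* (a :* u :+ b :* v) :- p :* (b :* v)) refl u p α (k + 1ℚ) v)
            (trans (cong (λ t → u - α * u + t - p * ((k + 1ℚ) * v)) eq)
              (solve 6 (λ u p a k v n → u :- a :* u :+ a :* u :- p :* ((k :+ :1) :* v) := u :- v :* (n :+ :1) :+ v :* (n :- k) :+ (k :+ :1) :* v :* (:1 :- p)) refl u p α k v (ι n))))
        1≤p+σ : 1ℚ ≤ p + σ
        1≤p+σ = by· (0<n reg) (‖ p≤1 ⊗ (‖ n≤B[n-k] reg ⊕ 0≤B) ⊕ 0≤B ⊗ ‖ [1-p]α≤1 ⊕ ‖ B≤σn ⊕ 0≤# 15 ⊗ 0≤B)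
          (solve 5 (λ p σ n B k → n :* (p :+ σ :- :1)
            := (:1 :- p) :* (B :* (n :- k) :- n :+ B) :+ B :* (:1 :- (:1 :- p) :* (n :+ :1 :- k))
            :+ (σ :* n :- :# 16 :* B) :+ :# 15 :* B) refl p σ (ι n) B k)

      module ChooseM′ {m r cap : ℕ} (0<r : 0 ℕ.< r) (M≡ : ι (suc m) ≡ ι n - k + ι r) (start : u * ι r ≤ v * (ι n + ι r))
                      (stop : r ≡ cap ⊎ v * (ι n + (1ℚ + ι r)) ≤ u * (1ℚ + ι r))
                      (r≤cap : r ℕ.≤ cap) (n≤8ωcap : ι n ≤ # 8 * ω * ι cap) (8ωcap≤ : # 8 * ω * ι cap ≤ ι n + # 8 * ω)
                      {x : ℚ} (0<x : 0ℚ < x) (xM : x * ι (suc m) ≡ 1ℚ) where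
        open Tilt {m} {r} {cap} 0<r M≡ start stop r≤cap n≤8ωcap 8ωcap≤ {x} 0<x xM using (0≤θ; ρ; module Primed)
        0<ρ : 0ℚ < ρ
        0<ρ = 0<+ (0<* (0<n reg) 0<x) (0≤# 2 ⊗ 0≤ω³)
        choose-x′ : ∀ m′ → ι n′ ≤ ρ * ι (suc m′) → ρ * ι (suc m′) ≤ ι n′ + ρ →
                    Σ[ x′ ∈ ℚ ] 0ℚ < x′ × ι (suc m′) * x′ ≡ 1ℚ → p′ ≤ w + # 12 * ω
        choose-x′ m′ n′≤ ≤n′+ρ (x′ , 0<x′ , Mx′) = compare (ι (suc m′) + k′ ℚ.≤? ι n′)
          where
          x′M′ : x′ * ι (suc m′) ≡ 1ℚ
          x′M′ = trans (ℚ.*-comm x′ (ι (suc m′))) Mx′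
          compare : Dec (ι (suc m′) + k′ ≤ ι n′) → p′ ≤ w + # 12 * ω
          compare (yes small)  = Primed.degenerate {m′} {x′} 0<x′ x′M′ n′≤ ≤n′+ρ small
          compare (no  ¬small) with ℚ.≤-total (u′ * (ι (suc m′) + k′ - ι n′)) (v′ * (ι (suc m′) + k′))
          ... | inj₁ u≤v = Primed.bound {m′} {x′} 0<x′ x′M′ n′≤ ≤n′+ρ (ℚ.<⇒≤ (ℚ.≰⇒> ¬small)) u≤v
          ... | inj₂ v≤u = ⊥-elim (Primed.absurd {m′} {x′} 0<x′ x′M′ n′≤ ≤n′+ρ (ℚ.≰⇒> ¬small) v≤u)
        choose-M′ : (∃[ M′ ] ι n′ ≤ ρ * ι M′ × ρ * ι M′ ≤ ι n′ + ρ) → p′ ≤ w + # 12 * ω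
        choose-M′ (zero   , n′≤ , _)     = ⊥-elim (<⇒≱ (0<n reg′) (subst (ι n′ ≤_) (trans (cong (ρ *_) ι0) (ℚ.*-zeroʳ ρ)) n′≤))
        choose-M′ (suc m′ , n′≤ , ≤n′+ρ) = choose-x′ m′ n′≤ ≤n′+ρ (*-inverse (0<ι {suc m′} (s≤s z≤n)))

      choose-M : ∀ {cap} → ι n ≤ # 8 * ω * ι cap → # 8 * ω * ι cap ≤ ι n + # 8 * ω →
                 (∃[ r ] r ℕ.≤ cap × u * ι r ≤ v * (ι n + ι r) × (r ≡ cap ⊎ v * (ι n + (1ℚ + ι r)) ≤ u * (1ℚ + ι r))) → p′ ≤ w + # 12 * ω
      choose-M n≤ ≤n (zero , _ , _ , inj₂ stop) = near-1 stop
      choose-M n≤ ≤n (zero , _ , _ , inj₁ refl) = ⊥-elim (<⇒≱ (0<n reg) (subst (ι n ≤_) (trans (cong (# 8 * ω *_) ι0) (ℚ.*-zeroʳ (# 8 * ω))) n≤))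
      choose-M {cap} n≤ ≤n (suc r , r≤cap , start , stop) = choose-x (*-inverse (0<ι {suc m} (s≤s z≤n)))
        where
        m : ℕ
        m = n ℕ.∸ suc j ℕ.+ r
        M≡ : ι (suc m) ≡ ι n - k + ι (suc r)
        M≡ = trans (cong ι (sym (ℕ.+-suc (n ℕ.∸ suc j) r))) (trans (ι-+ (n ℕ.∸ suc j) (suc r)) (cong (_+ ι (suc r)) (ι-∸ (ℕ.<⇒≤ (k<n reg)))))
        choose-x : Σ[ x ∈ ℚ ] 0ℚ < x × ι (suc m) * x ≡ 1ℚ → p′ ≤ w + # 12 * ω
        choose-x (x , 0<x , Mx) = choose-M′ (ceiling 0<ρ (0≤ι n′))
          where open ChooseM′ {m} {suc r} {cap} (s≤s z≤n) M≡ start stop r≤cap n≤ ≤n {x} 0<x (trans (ℚ.*-comm x (ι (suc m))) Mx)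

      choose-cap : (∃[ cap ] ι n ≤ # 8 * ω * ι cap × # 8 * ω * ι cap ≤ ι n + # 8 * ω) → p′ ≤ w + # 12 * ω
      choose-cap (cap , n≤ , ≤n) = choose-M {cap} n≤ ≤n (search u v (ι n) 0≤v (0≤ι n) cap)

    euler-bounded : p′ ≤ w + # 12 * ω
    euler-bounded = choose-cap (ceiling {# 8 * ω} {ι n} (0<* (0<# 7) 0<ω) (0≤ι n))

  euler-diagonal : ∀ n → T euler (suc n) (suc n) ≡ 0
  euler-diagonal n rewrite ℕ.n∸n≡0 n | T-outside euler (ℕ.n<1+n n) = ℕ.*-zeroʳ (suc n ℕ.+ 1)

  euler-edge : ∀ n → T euler (suc n) 0 ≡ T euler (suc n) n
  euler-edge zero    = refl
  euler-edge (suc n) = begin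
    1 ℕ.* T euler (suc n) 0
      ≡⟨ cong (1 ℕ.*_) (euler-edge n) ⟩
    1 ℕ.* T euler (suc n) n
      ≡⟨ sym (ℕ.+-identityʳ (1 ℕ.* T euler (suc n) n)) ⟩
    1 ℕ.* T euler (suc n) n ℕ.+ 0
      ≡⟨ cong₂ (λ s t → s ℕ.* T euler (suc n) n ℕ.+ t) (sym (ℕ.m+n∸n≡m 1 n))
           (sym (trans (cong ((suc n ℕ.+ 1) ℕ.*_) (euler-diagonal n)) (ℕ.*-zeroʳ (suc n ℕ.+ 1)))) ⟩
    (suc n ℕ.∸ n) ℕ.* T euler (suc n) n ℕ.+ (suc n ℕ.+ 1) ℕ.* T euler (suc n) (suc n) ∎
    where open ≡-Reasoning

  euler-symmetric : ∀ n i j → i ℕ.+ j ≡ n → T euler (suc n) i ≡ T euler (suc n) j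
  euler-symmetric n zero    j    refl = euler-edge n
  euler-symmetric n (suc i) zero refl = trans (cong (λ k → T euler (suc n) k) (sym (ℕ.+-identityʳ (suc i)))) (sym (euler-edge n))
  euler-symmetric (suc n) (suc i) (suc j) eq = begin
    (suc n ℕ.∸ i) ℕ.* T euler (suc n) i ℕ.+ (suc i ℕ.+ 1) ℕ.* T euler (suc n) (suc i)
      ≡⟨ cong₂ ℕ._+_ (cong₂ ℕ._*_ (weight i j (ℕ.suc-injective eq)) (euler-symmetric n i (suc j) (ℕ.suc-injective eq)))
                     (cong₂ ℕ._*_ (sym (weight j i eq′)) (euler-symmetric n (suc i) j (trans (sym (ℕ.+-suc i j)) (ℕ.suc-injective eq)))) ⟩
    (suc j ℕ.+ 1) ℕ.* T euler (suc n) (suc j) ℕ.+ (suc n ℕ.∸ j) ℕ.* T euler (suc n) j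
      ≡⟨ ℕ.+-comm ((suc j ℕ.+ 1) ℕ.* T euler (suc n) (suc j)) _ ⟩
    (suc n ℕ.∸ j) ℕ.* T euler (suc n) j ℕ.+ (suc j ℕ.+ 1) ℕ.* T euler (suc n) (suc j) ∎
    where
    open ≡-Reasoning
    eq′ : j ℕ.+ suc i ≡ n
    eq′ = trans (ℕ.+-suc j i) (trans (cong suc (ℕ.+-comm j i)) (trans (sym (ℕ.+-suc i j)) (ℕ.suc-injective eq)))
    weight : ∀ i j → i ℕ.+ suc j ≡ n → suc n ℕ.∸ i ≡ suc j ℕ.+ 1
    weight i j refl = trans (cong (ℕ._∸ i) (sym (ℕ.+-suc i (suc j)))) (trans (ℕ.m+n∸m≡n i (suc (suc j))) (ℕ.+-comm 1 (suc j)))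

  -- k ↦ n - k exchanges the two terms of the recursion.
  module Reflection {B : ℚ} {n₁ j : ℕ} {κ p : ℚ} (reg : Regular B (suc n₁) (suc j) κ) (prob : Probability euler (suc n₁) j p) where
    private
      n : ℕ
      n = suc n₁
    j* : ℕ
    j* = n₁ ℕ.∸ suc j
    private
      j+j* : suc j ℕ.+ j* ≡ n₁
      j+j* = ℕ.m+[n∸m]≡n (ℕ.s≤s⁻¹ (k<n reg))
      k+k* : suc j ℕ.+ suc j* ≡ n
      k+k* = trans (ℕ.+-suc (suc j) j*) (cong suc j+j*)
      ιk* : ι (suc j*) ≡ ι n - ι (suc j)
      ιk* = trans (solve 2 (λ a b → a := b :+ a :- b) refl (ι (suc j*)) (ι (suc j))) (cong (_- ι (suc j)) (trans (sym (ι-+ (suc j) (suc j*))) (cong ι k+k*)))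
    reg* : Regular B n (suc j*) (1ℚ - κ)
    reg* = record
      { κn       = trans (solve 2 (λ κ n → (:1 :- κ) :* n := n :- κ :* n) refl κ (ι n)) (trans (cong (λ s → ι n - s) (κn reg)) (sym ιk*))
      ; k<n      = subst (suc j* ℕ.<_) k+k* (ℕ.m<n+m (suc j*) (s≤s z≤n))
      ; n≤Bk     = subst (λ s → ι n ≤ B * s) (sym ιk*) (n≤B[n-k] reg)
      ; n≤B[n-k] = subst (λ s → ι n ≤ B * s) (trans (solve 2 (λ n k → k := n :- (n :- k)) refl (ι n) (ι (suc j))) (cong (λ s → ι n - s) (sym ιk*))) (n≤Bk reg)
      }
    prob* : Probability euler n j* (1ℚ - p)
    prob* = begin
      (1ℚ - p) * ι (T euler (suc n) (suc j*))
        ≡⟨ cong (λ s → (1ℚ - p) * ι s) (sym (euler-symmetric n (suc j) (suc j*) k+k*)) ⟩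
      (1ℚ - p) * t
        ≡⟨ solve 2 (λ p t → (:1 :- p) :* t := t :- p :* t) refl p t ⟩
      t - p * t
        ≡⟨ cong₂ _-_ (T-suc euler n j) prob ⟩
      up + ι (suc j ℕ.+ 1) * ι (T euler n (suc j)) - up
        ≡⟨ solve 2 (λ u s → u :+ s :- u := s) refl up (ι (suc j ℕ.+ 1) * ι (T euler n (suc j))) ⟩
      ι (suc j ℕ.+ 1) * ι (T euler n (suc j))
        ≡⟨ cong₂ (λ s r → ι s * ι r) (sym n∸j*) (euler-symmetric n₁ (suc j) j* j+j*) ⟩
      ι (n ℕ.∸ j*) * ι (T euler n j*) ∎
      where
      open ≡-Reasoning
      t up : ℚ
      t  = ι (T euler (suc n) (suc j))
      up = ι (n ℕ.∸ j) * ι (T euler n j)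
      n∸j* : n ℕ.∸ j* ≡ suc j ℕ.+ 1
      n∸j* = trans (cong (ℕ._∸ j*) (trans (sym k+k*) (trans (ℕ.+-suc (suc j) j*) (cong (λ s → suc (suc s)) (ℕ.+-comm j j*)))))
        (trans (cong (ℕ._∸ j*) (sym (trans (ℕ.+-suc j* (suc j)) (cong suc (ℕ.+-suc j* j))))) (trans (ℕ.m+n∸m≡n j* (suc (suc j))) (ℕ.+-comm 1 (suc j))))

  -- The one-sided estimates compare p′ with max (p , 1 - κ), and after reflection p with min (p′ , 1 - κ′).
  two-sided : ∀ {p p′ κ κ′ τ ω : ℚ} → 0ℚ ≤ ω → τ ≤ ω → κ′ ≤ κ + τ →
    (∀ w → p ≤ w → 1ℚ - κ ≤ w → p′ ≤ w + # 12 * ω) → (∀ w → 1ℚ - p′ ≤ w → κ′ ≤ w → 1ℚ - p ≤ w + # 12 * ω) →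
    p′ ≤ p + # 25 * ω
  two-sided {p} {p′} {κ} {κ′} {τ} {ω} 0≤ω τ≤ω κ′≤κ forth back with ℚ.≤-total (1ℚ - κ) p | ℚ.≤-total p′ (1ℚ - κ′)
  ... | inj₁ 1-κ≤p | _ = by (‖ forth p ℚ.≤-refl 1-κ≤p ⊕ 0≤# 13 ⊗ 0≤ω)
    (solve 3 (λ p p′ ω → p :+ :# 25 :* ω :- p′ := p :+ :# 12 :* ω :- p′ :+ :# 13 :* ω) refl p p′ ω)
  ... | inj₂ p≤1-κ | inj₁ p′≤1-κ′ = by (‖ back (1ℚ - p′) ℚ.≤-refl κ′≤1-p′ ⊕ 0≤# 13 ⊗ 0≤ω)
    (solve 3 (λ p p′ ω → p :+ :# 25 :* ω :- p′
      := :1 :- p′ :+ :# 12 :* ω :- (:1 :- p) :+ :# 13 :* ω) refl p p′ ω)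
    where
    κ′≤1-p′ : κ′ ≤ 1ℚ - p′
    κ′≤1-p′ = by (‖ p′≤1-κ′) (solve 2 (λ κ′ p′ → :1 :- p′ :- κ′ := :1 :- κ′ :- p′) refl κ′ p′)
  ... | inj₂ p≤1-κ | inj₂ 1-κ′≤p′ = by (‖ forth (1ℚ - κ) p≤1-κ ℚ.≤-refl ⊕ ‖ back κ′ 1-p′≤κ′ ℚ.≤-refl ⊕ ‖ κ′≤κ
      ⊕ ‖ τ≤ω)
    (solve 6 (λ p p′ κ κ′ τ ω → p :+ :# 25 :* ω :- p′
      := :1 :- κ :+ :# 12 :* ω :- p′ :+ (κ′ :+ :# 12 :* ω :- (:1 :- p)) :+ (κ :+ τ :- κ′) :+ (ω :- τ))
      refl p p′ κ κ′ τ ω)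
    where
    1-p′≤κ′ : 1ℚ - p′ ≤ κ′
    1-p′≤κ′ = by (‖ 1-κ′≤p′) (solve 2 (λ κ′ p′ → κ′ :- (:1 :- p′) := p′ :- (:1 :- κ′)) refl κ′ p′)

  cauchy-euler : CauchyCriterion euler
  cauchy-euler {B} {ε} 1≤B 0<ε = τ , 0<τ , N ,
    λ {n} {j} {n′} {j′} {κ} {κ′} {p} {p′} → main {n} {j} {n′} {j′} {κ} {κ′} {p} {p′}
    where
    G : ℚ
    G = # 2 * B
    K : ℚ
    K = Kₑ G
    0≤B : 0ℚ ≤ B
    0≤B = ℚ.≤-trans (0≤# 1) 1≤B
    0≤G : 0ℚ ≤ G
    0≤G = 0≤# 2 ⊗ 0≤B
    0≤K : 0ℚ ≤ K
    0≤K = 0≤# 2 ⊗ (0≤G ⊗ (0≤# 1 ⊕ 0≤G) ⊕ 0≤G ⊗ (0≤G ⊕ 0≤# 1 ⊕ 0≤G) ⊕ 0≤G ⊗ 0≤G ⊕ 0≤G) ⊗ ((0≤# 16 ⊕ 0≤G ⊗ 0≤G) ⊗ sq (1ℚ + G))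
    Cf γf Sf hf Rf : ℚ → ℚ → ℚ
    Cf _ _ = K + # 8 * G + # 8
    γf ω _ = ω * ω * ω * (ω * ω * (ω * ω))
    Sf _ _ = # 2 * (# 2 * B)
    hf _ H = H * H
    Rf _ _ = # 16 * B * B
    ε′ : ℚ
    ε′ = ½ * (½ * (½ * (½ * (½ * ε))))
    0<½* : ∀ {p} → 0ℚ < p → 0ℚ < ½ * p
    0<½* = 0<* (ℚ.positive⁻¹ ½)
    parameters : Setup (# 16 * B) ε′ Cf γf Sf hf Rf
    parameters = setup {# 16 * B} {ε′} Cf γf Sf hf Rf (by (0≤# 16 ⊗ ‖ 1≤B ⊕ 0≤# 15)
      (solve 1 (λ B → :# 16 :* B :- :1 := :# 16 :* (B :- :1) :+ :# 15) refl B))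
      (0<½* (0<½* (0<½* (0<½* (0<½* 0<ε)))))
      (λ {η} {H} 0<η 0<H → 0≤K ⊕ 0≤# 8 ⊗ 0≤G ⊕ 0≤# 8 , 0<* (0<* (0<* 0<η 0<η) 0<η) (0<* (0<* 0<η 0<η) (0<* 0<η 0<η)) , 0≤# 2 ⊗ 0≤G , ℚ.<⇒≤ 0<H ⊗ ℚ.<⇒≤ 0<H)
    open Setup parameters renaming (η to ω; 0<η to 0<ω; η≤ε to ω≤ε; ηB≤1 to ωB≤1; ηH≡1 to ωH≡1)
    τK≤ : τ * K + # 8 * (τ * G) + # 8 * τ ≤ ω * ω * ω * (ω * ω * (ω * ω))
    τK≤ = subst (τ * K + # 8 * (τ * G) + # 8 * τ ≤_) τC≡γ
      (by (ℚ.<⇒≤ 0<τ)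
        (solve 3 (λ τ K G → τ :* (:1 :+ (K :+ :# 8 :* G :+ :# 8)) :- (τ :* K :+ :# 8 :* (τ :* G) :+ :# 8 :* τ)
          := τ) refl τ K G))
    τ≤ω : τ ≤ ω
    τ≤ω = by (‖ τK≤ ⊕ ℚ.<⇒≤ 0<τ ⊗ (0≤K ⊕ 0≤# 8 ⊗ 0≤G ⊕ 0≤# 7)
        ⊕ 0≤ω ⊗ (‖ ω≤1 ⊗ ((0≤# 1 ⊕ 0≤ω ⊕ 0≤ω ⊗ 0≤ω) ⊗ (0≤# 1 ⊕ 0≤ω ⊗ 0≤ω ⊗ 0≤ω))))
      (solve 4 (λ τ K G ω → ω :- τ
        := ω :* ω :* ω :* (ω :* ω :* (ω :* ω)) :- (τ :* K :+ :# 8 :* (τ :* G) :+ :# 8 :* τ)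
        :+ τ :* (K :+ :# 8 :* G :+ :# 7)
        :+ ω :* ((:1 :- ω) :* ((:# 1 :+ ω :+ ω :* ω) :* (:# 1 :+ ω :* ω :* ω)))) refl τ K G ω)
      where
      0≤ω : 0ℚ ≤ ω
      0≤ω = ℚ.<⇒≤ 0<ω
      ω≤1 : ω ≤ 1ℚ
      ω≤1 = by (‖ ωB≤1 ⊕ 0≤ω ⊗ (0≤# 16 ⊗ ‖ 1≤B ⊕ 0≤# 15))
        (solve 2 (λ ω B → :1 :- ω := :1 :- ω :* (:# 16 :* B) :+ ω :* (:# 16 :* (B :- :1) :+ :# 15)) refl ω B)
    one-sided : ∀ {n₁ j n₁′ j′ κ κ′ p p′} → N ℕ.≤ suc n₁ → N ℕ.≤ suc n₁′ → Regular B (suc n₁) (suc j) κ → Regular B (suc n₁′) (suc j′) κ′ →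
      κ ≤ κ′ + τ → κ′ ≤ κ + τ → Probability euler (suc n₁) j p → Probability euler (suc n₁′) j′ p′ →
      ∀ w → p ≤ w → 1ℚ - κ ≤ w → p′ ≤ w + # 12 * ω
    one-sided {n₁} {j} {n₁′} {j′} {κ} {κ′} {p} {p′} N≤n N≤n′ reg reg′ κ≤κ′ κ′≤κ prob prob′ w p≤w 1-κ≤w =
      euler-bounded {B} {ω} {H} {τ} {σ} 1≤B 0<ω ωB≤1 ωH≡1 0<H 0<τ 0<σ σS≡τ τK≤ {n₁} {j} {n₁′} {j′} {κ} {κ′} {p} {p′} reg reg′ κ≤κ′ κ′≤κ
        (Large.sc (large (suc n₁) N≤n)) (Large.sc (large (suc n₁′) N≤n′)) (Large.R≤σn (large (suc n₁) N≤n)) (Large.R≤σn (large (suc n₁′) N≤n′))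
        prob prob′ {w} p≤w 1-κ≤w
    main : ∀ {n j n′ j′ κ κ′ p p′} → N ℕ.≤ n → N ℕ.≤ n′ → Regular B n (suc j) κ → Regular B n′ (suc j′) κ′ →
      κ ≤ κ′ + τ → κ′ ≤ κ + τ → Probability euler n j p → Probability euler n′ j′ p′ → p′ ≤ p + ε
    main {zero} _ _ reg _ _ _ _ _ = ⊥-elim (ℕ.n≮0 (k<n reg))
    main {suc _} {_} {zero} _ _ _ reg′ _ _ _ _ = ⊥-elim (ℕ.n≮0 (k<n reg′))
    main {suc n₁} {j} {suc n₁′} {j′} {κ} {κ′} {p} {p′} N≤n N≤n′ reg reg′ κ≤κ′ κ′≤κ prob prob′ = ℚ.≤-trans (two-sided {p} {p′} {κ} {κ′} {τ} {ω} (ℚ.<⇒≤ 0<ω) τ≤ω κ′≤κ forth back)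
      (by (0≤# 25 ⊗ ‖ ω≤ε ⊕ 0≤# 7 ⊗ ε/32)
        (solve 3 (λ p ω ε → p :+ ε :- (p :+ :# 25 :* ω)
          := :# 25 :* (:½ :* (:½ :* (:½ :* (:½ :* (:½ :* ε)))) :- ω)
          :+ :# 7 :* (:½ :* (:½ :* (:½ :* (:½ :* (:½ :* ε)))))) refl p ω ε))
      where
      ε/32 : 0ℚ ≤ ½ * (½ * (½ * (½ * (½ * ε))))
      ε/32 = 0≤½* (0≤½* (0≤½* (0≤½* (0≤½* (ℚ.<⇒≤ 0<ε)))))
      module R  = Reflection {B} {n₁} {j} {κ} {p} reg prob
      module R′ = Reflection {B} {n₁′} {j′} {κ′} {p′} reg′ prob′
      forth : ∀ w → p ≤ w → 1ℚ - κ ≤ w → p′ ≤ w + # 12 * ω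
      forth = one-sided {n₁} {j} {n₁′} {j′} {κ} {κ′} {p} {p′} N≤n N≤n′ reg reg′ κ≤κ′ κ′≤κ prob prob′
      back : ∀ w → 1ℚ - p′ ≤ w → κ′ ≤ w → 1ℚ - p ≤ w + # 12 * ω
      back w 1-p′≤w κ′≤w = one-sided {n₁′} {R′.j*} {n₁} {R.j*} {1ℚ - κ′} {1ℚ - κ} {1ℚ - p′} {1ℚ - p} N≤n′ N≤n R′.reg* R.reg*
        (by (‖ κ≤κ′) (solve 3 (λ κ κ′ τ → :1 :- κ :+ τ :- (:1 :- κ′) := κ′ :+ τ :- κ) refl κ κ′ τ)) (by (‖ κ′≤κ)
          (solve 3 (λ κ κ′ τ → :1 :- κ′ :+ τ :- (:1 :- κ) := κ :+ τ :- κ′) refl κ κ′ τ))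
        R′.prob* R.prob* w 1-p′≤w (subst (_≤ w) (solve 1 (λ κ′ → κ′ := :1 :- (:1 :- κ′)) refl κ′) κ′≤w)

module Uniform where

  open Prelude
  open OrderedField
  open Powers
  open Approximation
  open CauchyPascal
  open CauchyStirling₂
  open CauchyStirling₁
  open CauchyEuler
  open import Data.Integer.Base using (+_; +≤+; +<+)
  open Defs using (Triangle; pascal; stirling₂; stirling₁; euler; T; T↖; p₁; a)

  cauchy-criterion : ∀ t → CauchyCriterion t
  cauchy-criterion pascal    = cauchy-pascal
  cauchy-criterion stirling₂ = cauchy-stirling₂
  cauchy-criterion stirling₁ = cauchy-stirling₁
  cauchy-criterion euler     = cauchy-euler

  -- (s , p) = (m/ℓ , p₁ (m , ℓ))
  record Sample (t : Triangle) (c U : ℚ) (N : ℕ) (s p : ℚ) : Set where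
    field
      m ℓ  : ℕ
      N≤ℓ  : N ℕ.≤ ℓ
      sℓ   : s * ι ℓ ≡ ι m
      1+c≤s : 1ℚ + c ≤ s
      s≤1+U : s ≤ 1ℚ + U
      prob : p * ι (T t m ℓ) ≡ ι (a t m ℓ ℕ.* T↖ t m ℓ)

  module _ {c U : ℚ} (0<c : 0ℚ < c) (0≤U : 0ℚ ≤ U) {r : ℚ} (0<r : 0ℚ < r) (cr : c * r ≡ 1ℚ) where
    private
      B : ℚ
      B = (1ℚ + U) * (1ℚ + # 2 * r)
      0≤r : 0ℚ ≤ r
      0≤r = ℚ.<⇒≤ 0<r
      0≤c : 0ℚ ≤ c
      0≤c = ℚ.<⇒≤ 0<c
      1≤B : 1ℚ ≤ B
      1≤B = by (0≤U ⊕ (0≤# 1 ⊕ 0≤U) ⊗ (0≤# 2 ⊗ 0≤r))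
        (solve 2 (λ U r → (:1 :+ U) :* (:1 :+ :# 2 :* r) :- :1 := U :+ (:# 1 :+ U) :* (:# 2 :* r)) refl U r)

      module Index {n j : ℕ} {s : ℚ} (s[k] : s * ι (suc j) ≡ 1ℚ + ι n) (1+c≤s : 1ℚ + c ≤ s) (s≤1+U : s ≤ 1ℚ + U)
                   (2≤ck : # 2 ≤ c * ι (suc j)) where
        k : ℚ
        k = ι (suc j)
        0≤k : 0ℚ ≤ k
        0≤k = 0≤ι (suc j)
        k+½ck≤n : k + ½ * c * k ≤ ι n
        k+½ck≤n = by· (0<# 1) (0≤# 2 ⊗ ‖ ℚ.≤-reflexive s[k] ⊕ 0≤# 2 ⊗ 0≤k ⊗ ‖ 1+c≤s ⊕ ‖ 2≤ck)
          (solve 4 (λ k c s n → :# 2 :* (n :- (k :+ :½ :* c :* k))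
            := :# 2 :* (:1 :+ n :- s :* k) :+ :# 2 :* k :* (s :- (:1 :+ c)) :+ (c :* k :- :# 2))
            refl k c s (ι n))
        n≤[1+U]k : ι n ≤ (1ℚ + U) * k
        n≤[1+U]k = by (‖ ℚ.≤-reflexive (sym s[k]) ⊕ 0≤k ⊗ ‖ s≤1+U ⊕ 0≤# 1)
          (solve 4 (λ k U s n → (:1 :+ U) :* k :- n
            := s :* k :- (:1 :+ n) :+ k :* (:1 :+ U :- s) :+ :# 1) refl k U s (ι n))
        k<n′ : suc j ℕ.< n
        k<n′ = ℕ.≰⇒> λ n≤k → <⇒≱ (0<* (0<* (ℚ.positive⁻¹ ½) 0<c) (0<ι {suc j} (s≤s z≤n)))
          (by (‖ k+½ck≤n ⊕ ‖ ι-mono n≤k)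
            (solve 3 (λ k b n → :0 :- b := n :- (k :+ b) :+ (k :- n)) refl k (½ * c * k) (ι n)))
        0<n′ : 0ℚ < ι n
        0<n′ = 0<ι (ℕ.≤-<-trans z≤n k<n′)
        n-inverse : Σ[ y ∈ ℚ ] 0ℚ < y × ι n * y ≡ 1ℚ
        n-inverse = *-inverse 0<n′
        κ : ℚ
        κ = k * proj₁ n-inverse
        κn′ : κ * ι n ≡ k
        κn′ = trans (solve 3 (λ k y n → k :* y :* n := k :* (n :* y)) refl k (proj₁ n-inverse) (ι n)) (trans (cong (k *_) (proj₂ (proj₂ n-inverse))) (ℚ.*-identityʳ k))
        regular : Regular B n (suc j) κ
        regular = record
          { κn   = κn′
          ; k<n  = k<n′
          ; n≤Bk = by (‖ n≤[1+U]k ⊕ (0≤# 1 ⊕ 0≤U) ⊗ (0≤# 2 ⊗ 0≤r) ⊗ 0≤k)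
            (solve 4 (λ n U r k → (:1 :+ U) :* (:1 :+ :# 2 :* r) :* k :- n
              := (:1 :+ U) :* k :- n :+ (:# 1 :+ U) :* (:# 2 :* r) :* k) refl (ι n) U r k)
          ; n≤B[n-k] = by (‖ n≤[1+U]k
              ⊕ (0≤# 1 ⊕ 0≤U) ⊗ ((0≤# 1 ⊕ 0≤# 2 ⊗ 0≤r) ⊗ ‖ k+½ck≤n ⊕ (0≤½* 0≤c ⊗ 0≤k) ⊕ 0≤k ⊗ ‖ ℚ.≤-reflexive (sym cr)))
            (solve 5 (λ n U r k c → (:1 :+ U) :* (:1 :+ :# 2 :* r) :* (n :- k) :- n
              := (:1 :+ U) :* k :- n
              :+ (:# 1 :+ U) :* ((:# 1 :+ :# 2 :* r) :* (n :- (k :+ :½ :* c :* k)) :+ :½ :* c :* k :+ k :* (c :* r :- :1)))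
              refl (ι n) U r k c)
          }
        module _ {h : ℚ} (1≤hn : 1ℚ ≤ h * ι n) where
          1≤sκ : 1ℚ ≤ s * κ
          1≤sκ = by· 0<n′ (0≤# 1) (trans (solve 3 (λ n s κ → n :* (s :* κ :- :1) := s :* (κ :* n) :- n) refl (ι n) s κ)
            (trans (cong (λ z → s * z - ι n) κn′) (trans (cong (_- ι n) s[k]) (solve 1 (λ n → :1 :+ n :- n := :# 1) refl (ι n)))))
          sκ≤1+h : s * κ ≤ 1ℚ + h
          sκ≤1+h = by· 0<n′ (‖ 1≤hn) (trans (solve 4 (λ n s κ h → n :* (:1 :+ h :- s :* κ) := n :+ h :* n :- s :* (κ :* n)) refl (ι n) s κ h)
            (trans (cong (λ z → ι n + h * ι n - s * z) κn′) (trans (cong (λ z → ι n + h * ι n - z) s[k]) (solve 2 (λ n h → n :+ h :* n :- (:1 :+ n) := h :* n :- :1) refl (ι n) h))))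

    samples-close : ∀ t {ε} → 0ℚ < ε → Σ[ δ ∈ ℚ ] 0ℚ < δ × (∃[ N ] ∀ {s p s′ p′} →
      Sample t c U N s p → Sample t c U N s′ p′ → s ≤ s′ + δ → s′ ≤ s + δ → p′ ≤ p + ε)
    samples-close t {ε} 0<ε = from (cauchy-criterion t 1≤B 0<ε)
      where
      Goal : Set
      Goal = Σ[ δ ∈ ℚ ] 0ℚ < δ × (∃[ N ] ∀ {s p s′ p′} →
        Sample t c U N s p → Sample t c U N s′ p′ → s ≤ s′ + δ → s′ ≤ s + δ → p′ ≤ p + ε)
      close-κ : ∀ {s s′ κ κ′ δ} → 0ℚ ≤ κ → κ ≤ 1ℚ → 0ℚ ≤ κ′ → κ′ ≤ 1ℚ → 0ℚ ≤ δ → 1ℚ ≤ s′ * κ′ → s * κ ≤ 1ℚ + ½ * δ → s′ ≤ s + ½ * δ → κ ≤ κ′ + δ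
      close-κ {s} {s′} {κ} {κ′} {δ} 0≤κ κ≤1 0≤κ′ κ′≤1 0≤δ 1≤s′κ′ sκ≤ s′≤s = by (0≤κ ⊗ ‖ 1≤s′κ′ ⊕ 0≤κ′ ⊗ ‖ sκ≤
          ⊕ 0≤κ ⊗ 0≤κ′ ⊗ ‖ s′≤s ⊕ 0≤½* 0≤δ ⊗ (‖ κ′≤1 ⊕ ‖ κ≤1 ⊕ 0≤κ ⊗ ‖ κ′≤1))
        (solve 5 (λ s s′ κ κ′ δ → κ′ :+ δ :- κ
          := κ :* (s′ :* κ′ :- :1) :+ κ′ :* (:1 :+ :½ :* δ :- s :* κ) :+ κ :* κ′ :* (s :+ :½ :* δ :- s′)
          :+ :½ :* δ :* (:1 :- κ′ :+ (:1 :- κ) :+ κ :* (:1 :- κ′))) refl s s′ κ κ′ δ)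
      from : (Σ[ δ ∈ ℚ ] 0ℚ < δ × (∃[ N ] ∀ {n j n′ j′ κ κ′ p p′} →
        N ℕ.≤ n → N ℕ.≤ n′ → Regular B n (suc j) κ → Regular B n′ (suc j′) κ′ → κ ≤ κ′ + δ → κ′ ≤ κ + δ →
        Probability t n j p → Probability t n′ j′ p′ → p′ ≤ p + ε)) → Goal
      from (δ , 0<δ , N , criterion) = ½ * δ , 0<½δ , N₀ , main
        where
        0<½δ : 0ℚ < ½ * δ
        0<½δ = 0<* (ℚ.positive⁻¹ ½) 0<δ
        large-k : ∃[ N ] ∀ k → N ℕ.≤ k → # 2 ≤ c * ι k
        large-k = eventually (# 2) 0<c
        large-n : ∃[ N ] ∀ n → N ℕ.≤ n → 1ℚ ≤ ½ * δ * ι n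
        large-n = eventually 1ℚ 0<½δ
        N₀ : ℕ
        N₀ = suc (N ℕ.⊔ (proj₁ large-k ℕ.⊔ proj₁ large-n))
        N≤ : N ℕ.≤ N₀
        N≤ = ℕ.m≤n⇒m≤1+n (ℕ.m≤m⊔n N _)
        K≤ : proj₁ large-k ℕ.≤ N₀
        K≤ = ℕ.m≤n⇒m≤1+n (ℕ.≤-trans (ℕ.m≤m⊔n (proj₁ large-k) (proj₁ large-n)) (ℕ.m≤n⊔m N _))
        L≤ : proj₁ large-n ℕ.≤ N₀
        L≤ = ℕ.m≤n⇒m≤1+n (ℕ.≤-trans (ℕ.m≤n⊔m (proj₁ large-k) (proj₁ large-n)) (ℕ.m≤n⊔m N _))
        record Prepared (s p : ℚ) : Set where
          field
            {n j}   : ℕ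
            {κ}     : ℚ
            N₀≤n    : N₀ ℕ.≤ n
            regular : Regular B n (suc j) κ
            1≤sκ    : 1ℚ ≤ s * κ
            sκ≤     : s * κ ≤ 1ℚ + ½ * δ
            prob    : Probability t n j p
        prepare : ∀ {s p} → Sample t c U N₀ s p → Prepared s p
        prepare {s} {p} S = go (Sample.m S) (Sample.ℓ S) (Sample.N≤ℓ S) (Sample.sℓ S) (Sample.prob S)
          where
          go : ∀ m ℓ → N₀ ℕ.≤ ℓ → s * ι ℓ ≡ ι m → p * ι (T t m ℓ) ≡ ι (a t m ℓ ℕ.* T↖ t m ℓ) → Prepared s p
          go zero (suc j) N≤ℓ sℓ _ = ⊥-elim (<⇒≱ (0<ι {suc j} (s≤s z≤n))
            (by (‖ ℚ.≤-reflexive (trans sℓ ι0) ⊕ 0≤ι (suc j) ⊗ (‖ Sample.1+c≤s S ⊕ 0≤c))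
              (solve 3 (λ s k c → :0 :- k := :0 :- s :* k :+ k :* (s :- (:1 :+ c) :+ c)) refl s (ι (suc j)) c)))
          go (suc n) (suc j) N≤ℓ sℓ pr = record
            { N₀≤n = N≤n ; regular = I.regular ; 1≤sκ = I.1≤sκ {½ * δ} 1≤hn ; sκ≤ = I.sκ≤1+h {½ * δ} 1≤hn
            ; prob = trans pr (ι-* (a t (suc n) (suc j)) (T t n j)) }
            where
            module I = Index {n} {j} {s} (trans sℓ (ι-suc n)) (Sample.1+c≤s S) (Sample.s≤1+U S) (proj₂ large-k (suc j) (ℕ.≤-trans K≤ N≤ℓ))
            N≤n : N₀ ℕ.≤ n
            N≤n = ℕ.≤-trans N≤ℓ (ℕ.<⇒≤ I.k<n′)
            1≤hn : 1ℚ ≤ ½ * δ * ι n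
            1≤hn = proj₂ large-n n (ℕ.≤-trans L≤ N≤n)
        main : ∀ {s p s′ p′} → Sample t c U N₀ s p → Sample t c U N₀ s′ p′ → s ≤ s′ + ½ * δ → s′ ≤ s + ½ * δ → p′ ≤ p + ε
        main {s} {p} {s′} {p′} S S′ s≤s′ s′≤s = criterion {P.n} {P.j} {P′.n} {P′.j} {P.κ} {P′.κ} {p} {p′}
          (ℕ.≤-trans N≤ P.N₀≤n) (ℕ.≤-trans N≤ P′.N₀≤n) P.regular P′.regular
          (close-κ {s} {s′} R.0≤κ R.κ≤1 R′.0≤κ R′.κ≤1 (ℚ.<⇒≤ 0<δ) P′.1≤sκ P.sκ≤ s′≤s)
          (close-κ {s′} {s} R′.0≤κ R′.κ≤1 R.0≤κ R.κ≤1 (ℚ.<⇒≤ 0<δ) P.1≤sκ P′.sκ≤ s≤s′)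
          P.prob P′.prob
          where
          module P  = Prepared (prepare S)
          module P′ = Prepared (prepare S′)
          module R  = Regular P.regular
          module R′ = Regular P′.regular

module LimitFunction where

  open Prelude
  open OrderedField
  open Powers
  open Approximation
  open Uniform
  open import Data.Integer.Base using (+_; +≤+; +<+)
  open Defs using (Triangle; T; T-positive; T↖; p₁; ℝ; seq; cauchy; 0ℝ; 1ℝ; fromℚ; _≃_; ]0,+∞[; [0,1]; a)

  open Sample

  ∣∣-bound : ∀ {p ε} → p ≤ ε → 0ℚ - ε ≤ p → ℚ.∣ p ∣ ≤ ε
  ∣∣-bound {p} {ε} p≤ε -ε≤p with ℚ.∣p∣≡p∨∣p∣≡-p p
  ... | inj₁ eq = subst (_≤ ε) (sym eq) p≤ε
  ... | inj₂ eq = subst (_≤ ε) (sym (trans eq (sym (ℚ.+-identityˡ (ℚ.- p))))) (by (‖ -ε≤p)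
    (solve 2 (λ p ε → ε :- (:0 :- p) := p :- (:0 :- ε)) refl p ε))

  p≤∣p∣ : ∀ p → p ≤ ℚ.∣ p ∣
  p≤∣p∣ p with ℚ.≤-total 0ℚ p
  ... | inj₁ 0≤p = ℚ.≤-reflexive (sym (ℚ.0≤p⇒∣p∣≡p 0≤p))
  ... | inj₂ p≤0 = ℚ.≤-trans p≤0 (ℚ.0≤∣p∣ p)

  ∣-∣-comm : ∀ p q → ℚ.∣ p - q ∣ ≡ ℚ.∣ q - p ∣
  ∣-∣-comm p q = trans (sym (ℚ.∣-p∣≡∣p∣ (p - q))) (cong ℚ.∣_∣ (trans (sym (ℚ.+-identityˡ (ℚ.- (p - q)))) (solve 2 (λ p q → :0 :- (p :- q) := q :- p) refl p q)))

  close⇒≤ : ∀ {p q ε} → ℚ.∣ p - q ∣ < ε → p ≤ q + ε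
  close⇒≤ {p} {q} {ε} close = by (‖ ℚ.≤-trans (p≤∣p∣ (p - q)) (ℚ.<⇒≤ close))
    (solve 3 (λ p q ε → q :+ ε :- p := ε :- (p :- q)) refl p q ε)

  close⇒≥ : ∀ {p q ε} → ℚ.∣ p - q ∣ < ε → q ≤ p + ε
  close⇒≥ {p} {q} {ε} close = close⇒≤ {q} {p} (subst (_< ε) (∣-∣-comm p q) close)

  ½-< : ∀ {ε} → 0ℚ < ε → ½ * ε < ε
  ½-< {ε} 0<ε = by< (0<* (ℚ.positive⁻¹ ½) 0<ε) (solve 1 (λ ε → ε :- :½ :* ε := :½ :* ε) refl ε)

  ≤⇒close : ∀ {p q ε} → 0ℚ < ε → p ≤ q + ½ * ε → q ≤ p + ½ * ε → ℚ.∣ p - q ∣ < ε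
  ≤⇒close {p} {q} {ε} 0<ε p≤ q≤ = ℚ.≤-<-trans (∣∣-bound
    (by (‖ p≤) (solve 3 (λ p q ε → :½ :* ε :- (p :- q) := q :+ :½ :* ε :- p) refl p q ε)) (by (‖ q≤)
      (solve 3 (λ p q ε → p :- q :- (:0 :- :½ :* ε) := p :+ :½ :* ε :- q) refl p q ε))) (½-< 0<ε)

  common-lower : ∀ {p q} → 0ℚ < p → 0ℚ < q → Σ[ r ∈ ℚ ] 0ℚ < r × r ≤ p × r ≤ q
  common-lower {p} {q} 0<p 0<q with ℚ.≤-total p q
  ... | inj₁ p≤q = p , 0<p , ℚ.≤-refl , p≤q
  ... | inj₂ q≤p = q , 0<q , q≤p , ℚ.≤-refl

  ratio : ℕ → ℕ → ℚ
  ratio x zero    = 0ℚ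
  ratio x (suc d) = + x / suc d

  ratio-/ : ∀ x d .{{_ : ℕ.NonZero d}} → + x / d ≡ ratio x d
  ratio-/ x (suc d) = refl

  opaque
    unfolding ι

    toℚᵘ-ι : ∀ n → ℚ.toℚᵘ (ι n) ℚᵘ.≃ ℚᵘ.mkℚᵘ (+ n) 0
    toℚᵘ-ι n = ℚ.toℚᵘ-fromℚᵘ (ℚᵘ.mkℚᵘ (+ n) 0)

  ratio-* : ∀ x d → ratio x (suc d) * ι (suc d) ≡ ι x
  ratio-* x d = ℚ.toℚᵘ-injective (ℚᵘ.≃-trans (ℚ.toℚᵘ-homo-* (ratio x (suc d)) (ι (suc d)))
    (ℚᵘ.≃-trans (ℚᵘ.*-cong (ℚ.toℚᵘ-fromℚᵘ (ℚᵘ.mkℚᵘ (+ x) d)) (toℚᵘ-ι (suc d)))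
    (ℚᵘ.≃-trans (ℚᵘ.*≡* (trans (ℤ.*-identityʳ (+ x ℤ.* + suc d)) (cong (λ e → + x ℤ.* + e) (sym (ℕ.*-identityʳ (suc d))))))
      (ℚᵘ.≃-sym (toℚᵘ-ι x)))))

  ratio-*′ : ∀ x {d} → 0 ℕ.< d → ratio x d * ι d ≡ ι x
  ratio-*′ x {suc d} _ = ratio-* x d

  0≤ratio : ∀ x d → 0ℚ ≤ ratio x d
  0≤ratio x zero    = ℚ.≤-refl
  0≤ratio x (suc d) = by· (0<ι {suc d} (s≤s z≤n)) (0≤ι x) (trans (solve 2 (λ d r → d :* (r :- :0) := r :* d) refl (ι (suc d)) (ratio x (suc d))) (ratio-* x d))

  ratio≤1 : ∀ {x d} → x ℕ.≤ d → ratio x d ≤ 1ℚ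
  ratio≤1 {x} {zero}  _   = 0≤# 1
  ratio≤1 {x} {suc d} x≤d = by· (0<ι {suc d} (s≤s z≤n)) (‖ ι-mono x≤d)
    (trans (solve 2 (λ d r → d :* (:1 :- r) := d :- r :* d) refl (ι (suc d)) (ratio x (suc d))) (cong (λ z → ι (suc d) - z) (ratio-* x d)))

  -- q = ∣ ↥ q ∣ / ↧ₙ q for q ≥ 0.
  numerator-≡ : ∀ {q} → 0ℚ < q → q * ι (ℚ.↧ₙ q) ≡ ι ℤ.∣ ℚ.↥ q ∣
  numerator-≡ {ℚ.mkℚ (+ n) d c} _ = trans (cong (_* ι (suc d)) (sym (ℚ.↥p/↧p≡p (ℚ.mkℚ (+ n) d c)))) (ratio-* n d)
  numerator-≡ {ℚ.mkℚ ℤ.-[1+ n ] d c} (ℚ.*<* ())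

  module _ (t : Triangle) where

    probability : ℕ → ℕ → ℚ
    probability m ℓ = ratio (a t m ℓ ℕ.* T↖ t m ℓ) (T t m ℓ)

    aT↖≤T : ∀ m ℓ → a t m ℓ ℕ.* T↖ t m ℓ ℕ.≤ T t m ℓ
    aT↖≤T zero    ℓ       = subst (ℕ._≤ T t 0 ℓ) (sym (ℕ.*-zeroʳ (a t 0 ℓ))) z≤n
    aT↖≤T (suc m) zero    = subst (ℕ._≤ T t (suc m) 0) (sym (ℕ.*-zeroʳ (a t (suc m) 0))) z≤n
    aT↖≤T (suc m) (suc ℓ) = ℕ.m≤m+n _ _

    -- The sample m/ℓ = 1 + q with ℓ ≥ n.
    ℓ-of m-of : ℚ → ℕ → ℕ
    ℓ-of q n = ℚ.↧ₙ q ℕ.* suc n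
    m-of q n = (ℚ.↧ₙ q ℕ.+ ℤ.∣ ℚ.↥ q ∣) ℕ.* suc n

    value : ℚ → ℕ → ℚ
    value q n = probability (m-of q n) (ℓ-of q n)

    value-sample : ∀ {c U N q} n → N ℕ.≤ n → 0ℚ < c → c ≤ q → q ≤ U → Sample t c U N (1ℚ + q) (value q n)
    value-sample {c} {U} {N} {q} n N≤n 0<c c≤q q≤U = record
      { m = m-of q n ; ℓ = ℓ-of q n
      ; N≤ℓ = ℕ.≤-trans (ℕ.m≤n⇒m≤1+n N≤n) (ℕ.m≤n*m (suc n) (ℚ.↧ₙ q))
      ; sℓ = begin
          (1ℚ + q) * ι (d ℕ.* suc n)              ≡⟨ cong ((1ℚ + q) *_) (ι-* d (suc n)) ⟩
          (1ℚ + q) * (ι d * ι (suc n))            ≡⟨ solve 3 (λ q d s → (:1 :+ q) :* (d :* s) := (d :+ q :* d) :* s) refl q (ι d) (ι (suc n)) ⟩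
          (ι d + q * ι d) * ι (suc n)             ≡⟨ cong (λ z → (ι d + z) * ι (suc n)) qd ⟩
          (ι d + ι ℤ.∣ ℚ.↥ q ∣) * ι (suc n)       ≡⟨ cong (_* ι (suc n)) (sym (ι-+ d ℤ.∣ ℚ.↥ q ∣)) ⟩
          ι (d ℕ.+ ℤ.∣ ℚ.↥ q ∣) * ι (suc n)       ≡⟨ sym (ι-* (d ℕ.+ ℤ.∣ ℚ.↥ q ∣) (suc n)) ⟩
          ι (m-of q n)                            ∎
      ; 1+c≤s = ℚ.+-monoʳ-≤ 1ℚ c≤q
      ; s≤1+U = ℚ.+-monoʳ-≤ 1ℚ q≤U
      ; prob = ratio-*′ _ (T-positive t 0<ℓ ℓ<m)
      }
      where
      open ≡-Reasoning
      d : ℕ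
      d = ℚ.↧ₙ q
      0<q : 0ℚ < q
      0<q = ℚ.<-≤-trans 0<c c≤q
      qd : q * ι d ≡ ι ℤ.∣ ℚ.↥ q ∣
      qd = numerator-≡ {q} 0<q
      0<ℓ : 0 ℕ.< ℓ-of q n
      0<ℓ = ℕ.*-mono-≤ {1} {d} {1} {suc n} (s≤s z≤n) (s≤s z≤n)
      0<∣↥q∣ : 0 ℕ.< ℤ.∣ ℚ.↥ q ∣
      0<∣↥q∣ = ℕ.≰⇒> λ ≤0 → <⇒≱ (0<* 0<q (0<ι {d} (s≤s z≤n))) (subst (_≤ 0ℚ) (sym qd) (subst (ι ℤ.∣ ℚ.↥ q ∣ ≤_) ι0 (ι-mono ≤0)))
      ℓ<m : ℓ-of q n ℕ.< m-of q n
      ℓ<m = ℕ.*-monoˡ-< (suc n) (ℕ.m<m+n d 0<∣↥q∣)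

    SamplesNear : (c U ε : ℚ) → Set
    SamplesNear c U ε = Σ[ δ ∈ ℚ ] 0ℚ < δ × (∃[ N ] ∀ {s p s′ p′} →
      Sample t c U N s p → Sample t c U N s′ p′ → ℚ.∣ s - s′ ∣ < δ → ℚ.∣ p - p′ ∣ < ε)

    opaque
      samples-near : ∀ {c U ε} → 0ℚ < c → 0ℚ ≤ U → 0ℚ < ε → SamplesNear c U ε
      samples-near {c} {U} {ε} 0<c 0≤U 0<ε = from-inverse (*-inverse 0<c)
        where
        from-close : Σ[ δ ∈ ℚ ] 0ℚ < δ × (∃[ N ] ∀ {s p s′ p′} →
          Sample t c U N s p → Sample t c U N s′ p′ → s ≤ s′ + δ → s′ ≤ s + δ → p′ ≤ p + ½ * ε) → SamplesNear c U ε
        from-close (δ , 0<δ , N , close) = δ , 0<δ , N , λ {s} {p} {s′} {p′} S S′ s≈s′ → ≤⇒close {p} {p′} 0<ε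
          (close {s′} {p′} {s} {p} S′ S (close⇒≥ {s} {s′} s≈s′) (close⇒≤ {s} {s′} s≈s′))
          (close {s} {p} {s′} {p′} S S′ (close⇒≤ {s} {s′} s≈s′) (close⇒≥ {s} {s′} s≈s′))
        from-inverse : Σ[ r ∈ ℚ ] 0ℚ < r × c * r ≡ 1ℚ → SamplesNear c U ε
        from-inverse (r , 0<r , cr) = from-close (samples-close {c} {U} 0<c 0≤U {r} 0<r cr t {½ * ε} (0<* (ℚ.positive⁻¹ ½) 0<ε))

  record Bounds (λ∞ : ℝ) : Set where
    field
      c U  : ℚ
      N    : ℕ
      0<c  : 0ℚ < c
      c≤   : ∀ n → N ℕ.≤ n → c ≤ seq λ∞ n
      ≤U   : ∀ n → N ℕ.≤ n → seq λ∞ n ≤ U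

    0≤U : 0ℚ ≤ U
    0≤U = ℚ.≤-trans (ℚ.<⇒≤ 0<c) (ℚ.≤-trans (c≤ N ℕ.≤-refl) (≤U N ℕ.≤-refl))

  opaque
    bounds : ∀ {λ∞} → 0ℝ Defs.< λ∞ → Bounds λ∞
    bounds {λ∞} (c , 0<c , N₁ , c<) = from (cauchy λ∞ 1ℚ (0<# 0))
      where
      from : (∃[ N ] ∀ m n → N ℕ.≤ m → N ℕ.≤ n → ℚ.∣ seq λ∞ m - seq λ∞ n ∣ < 1ℚ) → Bounds λ∞
      from (N₂ , close) = record
        { c = c ; U = seq λ∞ N₂ + 1ℚ ; N = N₁ ℕ.⊔ N₂ ; 0<c = 0<c
        ; c≤ = λ n n≥ → subst (_≤ seq λ∞ n) (ℚ.+-identityˡ c) (ℚ.<⇒≤ (c< n (ℕ.m⊔n≤o⇒m≤o N₁ N₂ n≥)))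
        ; ≤U = λ n n≥ → close⇒≤ {seq λ∞ n} {seq λ∞ N₂} (close n N₂ (ℕ.m⊔n≤o⇒n≤o N₁ N₂ n≥) ℕ.≤-refl)
        }

  module Limit (t : Triangle) where

    Near : ℝ → ℝ → ℚ → Set
    Near x y ε = Σ[ δ ∈ ℚ ] 0ℚ < δ × (∃[ N ] ∀ m n → N ℕ.≤ m → N ℕ.≤ n →
      ℚ.∣ seq x m - seq y n ∣ < δ → ℚ.∣ value t (seq x m) m - value t (seq y n) n ∣ < ε)

    near : ∀ {x y : ℝ} → 0ℝ Defs.< x → 0ℝ Defs.< y → ∀ ε → 0ℚ < ε → Near x y ε
    near {x} {y} 0<x 0<y ε 0<ε = from-c (common-lower X.0<c Y.0<c)
      where
      module X = Bounds (bounds {x} 0<x)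
      module Y = Bounds (bounds {y} 0<y)
      U : ℚ
      U = X.U + Y.U
      X≤U : X.U ≤ U
      X≤U = by Y.0≤U (solve 2 (λ p q → p :+ q :- p := q) refl X.U Y.U)
      Y≤U : Y.U ≤ U
      Y≤U = by X.0≤U (solve 2 (λ p q → p :+ q :- q := p) refl X.U Y.U)
      from-c : Σ[ c ∈ ℚ ] 0ℚ < c × c ≤ X.c × c ≤ Y.c → Near x y ε
      from-c (c , 0<c , c≤X , c≤Y) = from-δ (samples-near t {c} {U} {ε} 0<c (X.0≤U ⊕ Y.0≤U) 0<ε)
        where
        from-δ : SamplesNear t c U ε → Near x y ε
        from-δ (δ , 0<δ , N , close) = δ , 0<δ , N ℕ.⊔ (X.N ℕ.⊔ Y.N) , λ m n m≥ n≥ x≈y →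
          close {1ℚ + seq x m} {value t (seq x m) m} {1ℚ + seq y n} {value t (seq y n) n} (x-sample m m≥) (y-sample n n≥)
            (subst (λ z → ℚ.∣ z ∣ < δ) (solve 2 (λ x y → x :- y := :1 :+ x :- (:1 :+ y)) refl (seq x m) (seq y n)) x≈y)
          where
          x-sample : ∀ m → N ℕ.⊔ (X.N ℕ.⊔ Y.N) ℕ.≤ m → Sample t c U N (1ℚ + seq x m) (value t (seq x m) m)
          x-sample m m≥ = value-sample t {c} {U} {N} {seq x m} m (ℕ.m⊔n≤o⇒m≤o N (X.N ℕ.⊔ Y.N) m≥) 0<c
            (ℚ.≤-trans c≤X (X.c≤ m m≥′)) (ℚ.≤-trans (X.≤U m m≥′) X≤U)
            where
            m≥′ : X.N ℕ.≤ m
            m≥′ = ℕ.m⊔n≤o⇒m≤o X.N Y.N (ℕ.m⊔n≤o⇒n≤o N (X.N ℕ.⊔ Y.N) m≥)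
          y-sample : ∀ n → N ℕ.⊔ (X.N ℕ.⊔ Y.N) ℕ.≤ n → Sample t c U N (1ℚ + seq y n) (value t (seq y n) n)
          y-sample n n≥ = value-sample t {c} {U} {N} {seq y n} n (ℕ.m⊔n≤o⇒m≤o N (X.N ℕ.⊔ Y.N) n≥) 0<c
            (ℚ.≤-trans c≤Y (Y.c≤ n n≥′)) (ℚ.≤-trans (Y.≤U n n≥′) Y≤U)
            where
            n≥′ : Y.N ℕ.≤ n
            n≥′ = ℕ.m⊔n≤o⇒n≤o X.N Y.N (ℕ.m⊔n≤o⇒n≤o N (X.N ℕ.⊔ Y.N) n≥)

    φ : (x : ℝ) → 0ℝ Defs.< x → ℝ
    φ x 0<x .seq n = value t (seq x n) n
    φ x 0<x .cauchy ε 0<ε = from-near (near {x} {x} 0<x 0<x ε 0<ε)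
      where
      from-near : Near x x ε → ∃[ N ] ∀ m n → N ℕ.≤ m → N ℕ.≤ n → ℚ.∣ value t (seq x m) m - value t (seq x n) n ∣ < ε
      from-near (δ , 0<δ , N , close) = from-cauchy (cauchy x δ 0<δ)
        where
        from-cauchy : (∃[ N ] ∀ m n → N ℕ.≤ m → N ℕ.≤ n → ℚ.∣ seq x m - seq x n ∣ < δ) →
                      ∃[ N ] ∀ m n → N ℕ.≤ m → N ℕ.≤ n → ℚ.∣ value t (seq x m) m - value t (seq x n) n ∣ < ε
        from-cauchy (N′ , x-close) = N ℕ.⊔ N′ , λ m n m≥ n≥ → close m n (ℕ.m⊔n≤o⇒m≤o N N′ m≥) (ℕ.m⊔n≤o⇒m≤o N N′ n≥)
          (x-close m n (ℕ.m⊔n≤o⇒n≤o N N′ m≥) (ℕ.m⊔n≤o⇒n≤o N N′ n≥))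

    φ-cong : ∀ {x y} (0<x : 0ℝ Defs.< x) (0<y : 0ℝ Defs.< y) → x ≃ y → φ x 0<x ≃ φ y 0<y
    φ-cong {x} {y} 0<x 0<y x≃y ε 0<ε = from-near (near {x} {y} 0<x 0<y ε 0<ε)
      where
      from-near : Near x y ε → ∃[ N ] ∀ n → N ℕ.≤ n → ℚ.∣ value t (seq x n) n - value t (seq y n) n ∣ < ε
      from-near (δ , 0<δ , N , close) = from-≃ (x≃y δ 0<δ)
        where
        from-≃ : (∃[ N ] ∀ n → N ℕ.≤ n → ℚ.∣ seq x n - seq y n ∣ < δ) →
                 ∃[ N ] ∀ n → N ℕ.≤ n → ℚ.∣ value t (seq x n) n - value t (seq y n) n ∣ < ε
        from-≃ (N′ , x≈y) = N ℕ.⊔ N′ , λ n n≥ → close n n (ℕ.m⊔n≤o⇒m≤o N N′ n≥) (ℕ.m⊔n≤o⇒m≤o N N′ n≥) (x≈y n (ℕ.m⊔n≤o⇒n≤o N N′ n≥))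

    φ-func : Func ]0,+∞[ [0,1]
    φ-func = record
      { to   = λ (x , 0<x) → φ x 0<x , 0≤φ x 0<x , φ≤1 x 0<x
      ; cong = λ {x} {y} → φ-cong {proj₁ x} {proj₁ y} (proj₂ x) (proj₂ y)
      }
      where
      0≤φ : ∀ x 0<x → 0ℝ Defs.≤ φ x 0<x
      0≤φ x 0<x ε 0<ε = 0 , λ n _ → subst (0ℚ <_) (ℚ.+-comm ε (value t (seq x n) n)) (0<+ 0<ε (0≤ratio _ (T t (m-of t (seq x n) n) (ℓ-of t (seq x n) n))))
      φ≤1 : ∀ x 0<x → φ x 0<x Defs.≤ 1ℝ
      φ≤1 x 0<x ε 0<ε = 0 , λ n _ → ℚ.≤-<-trans (ratio≤1 (aT↖≤T t (m-of t (seq x n) n) (ℓ-of t (seq x n) n)))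
        (by< 0<ε (solve 1 (λ ε → :1 :+ ε :- :1 := ε) refl ε))

    Converges : (x : ℝ) → 0ℝ Defs.< x → ℚ → Set
    Converges x 0<x ε = Σ[ δ ∈ ℚ ] 0ℚ < δ × (∃[ N ]
      ∀ (m ℓ : ℕ) .{{_ : ℕ.NonZero ℓ}} .{{_ : ℕ.NonZero (T t m ℓ)}} → N ℕ.≤ m → N ℕ.≤ ℓ →
      Defs.∣ fromℚ (+ m / ℓ) Defs.- (1ℝ Defs.+ x) ∣ Defs.< fromℚ δ → Defs.∣ fromℚ (p₁ t m ℓ) Defs.- φ x 0<x ∣ Defs.< fromℚ ε)

    converges : (x : ℝ) (0<x : 0ℝ Defs.< x) → ∀ (ε : ℚ) → 0ℚ < ε → Converges x 0<x ε
    converges x 0<x ε 0<ε = from-near (samples-near t {½ * X.c} {X.U + 1ℚ} {½ * ε} 0<½c 0≤U+1 0<½ε)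
      where
      module X = Bounds (bounds {x} 0<x)
      0<½c : 0ℚ < ½ * X.c
      0<½c = 0<* (ℚ.positive⁻¹ ½) X.0<c
      0≤U+1 : 0ℚ ≤ X.U + 1ℚ
      0≤U+1 = X.0≤U ⊕ 0≤# 1
      0<½ε : 0ℚ < ½ * ε
      0<½ε = 0<* (ℚ.positive⁻¹ ½) 0<ε
      module _ {δ₁ : ℚ} {N₁ : ℕ} (close : ∀ {s p s′ p′} → Sample t (½ * X.c) (X.U + 1ℚ) N₁ s p → Sample t (½ * X.c) (X.U + 1ℚ) N₁ s′ p′ →
                                          ℚ.∣ s - s′ ∣ < δ₁ → ℚ.∣ p - p′ ∣ < ½ * ε)
               {δ₂ : ℚ} (δ₂≤½c : δ₂ ≤ ½ * X.c) (δ₂≤1 : δ₂ ≤ 1ℚ) {δ : ℚ} (δ≤δ₁ : δ ≤ δ₁) (δ≤δ₂ : δ ≤ δ₂) where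
        main : ∀ (m ℓ : ℕ) .{{_ : ℕ.NonZero ℓ}} .{{_ : ℕ.NonZero (T t m ℓ)}} → N₁ ℕ.≤ m → N₁ ℕ.≤ ℓ →
          Defs.∣ fromℚ (+ m / ℓ) Defs.- (1ℝ Defs.+ x) ∣ Defs.< fromℚ δ → Defs.∣ fromℚ (p₁ t m ℓ) Defs.- φ x 0<x ∣ Defs.< fromℚ ε
        main m ℓ _ N≤ℓ (e , 0<e , N₂ , s≈) = ½ * ε , 0<½ε , N , λ n n≥ →
          subst (ℚ.∣ p - value t (seq x n) n ∣ + ½ * ε <_) (solve 1 (λ ε → :½ :* ε :+ :½ :* ε := ε) refl ε)
            (ℚ.+-monoˡ-< (½ * ε) (close {s} {p} {1ℚ + seq x n} {value t (seq x n) n} sample (sample′ n n≥)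
              (ℚ.<-≤-trans (s≈x n (ℕ.m⊔n≤o⇒m≤o N₂ X.N (ℕ.m⊔n≤o⇒n≤o N₁ _ n≥))) δ≤δ₁)))
          where
          s p : ℚ
          s = + m / ℓ
          p = p₁ t m ℓ
          N : ℕ
          N = N₁ ℕ.⊔ (N₂ ℕ.⊔ X.N)
          s≈x : ∀ n → N₂ ℕ.≤ n → ℚ.∣ s - (1ℚ + seq x n) ∣ < δ
          s≈x n n≥ = ℚ.≤-<-trans (by (ℚ.<⇒≤ 0<e)
            (solve 2 (λ y e → y :+ e :- y := e) refl (ℚ.∣ s - (1ℚ + seq x n) ∣) e)) (s≈ n n≥)
          xN : ℚ
          xN = seq x N
          c≤xN : X.c ≤ xN
          c≤xN = X.c≤ N (ℕ.m⊔n≤o⇒n≤o N₂ X.N (ℕ.m⊔n≤o⇒n≤o N₁ _ (ℕ.≤-refl {N})))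
          xN≤U : xN ≤ X.U
          xN≤U = X.≤U N (ℕ.m⊔n≤o⇒n≤o N₂ X.N (ℕ.m⊔n≤o⇒n≤o N₁ _ (ℕ.≤-refl {N})))
          s≈xN : ℚ.∣ s - (1ℚ + xN) ∣ < δ
          s≈xN = s≈x N (ℕ.m⊔n≤o⇒m≤o N₂ X.N (ℕ.m⊔n≤o⇒n≤o N₁ _ (ℕ.≤-refl {N})))
          ≤ratio : ∀ x d .{{_ : ℕ.NonZero d}} → + x / d * ι d ≡ ι x
          ≤ratio x (suc d) = ratio-* x d
          sample : Sample t (½ * X.c) (X.U + 1ℚ) N₁ s p
          sample = record
            { m = m ; ℓ = ℓ ; N≤ℓ = N≤ℓ ; sℓ = ≤ratio m ℓ
            ; 1+c≤s = by (‖ close⇒≥ {s} {1ℚ + xN} s≈xN ⊕ ‖ c≤xN ⊕ ‖ δ≤δ₂ ⊕ ‖ δ₂≤½c)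
              (solve 5 (λ s c y δ δ₂ → s :- (:1 :+ :½ :* c)
                := s :+ δ :- (:1 :+ y) :+ (y :- c) :+ (δ₂ :- δ) :+ (:½ :* c :- δ₂)) refl s X.c xN δ δ₂)
            ; s≤1+U = by (‖ close⇒≤ {s} {1ℚ + xN} s≈xN ⊕ ‖ xN≤U ⊕ ‖ δ≤δ₂ ⊕ ‖ δ₂≤1)
              (solve 5 (λ s U y δ δ₂ → :1 :+ (U :+ :1) :- s
                := :1 :+ y :+ δ :- s :+ (U :- y) :+ (δ₂ :- δ) :+ (:1 :- δ₂)) refl s X.U xN δ δ₂)
            ; prob = ≤ratio (a t m ℓ ℕ.* T↖ t m ℓ) (T t m ℓ) }
          sample′ : ∀ n → N ℕ.≤ n → Sample t (½ * X.c) (X.U + 1ℚ) N₁ (1ℚ + seq x n) (value t (seq x n) n)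
          sample′ n n≥ = value-sample t n (ℕ.m⊔n≤o⇒m≤o N₁ _ n≥) 0<½c
            (ℚ.≤-trans (by (0≤½* (ℚ.<⇒≤ X.0<c)) (solve 1 (λ c → c :- :½ :* c := :½ :* c) refl X.c)) (X.c≤ n n≥X))
            (ℚ.≤-trans (X.≤U n n≥X) (by (0≤# 1) (solve 1 (λ U → U :+ :1 :- U := :# 1) refl X.U)))
            where
            n≥X : X.N ℕ.≤ n
            n≥X = ℕ.m⊔n≤o⇒n≤o N₂ X.N (ℕ.m⊔n≤o⇒n≤o N₁ _ n≥)
      from-lower : ∀ {δ₁ N₁} → 0ℚ < δ₁ → (∀ {s p s′ p′} → Sample t (½ * X.c) (X.U + 1ℚ) N₁ s p → Sample t (½ * X.c) (X.U + 1ℚ) N₁ s′ p′ →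
                     ℚ.∣ s - s′ ∣ < δ₁ → ℚ.∣ p - p′ ∣ < ½ * ε) →
                   (Σ[ δ₂ ∈ ℚ ] 0ℚ < δ₂ × δ₂ ≤ ½ * X.c × δ₂ ≤ 1ℚ) → Converges x 0<x ε
      from-lower {δ₁} {N₁} 0<δ₁ close (δ₂ , 0<δ₂ , δ₂≤½c , δ₂≤1) = from-δ (common-lower 0<δ₁ 0<δ₂)
        where
        from-δ : (Σ[ δ ∈ ℚ ] 0ℚ < δ × δ ≤ δ₁ × δ ≤ δ₂) → Converges x 0<x ε
        from-δ (δ , 0<δ , δ≤δ₁ , δ≤δ₂) = δ , 0<δ , N₁ , main {δ₁} {N₁} (λ {s} {p} {s′} {p′} → close {s} {p} {s′} {p′}) {δ₂} δ₂≤½c δ₂≤1 {δ} δ≤δ₁ δ≤δ₂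
      from-near : SamplesNear t (½ * X.c) (X.U + 1ℚ) (½ * ε) → Converges x 0<x ε
      from-near (δ₁ , 0<δ₁ , N₁ , close) = from-lower {δ₁} {N₁} 0<δ₁ (λ {s} {p} {s′} {p′} → close {s} {p} {s′} {p′}) (common-lower 0<½c (0<# 0))

open Defs
open import Data.Integer.Base using (+_)

theorem1 : (t : Triangle) →
  Σ[ φ ∈ Func ]0,+∞[ [0,1] ]
    ((λ∞ : ℝ) (0<λ∞ : 0ℝ < λ∞) →
      ∀ (ε : ℚ) → 0ℚ ℚ.< ε →
      Σ[ δ ∈ ℚ ] 0ℚ ℚ.< δ × (∃[ N ]
        ∀ (m ℓ : ℕ) .{{_ : NonZero ℓ}} .{{_ : NonZero (T t m ℓ)}} →
        N ℕ.≤ m → N ℕ.≤ ℓ →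
        ∣ fromℚ (+ m ℚ./ ℓ) - (1ℝ + λ∞) ∣ < fromℚ δ →
        ∣ fromℚ (p₁ t m ℓ) - proj₁ (φ ⟨$⟩ (λ∞ , 0<λ∞)) ∣ < fromℚ ε))
theorem1 t = φ-func , converges
  where open LimitFunction.Limit t
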